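{- Let $K=K(n)$ satisfy $K\ge 2$ and $K=o(\log n)$, and consider the Achlioptas process on $n$ vertices in which $K$ edges are presented at each round. Then for every fixed $\varepsilon>0$: (i) there is an online algorithm such that, with probability tending to $1$ as $n\to\infty$, the graph of selected edges contains a Hamilton cycle after at most $(1+\varepsilon)\frac{n\log n}{2K}$ rounds; and (ii) for every online algorithm, with probability tending to $1$ the graph of selected edges does not contain a Hamilton cycle after $(1-\varepsilon)\frac{n\log n}{2K}$ rounds. That is, the minimum number of rounds needed for Hamiltonicity is with high probability $\frac{1+o(1)}{2K}n\log n$.
   Context: The Achlioptas process with parameter $K$: start with the empty graph on $n$ labeled vertices. At each round, $K$ distinct edges are chosen uniformly at random among all pairs of vertices that are not edges of the current graph, and an online algorithm must add exactly one of them to the current graph (the others are discarded). The algorithm's choice at a round may depend only on the history up to and including that round (not on future rounds). $\log$ denotes the natural logarithm; "with high probability" means with probability tending to $1$ as $n\to\infty$. -}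

module Defs where

open import Data.Nat as ℕ using (ℕ; zero; suc; _≤ᵇ_; _≡ᵇ_)
open import Data.Integer using (+_)
open import Data.Rational as ℚ using (ℚ; 0ℚ; 1ℚ; _/_; _÷_; >-nonZero)
open import Data.Fin using (Fin; toℕ)
open import Data.List using (List; []; _∷_; map; _++_; concatMap; allFin; filterᵇ; foldr; length; lookup)
open import Data.Bool.ListAction using (any)
open import Data.Bool using (Bool; true; false; _∧_; _∨_; not; if_then_else_)
open import Data.Product using (Σ; _×_; _,_)
open import Data.Sum using (_⊎_)
open import Relation.Binary.PropositionalEquality using (_≡_)

-- An edge {i , j} is stored as an ordered pair (i , j) with i < j.
Edge : ℕ → Set
Edge n = Fin n × Fin n

allEdges : (n : ℕ) → List (Edge n)
allEdges n = concatMap (λ i → map (λ j → (i , j))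
                         (filterᵇ (λ j → suc (toℕ i) ≤ᵇ toℕ j) (allFin n)))
                       (allFin n)

Graph : ℕ → Set
Graph n = List (Edge n)

sameEdge : {n : ℕ} → Edge n → Edge n → Bool
sameEdge (a , b) (c , d) = (toℕ a ≡ᵇ toℕ c) ∧ (toℕ b ≡ᵇ toℕ d)

adj : {n : ℕ} → Graph n → Fin n → Fin n → Bool
adj g u v = any (λ e → sameEdge e (u , v) ∨ sameEdge e (v , u)) g

isEdgeOf : {n : ℕ} → Graph n → Edge n → Bool
isEdgeOf g (u , v) = adj g u v

insertions : {A : Set} → A → List A → List (List A)
insertions x [] = (x ∷ []) ∷ []
insertions x (y ∷ ys) = (x ∷ y ∷ ys) ∷ map (y ∷_) (insertions x ys)

perms : {A : Set} → List A → List (List A)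
perms [] = [] ∷ []
perms (x ∷ xs) = concatMap (insertions x) (perms xs)

pathOK : {n : ℕ} → Graph n → Fin n → List (Fin n) → Bool
pathOK g v [] = true
pathOK g v (w ∷ ws) = adj g v w ∧ pathOK g w ws

lastOf : {A : Set} → A → List A → A
lastOf v [] = v
lastOf v (w ∷ ws) = lastOf w ws

cycleOK : {n : ℕ} → Graph n → List (Fin n) → Bool
cycleOK g [] = false
cycleOK g (v ∷ vs) = pathOK g v vs ∧ adj g (lastOf v vs) v

Hamiltonian : {n : ℕ} → Graph n → Bool
Hamiltonian {n} g = (3 ≤ᵇ n) ∧ any (cycleOK g) (perms (allFin n))

subsets : {A : Set} → ℕ → List A → List (List A)
subsets zero xs = [] ∷ []
subsets (suc k) [] = []
subsets (suc k) (x ∷ xs) = map (x ∷_) (subsets k xs) ++ subsets (suc k) xs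

nonEdges : {n : ℕ} → Graph n → List (Edge n)
nonEdges {n} g = filterᵇ (λ e → not (isEdgeOf g e)) (allEdges n)

-- History: the list of all offers (sets of presented edges) of past rounds.
History : ℕ → Set
History n = List (List (Edge n))

-- A (deterministic) online algorithm: given the history of all previous
-- offers and the current (nonempty) offer e ∷ es, it picks one of the
-- offered edges (by its position in the offer).
Alg : ℕ → Set
Alg n = History n → (e : Edge n) → (es : List (Edge n)) → Fin (suc (length es))

ℚsum : List ℚ → ℚ
ℚsum = foldr ℚ._+_ 0ℚ

average : List ℚ → ℚ
average [] = 0ℚ
average (x ∷ xs) = ℚsum (x ∷ xs) ℚ.* (+ 1 / suc (length xs))

-- probHam n K A t h g : probability that, running the process with K edges
-- per round and algorithm A for t further rounds from the current graph g
-- (with offer history h), the resulting graph is Hamiltonian.  Each round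
-- the offer is a uniformly random K-subset of the current non-edges.
-- Convention: if fewer than K non-edges remain, the process stops.
probHam : (n K : ℕ) → Alg n → ℕ → History n → Graph n → ℚ
probHam n K A zero h g = if Hamiltonian g then 1ℚ else 0ℚ
probHam n K A (suc t) h g with subsets K (nonEdges g)
... | [] = probHam n K A t h g
... | (o ∷ os) = average (map step (o ∷ os))
  where
  step : List (Edge n) → ℚ
  step [] = probHam n K A t h g
  step (e ∷ es) = probHam n K A t (h ++ ((e ∷ es) ∷ [])) (lookup (e ∷ es) (A h e es) ∷ g)

ProbHamAfter : (n K : ℕ) → Alg n → ℕ → ℚ
ProbHamAfter n K A t = probHam n K A t [] []

fromℕℚ : ℕ → ℚ
fromℕℚ m = + m / 1

expTerm : ℚ → ℕ → ℚ
expTerm x zero = 1ℚ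
expTerm x (suc j) = expTerm x j ℚ.* (x ℚ.* (+ 1 / suc j))

expPartial : ℚ → ℕ → ℚ
expPartial x zero = 0ℚ
expPartial x (suc k) = expPartial x k ℚ.+ expTerm x k

-- exp x ≤ m   (for x ≥ 0: all partial sums of the exponential series are ≤ m)
ExpLe : ℚ → ℕ → Set
ExpLe x m = (k : ℕ) → expPartial x k ℚ.≤ fromℕℚ m

-- LeTimesLog a b m  means  a ≤ b · log m   (used for a ≥ 0 and m ≥ 2):
-- either a = 0 and b ≥ 0, or b > 0 and exp (a / b) ≤ m.
LeTimesLog : ℚ → ℚ → ℕ → Set
LeTimesLog a b m =
  (a ≡ 0ℚ × 0ℚ ℚ.≤ b) ⊎ Σ (0ℚ ℚ.< b) (λ pos → ExpLe (_÷_ a b {{>-nonZero pos}}) m)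

-- t ≤ q · n log n / (2K)   ⇔   2 K t ≤ (q n) · log n
RoundsLe : ℕ → ℚ → ℕ → ℕ → Set
RoundsLe t q n K = LeTimesLog (fromℕℚ (2 ℕ.* K ℕ.* t)) (q ℚ.* fromℕℚ n) n

LittleOLog : (ℕ → ℕ) → Set
LittleOLog K = (δ : ℚ) → 0ℚ ℚ.< δ →
  Σ ℕ (λ N → (n : ℕ) → N ℕ.≤ n → LeTimesLog (fromℕℚ (K n)) δ n)

{-# OPTIONS --safe #-}

-- Upper bound.  Failure probabilities of the optimal strategy are bounded by potentials that are
-- supermartingales under one particular strategy.  Each vertex is to own D₀ edges.  Keep an active
-- set of at most n/(4uK) unsaturated vertices; when exactly one offered edge meets it, take that edge
-- and give it to its active endpoint.  While many vertices are unsaturated this happens with constant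
-- probability, so after O(n) rounds the active set contains all of them; from then on each of them is
-- served at rate almost 2K/n, so all are saturated after (1 + o(1)) n log n / (2K) rounds.  The other
-- endpoints of owned edges are almost uniform, so by a union bound every S whose closed neighbourhood
-- has at most 3|S| vertices has one of more than n/2 vertices.  In such a graph Pósa
-- rotations yield n²/72 boosters, and O(n) further rounds produce a Hamilton cycle.  Since
-- K = o(log n), the O(n) terms are negligible.
--
-- Lower bound.  A vertex that meets no offered edge is isolated whatever the algorithm does, and the
-- second moment method applies to the number of such vertices.
--
-- Rationally, b n log n is approximated by the largest s with n (1 - 1/(bn))^s ≥ 1.

module Submission where

open import Defs
open import Data.Bool using (Bool; true; false; _∧_; _∨_; not; if_then_else_) renaming (T to IsTrue)
open import Data.Bool.ListAction using (any)
open import Data.Empty using (⊥; ⊥-elim)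
open import Data.Fin as F using (Fin; zero; suc; toℕ)
import Data.Fin.Properties as FP
open import Data.Integer as ℤ using () renaming (+_ to pos)
import Data.Integer.Properties as ℤP
open import Data.List using (List; []; _∷_; map; _++_; length; lookup; concatMap; allFin; filterᵇ; tabulate; reverse)
import Data.List.Properties as LP
open import Data.List.Membership.Propositional using (_∈_; find)
open import Data.List.Membership.Propositional.Properties using (∈-allFin; ∈-map⁺; ∈-map⁻; ∈-++⁺ʳ; ∈-++⁻; ∈-∃++; ∈-concatMap⁺; ∈-concatMap⁻)
open import Data.List.Relation.Binary.Permutation.Propositional as Perm using (_↭_; ↭-refl; ↭-sym; ↭-trans; prep; swap)
open import Data.List.Relation.Binary.Permutation.Propositional.Properties using (All-resp-↭; ∈-resp-↭; ↭-empty-inv; shift; drop-mid; ++-comm; ↭-reverse; ++⁺ʳ; ++⁺ˡ; ↭-length)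
open import Data.List.Relation.Unary.All using (All; []; _∷_)
open import Data.List.Relation.Unary.AllPairs using ([]; _∷_)
open import Data.List.Relation.Unary.Any as Any using (here; there)
open import Data.List.Relation.Unary.Unique.Propositional using (Unique)
open import Data.List.Relation.Unary.Unique.Propositional.Properties using (allFin⁺; Unique[x∷xs]⇒x∉xs)
open import Data.Maybe using (Maybe; just; nothing)
open import Data.Nat as ℕ using (ℕ; zero; suc; z≤n; s≤s)
import Data.Nat.Properties as ℕP
import Data.Nat.Tactic.RingSolver as NS
open import Data.Product using (Σ; _×_; _,_; proj₁; proj₂)
open import Data.Rational as Q using (ℚ; 0ℚ; 1ℚ; _+_; _*_; _-_; -_; _≤_; _<_)
import Data.Rational.Properties as QP
import Data.Rational.Unnormalised as U
import Data.Rational.Unnormalised.Properties as UP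
open import Data.Sum using (_⊎_; inj₁; inj₂)
open import Function using (_∘_; id)
open import Level using (0ℓ)
open import Relation.Binary.PropositionalEquality using (_≡_; _≢_; refl; sym; trans; cong; cong₂; subst)
open import Relation.Nullary using (¬_; yes; no)
open import Tactic.RingSolver using (solve-∀)
open import Tactic.RingSolver.Core.AlmostCommutativeRing using (AlmostCommutativeRing; fromCommutativeRing)

-- The algorithm handed over is not the serving strategy but the optimum of backward induction.
-- Ownership, active sets and rotations then live in the analysis alone: a bound on the value `V` is
-- an inequality between rationals, hence decidable, so it may be proved under double negation and
-- paths never have to be searched for. Exceptional events are not conditioned away. Each has a
-- potential that bounds its probability; where a potential reaches 1 the claimed failure bound is
-- trivial, so every round may assume small degrees, and the end of each phase may assume what the
-- phase was for. The rate 2K/n must be attained up to a factor near 1 although every vertex needs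
-- many edges. A vertex with j > 0 missing edges gets weight U^j: this costs a constant factor
-- `U ^ D₀` at the start, while each service removes at least the fraction 1 - 1/U of the weight, so
-- `D₀` does not affect the leading term. The active set is capped because serving needs a round in
-- which no second offered edge meets it. In the lower bound, one-round estimates for one and for
-- two vertices are raised to the number of rounds, so they must agree to first order in K/n.

zero? : ∀ p → Maybe (0ℚ ≡ p)
zero? p with 0ℚ Q.≟ p
... | yes e = just e
... | no _ = nothing

ℚring : AlmostCommutativeRing 0ℓ 0ℓ
ℚring = fromCommutativeRing QP.+-*-commutativeRing zero?

-- Ordered-field facts

≤-by : ∀ {a b} e → 0ℚ ≤ e → a + e ≡ b → a ≤ b
≤-by {a} e 0≤e refl = subst (_≤ a + e) (QP.+-identityʳ a) (QP.+-monoʳ-≤ a 0≤e)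

≤-refl′ : ∀ {a b} → a ≡ b → a ≤ b
≤-refl′ refl = QP.≤-refl

infixr 5 _⟫_
_⟫_ : ∀ {a b c : ℚ} → a ≤ b → b ≤ c → a ≤ c
_⟫_ = QP.≤-trans

diff≥0 : ∀ {a b} → a ≤ b → 0ℚ ≤ b - a
diff≥0 {a} {b} a≤b = subst (_≤ b - a) (QP.+-inverseʳ a) (QP.+-monoˡ-≤ (- a) a≤b)

≥0diff : ∀ {a b} → 0ℚ ≤ b - a → a ≤ b
≥0diff {a} {b} p = ≤-by (b - a) p (eq a b)
  where
  eq : ∀ a b → a + (b - a) ≡ b
  eq = solve-∀ ℚring

+≥0 : ∀ {a b} → 0ℚ ≤ a → 0ℚ ≤ b → 0ℚ ≤ a + b
+≥0 p q = QP.+-mono-≤ p q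

*≤*ˡ : ∀ {c a b} → 0ℚ ≤ c → a ≤ b → c * a ≤ c * b
*≤*ˡ {c} p = QP.*-monoˡ-≤-nonNeg c {{Q.nonNegative p}}

*≤*ʳ : ∀ {c a b} → 0ℚ ≤ c → a ≤ b → a * c ≤ b * c
*≤*ʳ {c} p = QP.*-monoʳ-≤-nonNeg c {{Q.nonNegative p}}

*≥0 : ∀ {a b} → 0ℚ ≤ a → 0ℚ ≤ b → 0ℚ ≤ a * b
*≥0 {a} {b} p q = subst (_≤ a * b) (QP.*-zeroʳ a) (*≤*ˡ p q)

*≤* : ∀ {a b c d} → 0ℚ ≤ a → a ≤ b → 0ℚ ≤ c → c ≤ d → a * c ≤ b * d
*≤* 0≤a a≤b 0≤c c≤d = *≤*ˡ 0≤a c≤d ⟫ *≤*ʳ (0≤c ⟫ c≤d) a≤b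

*>0 : ∀ {a b} → 0ℚ < a → 0ℚ < b → 0ℚ < a * b
*>0 {a} {b} p q = QP.positive⁻¹ (a * b) {{QP.pos*pos⇒pos a {{Q.positive p}} b {{Q.positive q}}}}

*-cancel≤ : ∀ {a b} c → 0ℚ < c → c * a ≤ c * b → a ≤ b
*-cancel≤ c p = QP.*-cancelˡ-≤-pos c {{Q.positive p}}

neg≤ : ∀ {a b} → a ≤ b → - b ≤ - a
neg≤ = QP.neg-antimono-≤

-≤- : ∀ {a b c d} → a ≤ b → d ≤ c → a - c ≤ b - d
-≤- p q = QP.+-mono-≤ p (neg≤ q)

a-b≤a : ∀ {a b} → 0ℚ ≤ b → a - b ≤ a
a-b≤a {a} {b} p = ≤-by b p (eq a b)
  where
  eq : ∀ a b → a - b + b ≡ a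
  eq = solve-∀ ℚring

a≤a+b : ∀ {a b} → 0ℚ ≤ b → a ≤ a + b
a≤a+b {a} {b} p = ≤-by b p refl

a≤b+a : ∀ {a b} → 0ℚ ≤ b → a ≤ b + a
a≤b+a {a} {b} p = ≤-by b p (QP.+-comm a b)

≤⊎≥ : ∀ a b → (a ≤ b) ⊎ (b ≤ a)
≤⊎≥ = QP.≤-total

0≤1 : 0ℚ ≤ 1ℚ
0≤1 = QP.nonNegative⁻¹ 1ℚ

0<1 : 0ℚ < 1ℚ
0<1 = QP.positive⁻¹ 1ℚ

two : ℚ
two = 1ℚ + 1ℚ

two≥0 : 0ℚ ≤ two
two≥0 = +≥0 0≤1 0≤1

two≥1 : 1ℚ ≤ two
two≥1 = a≤a+b 0≤1

by-cases : ∀ {X : Set} a b → (a ≤ b → X) → (b < a → X) → X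
by-cases a b f g with a Q.≤? b
... | yes p = f p
... | no p = g (QP.≰⇒> p)

by-casesℕ : ∀ {X : Set} a b → (a ℕ.≤ b → X) → (b ℕ.< a → X) → X
by-casesℕ a b f g with a ℕP.≤? b
... | yes p = f p
... | no p = g (ℕP.≰⇒> p)

<⇒≱ℚ : ∀ {a b} → a < b → ¬ (b ≤ a)
<⇒≱ℚ p q = QP.<-irrefl refl (QP.<-≤-trans p q)

inv : (q : ℚ) → 0ℚ < q → ℚ
inv q p = Q.1/_ q {{Q.>-nonZero p}}

*-inv : ∀ q p → q * inv q p ≡ 1ℚ
*-inv q p = QP.*-inverseʳ q {{Q.>-nonZero p}}

inv>0 : ∀ q p → 0ℚ < inv q p
inv>0 q p = QP.positive⁻¹ (inv q p) {{QP.1/pos⇒pos q {{Q.positive p}}}}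

inv≥0 : ∀ q p → 0ℚ ≤ inv q p
inv≥0 q p = QP.<⇒≤ (inv>0 q p)

-- The embedding of ℕ

opaque
  -- Opaque, so that terms such as `ι (m ℕ.* n)` are never unfolded into normalised fractions;
  -- `ι-def` is the only way back to numerals.
  ι : ℕ → ℚ
  ι = fromℕℚ

  recip : ℕ → ℚ
  recip zero = 0ℚ
  recip (suc n) = pos 1 Q./ suc n

  ι-def : ∀ n → ι n ≡ fromℕℚ n
  ι-def n = refl

  recip-def : ∀ n → recip (suc n) ≡ pos 1 Q./ suc n
  recip-def n = refl

  recip0 : recip 0 ≡ 0ℚ
  recip0 = refl

  ιᵘ : ∀ m → Q.toℚᵘ (ι m) U.≃ U.mkℚᵘ (pos m) 0
  ιᵘ m = QP.toℚᵘ-fromℚᵘ (U.mkℚᵘ (pos m) 0)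

  ι-+ : ∀ m n → ι (m ℕ.+ n) ≡ ι m + ι n
  ι-+ m n = QP.toℚᵘ-injective (UP.≃-trans (ιᵘ (m ℕ.+ n)) (UP.≃-trans (U.*≡* eq) (UP.≃-trans (UP.+-cong
      (UP.≃-sym (ιᵘ m)) (UP.≃-sym (ιᵘ n))) (UP.≃-sym (QP.toℚᵘ-homo-+ (ι m) (ι n))))))
    where
    eq : pos (m ℕ.+ n) ℤ.* pos 1 ≡ (pos m ℤ.* pos 1 ℤ.+ pos n ℤ.* pos 1) ℤ.* pos 1
    eq = cong (ℤ._* pos 1) (cong₂ ℤ._+_ (sym (ℤP.*-identityʳ (pos m))) (sym (ℤP.*-identityʳ (pos n))))

  ι-* : ∀ m n → ι (m ℕ.* n) ≡ ι m * ι n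
  ι-* m n = QP.toℚᵘ-injective (UP.≃-trans (ιᵘ (m ℕ.* n)) (UP.≃-trans (U.*≡* eq) (UP.≃-trans (UP.*-cong
      (UP.≃-sym (ιᵘ m)) (UP.≃-sym (ιᵘ n))) (UP.≃-sym (QP.toℚᵘ-homo-* (ι m) (ι n))))))
    where
    eq : pos (m ℕ.* n) ℤ.* pos 1 ≡ (pos m ℤ.* pos n) ℤ.* pos 1
    eq = cong (ℤ._* pos 1) (ℤP.pos-* m n)

  ι-mono : ∀ {m n} → m ℕ.≤ n → ι m ≤ ι n
  ι-mono {m} {n} p = QP.toℚᵘ-cancel-≤ (UP.≤-respˡ-≃ (UP.≃-sym (ιᵘ m)) (UP.≤-respʳ-≃ (UP.≃-sym (ιᵘ n))
      (U.*≤* (ℤP.*-monoʳ-≤-nonNeg (pos 1) (ℤ.+≤+ p)))))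

  ι-mono< : ∀ {m n} → m ℕ.< n → ι m < ι n
  ι-mono< {m} {n} p = QP.toℚᵘ-cancel-< (UP.<-respˡ-≃ (UP.≃-sym (ιᵘ m)) (UP.<-respʳ-≃ (UP.≃-sym (ιᵘ n))
      (U.*<* (ℤP.*-monoʳ-<-pos (pos 1) (ℤ.+<+ p)))))

  archimedean : ∀ q → Σ ℕ λ N → q ≤ ι N
  archimedean q@(Q.mkℚ n d c) = N , QP.toℚᵘ-cancel-≤ (UP.≤-respʳ-≃ (UP.≃-sym (ιᵘ N)) (U.*≤* (ineq n)))
    where
    N : ℕ
    N = ℤ.∣ n ∣
    ineq : ∀ i → i ℤ.* pos 1 ℤ.≤ pos ℤ.∣ i ∣ ℤ.* pos (suc d)
    ineq (pos k) = subst (ℤ._≤ pos k ℤ.* pos (suc d)) refl (subst (pos k ℤ.* pos 1 ℤ.≤_) (ℤP.pos-* k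
        (suc d)) (subst (ℤ._≤ pos (k ℕ.* suc d)) (ℤP.pos-* k 1) (ℤ.+≤+ (ℕP.*-monoʳ-≤ k (s≤s z≤n)))))
    ineq ℤ.-[1+ k ] = subst (ℤ.-[1+ k ] ℤ.* pos 1 ℤ.≤_) (ℤP.pos-* (suc k) (suc d)) (subst (ℤ._≤ pos
        (suc k ℕ.* suc d)) (sym (ℤP.*-identityʳ ℤ.-[1+ k ])) ℤ.-≤+)

  *-recip : ∀ n → 0 ℕ.< n → ι n * recip n ≡ 1ℚ
  *-recip (suc n) _ = QP.toℚᵘ-injective (UP.≃-trans (QP.toℚᵘ-homo-* (ι (suc n)) (recip (suc n)))
      (UP.≃-trans (UP.*-cong (ιᵘ (suc n)) (QP.toℚᵘ-fromℚᵘ (U.mkℚᵘ (pos 1) n))) (U.*≡* (cong pos eq))))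
    where
    eq : (suc n ℕ.* 1) ℕ.* 1 ≡ 1 ℕ.* (1 ℕ.* suc n)
    eq = trans (ℕP.*-identityʳ (suc n ℕ.* 1)) (trans (ℕP.*-identityʳ (suc n)) (sym (trans
        (ℕP.*-identityˡ (1 ℕ.* suc n)) (ℕP.*-identityˡ (suc n)))))

ι≥0 : ∀ n → 0ℚ ≤ ι n
ι≥0 n = subst (_≤ ι n) (ι-def 0) (ι-mono z≤n)

ι>0 : ∀ {n} → 0 ℕ.< n → 0ℚ < ι n
ι>0 {n} p = subst (_< ι n) (ι-def 0) (ι-mono< p)

ι≥1 : ∀ {n} → 0 ℕ.< n → 1ℚ ≤ ι n
ι≥1 {n} p = subst (_≤ ι n) (ι-def 1) (ι-mono p)

ι-suc : ∀ n → ι (suc n) ≡ 1ℚ + ι n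
ι-suc n = trans (ι-+ 1 n) (cong (_+ ι n) (ι-def 1))

ι-cancel≤ : ∀ {m n} → ι m ≤ ι n → m ℕ.≤ n
ι-cancel≤ {m} {n} p with m ℕP.≤? n
... | yes q = q
... | no q = ⊥-elim (<⇒≱ℚ (ι-mono< (ℕP.≰⇒> q)) p)

recip≥0 : ∀ n → 0ℚ ≤ recip n
recip≥0 zero = ≤-refl′ (sym recip0)
recip≥0 (suc n) = *-cancel≤ (ι (suc n)) (ι>0 (s≤s z≤n)) (subst (_≤ ι (suc n) * recip (suc n)) (sym
    (QP.*-zeroʳ (ι (suc n)))) (subst (0ℚ ≤_) (sym (*-recip (suc n) (s≤s z≤n))) 0≤1))

≤-recip : ∀ {n c d} → 0 ℕ.< n → ι n * c ≤ d → c ≤ d * recip n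
≤-recip {n} {c} {d} p h = subst (_≤ d * recip n) (trans (eq (ι n) c (recip n)) (trans (cong (_* c)
    (*-recip n p)) (QP.*-identityˡ c))) (*≤*ʳ (recip≥0 n) h)
  where
  eq : ∀ n c r → n * c * r ≡ n * r * c
  eq = solve-∀ ℚring

recip-≤ : ∀ {n c d} → 0 ℕ.< n → d ≤ ι n * c → d * recip n ≤ c
recip-≤ {n} {c} {d} p h = subst (d * recip n ≤_) (trans (eq (ι n) c (recip n)) (trans (cong (_* c)
    (*-recip n p)) (QP.*-identityˡ c))) (*≤*ʳ (recip≥0 n) h)
  where
  eq : ∀ n c r → n * c * r ≡ n * r * c
  eq = solve-∀ ℚring

small-recip : ∀ q → 0ℚ < q → Σ ℕ λ e → (0 ℕ.< e) × (recip e ≤ q)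
small-recip q p with archimedean (inv q p)
... | N , h = suc N , s≤s z≤n , subst (_≤ q) (QP.*-identityˡ (recip (suc N))) (recip-≤ {suc N} (s≤s z≤n)
    (subst (_≤ ι (suc N) * q) (trans (QP.*-comm (inv q p) q) (*-inv q p)) (*≤*ʳ (QP.<⇒≤ p) (h ⟫ ι-mono
    (ℕP.n≤1+n N)))))

-- Powers and Bernoulli's inequality

infixr 8 _^_
_^_ : ℚ → ℕ → ℚ
x ^ zero = 1ℚ
x ^ suc n = x * x ^ n

^≥0 : ∀ {x} n → 0ℚ ≤ x → 0ℚ ≤ x ^ n
^≥0 zero p = 0≤1
^≥0 (suc n) p = *≥0 p (^≥0 n p)

^>0 : ∀ {x} n → 0ℚ < x → 0ℚ < x ^ n
^>0 zero p = 0<1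
^>0 (suc n) p = *>0 p (^>0 n p)

^-mono : ∀ {x y} n → 0ℚ ≤ x → x ≤ y → x ^ n ≤ y ^ n
^-mono zero p q = QP.≤-refl
^-mono (suc n) p q = *≤* p q (^≥0 n p) (^-mono n p q)

1^ : ∀ n → 1ℚ ^ n ≡ 1ℚ
1^ zero = refl
1^ (suc n) = trans (QP.*-identityˡ (1ℚ ^ n)) (1^ n)

^≤1 : ∀ {x} n → 0ℚ ≤ x → x ≤ 1ℚ → x ^ n ≤ 1ℚ
^≤1 {x} n p q = subst (x ^ n ≤_) (1^ n) (^-mono n p q)

1≤^ : ∀ {x} n → 1ℚ ≤ x → 1ℚ ≤ x ^ n
1≤^ {x} n q = subst (_≤ x ^ n) (1^ n) (^-mono n 0≤1 q)

^-+ : ∀ x m n → x ^ (m ℕ.+ n) ≡ x ^ m * x ^ n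
^-+ x zero n = sym (QP.*-identityˡ (x ^ n))
^-+ x (suc m) n = trans (cong (x *_) (^-+ x m n)) (sym (QP.*-assoc x (x ^ m) (x ^ n)))

^-*ˡ : ∀ x y n → (x * y) ^ n ≡ x ^ n * y ^ n
^-*ˡ x y zero = refl
^-*ˡ x y (suc n) = trans (cong (x * y *_) (^-*ˡ x y n)) (eq x y (x ^ n) (y ^ n))
  where
  eq : ∀ a b c d → a * b * (c * d) ≡ a * c * (b * d)
  eq = solve-∀ ℚring

^-^ : ∀ x m n → x ^ (m ℕ.* n) ≡ (x ^ m) ^ n
^-^ x m zero = cong (x ^_) (ℕP.*-zeroʳ m)
^-^ x m (suc n) = trans (cong (x ^_) (ℕP.*-suc m n)) (trans (^-+ x m (m ℕ.* n)) (cong (x ^ m *_)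
    (^-^ x m n)))

^-antitone : ∀ {x m n} → 0ℚ ≤ x → x ≤ 1ℚ → m ℕ.≤ n → x ^ n ≤ x ^ m
^-antitone {x} {m} {n} p q m≤n = subst (λ k → x ^ k ≤ x ^ m) (ℕP.m+[n∸m]≡n m≤n) (subst (_≤ x ^ m) (sym
    (^-+ x m (n ℕ.∸ m))) (subst (x ^ m * x ^ (n ℕ.∸ m) ≤_) (QP.*-identityʳ (x ^ m)) (*≤*ˡ (^≥0 m p) (^≤1
    (n ℕ.∸ m) p q))))

^-monotone : ∀ {x m n} → 1ℚ ≤ x → m ℕ.≤ n → x ^ m ≤ x ^ n
^-monotone {x} {m} {n} q m≤n = subst (λ k → x ^ m ≤ x ^ k) (ℕP.m+[n∸m]≡n m≤n) (subst (x ^ m ≤_) (sym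
    (^-+ x m (n ℕ.∸ m))) (subst (_≤ x ^ m * x ^ (n ℕ.∸ m)) (QP.*-identityʳ (x ^ m)) (*≤*ˡ (^≥0 m (0≤1
    ⟫ q)) (1≤^ (n ℕ.∸ m) q))))

ι-^ : ∀ m n → ι (m ℕ.^ n) ≡ ι m ^ n
ι-^ m zero = ι-def 1
ι-^ m (suc n) = trans (ι-* m (m ℕ.^ n)) (cong (ι m *_) (ι-^ m n))

^-inverse : ∀ {x y} n → x * y ≡ 1ℚ → x ^ n * y ^ n ≡ 1ℚ
^-inverse {x} {y} n e = trans (sym (^-*ˡ x y n)) (trans (cong (_^ n) e) (1^ n))

square≥0 : ∀ x → 0ℚ ≤ x * x
square≥0 x with ≤⊎≥ 0ℚ x
... | inj₁ h = *≥0 h h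
... | inj₂ h = subst (0ℚ ≤_) (eq x) (*≥0 (neg≤ h) (neg≤ h))
  where
  eq : ∀ x → (- x) * (- x) ≡ x * x
  eq = solve-∀ ℚring

bernoulli : ∀ {x} n → - 1ℚ ≤ x → 1ℚ + ι n * x ≤ (1ℚ + x) ^ n
bernoulli {x} zero p = ≤-refl′ (trans (cong (λ k → 1ℚ + k * x) (ι-def 0)) (eq x))
  where
  eq : ∀ x → 1ℚ + 0ℚ * x ≡ 1ℚ
  eq = solve-∀ ℚring
bernoulli {x} (suc n) p = ≤-by (ι n * (x * x)) (*≥0 (ι≥0 n) (square≥0 x)) (trans (cong
    (λ k → 1ℚ + k * x + ι n * (x * x)) (ι-suc n)) (eq (ι n) x))
  ⟫ *≤*ˡ (diff≥0 p ⟫ ≤-refl′ (eq₂ x)) (bernoulli n p)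
  where
  eq : ∀ n x → 1ℚ + (1ℚ + n) * x + n * (x * x) ≡ (1ℚ + x) * (1ℚ + n * x)
  eq = solve-∀ ℚring
  eq₂ : ∀ x → x - (- 1ℚ) ≡ 1ℚ + x
  eq₂ = solve-∀ ℚring

bernoulli⁻ : ∀ {x} n → x ≤ 1ℚ → 1ℚ - ι n * x ≤ (1ℚ - x) ^ n
bernoulli⁻ {x} n p = ≤-refl′ (eq (ι n) x) ⟫ bernoulli n (neg≤ p)
  where
  eq : ∀ n x → 1ℚ - n * x ≡ 1ℚ + n * (- x)
  eq = solve-∀ ℚring

ι≤two^ : ∀ r → ι r ≤ two ^ r
ι≤two^ r = ≤-refl′ (sym (QP.*-identityʳ (ι r))) ⟫ a≤b+a 0≤1 ⟫ bernoulli r (neg≤ {0ℚ} {1ℚ} 0≤1 ⟫ 0≤1)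

-- Finite sums

∑ : {A : Set} → List A → (A → ℚ) → ℚ
∑ [] f = 0ℚ
∑ (x ∷ xs) f = f x + ∑ xs f

⟦_⟧ : Bool → ℚ
⟦ true ⟧ = 1ℚ
⟦ false ⟧ = 0ℚ

⟦⟧≥0 : ∀ b → 0ℚ ≤ ⟦ b ⟧
⟦⟧≥0 true = 0≤1
⟦⟧≥0 false = QP.≤-refl

⟦⟧≤1 : ∀ b → ⟦ b ⟧ ≤ 1ℚ
⟦⟧≤1 true = QP.≤-refl
⟦⟧≤1 false = 0≤1

⟦∧⟧ : ∀ a b → ⟦ a ∧ b ⟧ ≡ ⟦ a ⟧ * ⟦ b ⟧
⟦∧⟧ true b = sym (QP.*-identityˡ ⟦ b ⟧)
⟦∧⟧ false b = sym (QP.*-zeroˡ ⟦ b ⟧)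

⟦not⟧ : ∀ a → ⟦ not a ⟧ ≡ 1ℚ - ⟦ a ⟧
⟦not⟧ true = refl
⟦not⟧ false = refl

⟦∨⟧≤ : ∀ a b → ⟦ a ∨ b ⟧ ≤ ⟦ a ⟧ + ⟦ b ⟧
⟦∨⟧≤ true b = a≤a+b (⟦⟧≥0 b)
⟦∨⟧≤ false b = a≤b+a QP.≤-refl

#ᵇ : {A : Set} → (A → Bool) → List A → ℕ
#ᵇ p [] = 0
#ᵇ p (x ∷ xs) = if p x then suc (#ᵇ p xs) else #ᵇ p xs

module _ {A : Set} where

  ∑-cong∈ : ∀ (xs : List A) {f g} → (∀ x → x ∈ xs → f x ≡ g x) → ∑ xs f ≡ ∑ xs g
  ∑-cong∈ [] h = refl
  ∑-cong∈ (x ∷ xs) h = cong₂ _+_ (h x (here refl)) (∑-cong∈ xs (λ y m → h y (there m)))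

  ∑-cong : ∀ (xs : List A) {f g} → (∀ x → f x ≡ g x) → ∑ xs f ≡ ∑ xs g
  ∑-cong xs h = ∑-cong∈ xs (λ x _ → h x)

  ∑-mono∈ : ∀ (xs : List A) {f g} → (∀ x → x ∈ xs → f x ≤ g x) → ∑ xs f ≤ ∑ xs g
  ∑-mono∈ [] h = QP.≤-refl
  ∑-mono∈ (x ∷ xs) h = QP.+-mono-≤ (h x (here refl)) (∑-mono∈ xs (λ y m → h y (there m)))

  ∑-mono : ∀ (xs : List A) {f g} → (∀ x → f x ≤ g x) → ∑ xs f ≤ ∑ xs g
  ∑-mono xs h = ∑-mono∈ xs (λ x _ → h x)

  ∑≥0 : ∀ (xs : List A) {f} → (∀ x → 0ℚ ≤ f x) → 0ℚ ≤ ∑ xs f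
  ∑≥0 [] h = QP.≤-refl
  ∑≥0 (x ∷ xs) h = +≥0 (h x) (∑≥0 xs h)

  ∑-+ : ∀ (xs : List A) f g → ∑ xs (λ x → f x + g x) ≡ ∑ xs f + ∑ xs g
  ∑-+ [] f g = refl
  ∑-+ (x ∷ xs) f g = trans (cong (f x + g x +_) (∑-+ xs f g)) (eq (f x) (g x) (∑ xs f) (∑ xs g))
    where
    eq : ∀ a b c d → a + b + (c + d) ≡ a + c + (b + d)
    eq = solve-∀ ℚring

  ∑-*ˡ : ∀ (xs : List A) c f → ∑ xs (λ x → c * f x) ≡ c * ∑ xs f
  ∑-*ˡ [] c f = sym (QP.*-zeroʳ c)
  ∑-*ˡ (x ∷ xs) c f = trans (cong (c * f x +_) (∑-*ˡ xs c f)) (sym (QP.*-distribˡ-+ c (f x) (∑ xs f)))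

  ∑-*ʳ : ∀ (xs : List A) c f → ∑ xs (λ x → f x * c) ≡ ∑ xs f * c
  ∑-*ʳ xs c f = trans (∑-cong xs (λ x → QP.*-comm (f x) c)) (trans (∑-*ˡ xs c f) (QP.*-comm c (∑ xs f)))

  ∑-const : ∀ (xs : List A) c → ∑ xs (λ _ → c) ≡ ι (length xs) * c
  ∑-const [] c = sym (trans (cong (_* c) (ι-def 0)) (QP.*-zeroˡ c))
  ∑-const (x ∷ xs) c = trans (cong (c +_) (∑-const xs c)) (trans (eq c (ι (length xs))) (cong (_* c)
      (sym (ι-suc (length xs)))))
    where
    eq : ∀ c n → c + n * c ≡ (1ℚ + n) * c
    eq = solve-∀ ℚring

  ∑-0 : ∀ (xs : List A) → ∑ xs (λ _ → 0ℚ) ≡ 0ℚ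
  ∑-0 xs = trans (∑-const xs 0ℚ) (QP.*-zeroʳ (ι (length xs)))

  ∑-++ : ∀ (xs ys : List A) f → ∑ (xs ++ ys) f ≡ ∑ xs f + ∑ ys f
  ∑-++ [] ys f = sym (QP.+-identityˡ (∑ ys f))
  ∑-++ (x ∷ xs) ys f = trans (cong (f x +_) (∑-++ xs ys f)) (sym (QP.+-assoc (f x) (∑ xs f) (∑ ys f)))

  ∑-filter : ∀ p (xs : List A) f → ∑ (filterᵇ p xs) f ≡ ∑ xs (λ x → ⟦ p x ⟧ * f x)
  ∑-filter p [] f = refl
  ∑-filter p (x ∷ xs) f with p x
  ... | true = cong₂ _+_ (sym (QP.*-identityˡ (f x))) (∑-filter p xs f)
  ... | false = trans (∑-filter p xs f) (trans (sym (QP.+-identityˡ _)) (cong (_+ _) (sym (QP.*-zeroˡ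
      (f x)))))

  ∑-map : ∀ {B : Set} (h : B → A) (xs : List B) f → ∑ (map h xs) f ≡ ∑ xs (λ x → f (h x))
  ∑-map h [] f = refl
  ∑-map h (x ∷ xs) f = cong (f (h x) +_) (∑-map h xs f)

  ∑-concatMap : ∀ {B : Set} (h : B → List A) (xs : List B) f →
    ∑ (concatMap h xs) f ≡ ∑ xs (λ x → ∑ (h x) f)
  ∑-concatMap h [] f = refl
  ∑-concatMap h (x ∷ xs) f = trans (∑-++ (h x) (concatMap h xs) f) (cong (∑ (h x) f +_)
      (∑-concatMap h xs f))

∑-swap : ∀ {A B : Set} (xs : List A) (ys : List B) (f : A → B → ℚ) →
  ∑ xs (λ x → ∑ ys (f x)) ≡ ∑ ys (λ y → ∑ xs (λ x → f x y))
∑-swap [] ys f = sym (∑-0 ys)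
∑-swap (x ∷ xs) ys f = trans (cong (∑ ys (f x) +_) (∑-swap xs ys f)) (sym (∑-+ ys (f x) (λ y → ∑ xs
    (λ x → f x y))))

module _ {A : Set} where

  ∑-term≤ : ∀ {xs : List A} {f x} → (∀ x → 0ℚ ≤ f x) → x ∈ xs → f x ≤ ∑ xs f
  ∑-term≤ {y ∷ xs} {f} h (here refl) = a≤a+b (∑≥0 xs h)
  ∑-term≤ {y ∷ xs} {f} h (there m) = ∑-term≤ h m ⟫ a≤b+a (h y)

  #ᵇ-∑ : ∀ p (xs : List A) → ι (#ᵇ p xs) ≡ ∑ xs (λ x → ⟦ p x ⟧)
  #ᵇ-∑ p [] = ι-def 0
  #ᵇ-∑ p (x ∷ xs) with p x
  ... | true = trans (ι-suc (#ᵇ p xs)) (cong (1ℚ +_) (#ᵇ-∑ p xs))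
  ... | false = trans (#ᵇ-∑ p xs) (sym (QP.+-identityˡ _))

  #ᵇ-not : ∀ p (xs : List A) → #ᵇ (not ∘ p) xs ℕ.+ #ᵇ p xs ≡ length xs
  #ᵇ-not p [] = refl
  #ᵇ-not p (x ∷ xs) with p x
  ... | true = trans (ℕP.+-suc _ _) (cong suc (#ᵇ-not p xs))
  ... | false = cong suc (#ᵇ-not p xs)

-- Sums over finite types and Kronecker deltas

∑ᶠ : ∀ {n} → (Fin n → ℚ) → ℚ
∑ᶠ {n} f = ∑ (allFin n) f

∑-tabulate : ∀ {A : Set} {n} (h : Fin n → A) f → ∑ (tabulate h) f ≡ ∑ᶠ (f ∘ h)
∑-tabulate {n = n} h f = trans (cong (λ l → ∑ l f) (sym (LP.map-tabulate id h))) (∑-map h (allFin n) f)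

∑ᶠ-suc : ∀ {n} (f : Fin (suc n) → ℚ) → ∑ᶠ f ≡ f zero + ∑ᶠ (f ∘ suc)
∑ᶠ-suc f = cong (f zero +_) (∑-tabulate suc f)

∑ᶠ-const : ∀ n c → ∑ᶠ {n} (λ _ → c) ≡ ι n * c
∑ᶠ-const n c = trans (∑-const (allFin n) c) (cong (λ k → ι k * c) (LP.length-tabulate {n = n} id))

∑ᶠ-term≤ : ∀ {n} {f : Fin n → ℚ} v → (∀ x → 0ℚ ≤ f x) → f v ≤ ∑ᶠ f
∑ᶠ-term≤ v h = ∑-term≤ h (∈-allFin v)

_==_ : ∀ {n} → Fin n → Fin n → Bool
i == j = toℕ i ℕ.≡ᵇ toℕ j

==-refl : ∀ {n} (i : Fin n) → (i == i) ≡ true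
==-refl zero = refl
==-refl (suc i) = ==-refl i

==-true : ∀ {n} (i j : Fin n) → (i == j) ≡ true → i ≡ j
==-true zero zero e = refl
==-true (suc i) (suc j) e = cong suc (==-true i j e)

==-false : ∀ {n} {i j : Fin n} → i ≢ j → (i == j) ≡ false
==-false {i = i} {j} h with i == j in e
... | true = ⊥-elim (h (==-true i j e))
... | false = refl

==-sym : ∀ {n} (i j : Fin n) → (i == j) ≡ (j == i)
==-sym zero zero = refl
==-sym zero (suc j) = refl
==-sym (suc i) zero = refl
==-sym (suc i) (suc j) = ==-sym i j

∑ᶠ-δ : ∀ {n} (i : Fin n) (f : Fin n → ℚ) → ∑ᶠ (λ v → ⟦ v == i ⟧ * f v) ≡ f i
∑ᶠ-δ {suc n} zero f = trans (∑ᶠ-suc (λ v → ⟦ v == zero ⟧ * f v)) (trans (cong₂ _+_ (QP.*-identityˡ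
    (f zero)) (trans (∑-cong (allFin n) (λ v → QP.*-zeroˡ (f (suc v)))) (∑-0 (allFin n))))
    (QP.+-identityʳ (f zero)))
∑ᶠ-δ {suc n} (suc i) f = trans (∑ᶠ-suc (λ v → ⟦ v == suc i ⟧ * f v)) (trans (cong₂ _+_ (QP.*-zeroˡ
    (f zero)) (∑ᶠ-δ i (f ∘ suc))) (QP.+-identityˡ _))

-- Uniformly random subsets of a list

bin : ℕ → ℕ → ℕ
bin n zero = 1
bin zero (suc k) = 0
bin (suc n) (suc k) = bin n k ℕ.+ bin n (suc k)

bin-suc-mono : ∀ n k → bin n k ℕ.≤ bin (suc n) k
bin-suc-mono n zero = ℕP.≤-refl
bin-suc-mono n (suc k) = ℕP.m≤n+m (bin n (suc k)) (bin n k)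

bin-mono : ∀ m l k → bin m k ℕ.≤ bin (m ℕ.+ l) k
bin-mono m zero k = ℕP.≤-reflexive (cong (λ i → bin i k) (sym (ℕP.+-identityʳ m)))
bin-mono m (suc l) k = ℕP.≤-trans (bin-mono m l k) (subst (λ i → bin (m ℕ.+ l) k ℕ.≤ bin i k) (sym
    (ℕP.+-suc m l)) (bin-suc-mono (m ℕ.+ l) k))

bin-absorb : ∀ n k → suc k ℕ.* bin (suc n) (suc k) ≡ suc n ℕ.* bin n k
bin-absorb zero zero = refl
bin-absorb zero (suc k) = ℕP.*-zeroʳ (suc (suc k))
bin-absorb (suc n) zero = trans (ℕP.*-identityˡ _) (cong suc (trans (sym (ℕP.*-identityˡ _))
    (bin-absorb n zero)))
bin-absorb (suc n) (suc k) = trans (eq₁ (suc k) (bin (suc n) (suc k)) (bin (suc n) (suc (suc k))))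
    (trans (cong₂ (λ a b → bin (suc n) (suc k) ℕ.+ a ℕ.+ b) (bin-absorb n k) (bin-absorb n (suc k)))
    (eq₂ (suc n) (bin n k) (bin n (suc k))))
  where
  eq₁ : ∀ k a b → suc k ℕ.* (a ℕ.+ b) ≡ a ℕ.+ k ℕ.* a ℕ.+ suc k ℕ.* b
  eq₁ = NS.solve-∀
  eq₂ : ∀ n a b → a ℕ.+ b ℕ.+ n ℕ.* a ℕ.+ n ℕ.* b ≡ suc n ℕ.* (a ℕ.+ b)
  eq₂ = NS.solve-∀

-- Adding the `suc l` new points one at a time, each creates at most `bin (m ℕ.+ l) k` subsets in
-- which it is the newest element.
bin-+-upper : ∀ m l k → bin (suc (m ℕ.+ l)) (suc k) ℕ.≤ bin m (suc k) ℕ.+ suc l ℕ.* bin (m ℕ.+ l) k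
bin-+-upper m zero k rewrite ℕP.+-identityʳ m | ℕP.+-identityʳ (bin m k) = ℕP.≤-reflexive (ℕP.+-comm
    (bin m k) (bin m (suc k)))
bin-+-upper m (suc l) k rewrite ℕP.+-suc m l = ℕP.≤-trans (ℕP.+-monoʳ-≤ (bin (suc (m ℕ.+ l)) k)
    (ℕP.≤-trans (bin-+-upper m l k) (ℕP.+-monoʳ-≤ (bin m (suc k)) (ℕP.*-monoʳ-≤ (suc l) (bin-suc-mono
    (m ℕ.+ l) k))))) (ℕP.≤-reflexive (eq (bin (suc (m ℕ.+ l)) k) (bin m (suc k)) (suc l)))
  where
  eq : ∀ a b l → a ℕ.+ (b ℕ.+ l ℕ.* a) ≡ b ℕ.+ suc l ℕ.* a
  eq = NS.solve-∀

-- Each of the `l` new points completes every k-subset of the old `m` points.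
bin-+-lower : ∀ m l k → bin m (suc k) ℕ.+ l ℕ.* bin m k ℕ.≤ bin (m ℕ.+ l) (suc k)
bin-+-lower m zero k = ℕP.≤-reflexive (trans (ℕP.+-identityʳ _) (cong (λ i → bin i (suc k)) (sym
    (ℕP.+-identityʳ m))))
bin-+-lower m (suc l) k rewrite ℕP.+-suc m l = ℕP.≤-trans (ℕP.≤-reflexive (eq (bin m (suc k))
    (bin m k) l)) (ℕP.+-mono-≤ (bin-mono m l k) (bin-+-lower m l k))
  where
  eq : ∀ b a l → b ℕ.+ suc l ℕ.* a ≡ a ℕ.+ (b ℕ.+ l ℕ.* a)
  eq = NS.solve-∀

-- The probability that a random k-subset of m + l points avoids l given ones
-- is at least 1 - lk/(m+l) and at most 1/(1 + lk/(m+l)).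
avoid-≥ : ∀ m l k →
  (m ℕ.+ l) ℕ.* bin (m ℕ.+ l) k ℕ.≤ (m ℕ.+ l) ℕ.* bin m k ℕ.+ l ℕ.* k ℕ.* bin (m ℕ.+ l) k
avoid-≥ m l zero = ℕP.m≤m+n _ _
avoid-≥ m zero (suc k) rewrite ℕP.+-identityʳ m = ℕP.m≤m+n _ _
avoid-≥ m (suc l) (suc k) rewrite ℕP.+-suc m l = ℕP.≤-trans (ℕP.*-monoʳ-≤ (suc (m ℕ.+ l))
    (bin-+-upper m l k)) (ℕP.≤-reflexive (trans (eq (suc (m ℕ.+ l)) (bin m (suc k)) (suc l) (bin
    (m ℕ.+ l) k)) (trans (cong (λ z → suc (m ℕ.+ l) ℕ.* bin m (suc k) ℕ.+ suc l ℕ.* z) (sym (bin-absorb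
    (m ℕ.+ l) k))) (cong (suc (m ℕ.+ l) ℕ.* bin m (suc k) ℕ.+_) (sym (ℕP.*-assoc (suc l) (suc k) (bin
    (suc (m ℕ.+ l)) (suc k))))))))
  where
  eq : ∀ n b l a → n ℕ.* (b ℕ.+ l ℕ.* a) ≡ n ℕ.* b ℕ.+ l ℕ.* (n ℕ.* a)
  eq = NS.solve-∀

-- The exact factor on the right is m - k; enlarging it to m avoids truncated subtraction and
-- suffices for `avoid-≤`.
bin-shift : ∀ m k → suc k ℕ.* bin m (suc k) ℕ.≤ m ℕ.* bin m k
bin-shift zero k = ℕP.≤-reflexive (ℕP.*-zeroʳ (suc k))
bin-shift (suc m) k = ℕP.≤-trans (ℕP.≤-reflexive (bin-absorb m k)) (ℕP.*-monoʳ-≤ (suc m)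
    (bin-suc-mono m k))

avoid-≤ : ∀ m l k → bin m k ℕ.* (m ℕ.+ l ℕ.+ l ℕ.* k) ℕ.≤ (m ℕ.+ l) ℕ.* bin (m ℕ.+ l) k
avoid-≤ m l zero = ℕP.≤-reflexive (eq (m ℕ.+ l) l)
  where
  eq : ∀ n l → 1 ℕ.* (n ℕ.+ l ℕ.* 0) ≡ n ℕ.* 1
  eq = NS.solve-∀
avoid-≤ m l (suc k) = ℕP.≤-trans (ℕP.≤-reflexive (eq₁ (bin m (suc k)) (m ℕ.+ l) l (suc k))) (ℕP.≤-trans
    (ℕP.+-monoʳ-≤ ((m ℕ.+ l) ℕ.* bin m (suc k)) (ℕP.*-monoʳ-≤ l (ℕP.≤-trans (bin-shift m k)
    (ℕP.*-monoˡ-≤ (bin m k) (ℕP.m≤m+n m l))))) (ℕP.≤-trans (ℕP.≤-reflexive (eq₂ (m ℕ.+ l) (bin m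
    (suc k)) l (bin m k))) (ℕP.*-monoʳ-≤ (m ℕ.+ l) (bin-+-lower m l k))))
  where
  eq₁ : ∀ b n l k → b ℕ.* (n ℕ.+ l ℕ.* k) ≡ n ℕ.* b ℕ.+ l ℕ.* (k ℕ.* b)
  eq₁ = NS.solve-∀
  eq₂ : ∀ n b l a → n ℕ.* b ℕ.+ l ℕ.* (n ℕ.* a) ≡ n ℕ.* (b ℕ.+ l ℕ.* a)
  eq₂ = NS.solve-∀

module _ {A : Set} where

  length-subsets : ∀ k (xs : List A) → length (subsets k xs) ≡ bin (length xs) k
  length-subsets zero [] = refl
  length-subsets zero (x ∷ xs) = refl
  length-subsets (suc k) [] = refl
  length-subsets (suc k) (x ∷ xs) = trans (LP.length-++ (map (x ∷_) (subsets k xs))) (cong₂ ℕ._+_ (trans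
      (LP.length-map (x ∷_) (subsets k xs)) (length-subsets k xs)) (length-subsets (suc k) xs))

  []∉subsets : ∀ k (xs : List A) → ¬ ([] ∈ subsets (suc k) xs)
  []∉subsets k (y ∷ xs) m with ∈-++⁻ (map (y ∷_) (subsets k xs)) m
  ... | inj₂ m₂ = []∉subsets k xs m₂
  ... | inj₁ m₁ with ∈-map⁻ (y ∷_) m₁
  ... | _ , _ , ()

  sole : (A → Bool) → List A → Maybe A
  sole p [] = nothing
  sole p (x ∷ xs) = if p x then (if any p xs then nothing else just x) else sole p xs

  onSole : (A → Bool) → (A → ℚ) → List A → ℚ
  onSole p f o with sole p o
  ... | just x = f x
  ... | nothing = 0ℚ

  sole-∈ : ∀ p (o : List A) {x} → sole p o ≡ just x → x ∈ o
  sole-∈ p (y ∷ o) e with p y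
  ... | false = there (sole-∈ p o e)
  ... | true with any p o
  sole-∈ p (y ∷ o) refl | true | false = here refl

  ∑-subsets-∷ : ∀ k x (xs : List A) f →
    ∑ (subsets (suc k) (x ∷ xs)) f ≡ ∑ (subsets k xs) (λ o → f (x ∷ o)) + ∑ (subsets (suc k) xs) f
  ∑-subsets-∷ k x xs f = trans (∑-++ (map (x ∷_) (subsets k xs)) (subsets (suc k) xs) f) (cong (_+ ∑
      (subsets (suc k) xs) f) (∑-map (x ∷_) (subsets k xs) f))

  ∑-avoid : ∀ p k (xs : List A) →
    ∑ (subsets k xs) (λ o → ⟦ not (any p o) ⟧) ≡ ι (bin (#ᵇ (not ∘ p) xs) k)
  ∑-avoid p zero xs = trans (QP.+-identityʳ 1ℚ) (sym (ι-def 1))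
  ∑-avoid p (suc k) [] = sym (ι-def 0)
  ∑-avoid p (suc k) (x ∷ xs) = trans (∑-subsets-∷ k x xs _) (go (p x) refl)
    where
    go : ∀ b → p x ≡ b →
      ∑ (subsets k xs) (λ o → ⟦ not (any p (x ∷ o)) ⟧) + ∑ (subsets (suc k) xs) (λ o → ⟦ not
        (any p o) ⟧) ≡ ι (bin (#ᵇ (not ∘ p) (x ∷ xs)) (suc k))
    go true e rewrite e = trans (cong₂ _+_ (∑-0 (subsets k xs)) (∑-avoid p (suc k) xs))
        (QP.+-identityˡ _)
    go false e rewrite e = trans (cong₂ _+_ (∑-avoid p k xs) (∑-avoid p (suc k) xs)) (sym (ι-+ (bin (#ᵇ
        (not ∘ p) xs) k) _))

  -- An offer with sole p-element x consists of x and k elements outside p, so every such x is sole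
  -- in equally many offers. This uniformity is why serving acts only on sole edges.
  ∑-sole : ∀ p f k (xs : List A) →
    ∑ (subsets (suc k) xs) (onSole p f) ≡ ι (bin (#ᵇ (not ∘ p) xs) k) * ∑ xs (λ x → ⟦ p x ⟧ * f x)
  ∑-sole p f k [] = sym (QP.*-zeroʳ (ι (bin 0 k)))
  ∑-sole p f k (x ∷ xs) = trans (∑-subsets-∷ k x xs _) (trans (cong (∑ (subsets k xs) (λ o → onSole p f
      (x ∷ o)) +_) (∑-sole p f k xs)) (go (p x) refl k))
    where
    W = ∑ xs (λ x → ⟦ p x ⟧ * f x)
    c : ℕ → ℕ
    c = bin (#ᵇ (not ∘ p) xs)
    e₁ : ∀ a b c → a * b + a * c ≡ a * (1ℚ * b + c)
    e₁ = solve-∀ ℚring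
    e₂ : ∀ a b c d → b * a + c * a ≡ (b + c) * (0ℚ * d + a)
    e₂ = solve-∀ ℚring
    e₃ : ∀ a d → 0ℚ + 0ℚ + 1ℚ * a ≡ 1ℚ * (0ℚ * d + a)
    e₃ = solve-∀ ℚring
    first : p x ≡ true → ∀ o → onSole p f (x ∷ o) ≡ ⟦ not (any p o) ⟧ * f x
    first e o rewrite e with any p o
    ... | true = sym (QP.*-zeroˡ (f x))
    ... | false = sym (QP.*-identityˡ (f x))
    skip : p x ≡ false → ∀ o → onSole p f (x ∷ o) ≡ onSole p f o
    skip e o rewrite e = refl
    go : ∀ b → p x ≡ b → ∀ k →
      ∑ (subsets k xs) (λ o → onSole p f (x ∷ o)) + ι (c k) * W ≡ ι (bin (#ᵇ (not ∘ p) (x ∷ xs)) k) *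
        (⟦ p x ⟧ * f x + W)
    go true e k = trans (cong (_+ ι (c k) * W) (trans (∑-cong (subsets k xs) (first e)) (trans (∑-*ʳ
        (subsets k xs) (f x) _) (cong (_* f x) (∑-avoid p k xs))))) (trans (e₁ (ι (c k)) (f x) W) (cong₂
        (λ b d → ι (bin d k) * (⟦ b ⟧ * f x + W)) (sym e) d₁))
      where
      d₁ : #ᵇ (not ∘ p) xs ≡ #ᵇ (not ∘ p) (x ∷ xs)
      d₁ rewrite e = refl
    go false e zero rewrite e | ι-def 1 = e₃ W (f x)
    go false e (suc k) = trans (cong (_+ ι (c (suc k)) * W) (trans (∑-cong (subsets (suc k) xs)
        (skip e)) (∑-sole p f k xs))) (trans (e₂ W (ι (c k)) (ι (c (suc k))) (f x)) (cong₂ (λ b d → d *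
        (⟦ b ⟧ * f x + W)) (sym e) (trans (sym (ι-+ (c k) (c (suc k)))) d₁)))
      where
      d₁ : ι (c k ℕ.+ c (suc k)) ≡ ι (bin (#ᵇ (not ∘ p) (x ∷ xs)) (suc k))
      d₁ rewrite e = refl

  -- Double counting: the k companions of an element are chosen freely among the others.
  ∑-elements : ∀ (f : A → ℚ) k x (xs : List A) →
    ∑ (subsets (suc k) (x ∷ xs)) (λ o → ∑ o f) ≡ ι (bin (length xs) k) * ∑ (x ∷ xs) f
  ∑-elements f k x xs = trans (∑-subsets-∷ k x xs _) (trans (cong (_+ ∑ (subsets (suc k) xs)
      (λ o → ∑ o f)) (trans (∑-+ (subsets k xs) (λ _ → f x) (λ o → ∑ o f)) (cong (_+ ∑ (subsets k xs)
      (λ o → ∑ o f)) (trans (∑-const (subsets k xs) (f x)) (cong (λ l → ι l * f x)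
      (length-subsets k xs)))))) (rest k xs))
    where
    e₂ : ∀ x b → 1ℚ * x + 0ℚ + 1ℚ * b ≡ 1ℚ * (x + b)
    e₂ = solve-∀ ℚring
    e₃ : ∀ x c t d → (c + d) * x + c * t + d * t ≡ (c + d) * (x + t)
    e₃ = solve-∀ ℚring
    e₄ : ∀ a x → a * x + 0ℚ + 0ℚ ≡ a * (x + 0ℚ)
    e₄ = solve-∀ ℚring
    rest : ∀ k xs →
      ι (bin (length xs) k) * f x + ∑ (subsets k xs) (λ o → ∑ o f) + ∑ (subsets (suc k) xs)
        (λ o → ∑ o f) ≡ ι (bin (length xs) k) * ∑ (x ∷ xs) f
    rest zero [] = e₄ (ι 1) (f x)
    rest zero (y ∷ ys) = trans (cong (ι 1 * f x + (0ℚ + 0ℚ) +_) (∑-elements f zero y ys)) (subst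
        (λ o → o * f x + (0ℚ + 0ℚ) + o * ∑ (y ∷ ys) f ≡ o * (f x + ∑ (y ∷ ys) f)) (sym (ι-def 1)) (e₂
        (f x) (∑ (y ∷ ys) f)))
    rest (suc k) [] = e₄ (ι 0) (f x)
    rest (suc k) (y ∷ ys) = trans (cong₂ (λ a b → ι (bin (suc (length ys)) (suc k)) * f x + a + b)
        (∑-elements f k y ys) (∑-elements f (suc k) y ys)) (subst (λ s → s * f x + ι (bin
        (length ys) k) * ∑ (y ∷ ys) f + ι (bin (length ys) (suc k)) * ∑ (y ∷ ys) f ≡ s * (f x + ∑
        (y ∷ ys) f)) (sym (ι-+ (bin (length ys) k) (bin (length ys) (suc k)))) (e₃ (f x) (ι (bin
        (length ys) k)) (∑ (y ∷ ys) f) (ι (bin (length ys) (suc k)))))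

∑-elements′ : ∀ {A : Set} (f : A → ℚ) k l → 0 ℕ.< length l →
  ∑ (subsets (suc k) l) (λ o → ∑ o f) ≡ ι (bin (ℕ.pred (length l)) k) * ∑ l f
∑-elements′ f k (x ∷ l) _ = ∑-elements f k x l

subsets-rate : ∀ {A : Set} k (l : List A) → 0 ℕ.< length l →
  ι (length l) * ι (bin (ℕ.pred (length l)) k) ≡ ι (suc k) * ι (length (subsets (suc k) l))
subsets-rate k l@(x ∷ xs) _ = trans (sym (ι-* (length l) (bin (length xs) k))) (trans (cong ι (sym
    (trans (cong (suc k ℕ.*_) (length-subsets (suc k) l)) (bin-absorb (length xs) k)))) (ι-* (suc k)
    (length (subsets (suc k) l))))

-- The exponential series

expTerm-suc : ∀ x j → ι (suc j) * expTerm x (suc j) ≡ x * expTerm x j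
expTerm-suc x j = trans (eq (ι (suc j)) (expTerm x j) x (pos 1 Q./ suc j)) (trans (cong (_*
    (x * expTerm x j)) (trans (cong (ι (suc j) *_) (sym (recip-def j))) (*-recip (suc j) (s≤s z≤n))))
    (QP.*-identityˡ _))
  where
  eq : ∀ n e x r → n * (e * (x * r)) ≡ n * r * (x * e)
  eq = solve-∀ ℚring

expTerm≥0 : ∀ {x} j → 0ℚ ≤ x → 0ℚ ≤ expTerm x j
expTerm≥0 zero p = 0≤1
expTerm≥0 (suc j) p = *≥0 (expTerm≥0 j p) (*≥0 p (subst (0ℚ ≤_) (recip-def j) (recip≥0 (suc j))))

expPartial≥0 : ∀ {x} k → 0ℚ ≤ x → 0ℚ ≤ expPartial x k
expPartial≥0 zero p = QP.≤-refl
expPartial≥0 (suc k) p = +≥0 (expPartial≥0 k p) (expTerm≥0 k p)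

private
  ι*-distrib : ∀ j a b → ι (suc j) * (a - b) ≡ ι (suc j) * a - ι (suc j) * b
  ι*-distrib j a b = eq (ι (suc j)) a b
    where
    eq : ∀ n a b → n * (a - b) ≡ n * a - n * b
    eq = solve-∀ ℚring

-- Mean value inequalities for x ^ j / j !
expTerm-upper : ∀ {x y} j → 0ℚ ≤ x → x ≤ y →
  expTerm y (suc j) - expTerm x (suc j) ≤ (y - x) * expTerm y j
expTerm-upper {x} {y} j 0≤x x≤y = *-cancel≤ (ι (suc j)) (ι>0 (s≤s z≤n)) (≤-refl′ (trans
    (ι*-distrib j _ _) (cong₂ _-_ (expTerm-suc y j) (expTerm-suc x j))) ⟫ core j ⟫ ≤-refl′ (trans
    (e₂ x y (ι j) (expTerm y j)) (cong (_* ((y - x) * expTerm y j)) (sym (ι-suc j)))))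
  where
  e₁ : ∀ x y a b → y * a - x * b ≡ (y - x) * a + x * (a - b)
  e₁ = solve-∀ ℚring
  e₂ : ∀ x y n a → (y - x) * a + (y - x) * (n * a) ≡ (1ℚ + n) * ((y - x) * a)
  e₂ = solve-∀ ℚring
  e₃ : ∀ x y → y * 1ℚ - x * 1ℚ ≡ (y - x) * 1ℚ + (y - x) * (0ℚ * 1ℚ)
  e₃ = solve-∀ ℚring
  e₄ : ∀ y d e → y * (d * e) ≡ d * (y * e)
  e₄ = solve-∀ ℚring
  core : ∀ j → y * expTerm y j - x * expTerm x j ≤ (y - x) * expTerm y j + (y - x) * (ι j * expTerm y j)
  core zero = ≤-refl′ (trans (e₃ x y) (cong (λ z → (y - x) * 1ℚ + (y - x) * (z * 1ℚ)) (sym (ι-def 0))))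
  core (suc i) = ≤-refl′ (e₁ x y (expTerm y (suc i)) (expTerm x (suc i)))
    ⟫ QP.+-monoʳ-≤ ((y - x) * expTerm y (suc i)) (*≤*ˡ 0≤x (expTerm-upper i 0≤x x≤y) ⟫ *≤*ʳ (*≥0
      (diff≥0 x≤y) (expTerm≥0 i (0≤x ⟫ x≤y))) x≤y ⟫ ≤-refl′ (trans (e₄ y (y - x) (expTerm y i)) (cong
      ((y - x) *_) (sym (expTerm-suc y i)))))

expTerm-lower : ∀ {x y} j → 0ℚ ≤ x → x ≤ y →
  (y - x) * expTerm x j ≤ expTerm y (suc j) - expTerm x (suc j)
expTerm-lower {x} {y} j 0≤x x≤y = *-cancel≤ (ι (suc j)) (ι>0 (s≤s z≤n)) (≤-refl′ (trans (cong (_*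
    ((y - x) * expTerm x j)) (ι-suc j)) (sym (e₂ x y (ι j) (expTerm x j)))) ⟫ core j ⟫ ≤-refl′ (sym
    (trans (ι*-distrib j _ _) (cong₂ _-_ (expTerm-suc y j) (expTerm-suc x j)))))
  where
  e₁ : ∀ x y a b → (y - x) * b + y * (a - b) ≡ y * a - x * b
  e₁ = solve-∀ ℚring
  e₂ : ∀ x y n a → (y - x) * a + (y - x) * (n * a) ≡ (1ℚ + n) * ((y - x) * a)
  e₂ = solve-∀ ℚring
  e₃ : ∀ x y → y * 1ℚ - x * 1ℚ ≡ (y - x) * 1ℚ + (y - x) * (0ℚ * 1ℚ)
  e₃ = solve-∀ ℚring
  e₄ : ∀ y d e → y * (d * e) ≡ d * (y * e)
  e₄ = solve-∀ ℚring
  core : ∀ j → (y - x) * expTerm x j + (y - x) * (ι j * expTerm x j) ≤ y * expTerm y j - x * expTerm x j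
  core zero = ≤-refl′ (sym (trans (e₃ x y) (cong (λ z → (y - x) * 1ℚ + (y - x) * (z * 1ℚ)) (sym
      (ι-def 0)))))
  core (suc i) = QP.+-monoʳ-≤ ((y - x) * expTerm x (suc i)) (≤-refl′ (trans (cong ((y - x) *_)
      (expTerm-suc x i)) (sym (e₄ x (y - x) (expTerm x i)))) ⟫ *≤*ʳ (*≥0 (diff≥0 x≤y)
      (expTerm≥0 i 0≤x)) x≤y ⟫ *≤*ˡ (0≤x ⟫ x≤y) (expTerm-lower i 0≤x x≤y))
    ⟫ ≤-refl′ (e₁ x y (expTerm y (suc i)) (expTerm x (suc i)))

expPartial-upper : ∀ {x y} k → 0ℚ ≤ x → x ≤ y →
  expPartial y k - expPartial x k ≤ (y - x) * expPartial y k
expPartial-upper {x} {y} zero 0≤x x≤y = ≤-refl′ (sym (QP.*-zeroʳ (y - x)))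
expPartial-upper {x} {y} (suc k) 0≤x x≤y = strong k ⟫ *≤*ˡ (diff≥0 x≤y) (a≤a+b (expTerm≥0 k (0≤x ⟫ x≤y)))
  where
  e₀ : ∀ d → 0ℚ + 1ℚ - (0ℚ + 1ℚ) ≡ d * 0ℚ
  e₀ = solve-∀ ℚring
  e₁ : ∀ a b c d → a + b - (c + d) ≡ (a - c) + (b - d)
  e₁ = solve-∀ ℚring
  strong : ∀ k → expPartial y (suc k) - expPartial x (suc k) ≤ (y - x) * expPartial y k
  strong zero = ≤-refl′ (e₀ (y - x))
  strong (suc k) = ≤-refl′ (e₁ (expPartial y (suc k)) (expTerm y (suc k)) (expPartial x (suc k))
      (expTerm x (suc k)))
    ⟫ QP.+-mono-≤ (strong k) (expTerm-upper k 0≤x x≤y)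
    ⟫ ≤-refl′ (sym (QP.*-distribˡ-+ (y - x) (expPartial y k) (expTerm y k)))

expPartial-lower : ∀ {x y} k → 0ℚ ≤ x → x ≤ y →
  (y - x) * expPartial x k ≤ expPartial y (suc k) - expPartial x (suc k)
expPartial-lower {x} {y} zero 0≤x x≤y = ≤-refl′ (sym (e₀ (y - x)))
  where
  e₀ : ∀ d → 0ℚ + 1ℚ - (0ℚ + 1ℚ) ≡ d * 0ℚ
  e₀ = solve-∀ ℚring
expPartial-lower {x} {y} (suc k) 0≤x x≤y = ≤-refl′ (QP.*-distribˡ-+ (y - x) (expPartial x k)
    (expTerm x k))
  ⟫ QP.+-mono-≤ (expPartial-lower k 0≤x x≤y) (expTerm-lower k 0≤x x≤y)
  ⟫ ≤-refl′ (sym (e₁ (expPartial y (suc k)) (expTerm y (suc k)) (expPartial x (suc k)) (expTerm x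
    (suc k))))
  where
  e₁ : ∀ a b c d → a + b - (c + d) ≡ (a - c) + (b - d)
  e₁ = solve-∀ ℚring

expPartial-mono : ∀ {x y} k → 0ℚ ≤ x → x ≤ y → expPartial x k ≤ expPartial y k
expPartial-mono zero 0≤x x≤y = QP.≤-refl
expPartial-mono (suc k) 0≤x x≤y = ≥0diff (*≥0 (diff≥0 x≤y) (expPartial≥0 k 0≤x)
    ⟫ expPartial-lower k 0≤x x≤y)

expPartial-0 : ∀ k → expPartial 0ℚ k ≤ 1ℚ
expPartial-0 zero = 0≤1
expPartial-0 (suc k) = ≤-refl′ (go k)
  where
  go : ∀ k → expPartial 0ℚ (suc k) ≡ 1ℚ
  go zero = refl
  go (suc k) = trans (cong₂ _+_ (go k) (e₁ (expTerm 0ℚ k) (pos 1 Q./ suc k))) refl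
    where
    e₁ : ∀ a r → a * (0ℚ * r) ≡ 0ℚ
    e₁ = solve-∀ ℚring

ιsuc* : ∀ s z → ι (suc s) * z ≡ ι s * z + z
ιsuc* s z = trans (cong (_* z) (ι-suc s)) (eq (ι s) z)
  where
  eq : ∀ s z → (1ℚ + s) * z ≡ s * z + z
  eq = solve-∀ ℚring

ι0* : ∀ z → ι 0 * z ≡ 0ℚ
ι0* z = trans (cong (_* z) (ι-def 0)) (QP.*-zeroˡ z)

-- The inequality exp (s z) ≤ (1 - z)^(-s) for partial sums E: since E′ ≤ E, one step from x to x +
-- z gives (1 - z) E(x + z) ≤ E(x).
exp-≤-geometric : ∀ {z} s k → 0ℚ ≤ z → z ≤ 1ℚ → (1ℚ - z) ^ s * expPartial (ι s * z) k ≤ 1ℚ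
exp-≤-geometric {z} zero k 0≤z z≤1 = ≤-refl′ (trans (QP.*-identityˡ _) (cong (λ y → expPartial y k)
    (ι0* z)))
  ⟫ expPartial-0 k
exp-≤-geometric {z} (suc s) k 0≤z z≤1 = ≤-refl′ (trans (cong (λ y → (1ℚ - z) *
    (1ℚ - z) ^ s * expPartial y k) (ιsuc* s z)) (e₁ (1ℚ - z) ((1ℚ - z) ^ s) _))
  ⟫ *≤*ˡ (^≥0 s (diff≥0 z≤1)) step
  ⟫ exp-≤-geometric s k 0≤z z≤1
  where
  x = ι s * z
  e₁ : ∀ a b c → a * b * c ≡ b * (a * c)
  e₁ = solve-∀ ℚring
  e₂ : ∀ x z a b → (1ℚ - z) * a + ((x + z - x) * a - (a - b)) ≡ b
  e₂ = solve-∀ ℚring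
  step : (1ℚ - z) * expPartial (x + z) k ≤ expPartial x k
  step = ≤-by _ (diff≥0 (expPartial-upper k (*≥0 (ι≥0 s) 0≤z) (a≤a+b 0≤z))) (e₂ x z (expPartial
      (x + z) k) (expPartial x k))

-- The lower mean value inequality bounds the increment of k + 1 terms of the series by the sum of
-- only k terms, so every factor 1 + z costs one more term.
geometric-≤-exp : ∀ {z} s → 0ℚ ≤ z → (1ℚ + z) ^ s ≤ expPartial (ι s * z) (suc s)
geometric-≤-exp {z} zero 0≤z = QP.≤-refl
geometric-≤-exp {z} (suc s) 0≤z = *≤*ˡ (+≥0 0≤1 0≤z) (geometric-≤-exp s 0≤z)
  ⟫ ≤-by _ (+≥0 (diff≥0 (expPartial-lower (suc s) x≥0 (a≤a+b 0≤z))) (expTerm≥0 (suc s) x≥0)) (e₂ x z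
    (expPartial (x + z) (suc (suc s))) (expPartial x (suc s)) (expTerm x (suc s)))
  ⟫ ≤-refl′ (cong (λ y → expPartial y (suc (suc s))) (sym (ιsuc* s z)))
  where
  x = ι s * z
  x≥0 = *≥0 (ι≥0 s) 0≤z
  e₂ : ∀ x z a b c → (1ℚ + z) * b + ((a - (b + c) - (x + z - x) * b) + c) ≡ a
  e₂ = solve-∀ ℚring

-- Together with `ExpLe-elim` this is the whole interface to logarithms: a power of 1 - z certifies
-- all partial sums at once, and conversely one partial sum already bounds a power of 1 + z.
ExpLe-intro : ∀ {x z} s m → 0ℚ ≤ x → 0ℚ ≤ z → z < 1ℚ → x ≤ ι s * z → 1ℚ ≤ ι m * (1ℚ - z) ^ s → ExpLe x m
ExpLe-intro {x} {z} s m 0≤x 0≤z z<1 x≤ h k = expPartial-mono k 0≤x x≤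
  ⟫ *-cancel≤ ((1ℚ - z) ^ s) (^>0 s 0<1-z) (exp-≤-geometric s k 0≤z (QP.<⇒≤ z<1) ⟫ h ⟫ ≤-refl′ (trans
    (QP.*-comm (ι m) _) (cong ((1ℚ - z) ^ s *_) (ι-def m))))
  where
  0<1-z : 0ℚ < 1ℚ - z
  0<1-z = subst (_< 1ℚ - z) (QP.+-inverseʳ z) (QP.+-monoˡ-< (- z) z<1)

ExpLe-elim : ∀ {x z} s m → 0ℚ ≤ z → ι s * z ≤ x → ExpLe x m → (1ℚ + z) ^ s ≤ ι m
ExpLe-elim {x} {z} s m 0≤z le h = geometric-≤-exp s 0≤z
  ⟫ expPartial-mono (suc s) (*≥0 (ι≥0 s) 0≤z) le
  ⟫ h (suc s)
  ⟫ ≤-refl′ (sym (ι-def m))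

-- Edges, non-edges and degrees

∨-comm : ∀ a b → a ∨ b ≡ b ∨ a
∨-comm true true = refl
∨-comm true false = refl
∨-comm false true = refl
∨-comm false false = refl

adj-sym : ∀ {n} (g : Graph n) u v → adj g u v ≡ adj g v u
adj-sym [] u v = refl
adj-sym (e ∷ g) u v = cong₂ _∨_ (∨-comm (sameEdge e (u , v)) (sameEdge e (v , u))) (adj-sym g u v)

adj-∷ : ∀ {n} (g : Graph n) e u v → adj g u v ≡ true → adj (e ∷ g) u v ≡ true
adj-∷ g e u v h rewrite h = ∨true (sameEdge e (u , v) ∨ sameEdge e (v , u))
  where
  ∨true : ∀ a → a ∨ true ≡ true
  ∨true true = refl
  ∨true false = refl

adj-head : ∀ {n} (g : Graph n) u v → adj ((u , v) ∷ g) u v ≡ true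
adj-head g u v rewrite ==-refl u | ==-refl v = refl

nonadj : ∀ {n} → Graph n → Fin n → Fin n → Bool
nonadj g i j = not (i == j) ∧ not (adj g i j)

_<ᵉ_ : ∀ {n} → Fin n → Fin n → Bool
i <ᵉ j = suc (toℕ i) ℕ.≤ᵇ toℕ j

∑-allEdges : ∀ n (f : Edge n → ℚ) → ∑ (allEdges n) f ≡ ∑ᶠ λ i → ∑ᶠ λ j → ⟦ i <ᵉ j ⟧ * f (i , j)
∑-allEdges n f = trans (∑-concatMap _ (allFin n) f) (∑-cong (allFin n) (λ i → trans (∑-map (i ,_)
    (filterᵇ (i <ᵉ_) (allFin n)) f) (∑-filter (i <ᵉ_) (allFin n) (λ j → f (i , j)))))

order-split : ∀ {n} (i j : Fin n) → ⟦ i <ᵉ j ⟧ + ⟦ j <ᵉ i ⟧ ≡ ⟦ not (i == j) ⟧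
order-split zero zero = refl
order-split zero (suc j) = refl
order-split (suc i) zero = refl
order-split (suc i) (suc j) = order-split i j

∑ᶠᶠ-cong : ∀ {n} {f g : Fin n → Fin n → ℚ} → (∀ i j → f i j ≡ g i j) →
  (∑ᶠ λ i → ∑ᶠ (f i)) ≡ (∑ᶠ λ i → ∑ᶠ (g i))
∑ᶠᶠ-cong {n} h = ∑-cong (allFin n) (λ i → ∑-cong (allFin n) (h i))

∑ᶠᶠ-+ : ∀ {n} (f g : Fin n → Fin n → ℚ) →
  (∑ᶠ λ i → ∑ᶠ λ j → f i j + g i j) ≡ (∑ᶠ λ i → ∑ᶠ (f i)) + (∑ᶠ λ i → ∑ᶠ (g i))
∑ᶠᶠ-+ {n} f g = trans (∑-cong (allFin n) (λ i → ∑-+ (allFin n) (f i) (g i))) (∑-+ (allFin n) _ _)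

-- Edges are stored with i < j only. Symmetrising turns a sum over non-edges into one over ordered
-- pairs, where row i belongs to vertex i and can be estimated separately.
∑-nonEdges : ∀ {n} (g : Graph n) (F : Fin n → Fin n → ℚ) →
  ∑ (nonEdges g) (λ e → F (proj₁ e) (proj₂ e) + F (proj₂ e) (proj₁ e)) ≡ ∑ᶠ λ i → ∑ᶠ λ j →
  ⟦ nonadj g i j ⟧ * F i j
∑-nonEdges {n} g F = trans (∑-filter (λ e → not (isEdgeOf g e)) (allEdges n) _) (trans (∑-allEdges n _)
    (trans (∑ᶠᶠ-cong split) (trans (∑ᶠᶠ-+ (λ i j → ⟦ i <ᵉ j ⟧ * H i j) (λ i j → ⟦ i <ᵉ j ⟧ * H j i))
    (trans (cong ((∑ᶠ λ i → ∑ᶠ λ j → ⟦ i <ᵉ j ⟧ * H i j) +_) (∑-swap (allFin n) (allFin n)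
    (λ i j → ⟦ i <ᵉ j ⟧ * H j i))) (trans (sym (∑ᶠᶠ-+ (λ i j → ⟦ i <ᵉ j ⟧ * H i j)
    (λ i j → ⟦ j <ᵉ i ⟧ * H i j))) (∑ᶠᶠ-cong join))))))
  where
  H : Fin n → Fin n → ℚ
  H i j = ⟦ not (adj g i j) ⟧ * F i j
  e₁ : ∀ o a f h → o * (a * (f + h)) ≡ o * (a * f) + o * (a * h)
  e₁ = solve-∀ ℚring
  split : ∀ i j →
    ⟦ i <ᵉ j ⟧ * (⟦ not (adj g i j) ⟧ * (F i j + F j i)) ≡ ⟦ i <ᵉ j ⟧ * H i j + ⟦ i <ᵉ j ⟧ * H j i
  split i j = trans (e₁ ⟦ i <ᵉ j ⟧ ⟦ not (adj g i j) ⟧ (F i j) (F j i)) (cong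
      (λ b → ⟦ i <ᵉ j ⟧ * H i j + ⟦ i <ᵉ j ⟧ * (⟦ not b ⟧ * F j i)) (adj-sym g i j))
  e₂ : ∀ o p a f → o * (a * f) + p * (a * f) ≡ ((o + p) * a) * f
  e₂ = solve-∀ ℚring
  join : ∀ i j → ⟦ i <ᵉ j ⟧ * H i j + ⟦ j <ᵉ i ⟧ * H i j ≡ ⟦ nonadj g i j ⟧ * F i j
  join i j = trans (e₂ ⟦ i <ᵉ j ⟧ ⟦ j <ᵉ i ⟧ ⟦ not (adj g i j) ⟧ (F i j)) (cong (_* F i j) (trans (cong
      (_* ⟦ not (adj g i j) ⟧) (order-split i j)) (sym (⟦∧⟧ (not (i == j)) (not (adj g i j))))))

bit : Bool → ℕ
bit true = 1
bit false = 0

ι-bit : ∀ b → ι (bit b) ≡ ⟦ b ⟧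
ι-bit true = ι-def 1
ι-bit false = ι-def 0

degree : ∀ {n} → Graph n → Fin n → ℕ
degree [] v = 0
degree ((a , b) ∷ g) v = bit (v == a) ℕ.+ bit (v == b) ℕ.+ degree g v

ι-degree-∷ : ∀ {n} (a b : Fin n) g v →
  ι (degree ((a , b) ∷ g) v) ≡ ⟦ v == a ⟧ + ⟦ v == b ⟧ + ι (degree g v)
ι-degree-∷ a b g v = trans (ι-+ _ (degree g v)) (cong (_+ ι (degree g v)) (trans (ι-+ (bit (v == a))
    (bit (v == b))) (cong₂ _+_ (ι-bit (v == a)) (ι-bit (v == b)))))

∑ᶠ-δ₁ : ∀ {n} (i : Fin n) → ∑ᶠ (λ v → ⟦ v == i ⟧) ≡ 1ℚ
∑ᶠ-δ₁ {n} i = trans (∑-cong (allFin n) (λ v → sym (QP.*-identityʳ ⟦ v == i ⟧))) (∑ᶠ-δ i (λ _ → 1ℚ))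

-- Only an inequality, as `degree` counts list entries and an arbitrary list may repeat an edge or
-- contain loops.
neighbours≤degree : ∀ {n} (g : Graph n) v → ∑ᶠ (λ x → ⟦ adj g v x ⟧) ≤ ι (degree g v)
neighbours≤degree {n} [] v = ≤-refl′ (trans (∑-0 (allFin n)) (sym (ι-def 0)))
neighbours≤degree {n} ((a , b) ∷ g) v = ∑-mono (allFin n) each
  ⟫ ≤-refl′ (trans (∑-+ (allFin n) _ _) (cong (_+ ∑ᶠ (λ x → ⟦ adj g v x ⟧)) (trans (∑-+ (allFin n) _ _)
    (cong₂ _+_ (trans (∑-*ʳ (allFin n) ⟦ v == a ⟧ _) (trans (cong (_* ⟦ v == a ⟧) (∑ᶠ-δ₁ b))
    (QP.*-identityˡ ⟦ v == a ⟧))) (trans (∑-*ʳ (allFin n) ⟦ v == b ⟧ _) (trans (cong (_* ⟦ v == b ⟧)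
    (∑ᶠ-δ₁ a)) (QP.*-identityˡ ⟦ v == b ⟧)))))))
  ⟫ QP.+-monoʳ-≤ (⟦ v == a ⟧ + ⟦ v == b ⟧) (neighbours≤degree g v)
  ⟫ ≤-refl′ (sym (ι-degree-∷ a b g v))
  where
  same : ∀ (c d : Fin n) x → ⟦ (c == v) ∧ (d == x) ⟧ ≤ ⟦ x == d ⟧ * ⟦ v == c ⟧
  same c d x = ≤-refl′ (trans (⟦∧⟧ (c == v) (d == x)) (trans (QP.*-comm ⟦ c == v ⟧ ⟦ d == x ⟧) (cong₂
      (λ p q → ⟦ p ⟧ * ⟦ q ⟧) (==-sym d x) (==-sym c v))))
  each : ∀ x →
    ⟦ adj ((a , b) ∷ g) v x ⟧ ≤ ⟦ x == b ⟧ * ⟦ v == a ⟧ + ⟦ x == a ⟧ * ⟦ v == b ⟧ + ⟦ adj g v x ⟧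
  each x = ⟦∨⟧≤ (sameEdge (a , b) (v , x) ∨ sameEdge (a , b) (x , v)) (adj g v x)
    ⟫ QP.+-monoˡ-≤ ⟦ adj g v x ⟧ (⟦∨⟧≤ (sameEdge (a , b) (v , x)) (sameEdge (a , b) (x , v))
      ⟫ QP.+-mono-≤ (same a b x) (≤-refl′ (trans (⟦∧⟧ (a == x) (b == v)) (cong₂ (λ p q → ⟦ p ⟧ * ⟦ q ⟧)
      (==-sym a x) (==-sym b v)))))

∑-degree : ∀ {n} (g : Graph n) → ∑ᶠ (λ v → ι (degree g v)) ≡ ι (length g) + ι (length g)
∑-degree {n} [] = trans (trans (∑-cong (allFin n) (λ _ → ι-def 0)) (∑-0 (allFin n))) (sym (cong₂ _+_
    (ι-def 0) (ι-def 0)))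
∑-degree {n} ((a , b) ∷ g) = trans (∑-cong (allFin n) (ι-degree-∷ a b g)) (trans (∑-+ (allFin n) _ _)
    (trans (cong₂ _+_ (trans (∑-+ (allFin n) _ _) (cong₂ _+_ (∑ᶠ-δ₁ a) (∑ᶠ-δ₁ b))) (∑-degree g)) (trans
    (eq (ι (length g))) (sym (cong₂ _+_ (ι-suc (length g)) (ι-suc (length g)))))))
  where
  eq : ∀ x → 1ℚ + 1ℚ + (x + x) ≡ (1ℚ + x) + (1ℚ + x)
  eq = solve-∀ ℚring

row≤ : ∀ {n} (g : Graph n) i → ∑ᶠ (λ j → ⟦ nonadj g i j ⟧) ≤ ι n - 1ℚ
row≤ {n} g i = ∑-mono (allFin n) (λ j → ∧≤ (i == j) (adj g i j) ⟫ ≤-refl′ (cong (λ b → 1ℚ - ⟦ b ⟧)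
    (==-sym i j)))
  ⟫ ≤-refl′ (∑-1- (λ j → ⟦ j == i ⟧) (∑ᶠ-δ₁ i))
  where
  ∧≤ : ∀ a b → ⟦ not a ∧ not b ⟧ ≤ 1ℚ - ⟦ a ⟧
  ∧≤ true b = QP.≤-refl
  ∧≤ false b = ⟦⟧≤1 (not b)
  ∑-1- : ∀ f → ∑ᶠ f ≡ 1ℚ → ∑ᶠ {n} (λ j → 1ℚ - f j) ≡ ι n - 1ℚ
  ∑-1- f e = trans (∑-+ (allFin n) _ _) (cong₂ _+_ (trans (∑ᶠ-const n 1ℚ) (QP.*-identityʳ (ι n))) (trans
      (∑-cong (allFin n) (λ j → neg1 (f j))) (trans (∑-*ˡ (allFin n) (- 1ℚ) f) (cong (- 1ℚ *_) e))))
    where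
    neg1 : ∀ x → - x ≡ - 1ℚ * x
    neg1 = solve-∀ ℚring

row≥ : ∀ {n} (g : Graph n) i → ι n - 1ℚ - ι (degree g i) ≤ ∑ᶠ (λ j → ⟦ nonadj g i j ⟧)
row≥ {n} g i = QP.+-monoʳ-≤ (ι n - 1ℚ) (neg≤ (neighbours≤degree g i))
  ⟫ ≤-refl′ (sym sum)
  ⟫ ∑-mono (allFin n) each
  where
  each : ∀ j → 1ℚ + (- 1ℚ * ⟦ j == i ⟧ + - 1ℚ * ⟦ adj g i j ⟧) ≤ ⟦ nonadj g i j ⟧
  each j = ≤-refl′ (cong (λ b → 1ℚ + (- 1ℚ * ⟦ b ⟧ + - 1ℚ * ⟦ adj g i j ⟧)) (==-sym j i))
    ⟫ bool (i == j) (adj g i j)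
    where
    bool : ∀ a b → 1ℚ + (- 1ℚ * ⟦ a ⟧ + - 1ℚ * ⟦ b ⟧) ≤ ⟦ not a ∧ not b ⟧
    bool true true = QP.≤ᵇ⇒≤ _
    bool true false = QP.≤-refl
    bool false true = QP.≤-refl
    bool false false = QP.≤-refl
  e₁ : ∀ n d → n * 1ℚ + (- 1ℚ * 1ℚ + - 1ℚ * d) ≡ n - 1ℚ - d
  e₁ = solve-∀ ℚring
  sum : ∑ᶠ {n} (λ j → 1ℚ + (- 1ℚ * ⟦ j == i ⟧ + - 1ℚ * ⟦ adj g i j ⟧)) ≡ ι n - 1ℚ - ∑ᶠ
      (λ x → ⟦ adj g i x ⟧)
  sum = trans (∑-+ (allFin n) _ _) (trans (cong₂ _+_ (∑ᶠ-const n 1ℚ) (trans (∑-+ (allFin n) _ _)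
      (cong₂ _+_ (trans (∑-*ˡ (allFin n) (- 1ℚ) _) (cong (- 1ℚ *_) (∑ᶠ-δ₁ i))) (∑-*ˡ (allFin n)
      (- 1ℚ) _)))) (e₁ (ι n) _))

twice-nonEdges : ∀ {n} (g : Graph n) → ι (length (nonEdges g)) + ι (length (nonEdges g)) ≡ ∑ᶠ λ i →
  ∑ᶠ λ j → ⟦ nonadj g i j ⟧
twice-nonEdges {n} g = trans (trans (eq (ι (length (nonEdges g)))) (sym (∑-const (nonEdges g)
    (1ℚ + 1ℚ)))) (trans (∑-nonEdges g (λ _ _ → 1ℚ)) (∑ᶠᶠ-cong (λ i j → QP.*-identityʳ ⟦ nonadj g i j ⟧)))
  where
  eq : ∀ x → x + x ≡ x * (1ℚ + 1ℚ)
  eq = solve-∀ ℚring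

nonEdges≤ : ∀ {n} (g : Graph n) → ι (length (nonEdges g)) + ι (length (nonEdges g)) ≤ ι n * (ι n - 1ℚ)
nonEdges≤ {n} g = ≤-refl′ (twice-nonEdges g)
  ⟫ ∑-mono (allFin n) (row≤ g)
  ⟫ ≤-refl′ (∑ᶠ-const n (ι n - 1ℚ))

nonEdges≥ : ∀ {n} (g : Graph n) →
  ι n * (ι n - 1ℚ) - (ι (length g) + ι (length g)) ≤ ι (length (nonEdges g)) + ι (length (nonEdges g))
nonEdges≥ {n} g = ≤-refl′ (sym sum) ⟫ ∑-mono (allFin n) (row≥ g) ⟫ ≤-refl′ (sym (twice-nonEdges g))
  where
  neg1 : ∀ x → - x ≡ - 1ℚ * x
  neg1 = solve-∀ ℚring
  sum : (∑ᶠ λ i → ι n - 1ℚ - ι (degree g i)) ≡ ι n * (ι n - 1ℚ) - (ι (length g) + ι (length g))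
  sum = trans (∑-+ (allFin n) _ _) (cong₂ _+_ (∑ᶠ-const n (ι n - 1ℚ)) (trans (∑-cong (allFin n)
      (λ i → neg1 (ι (degree g i)))) (trans (∑-*ˡ (allFin n) (- 1ℚ) _) (trans (cong (- 1ℚ *_)
      (∑-degree g)) (sym (neg1 _))))))

-- The optimal success probability

ℚsum-map : ∀ {A : Set} (f : A → ℚ) xs → ℚsum (map f xs) ≡ ∑ xs f
ℚsum-map f [] = refl
ℚsum-map f (x ∷ xs) = cong (f x +_) (ℚsum-map f xs)

average-∑ : ∀ {A : Set} (f : A → ℚ) xs → average (map f xs) ≡ ∑ xs f * recip (length xs)
average-∑ f [] = sym (QP.*-zeroˡ (recip 0))
average-∑ f (x ∷ xs) = cong₂ _*_ (ℚsum-map f (x ∷ xs)) (trans (sym (recip-def (length (map f xs))))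
    (cong (recip ∘ suc) (LP.length-map f xs)))

≤-average : ∀ {A : Set} (f : A → ℚ) xs c → 0 ℕ.< length xs → ι (length xs) * c ≤ ∑ xs f →
  c ≤ average (map f xs)
≤-average f xs c p h = ≤-recip {length xs} p h ⟫ ≤-refl′ (sym (average-∑ f xs))

average-mono : ∀ {A : Set} (f g : A → ℚ) xs → (∀ x → f x ≤ g x) → average (map f xs) ≤ average (map g xs)
average-mono f g xs h = ≤-refl′ (average-∑ f xs)
  ⟫ *≤*ʳ (recip≥0 (length xs)) (∑-mono xs h)
  ⟫ ≤-refl′ (sym (average-∑ g xs))

average-tail-cong : ∀ {A : Set} x (f g : A → ℚ) xs → (∀ y → f y ≡ g y) →
  average (x ∷ map f xs) ≡ average (x ∷ map g xs)
average-tail-cong x f g xs h = cong (λ l → average (x ∷ l)) (LP.map-cong h xs)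

argmax : ∀ {A : Set} (f : A → ℚ) (e : A) (es : List A) → Fin (suc (length es))
argmax f e [] = zero
argmax f e (e′ ∷ es) with f e Q.≤? f (lookup (e′ ∷ es) (argmax f e′ es))
... | yes _ = suc (argmax f e′ es)
... | no _ = zero

argmax-max : ∀ {A : Set} (f : A → ℚ) e es x → x ∈ (e ∷ es) → f x ≤ f (lookup (e ∷ es) (argmax f e es))
argmax-max f e [] x (here refl) = QP.≤-refl
argmax-max f e (e′ ∷ es) x m with f e Q.≤? f (lookup (e′ ∷ es) (argmax f e′ es))
argmax-max f e (e′ ∷ es) x (here refl) | yes p = p
argmax-max f e (e′ ∷ es) x (there m) | yes p = argmax-max f e′ es x m
argmax-max f e (e′ ∷ es) x (here refl) | no p = QP.≤-refl
argmax-max f e (e′ ∷ es) x (there m) | no p = argmax-max f e′ es x m ⟫ QP.<⇒≤ (QP.≰⇒> p)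

module Process (n K : ℕ) where

  offers : Graph n → List (List (Edge n))
  offers g = subsets K (nonEdges g)

  -- A copy, accessible by name, of the `where`-bound `step` of `probHam`.
  offerStep : Alg n → ℕ → History n → Graph n → List (Edge n) → ℚ
  offerStep A t h g [] = probHam n K A t h g
  offerStep A t h g (e ∷ es) = probHam n K A t (h ++ ((e ∷ es) ∷ [])) (lookup (e ∷ es) (A h e es) ∷ g)

  probHam-suc : ∀ A t h g → 0 ℕ.< length (offers g) →
    probHam n K A (suc t) h g ≡ average (map (offerStep A t h g) (offers g))
  probHam-suc A t h g p with subsets K (nonEdges g)
  probHam-suc A t h g () | []
  ... | [] ∷ os = average-tail-cong (probHam n K A t h g) _ (offerStep A t h g) os (λ { [] → refl ;
      (e ∷ es) → refl })
  ... | (e ∷ es) ∷ os = average-tail-cong (probHam n K A t (h ++ ((e ∷ es) ∷ [])) (lookup (e ∷ es)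
      (A h e es) ∷ g)) _ (offerStep A t h g) os (λ { [] → refl ; (e ∷ es) → refl })

  probHam-stuck : ∀ A t h g → length (offers g) ≡ 0 → probHam n K A (suc t) h g ≡ probHam n K A t h g
  probHam-stuck A t h g p with subsets K (nonEdges g)
  ... | [] = refl

  success : Graph n → ℚ
  success g = if Hamiltonian g then 1ℚ else 0ℚ

  success≥0 : ∀ g → 0ℚ ≤ success g
  success≥0 g with Hamiltonian g
  ... | true = 0≤1
  ... | false = QP.≤-refl

  probHam≥0 : ∀ A t h g → 0ℚ ≤ probHam n K A t h g
  probHam≥0 A zero h g = success≥0 g
  probHam≥0 A (suc t) h g with length (offers g) in e
  ... | zero = subst (0ℚ ≤_) (sym (probHam-stuck A t h g e)) (probHam≥0 A t h g)
  ... | suc l = subst (0ℚ ≤_) (sym (probHam-suc A t h g (subst (0 ℕ.<_) (sym e) (s≤s z≤n)))) (subst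
      (0ℚ ≤_) (sym (average-∑ _ (offers g))) (*≥0 (∑≥0 (offers g) each) (recip≥0 _)))
    where
    each : ∀ o → 0ℚ ≤ offerStep A t h g o
    each [] = probHam≥0 A t h g
    each (x ∷ es) = probHam≥0 A t _ _

  pick : (Edge n → ℚ) → List (Edge n) → ℚ
  pick f [] = 0ℚ
  pick f (e ∷ es) = f (lookup (e ∷ es) (argmax f e es))

  -- The value function of dynamic programming; it sees the graph and the time left, not the
  -- history. With no offers it is 0 rather than the value of the stopped process, which is harmless
  -- in a lower bound.
  V : ℕ → Graph n → ℚ
  V zero g = success g
  V (suc t) g = average (map (pick (λ e → V t (e ∷ g))) (offers g))

  -- An algorithm sees past offers but not its own past choices. As these are determined by the
  -- graph and the time left, the current graph is recovered by making them again.
  replay : ℕ → Graph n → History n → Graph n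
  replay t g [] = g
  replay t g ([] ∷ h) = replay (t ℕ.∸ 1) g h
  replay t g ((e ∷ es) ∷ h) = replay (t ℕ.∸ 1) (lookup (e ∷ es) (argmax (λ x → V (t ℕ.∸ 1)
      (x ∷ g)) e es) ∷ g) h

  optimal : ℕ → Alg n
  optimal T h e es = argmax (λ x → V (T ℕ.∸ length h ℕ.∸ 1) (x ∷ replay T [] h)) e es

  replay-∷ʳ : ∀ t g h e es →
    replay t g (h ++ ((e ∷ es) ∷ [])) ≡ lookup (e ∷ es) (argmax (λ x → V (t ℕ.∸ length h ℕ.∸ 1)
      (x ∷ replay t g h)) e es) ∷ replay t g h
  replay-∷ʳ t g [] e es = refl
  replay-∷ʳ t g ([] ∷ h) e es = trans (replay-∷ʳ (t ℕ.∸ 1) g h e es) (cong (λ k → lookup (e ∷ es)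
      (argmax (λ x → V (k ℕ.∸ 1) (x ∷ replay (t ℕ.∸ 1) g h)) e es) ∷ replay (t ℕ.∸ 1) g h)
      (ℕP.∸-+-assoc t 1 (length h)))
  replay-∷ʳ t g ((e′ ∷ es′) ∷ h) e es = trans (replay-∷ʳ (t ℕ.∸ 1) g′ h e es) (cong (λ k → lookup
      (e ∷ es) (argmax (λ x → V (k ℕ.∸ 1) (x ∷ replay (t ℕ.∸ 1) g′ h)) e es) ∷ replay (t ℕ.∸ 1) g′ h)
      (ℕP.∸-+-assoc t 1 (length h)))
    where
    g′ = lookup (e′ ∷ es′) (argmax (λ x → V (t ℕ.∸ 1) (x ∷ g)) e′ es′) ∷ g

  -- The hypothesis says that no round was skipped, so that `replay` and the recursion consult the
  -- same value function. It would break once offers run out, because the history then stops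
  -- growing, but there `V` is 0.
  V≤optimal : ∀ T t h → T ≡ length h ℕ.+ t →
    V t (replay T [] h) ≤ probHam n K (optimal T) t h (replay T [] h)
  V≤optimal T zero h eq = QP.≤-refl
  V≤optimal T (suc t) h eq with length (offers (replay T [] h)) in e
  ... | zero = ≤-refl′ (trans (average-∑ _ (offers g)) (trans (cong (λ k → ∑ (offers g) w * recip k) e)
      (trans (cong (∑ (offers g) w *_) recip0) (QP.*-zeroʳ (∑ (offers g) w)))))
    ⟫ probHam≥0 (optimal T) (suc t) h g
    where
    g = replay T [] h
    w = pick (λ e → V t (e ∷ g))
  ... | suc l = average-mono _ _ (offers g) each
    ⟫ ≤-refl′ (sym (probHam-suc (optimal T) t h g (subst (0 ℕ.<_) (sym e) (s≤s z≤n))))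
    where
    g = replay T [] h
    T∸ : T ℕ.∸ length h ≡ suc t
    T∸ = trans (cong (ℕ._∸ length h) eq) (ℕP.m+n∸m≡n (length h) (suc t))
    each : ∀ o → pick (λ e → V t (e ∷ g)) o ≤ offerStep (optimal T) t h g o
    each [] = probHam≥0 (optimal T) t h g
    each (x ∷ es) = subst (λ g′ → V t g″ ≤ probHam n K (optimal T) t h′ g′) rep (subst
        (λ g′ → V t g′ ≤ probHam n K (optimal T) t h′ (replay T [] h′)) (trans rep (cong (λ k → lookup
        (x ∷ es) (argmax (λ y → V (k ℕ.∸ 1) (y ∷ g)) x es) ∷ g) T∸)) (V≤optimal T t h′ (trans eq (trans
        (ℕP.+-suc (length h) t) (cong (ℕ._+ t) (sym (trans (LP.length-++ h) (ℕP.+-comm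
        (length h) 1))))))))
      where
      h′ = h ++ ((x ∷ es) ∷ [])
      g″ = lookup (x ∷ es) (argmax (λ y → V t (y ∷ g)) x es) ∷ g
      rep : replay T [] h′ ≡ lookup (x ∷ es) (argmax (λ y → V (T ℕ.∸ length h ℕ.∸ 1) (y ∷ g)) x es) ∷ g
      rep = replay-∷ʳ T [] h x es

  -- From g, some strategy fails to be Hamiltonian after t rounds with probability at most b.
  Fail≤ : ℕ → Graph n → ℚ → Set
  Fail≤ t g b = 1ℚ - b ≤ V t g

  Fail≤-weaken : ∀ {t g b c} → b ≤ c → Fail≤ t g b → Fail≤ t g c
  Fail≤-weaken {t} {g} {b} {c} p h = -≤- {1ℚ} {1ℚ} {c} {b} QP.≤-refl p ⟫ h

  V≥0 : ∀ t g → 0ℚ ≤ V t g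
  V≥0 zero g = success≥0 g
  V≥0 (suc t) g = subst (0ℚ ≤_) (sym (average-∑ _ (offers g))) (*≥0 (∑≥0 (offers g) each) (recip≥0
      (length (offers g))))
    where
    each : ∀ o → 0ℚ ≤ pick (λ e → V t (e ∷ g)) o
    each [] = QP.≤-refl
    each (x ∷ es) = V≥0 t _

  Fail≤-trivial : ∀ {t g b} → 1ℚ ≤ b → Fail≤ t g b
  Fail≤-trivial {t} {g} {b} p = -≤- {1ℚ} {1ℚ} {b} {1ℚ} QP.≤-refl p ⟫ V≥0 t g

  -- This is where the classical existence of boosters is turned into a bound: the comparison of two
  -- rationals is decidable.
  Fail≤-stable : ∀ {t g b} → ¬ ¬ Fail≤ t g b → Fail≤ t g b
  Fail≤-stable {t} {g} {b} h with 1ℚ - b Q.≤? V t g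
  ... | yes p = p
  ... | no p = ⊥-elim (h p)

  -- The supermartingale step. Any edge of the offer may be exhibited, as `V` takes the best one;
  -- only the mean of the resulting bounds matters.
  Fail≤-step : ∀ {t g} (β : List (Edge n) → ℚ) B → 0 ℕ.< length (offers g) →
    (∀ o → o ∈ offers g → Σ (Edge n) λ e → (e ∈ o) × Fail≤ t (e ∷ g) (β o)) →
    ∑ (offers g) β ≤ ι (length (offers g)) * B → Fail≤ (suc t) g B
  Fail≤-step {t} {g} β B p h le = ≤-average _ (offers g) (1ℚ - B) p (≤-refl′ (e₁ (ι (length
      (offers g))) B) ⟫ QP.+-monoʳ-≤ (ι (length (offers g)) * 1ℚ) (neg≤ le) ⟫ ≤-refl′ sum ⟫ ∑-mono∈
      (offers g) each)
    where
    e₁ : ∀ l b → l * (1ℚ - b) ≡ l * 1ℚ - l * b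
    e₁ = solve-∀ ℚring
    neg1 : ∀ x → - x ≡ - 1ℚ * x
    neg1 = solve-∀ ℚring
    sum : ι (length (offers g)) * 1ℚ - ∑ (offers g) β ≡ ∑ (offers g) (λ o → 1ℚ + - 1ℚ * β o)
    sum = sym (trans (∑-+ (offers g) (λ _ → 1ℚ) (λ o → - 1ℚ * β o)) (cong₂ _+_ (∑-const (offers g) 1ℚ)
        (trans (∑-*ˡ (offers g) (- 1ℚ) β) (sym (neg1 (∑ (offers g) β))))))
    each : ∀ o → o ∈ offers g → 1ℚ + - 1ℚ * β o ≤ pick (λ e → V t (e ∷ g)) o
    each o m with h o m
    each (x ∷ es) m | e , e∈ , fl = ≤-refl′ (cong (1ℚ +_) (sym (neg1 (β (x ∷ es)))))
      ⟫ fl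
      ⟫ argmax-max (λ e → V t (e ∷ g)) x es e e∈

-- Consecutive elements of lists

data Consec {A : Set} (x y : A) : List A → Set where
  here : ∀ {zs} → Consec x y (x ∷ y ∷ zs)
  there : ∀ {z zs} → Consec x y zs → Consec x y (z ∷ zs)

Starts Ends : {A : Set} → A → List A → Set
Starts x q = Σ _ λ t → q ≡ x ∷ t
Ends x q = Σ _ λ t → q ≡ t ++ x ∷ []

module _ {A : Set} where

  consec-++ˡ : ∀ {x y : A} {as} bs → Consec x y as → Consec x y (as ++ bs)
  consec-++ˡ bs here = here
  consec-++ˡ bs (there c) = there (consec-++ˡ bs c)

  consec-++ʳ : ∀ {x y : A} as {bs} → Consec x y bs → Consec x y (as ++ bs)
  consec-++ʳ [] c = c
  consec-++ʳ (a ∷ as) c = there (consec-++ʳ as c)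

  consec-mid : ∀ {x y : A} as {bs} → Consec x y (as ++ x ∷ y ∷ bs)
  consec-mid as = consec-++ʳ as here

  consec-split : ∀ {x y : A} as bs → Consec x y (as ++ bs) →
    Consec x y as ⊎ Consec x y bs ⊎ (Ends x as × Starts y bs)
  consec-split [] bs c = inj₂ (inj₁ c)
  consec-split (a ∷ []) (y ∷ bs) here = inj₂ (inj₂ (([] , refl) , (bs , refl)))
  consec-split (a ∷ []) bs (there c) = inj₂ (inj₁ c)
  consec-split (a ∷ a′ ∷ as) bs here = inj₁ here
  consec-split (a ∷ a′ ∷ as) bs (there c) with consec-split (a′ ∷ as) bs c
  ... | inj₁ d = inj₁ (there d)
  ... | inj₂ (inj₁ d) = inj₂ (inj₁ d)
  ... | inj₂ (inj₂ ((t , e) , s)) = inj₂ (inj₂ ((a ∷ t , cong (a ∷_) e) , s))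

  consec-reverse : ∀ {x y : A} {as} → Consec x y as → Consec y x (reverse as)
  consec-reverse {x} {y} {x ∷ y ∷ zs} here = subst (Consec y x) (sym (trans (LP.unfold-reverse x
      (y ∷ zs)) (trans (cong (_++ x ∷ []) (LP.unfold-reverse y zs)) (LP.++-assoc (reverse zs) (y ∷ [])
      (x ∷ []))))) (consec-mid (reverse zs))
  consec-reverse {x} {y} {z ∷ zs} (there c) = subst (Consec y x) (sym (LP.unfold-reverse z zs))
      (consec-++ˡ (z ∷ []) (consec-reverse c))

  consec-reverse⁻ : ∀ {x y : A} as → Consec x y (reverse as) → Consec y x as
  consec-reverse⁻ {x} {y} as c = subst (Consec y x) (LP.reverse-involutive as) (consec-reverse c)

  consec-∈ˡ : ∀ {x y : A} {zs} → Consec x y zs → x ∈ zs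
  consec-∈ˡ here = here refl
  consec-∈ˡ (there c) = there (consec-∈ˡ c)

  consec-∈ʳ : ∀ {x y z : A} {zs} → Consec x y (z ∷ zs) → y ∈ zs
  consec-∈ʳ here = here refl
  consec-∈ʳ {zs = z ∷ zs} (there c) = there (consec-∈ʳ c)

  predecessor-unique : ∀ {u v w : A} {q} → Unique q → Consec u w q → Consec v w q → u ≡ v
  predecessor-unique u here here = refl
  predecessor-unique (_ ∷ u) here (there d) = ⊥-elim (Unique[x∷xs]⇒x∉xs u (consec-∈ʳ d))
  predecessor-unique (_ ∷ u) (there c) here = ⊥-elim (Unique[x∷xs]⇒x∉xs u (consec-∈ʳ c))
  predecessor-unique (_ ∷ u) (there c) (there d) = predecessor-unique u c d

  successor-unique : ∀ {u v w : A} {q} → Unique q → Consec w u q → Consec w v q → u ≡ v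
  successor-unique u here here = refl
  successor-unique u here (there d) = ⊥-elim (Unique[x∷xs]⇒x∉xs u (consec-∈ˡ d))
  successor-unique u (there c) here = ⊥-elim (Unique[x∷xs]⇒x∉xs u (consec-∈ˡ c))
  successor-unique (_ ∷ u) (there c) (there d) = successor-unique u c d

  unique-++ˡ : ∀ (as : List A) {bs} → Unique (as ++ bs) → Unique as
  unique-++ˡ [] u = []
  unique-++ˡ (a ∷ as) (n ∷ u) = All-++ˡ as n ∷ unique-++ˡ as u
    where
    All-++ˡ : ∀ {P : A → Set} as {bs} → All P (as ++ bs) → All P as
    All-++ˡ [] _ = []
    All-++ˡ (a ∷ as) (p ∷ ps) = p ∷ All-++ˡ as ps

  unique-resp-↭ : ∀ {xs ys : List A} → xs ↭ ys → Unique xs → Unique ys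
  unique-resp-↭ Perm.refl u = u
  unique-resp-↭ (prep x p) (a ∷ u) = All-resp-↭ p a ∷ unique-resp-↭ p u
  unique-resp-↭ (swap x y p) ((n ∷ a) ∷ (b ∷ u)) = ((n ∘ sym) ∷ All-resp-↭ p b) ∷
      (All-resp-↭ p a ∷ unique-resp-↭ p u)
  unique-resp-↭ (Perm.trans p q) u = unique-resp-↭ q (unique-resp-↭ p u)

  ∑-↭ : ∀ {xs ys : List A} f → xs ↭ ys → ∑ xs f ≡ ∑ ys f
  ∑-↭ f Perm.refl = refl
  ∑-↭ f (prep x p) = cong (f x +_) (∑-↭ f p)
  ∑-↭ {x ∷ y ∷ xs} {_ ∷ _ ∷ ys} f (swap _ _ p) = trans (cong (λ s → f x + (f y + s)) (∑-↭ f p)) (eq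
      (f x) (f y) (∑ ys f))
    where
    eq : ∀ a b c → a + (b + c) ≡ b + (a + c)
    eq = solve-∀ ℚring
  ∑-↭ f (Perm.trans p q) = trans (∑-↭ f p) (∑-↭ f q)

  ends-exists : ∀ (x : A) xs → Σ A λ u → Ends u (x ∷ xs)
  ends-exists x [] = x , [] , refl
  ends-exists x (y ∷ ys) with ends-exists y ys
  ... | u , t , e = u , x ∷ t , cong (x ∷_) e

  ends-++ : ∀ {l : A} as {bs} → Ends l bs → Ends l (as ++ bs)
  ends-++ as (t , e) = as ++ t , trans (cong (as ++_) e) (sym (LP.++-assoc as t _))

  ends-++⁻ : ∀ {l : A} as {c cs} → Ends l (as ++ c ∷ cs) → Ends l (c ∷ cs)
  ends-++⁻ [] e = e
  ends-++⁻ (a ∷ []) ([] , ())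
  ends-++⁻ (a ∷ a′ ∷ as) ([] , ())
  ends-++⁻ (a ∷ as) (x ∷ t , e) = ends-++⁻ as (t , LP.∷-injectiveʳ e)

  ends-reverse : ∀ {h : A} {q} → Starts h q → Ends h (reverse q)
  ends-reverse {h} (t , refl) = reverse t , LP.unfold-reverse h t

  starts-reverse : ∀ {l : A} {q} → Ends l q → Starts l (reverse q)
  starts-reverse {l} (t , refl) = reverse t , LP.reverse-++ t (l ∷ [])

  starts-++ : ∀ {h : A} {as} bs → Starts h as → Starts h (as ++ bs)
  starts-++ bs (t , refl) = t ++ bs , refl

  ends-unique : ∀ {a b : A} {q} → Ends a q → Ends b q → a ≡ b
  ends-unique (t , e) (t′ , e′) = proj₂ (LP.∷ʳ-injective t t′ (trans (sym e) e′))

  ends-∈ : ∀ {a : A} {q} → Ends a q → a ∈ q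
  ends-∈ (t , refl) = ∈-++⁺ʳ t (here refl)

  starts-ends-same : ∀ {a : A} {q} → Unique q → Starts a q → Ends a q → q ≡ a ∷ []
  starts-ends-same u ([] , refl) e = refl
  starts-ends-same {a} u (x ∷ t , refl) ([] , ())
  starts-ends-same {a} u (x ∷ t , refl) (y ∷ t′ , e) = ⊥-elim (Unique[x∷xs]⇒x∉xs u (subst (a ∈_) (sym
      (LP.∷-injectiveʳ e)) (∈-++⁺ʳ t′ (here refl))))

Near : {A : Set} → A → A → List A → Set
Near x y q = Consec x y q ⊎ Consec y x q

-- Pósa rotations

count : ∀ {n} → (Fin n → Bool) → ℕ
count {n} p = #ᵇ p (allFin n)

ι-count : ∀ {n} (p : Fin n → Bool) → ι (count p) ≡ ∑ᶠ (λ v → ⟦ p v ⟧)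
ι-count {n} p = #ᵇ-∑ p (allFin n)

false≢true : ∀ {b} → b ≡ false → b ≡ true → ⊥
false≢true refl ()

not-true : ∀ {b} → ¬ (b ≡ true) → b ≡ false
not-true {true} h = ⊥-elim (h refl)
not-true {false} h = refl

∨-introˡ : ∀ {a} b → a ≡ true → a ∨ b ≡ true
∨-introˡ b refl = refl

∨-introʳ : ∀ a {b} → b ≡ true → a ∨ b ≡ true
∨-introʳ true h = refl
∨-introʳ false h = h

∨-elim : ∀ a b → a ∨ b ≡ true → (a ≡ true) ⊎ (b ≡ true)
∨-elim true b h = inj₁ refl
∨-elim false b h = inj₂ h

∧-intro : ∀ {a b} → a ≡ true → b ≡ true → a ∧ b ≡ true
∧-intro refl refl = refl

∧-elim : ∀ a b → a ∧ b ≡ true → (a ≡ true) × (b ≡ true)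
∧-elim true b h = refl , h

#ᵇ-insert : ∀ {n} (σ : Fin n → Bool) u xs → σ u ≡ false → u ∈ xs →
  #ᵇ (λ v → not ((v == u) ∨ σ v)) xs ℕ.< #ᵇ (not ∘ σ) xs
#ᵇ-insert {n} σ u (x ∷ xs) σu m = go m
  where
  weak : ∀ xs → #ᵇ (λ v → not ((v == u) ∨ σ v)) xs ℕ.≤ #ᵇ (not ∘ σ) xs
  weak [] = z≤n
  weak (x ∷ xs) with x == u | σ x
  ... | true | true = weak xs
  ... | true | false = ℕP.≤-trans (weak xs) (ℕP.n≤1+n _)
  ... | false | true = weak xs
  ... | false | false = s≤s (weak xs)
  go : u ∈ (x ∷ xs) → #ᵇ (λ v → not ((v == u) ∨ σ v)) (x ∷ xs) ℕ.< #ᵇ (not ∘ σ) (x ∷ xs)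
  go (here refl) rewrite ==-refl u | σu = s≤s (weak xs)
  go (there m) with x == u | σ x
  ... | true | true = #ᵇ-insert σ u xs σu m
  ... | true | false = ℕP.≤-trans (#ᵇ-insert σ u xs σu m) (ℕP.n≤1+n _)
  ... | false | true = #ᵇ-insert σ u xs σu m
  ... | false | false = s≤s (#ᵇ-insert σ u xs σu m)

-- mark σ p w: w is next to σ along p, or the last vertex of p.
mark : ∀ {n} → (Fin n → Bool) → List (Fin n) → Fin n → Bool
mark σ [] w = false
mark σ (x ∷ []) w = w == x
mark σ (x ∷ y ∷ zs) w = ((w == x) ∧ σ y) ∨ (((w == y) ∧ σ x) ∨ mark σ (y ∷ zs) w)

mark-before : ∀ {n} (σ : Fin n → Bool) {a w p} → Consec a w p → σ a ≡ true → mark σ p w ≡ true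
mark-before σ {a} {w} {a ∷ w ∷ zs} here σa = ∨-introʳ ((w == a) ∧ σ w) (∨-introˡ (mark σ (w ∷ zs) w)
    (∧-intro (==-refl w) σa))
mark-before σ {a} {w} {x ∷ y ∷ zs} (there c) σa = ∨-introʳ ((w == x) ∧ σ y) (∨-introʳ ((w == y) ∧ σ x)
    (mark-before σ c σa))

mark-after : ∀ {n} (σ : Fin n → Bool) {a w p} → Consec w a p → σ a ≡ true → mark σ p w ≡ true
mark-after σ {a} {w} {w ∷ a ∷ zs} here σa = ∨-introˡ (((w == a) ∧ σ w) ∨ mark σ (a ∷ zs) w) (∧-intro
    (==-refl w) σa)
mark-after σ {a} {w} {x ∷ y ∷ zs} (there c) σa = ∨-introʳ ((w == x) ∧ σ y) (∨-introʳ ((w == y) ∧ σ x)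
    (mark-after σ c σa))

mark-last : ∀ {n} (σ : Fin n → Bool) as w → mark σ (as ++ w ∷ []) w ≡ true
mark-last σ [] w = ==-refl w
mark-last σ (x ∷ []) w = ∨-introʳ ((w == x) ∧ σ w) (∨-introʳ ((w == w) ∧ σ x) (==-refl w))
mark-last σ (x ∷ y ∷ as) w = ∨-introʳ ((w == x) ∧ σ y) (∨-introʳ ((w == y) ∧ σ x) (mark-last σ
    (y ∷ as) w))

-- A vertex of σ marks at most its two path neighbours, and the last vertex is marked in addition.
-- If the head is in σ, its missing predecessor pays for this, so there is no additive constant
-- beside 2|σ|.
∑-mark : ∀ {n} (σ : Fin n → Bool) x xs →
  ∑ᶠ (λ w → ⟦ mark σ (x ∷ xs) w ⟧) ≤ 1ℚ + (∑ (x ∷ xs) (λ v → ⟦ σ v ⟧) + ∑ (x ∷ xs)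
    (λ v → ⟦ σ v ⟧)) - ⟦ σ x ⟧
∑-mark {n} σ x [] = ≤-refl′ (∑ᶠ-δ₁ x) ⟫ ≤-by ⟦ σ x ⟧ (⟦⟧≥0 (σ x)) (eq ⟦ σ x ⟧)
  where
  eq : ∀ s → 1ℚ + s ≡ 1ℚ + ((s + 0ℚ) + (s + 0ℚ)) - s
  eq = solve-∀ ℚring
∑-mark {n} σ x (y ∷ zs) = ∑-mono (allFin n) each
  ⟫ ≤-refl′ (trans (∑-+ (allFin n) (λ w → ⟦ w == x ⟧ * ⟦ σ y ⟧) (λ w → ⟦ w == y ⟧ * ⟦ σ x ⟧ + ⟦ mark σ
    (y ∷ zs) w ⟧)) (cong₂ _+_ (trans (∑-*ʳ (allFin n) ⟦ σ y ⟧ (λ w → ⟦ w == x ⟧)) (cong (_* ⟦ σ y ⟧)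
    (∑ᶠ-δ₁ x))) (trans (∑-+ (allFin n) (λ w → ⟦ w == y ⟧ * ⟦ σ x ⟧) (λ w → ⟦ mark σ (y ∷ zs) w ⟧)) (cong
    (_+ ∑ᶠ (λ w → ⟦ mark σ (y ∷ zs) w ⟧)) (trans (∑-*ʳ (allFin n) ⟦ σ x ⟧ (λ w → ⟦ w == y ⟧)) (cong
    (_* ⟦ σ x ⟧) (∑ᶠ-δ₁ y)))))))
  ⟫ QP.+-monoʳ-≤ (1ℚ * ⟦ σ y ⟧) (QP.+-monoʳ-≤ (1ℚ * ⟦ σ x ⟧) (∑-mark σ y zs))
  ⟫ ≤-refl′ (eq ⟦ σ x ⟧ ⟦ σ y ⟧ (∑ zs (λ v → ⟦ σ v ⟧)))
  where
  eq : ∀ s r z →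
    1ℚ * r + (1ℚ * s + (1ℚ + ((r + z) + (r + z)) - r)) ≡ 1ℚ + ((s + (r + z)) + (s + (r + z))) - s
  eq = solve-∀ ℚring
  each : ∀ w →
    ⟦ mark σ (x ∷ y ∷ zs) w ⟧ ≤ ⟦ w == x ⟧ * ⟦ σ y ⟧ + (⟦ w == y ⟧ * ⟦ σ x ⟧ + ⟦ mark σ (y ∷ zs) w ⟧)
  each w = ⟦∨⟧≤ ((w == x) ∧ σ y) (((w == y) ∧ σ x) ∨ mark σ (y ∷ zs) w)
    ⟫ QP.+-mono-≤ (≤-refl′ (⟦∧⟧ (w == x) (σ y))) (⟦∨⟧≤ ((w == y) ∧ σ x) (mark σ (y ∷ zs) w)
      ⟫ QP.+-monoˡ-≤ ⟦ mark σ (y ∷ zs) w ⟧ (≤-refl′ (⟦∧⟧ (w == y) (σ x))))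

Expander : ∀ {n} → Graph n → Set
Expander {n} g = ∀ (S R : Fin n → Bool) → (∀ v → S v ≡ true → R v ≡ true) →
    (∀ v w → S v ≡ true → adj g v w ≡ true → R w ≡ true) → (Σ (Fin n) λ v → S v ≡ true) → count R ℕ.≤ 3
    ℕ.* count S → n ℕ.< 2 ℕ.* count R

module _ {n : ℕ} where

  IsPath : Graph n → List (Fin n) → Set
  IsPath g q = ∀ {x y} → Consec x y q → adj g x y ≡ true

  -- The path spans all vertices except those of `r`. Rotations keep the end `l` and move the end
  -- `h`.
  record Spanning (g : Graph n) (r : List (Fin n)) (l h : Fin n) (q : List (Fin n)) : Set where
    constructor spanning
    field
      path : IsPath g q
      covers : q ++ r ↭ allFin n
      first : Starts h q
      last : Ends l q

  open Spanning public

  spanning-unique : ∀ {g r l h q} → Spanning g r l h q → Unique q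
  spanning-unique {q = q} s = unique-++ˡ q (unique-resp-↭ (↭-sym (covers s)) (allFin⁺ n))

  spanning-∈ : ∀ {g r l h q} → Spanning g r l h q → ∀ w → w ∈ q ⊎ w ∈ r
  spanning-∈ {q = q} s w = ∈-++⁻ q (∈-resp-↭ (↭-sym (covers s)) (∈-allFin w))

  spanning-reverse : ∀ {g r l h q} → Spanning g r l h q → Spanning g r h l (reverse q)
  spanning-reverse {g} {r} {q = q} s = spanning (λ {x} {y} c → trans (adj-sym g x y) (path s
      (consec-reverse⁻ q c))) (↭-trans (++⁺ʳ r (↭-reverse q)) (covers s)) (starts-reverse (last s))
      (ends-reverse (first s))

  -- The edge h w replaces the edge u w, where `u` is the predecessor of `w`; so `u` becomes the new
  -- first vertex.
  rotate : ∀ {g r l h xs w ys} → Spanning g r l h (h ∷ xs ++ w ∷ ys) → adj g h w ≡ true → ∀ {u} →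
    Ends u (h ∷ xs) → Spanning g r l u (reverse (h ∷ xs) ++ w ∷ ys)
  rotate {g} {r} {l} {h} {xs} {w} {ys} s a {u} eu = spanning pth (↭-trans (++⁺ʳ r (++⁺ʳ (w ∷ ys)
      (↭-reverse (h ∷ xs)))) (covers s)) (starts-++ (w ∷ ys) (starts-reverse eu)) (ends-++ (reverse
      (h ∷ xs)) (ends-++⁻ (h ∷ xs) (last s)))
    where
    pth : IsPath g (reverse (h ∷ xs) ++ w ∷ ys)
    pth {x} {y} c with consec-split (reverse (h ∷ xs)) (w ∷ ys) c
    ... | inj₁ d = trans (adj-sym g x y) (path s (consec-++ˡ (w ∷ ys) (consec-reverse⁻ (h ∷ xs) d)))
    ... | inj₂ (inj₁ d) = path s (consec-++ʳ (h ∷ xs) d)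
    ... | inj₂ (inj₂ (e , (t , refl))) with ends-unique e (ends-reverse {h = h} {q = h ∷ xs} (xs , refl))
    ... | refl = a

  -- The only adjacency that a rotation destroys is the one between `u` and `w`, and it involves the
  -- new endpoint.
  rotate-near : ∀ {u h x y : Fin n} xs {w ys} → Ends u (h ∷ xs) → x ≢ u → y ≢ u →
    Near x y (h ∷ xs ++ w ∷ ys) → Near x y (reverse (h ∷ xs) ++ w ∷ ys)
  rotate-near {u} {h} xs {w} {ys} eu x≢ y≢ (inj₁ c) with consec-split (h ∷ xs) (w ∷ ys) c
  ... | inj₁ d = inj₂ (consec-++ˡ (w ∷ ys) (consec-reverse d))
  ... | inj₂ (inj₁ d) = inj₁ (consec-++ʳ (reverse (h ∷ xs)) d)
  ... | inj₂ (inj₂ (e , _)) = ⊥-elim (x≢ (ends-unique e eu))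
  rotate-near {u} {h} xs {w} {ys} eu x≢ y≢ (inj₂ c) with consec-split (h ∷ xs) (w ∷ ys) c
  ... | inj₁ d = inj₁ (consec-++ˡ (w ∷ ys) (consec-reverse d))
  ... | inj₂ (inj₁ d) = inj₂ (consec-++ʳ (reverse (h ∷ xs)) d)
  ... | inj₂ (inj₂ (e , _)) = ⊥-elim (y≢ (ends-unique e eu))

  module Rotations (g : Graph n) (r : List (Fin n)) (l h₀ : Fin n) (p₀ : List (Fin n))
      (start : Spanning g r l h₀ p₀) where

    -- The second component is the invariant of Pósa's argument: a rotation breaks an edge at a new
    -- endpoint only, so edges of `p₀` with both ends outside σ survive up to orientation.
    Reached : (Fin n → Bool) → Fin n → Set
    Reached σ v = Σ (List (Fin n)) λ q → Spanning g r l v q × (∀ {x y} → Consec x y p₀ → σ x ≡ false → σ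
        y ≡ false → Near x y q)

    Closed : (Fin n → Bool) → Set
    Closed σ = ∀ {v q} → σ v ≡ true → Spanning g r l v q → (∀ {x y} → Consec x y p₀ → σ x ≡ false → σ y ≡
        false → Near x y q) → ∀ xs w ys {u} → q ≡ v ∷ xs ++ w ∷ ys → adj g v w ≡ true → Ends u
        (v ∷ xs) → σ u ≡ true

    -- Closedness quantifies over paths and is not decided. The continuation receives the present
    -- set as if it were closed; when it uses closedness at a missing endpoint `u`, that use is
    -- refuted by restarting with `u` added. The complement of σ shrinks with each restart.
    closure : ∀ fuel σ → count (not ∘ σ) ℕ.≤ fuel → σ h₀ ≡ true → (∀ v → σ v ≡ true → Reached σ v) →
      (∀ σ → σ h₀ ≡ true → (∀ v → σ v ≡ true → Reached σ v) → Closed σ → ⊥) → ⊥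
    closure fuel σ le σh reach k = k σ σh reach closed
      where
      add : ∀ {u} q → σ u ≡ false → Spanning g r l u q →
        (∀ {x y} → Consec x y p₀ → x ≢ u → y ≢ u → σ x ≡ false → σ y ≡ false → Near x y q) → ⊥
      add {u} q σu sp near = go fuel le
        where
        σ′ : Fin n → Bool
        σ′ v = (v == u) ∨ σ v
        old : ∀ v → σ′ v ≡ false → σ v ≡ false
        old v e with v == u
        ... | false = e
        ne : ∀ v → σ′ v ≡ false → v ≢ u
        ne v e refl rewrite ==-refl u with e
        ... | ()
        reach′ : ∀ v → σ′ v ≡ true → Reached σ′ v
        reach′ v e with ∨-elim (v == u) (σ v) e
        ... | inj₂ e₂ with reach v e₂
        ... | q′ , s′ , nr = q′ , s′ , λ c a b → nr c (old _ a) (old _ b)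
        reach′ v e | inj₁ e₁ with ==-true v u e₁
        ... | refl = q , sp , λ c a b → near c (ne _ a) (ne _ b) (old _ a) (old _ b)
        less : count (not ∘ σ′) ℕ.< count (not ∘ σ)
        less = #ᵇ-insert σ u (allFin n) σu (∈-allFin u)
        go : ∀ fuel → count (not ∘ σ) ℕ.≤ fuel → ⊥
        go zero le with ℕP.≤-trans less le
        ... | ()
        go (suc fuel) le = closure fuel σ′ (ℕP.≤-pred (ℕP.≤-trans less le)) (∨-introʳ
            (h₀ == u) σh) reach′ k
      closed : Closed σ
      closed {v} {q} σv s nr xs w ys {u} refl a eu with σ u in σu
      ... | true = refl
      ... | false = ⊥-elim (add _ σu (rotate {xs = xs} s a eu) (λ c x≢ y≢ σx σy → rotate-near xs eu x≢ y≢
          (nr c σx σy)))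

    -- A neighbour w of an endpoint whose p₀-neighbours are not endpoints keeps both of them
    -- in the rotated path, so its predecessor there, which is a new endpoint, is one of them.
    neighbours-marked : (∀ {v q} → Spanning g r l v q → ∀ w → w ∈ r → adj g v w ≡ false) → ∀ σ →
      σ h₀ ≡ true → (∀ v → σ v ≡ true → Reached σ v) → Closed σ → ∀ v w → σ v ≡ true →
      adj g v w ≡ true → σ w ∨ mark σ p₀ w ≡ true
    neighbours-marked max σ σh reach closed v w σv a with reach v σv
    ... | q , s , nr with σ w in σw | mark σ p₀ w in mw
    ... | true | _ = refl
    ... | false | true = refl
    ... | false | false with spanning-∈ start w | spanning-∈ s w
    ... | inj₂ w∈r | _ = ⊥-elim (false≢true (max s w w∈r) a)
    ... | inj₁ _ | inj₂ w∈r = ⊥-elim (false≢true (max s w w∈r) a)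
    ... | inj₁ w∈p | inj₁ w∈q with first s
    ... | t , refl = ⊥-elim (contra w∈q)
      where
      contra : w ∈ (v ∷ t) → ⊥
      contra (here refl) = false≢true σw σv
      contra (there w∈t) with ∈-∃++ w∈t | ∈-∃++ w∈p
      ... | xs , ys , refl | as , bs , e with ends-exists v xs
      ... | u , eu = finish as bs e
        where
        σu : σ u ≡ true
        σu = closed σv s nr xs w ys refl a eu
        cu : Consec u w (v ∷ xs ++ w ∷ ys)
        cu = subst (Consec u w) (trans (sym (LP.++-assoc (proj₁ eu) (u ∷ []) (w ∷ ys))) (cong
            (_++ w ∷ ys) (sym (proj₂ eu)))) (consec-mid (proj₁ eu))
        uq : Unique (v ∷ xs ++ w ∷ ys)
        uq = spanning-unique s
        inner : ∀ x y → Consec x w p₀ → Consec w y p₀ → ⊥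
        inner x y cx cy = cases (nr cx σx σw) (nr cy σw σy)
          where
          σx : σ x ≡ false
          σx = not-true (λ h → false≢true mw (mark-before σ cx h))
          σy : σ y ≡ false
          σy = not-true (λ h → false≢true mw (mark-after σ cy h))
          distinct : ∀ {x p} → Unique p → Consec x w p → Consec w x p → ⊥
          distinct u here (there d) = Unique[x∷xs]⇒x∉xs u (there (consec-∈ʳ d))
          distinct u (there c) here = Unique[x∷xs]⇒x∉xs u (there (consec-∈ʳ c))
          distinct (_ ∷ u) (there c) (there d) = distinct u c d
          distinct {x} ((ne ∷ _) ∷ _) here here = ne refl
          cases : Near x w (v ∷ xs ++ w ∷ ys) → Near w y (v ∷ xs ++ w ∷ ys) → ⊥
          cases (inj₁ c) _ with predecessor-unique uq c cu
          ... | refl = false≢true σx σu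
          cases (inj₂ _) (inj₂ d) with predecessor-unique uq d cu
          ... | refl = false≢true σy σu
          -- Both `x` and `y` would be the successor of `w` in the rotated path, so a single vertex
          -- would stand on both sides of `w` in `p₀`.
          cases (inj₂ c) (inj₁ d) with successor-unique uq c d
          ... | refl = distinct (spanning-unique start) cx cy
        finish : ∀ as bs → p₀ ≡ as ++ w ∷ bs → ⊥
        finish as [] e = false≢true mw (subst (λ p → mark σ p w ≡ true) (sym e) (mark-last σ as w))
        finish [] (b ∷ bs) e with trans (sym e) (proj₂ (first start))
        ... | refl = false≢true σw σh
        finish (a₀ ∷ as) (b ∷ bs) e with ends-exists a₀ as
        ... | x , t , e′ = inner x b (subst (Consec x w) (sym (trans e (trans (cong (_++ w ∷ b ∷ bs) e′)
            (LP.++-assoc t (x ∷ []) (w ∷ b ∷ bs))))) (consec-mid t)) (subst (Consec w b) (sym e)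
            (consec-mid (a₀ ∷ as)))

    -- The set R of endpoints and marked vertices contains the closed neighbourhood of σ and has at
    -- most 3|σ| elements, so expansion gives n < 2|R| ≤ 6|σ|.
    many-endpoints : Expander g → (∀ {v q} → Spanning g r l v q → ∀ w → w ∈ r → adj g v w ≡ false) →
      (∀ σ → (∀ v → σ v ≡ true → Σ (List (Fin n)) (Spanning g r l v)) → n ℕ.< 6 ℕ.* count σ → ⊥) → ⊥
    many-endpoints ex max k = closure (count (not ∘ σ₀)) σ₀ ℕP.≤-refl (==-refl h₀) reach₀ done
      where
      σ₀ : Fin n → Bool
      σ₀ v = v == h₀
      reach₀ : ∀ v → σ₀ v ≡ true → Reached σ₀ v
      reach₀ v e with ==-true v h₀ e
      ... | refl = p₀ , start , λ c _ _ → inj₁ c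
      done : ∀ σ → σ h₀ ≡ true → (∀ v → σ v ≡ true → Reached σ v) → Closed σ → ⊥
      done σ σh reach closed = k σ (λ v e → proj₁ (reach v e) , proj₁ (proj₂ (reach v e))) (ℕP.<-≤-trans
          (ex σ R (λ v e → ∨-introˡ (mark σ p₀ v) e) (neighbours-marked max σ σh reach closed)
          (h₀ , σh) R≤) (subst (2 ℕ.* count R ℕ.≤_) (sym (ℕP.*-assoc 2 3 (count σ)))
          (ℕP.*-monoʳ-≤ 2 R≤)))
        where
        R : Fin n → Bool
        R w = σ w ∨ mark σ p₀ w
        ∑σ = ∑ᶠ (λ v → ⟦ σ v ⟧)
        on-p₀ : ∑ p₀ (λ v → ⟦ σ v ⟧) ≤ ∑σ
        on-p₀ = a≤a+b (∑≥0 r (λ v → ⟦⟧≥0 (σ v)))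
          ⟫ ≤-refl′ (trans (sym (∑-++ p₀ r (λ v → ⟦ σ v ⟧))) (∑-↭ (λ v → ⟦ σ v ⟧) (covers start)))
        marks : ∑ᶠ (λ w → ⟦ mark σ p₀ w ⟧) ≤ ∑σ + ∑σ
        marks with first start
        ... | t , refl = ∑-mark σ h₀ t
          ⟫ ≤-refl′ (trans (cong (λ b → 1ℚ + (X + X) - ⟦ b ⟧) σh) (eq X))
          ⟫ QP.+-mono-≤ on-p₀ on-p₀
          where
          X = ∑ (h₀ ∷ t) (λ v → ⟦ σ v ⟧)
          eq : ∀ x → 1ℚ + (x + x) - 1ℚ ≡ x + x
          eq = solve-∀ ℚring
        three : ∀ x → x + (x + x) ≡ ι 3 * x
        three x = trans (eq x) (cong (_* x) (sym (ι-def 3)))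
          where
          eq : ∀ x → x + (x + x) ≡ fromℕℚ 3 * x
          eq = solve-∀ ℚring
        R≤ : count R ℕ.≤ 3 ℕ.* count σ
        R≤ = ι-cancel≤ (≤-refl′ (ι-count R) ⟫ ∑-mono (allFin n) (λ w → ⟦∨⟧≤ (σ w) (mark σ p₀ w))
            ⟫ ≤-refl′ (∑-+ (allFin n) (λ w → ⟦ σ w ⟧) (λ w → ⟦ mark σ p₀ w ⟧)) ⟫ QP.+-monoʳ-≤ ∑σ marks
            ⟫ ≤-refl′ (trans (three ∑σ) (trans (cong (ι 3 *_) (sym (ι-count σ))) (sym (ι-* 3
            (count σ))))))

-- Boosters

any-true : ∀ {A : Set} (p : A → Bool) {xs x} → x ∈ xs → p x ≡ true → any p xs ≡ true
any-true p {y ∷ xs} (here refl) h = ∨-introˡ (any p xs) h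
any-true p {y ∷ xs} (there m) h = ∨-introʳ (p y) (any-true p m h)

any-witness : ∀ {A : Set} (p : A → Bool) xs → any p xs ≡ true → Σ A λ x → (x ∈ xs) × (p x ≡ true)
any-witness p (x ∷ xs) h with ∨-elim (p x) (any p xs) h
... | inj₁ e = x , here refl , e
... | inj₂ e with any-witness p xs e
... | y , m , e′ = y , there m , e′

∈-insertions : ∀ {A : Set} {x : A} a b → (a ++ x ∷ b) ∈ insertions x (a ++ b)
∈-insertions [] [] = here refl
∈-insertions [] (y ∷ b) = here refl
∈-insertions (y ∷ a) b = there (∈-map⁺ (y ∷_) (∈-insertions a b))

∈-perms : ∀ {A : Set} (xs : List A) {p} → p ↭ xs → p ∈ perms xs
∈-perms [] pm with ↭-empty-inv pm
... | refl = here refl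
∈-perms (x ∷ xs) pm with ∈-∃++ (∈-resp-↭ (↭-sym pm) (here refl))
... | a , b , refl = ∈-concatMap⁺ (insertions x) (Any.map (λ { refl → ∈-insertions a b }) (∈-perms xs
    (drop-mid a [] pm)))

pathOK-∷ : ∀ {n} (g : Graph n) e v vs → pathOK g v vs ≡ true → pathOK (e ∷ g) v vs ≡ true
pathOK-∷ g e v [] h = refl
pathOK-∷ g e v (w ∷ ws) h with ∧-elim (adj g v w) (pathOK g w ws) h
... | a , b = ∧-intro (adj-∷ g e v w a) (pathOK-∷ g e w ws b)

hamiltonian-∷ : ∀ {n} (g : Graph n) e → Hamiltonian g ≡ true → Hamiltonian (e ∷ g) ≡ true
hamiltonian-∷ {n} g e h with ∧-elim (3 ℕ.≤ᵇ n) (any (cycleOK g) (perms (allFin n))) h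
... | a , b with any-witness (cycleOK g) (perms (allFin n)) b
... | v ∷ vs , m , ok with ∧-elim (pathOK g v vs) (adj g (lastOf v vs) v) ok
... | c , d = ∧-intro a (any-true (cycleOK (e ∷ g)) m (∧-intro (pathOK-∷ g e v vs c) (adj-∷ g e
    (lastOf v vs) v d)))

ends-lastOf : ∀ {A : Set} (w : A) t → Ends (lastOf w t) (w ∷ t)
ends-lastOf w [] = [] , refl
ends-lastOf w (x ∷ t) with ends-lastOf x t
... | s , e = w ∷ s , cong (w ∷_) e

-- Double-negation shift for a finite quantifier; it selects the sets of second endpoints for all
-- first endpoints simultaneously.
¬¬-∀Fin : ∀ {n} {P : Fin n → Set} → (∀ v → ¬ ¬ P v) → ¬ ¬ (∀ v → P v)
¬¬-∀Fin {zero} h k = k (λ ())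
¬¬-∀Fin {suc n} {P} h k = h zero (λ p₀ → ¬¬-∀Fin {n} {P ∘ suc} (h ∘ suc) (λ ps → k (λ { zero → p₀ ;
    (suc i) → ps i })))

member : ∀ {n} → List (Fin n) → Fin n → Bool
member q w = any (w ==_) q

member-∈ : ∀ {n} (q : List (Fin n)) w → member q w ≡ true → w ∈ q
member-∈ q w h with any-witness (w ==_) q h
... | x , m , e with ==-true w x e
... | refl = m

∈-member : ∀ {n} {q : List (Fin n)} {w} → w ∈ q → member q w ≡ true
∈-member {w = w} m = any-true (w ==_) m (==-refl w)

count-member : ∀ {n} (q : List (Fin n)) → count (member q) ℕ.≤ length q
count-member {n} q = ι-cancel≤ (≤-refl′ (ι-count (member q)) ⟫ go q)
  where
  go : ∀ q → ∑ᶠ (λ w → ⟦ member q w ⟧) ≤ ι (length q)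
  go [] = ≤-refl′ (trans (∑-0 (allFin n)) (sym (ι-def 0)))
  go (x ∷ q) = ∑-mono (allFin n) (λ w → ⟦∨⟧≤ (w == x) (member q w))
    ⟫ ≤-refl′ (∑-+ (allFin n) (λ w → ⟦ w == x ⟧) (λ w → ⟦ member q w ⟧))
    ⟫ QP.+-mono-≤ (≤-refl′ (∑ᶠ-δ₁ x)) (go q)
    ⟫ ≤-refl′ (sym (ι-suc (length q)))

module _ {n : ℕ} where

  PathIn : Graph n → ℕ → Set
  PathIn g k = Σ (List (Fin n)) λ r → Σ (Fin n) λ l → Σ (Fin n) λ h → Σ (List
      (Fin n)) λ q → Spanning g r l h q × (length r ≡ k)

  -- Good g 0 is the goal; Good g (suc k) leaves k vertices outside a path.
  Good : Graph n → ℕ → Set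
  Good g zero = Hamiltonian g ≡ true
  Good g (suc k) = PathIn g k

  spanning-∷ : ∀ {g : Graph n} {r l h q} e → Spanning g r l h q → Spanning (e ∷ g) r l h q
  spanning-∷ {g} e s = spanning (λ {x} {y} c → adj-∷ g e x y (path s c)) (covers s) (first s) (last s)

  good-∷ : ∀ {g} e k → Good g k → Good (e ∷ g) k
  good-∷ {g} e zero h = hamiltonian-∷ g e h
  good-∷ {g} e (suc k) (r , l , h , q , s , eq) = r , l , h , q , spanning-∷ e s , eq

  expander-∷ : ∀ {g : Graph n} e → Expander g → Expander (e ∷ g)
  expander-∷ {g} e ex S R S⊆R N = ex S R S⊆R (λ v w Sv a → N v w Sv (adj-∷ g e v w a))

  insert-outside : ∀ {q r₁ r₂ : List (Fin n)} {y} → q ++ (r₁ ++ y ∷ r₂) ↭ allFin n →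
    (y ∷ q) ++ (r₁ ++ r₂) ↭ allFin n
  insert-outside {q} {r₁} {r₂} {y} p = ↭-trans (↭-sym (shift y q (r₁ ++ r₂))) (↭-trans (++⁺ˡ q (↭-sym
      (shift y r₁ r₂))) p)

  good-suc : ∀ {g : Graph n} r₁ y r₂ {l h q} → Spanning g (r₁ ++ r₂) l h q →
    Good g (length (r₁ ++ y ∷ r₂))
  good-suc {g} r₁ y r₂ s = subst (Good g) (sym (trans (LP.length-++ r₁) (trans (ℕP.+-suc (length r₁)
      (length r₂)) (cong suc (sym (LP.length-++ r₁)))))) (r₁ ++ r₂ , _ , _ , _ , s , refl)

  extend : ∀ {g r l v q} → Spanning g r l v q → ∀ w → w ∈ r → adj g v w ≡ true → Good g (length r)
  extend {g} {r} {l} {v} {q} s w w∈ a with ∈-∃++ w∈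
  ... | r₁ , r₂ , refl = good-suc r₁ w r₂ {l} {w} {w ∷ q} (spanning pth (insert-outside {q} {r₁} {r₂}
      (covers s)) (q , refl) (w ∷ proj₁ (last s) , cong (w ∷_) (proj₂ (last s))))
    where
    pth : IsPath g (w ∷ q)
    pth {x} {y} c with first s
    pth {x} {y} here | t , refl = trans (adj-sym g w v) a
    pth {x} {y} (there c) | t , e = path s c

  -- The edge v w closes the path to a cycle, which is reopened just before `z` so that the outside
  -- vertex `y` can be attached there.
  cycle-extend : ∀ {g r v w q} → Spanning g r v w q → adj g v w ≡ true → ∀ z y → z ∈ q → y ∈ r →
    adj g z y ≡ true → Good g (length r)
  cycle-extend {g} {r} {v} {w} s a z y z∈ y∈ zy with ∈-∃++ z∈ | ∈-∃++ y∈
  ... | xs , ys , refl | r₁ , r₂ , refl with ends-exists y (z ∷ ys ++ xs)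
  ... | l′ , el = good-suc r₁ y r₂ {l′} {y} {y ∷ z ∷ ys ++ xs} (spanning pth
      (insert-outside {z ∷ ys ++ xs} {r₁} {r₂} (↭-trans (++⁺ʳ (r₁ ++ y ∷ r₂) (++-comm (z ∷ ys) xs))
      (covers s))) (_ , refl) el)
    where
    pth : IsPath g (y ∷ z ∷ ys ++ xs)
    pth here = trans (adj-sym g y z) zy
    pth (there c) with consec-split (z ∷ ys) xs c
    ... | inj₁ d = path s (consec-++ʳ xs d)
    ... | inj₂ (inj₁ d) = path s (consec-++ˡ (z ∷ ys) d)
    ... | inj₂ (inj₂ (e , (t , refl))) with ends-unique e (ends-++⁻ xs (last s)) | first s
    ... | refl | _ , refl = a

  cycle-hamiltonian : ∀ {g v w q} → 3 ℕ.≤ n → Spanning g [] v w q → adj g v w ≡ true →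
    Hamiltonian g ≡ true
  cycle-hamiltonian {g} {v} {w} {q} n≥3 s a with first s
  ... | t , refl = ∧-intro (T⇒≡true (ℕP.≤⇒≤ᵇ n≥3)) (any-true (cycleOK g) (∈-perms (allFin n) (subst
      (_↭ allFin n) (LP.++-identityʳ (w ∷ t)) (covers s))) (∧-intro (ok w t (path s)) (subst
      (λ x → adj g x w ≡ true) (ends-unique (last s) (ends-lastOf w t)) a)))
    where
    T⇒≡true : ∀ {b} → IsTrue b → b ≡ true
    T⇒≡true {true} _ = refl
    ok : ∀ w t → IsPath g (w ∷ t) → pathOK g w t ≡ true
    ok w [] p = refl
    ok w (x ∷ t) p = ∧-intro (p here) (ok x t (λ c → p (there c)))

  length-spanning : ∀ {g : Graph n} {r l h q} → Spanning g r l h q → length q ℕ.+ length r ≡ n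
  length-spanning {q = q} s = trans (sym (LP.length-++ q)) (trans (↭-length (covers s))
      (LP.length-tabulate {n = n} id))

  -- Connectivity in disguise: if no edge left a cycle that misses vertices, the cycle and its
  -- complement would both be closed under adjacency, and expansion would give each of them more
  -- than n/2 vertices.
  close-cycle : ∀ {g r v w q} → 3 ℕ.≤ n → Expander g → Spanning g r v w q → adj g v w ≡ true →
    ¬ ¬ Good g (length r)
  close-cycle {g} {[]} n≥3 ex s a k = k (cycle-hamiltonian n≥3 s a)
  close-cycle {g} {y₀ ∷ r} {v} {w} {q} n≥3 ex s a k = ℕP.<-irrefl refl (ℕP.<-≤-trans (ℕP.+-mono-<-≤
      (ℕP.n<1+n n) (ℕP.n≤1+n n)) (ℕP.≤-trans (ℕP.+-mono-≤ big-q big-r) (ℕP.≤-reflexive (trans (eq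
      (length q) (length (y₀ ∷ r))) (cong₂ ℕ._+_ (length-spanning s) (length-spanning s))))))
    where
    eq : ∀ a b → 2 ℕ.* a ℕ.+ 2 ℕ.* b ≡ (a ℕ.+ b) ℕ.+ (a ℕ.+ b)
    eq = NS.solve-∀
    no-edge : ∀ z y → z ∈ q → y ∈ (y₀ ∷ r) → ¬ (adj g z y ≡ true)
    no-edge z y z∈ y∈ h = k (cycle-extend s a z y z∈ y∈ h)
    big : ∀ (p o : List (Fin n)) x → x ∈ p → (∀ w → w ∈ p ⊎ w ∈ o) →
      (∀ z y → z ∈ p → y ∈ o → ¬ (adj g z y ≡ true)) → n ℕ.< 2 ℕ.* length p
    big p o x x∈ cover sep = ℕP.<-≤-trans (ex (member p) (member p) (λ _ h → h) nbr (x , ∈-member x∈)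
        (ℕP.m≤n*m (count (member p)) 3)) (ℕP.*-monoʳ-≤ 2 (count-member p))
      where
      nbr : ∀ v w → member p v ≡ true → adj g v w ≡ true → member p w ≡ true
      nbr v w h a with cover w
      ... | inj₁ w∈ = ∈-member w∈
      ... | inj₂ w∈ = ⊥-elim (sep v w (member-∈ p v h) w∈ a)
    swp : ∀ {A B : Set} → A ⊎ B → B ⊎ A
    swp (inj₁ x) = inj₂ x
    swp (inj₂ x) = inj₁ x
    big-q = big q (y₀ ∷ r) v (ends-∈ (last s)) (spanning-∈ s) no-edge
    big-r = big (y₀ ∷ r) q y₀ (here refl) (λ w → swp (spanning-∈ s w))
        (λ z y z∈ y∈ h → no-edge y z y∈ z∈ (trans (adj-sym g y z) h))

  -- Rotations with `l` fixed give more than n/6 endpoints v; reversing the path and rotating with v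
  -- fixed gives more than n/6 partners w for each. As `Good g k` fails, no such path can be
  -- extended or is already closed, so the ordered pairs (v , w) are non-edges.
  boosters : ∀ {g : Graph n} {k} → 3 ℕ.≤ n → Expander g → PathIn g k → ¬ Good g k →
    (∀ (β : Fin n → Fin n → Bool) → (∀ v w → β v w ≡ true → (nonadj g v w ≡ true) × (∀ e → adj
      (e ∷ g) v w ≡ true → ¬ ¬ Good (e ∷ g) k)) → ι n * ι n ≤ ι 36 * (∑ᶠ λ v → ∑ᶠ λ w → ⟦ β v w ⟧) → ⊥) →
    ⊥
  boosters {g} n≥3 ex (r , l , h , q , s , refl) bad cont = Rotations.many-endpoints g r l h q s ex
      maximal (λ σ reach big → ¬¬-∀Fin (second σ reach) (finish σ big))
    where
    maximal : ∀ {l v q} → Spanning g r l v q → ∀ w → w ∈ r → adj g v w ≡ false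
    maximal s w w∈ = not-true (λ a → bad (extend s w w∈ a))
    Second : (Fin n → Bool) → Fin n → Set
    Second σ v = Σ (Fin n → Bool) λ τ → σ v ≡ true → (∀ w → τ w ≡ true → Σ (List (Fin n))
        (Spanning g r v w)) × (n ℕ.< 6 ℕ.* count τ)
    second : ∀ σ → (∀ v → σ v ≡ true → Σ (List (Fin n)) (Spanning g r l v)) → ∀ v → ¬ ¬ Second σ v
    second σ reach v k with σ v in σv
    ... | false = k ((λ _ → true) , λ ())
    ... | true with reach v σv
    ... | p , sp = Rotations.many-endpoints g r v l (reverse p) (spanning-reverse sp) ex maximal
        (λ τ reach₂ big → k (τ , λ _ → reach₂ , big))
    -- Pairs with v = w have to be excluded. They come from a one-vertex path, whose vertex would
    -- have no neighbour; as n ≥ 3 this contradicts expansion.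
    lone : ∀ {w p} → Spanning g r w w p → ⊥
    lone {w} {p} sp with starts-ends-same (spanning-unique sp) (first sp) (last sp)
    ... | refl = ℕP.<-irrefl refl (ℕP.<-≤-trans (ex only only (λ _ e → e) nbr (w , ==-refl w) (ℕP.m≤n*m
        (count only) 3)) (ℕP.≤-trans (ℕP.≤-reflexive (cong (2 ℕ.*_) one)) (ℕP.≤-trans (ℕP.n≤1+n 2) n≥3)))
      where
      only : Fin n → Bool
      only v = v == w
      one : count only ≡ 1
      one = ℕP.≤-antisym (ι-cancel≤ (≤-refl′ e)) (ι-cancel≤ (≤-refl′ (sym e)))
        where
        e : ι (count only) ≡ ι 1
        e = trans (ι-count only) (trans (∑ᶠ-δ₁ w) (sym (ι-def 1)))
      nbr : ∀ v x → only v ≡ true → adj g v x ≡ true → only x ≡ true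
      nbr v x e a with ==-true v w e | spanning-∈ sp x
      ... | refl | inj₁ (here refl) = ==-refl w
      ... | refl | inj₂ x∈ = ⊥-elim (false≢true (maximal sp x x∈) a)
    finish : ∀ σ → n ℕ.< 6 ℕ.* count σ → ¬ (∀ v → Second σ v)
    finish σ big sec = cont β props total
      where
      β : Fin n → Fin n → Bool
      β v w = σ v ∧ proj₁ (sec v) w
      props : ∀ v w → β v w ≡ true →
        (nonadj g v w ≡ true) × (∀ e → adj (e ∷ g) v w ≡ true → ¬ ¬ Good (e ∷ g) (length r))
      props v w b with ∧-elim (σ v) (proj₁ (sec v) w) b
      ... | σv , τw with proj₁ (proj₂ (sec v) σv) w τw
      ... | p , sp = ∧-intro (cong not v≠w) (cong not (not-true
          (λ a → close-cycle n≥3 ex sp a bad))) , λ e a → close-cycle n≥3 (expander-∷ {g} e ex)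
          (spanning-∷ e sp) a
        where
        v≠w : (v == w) ≡ false
        v≠w = not-true λ e → lone (subst (λ x → Spanning g r x w p) (==-true v w e) sp)
      row : ∀ v → ⟦ σ v ⟧ * ι n ≤ ι 6 * ∑ᶠ (λ w → ⟦ β v w ⟧)
      row v with σ v in σv
      ... | false = ≤-refl′ (trans (QP.*-zeroˡ (ι n)) (sym (trans (cong (ι 6 *_) (∑-0 (allFin n)))
          (QP.*-zeroʳ (ι 6)))))
      ... | true = ≤-refl′ (QP.*-identityˡ (ι n))
        ⟫ ι-mono (ℕP.<⇒≤ (proj₂ (proj₂ (sec v) σv)))
        ⟫ ≤-refl′ (trans (ι-* 6 (count (proj₁ (sec v)))) (cong (ι 6 *_) (ι-count (proj₁ (sec v)))))
      e36 : ∀ x → ι 6 * (ι 6 * x) ≡ ι 36 * x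
      e36 x = trans (sym (QP.*-assoc (ι 6) (ι 6) x)) (cong (_* x) (sym (ι-* 6 6)))
      total : ι n * ι n ≤ ι 36 * (∑ᶠ λ v → ∑ᶠ λ w → ⟦ β v w ⟧)
      total = *≤*ʳ (ι≥0 n) (ι-mono (ℕP.<⇒≤ big) ⟫ ≤-refl′ (trans (ι-* 6 (count σ)) (cong (ι 6 *_)
          (ι-count σ))))
        ⟫ ≤-refl′ (trans (QP.*-assoc (ι 6) (∑ᶠ (λ v → ⟦ σ v ⟧)) (ι n)) (cong (ι 6 *_) (sym (∑-*ʳ
          (allFin n) (ι n) (λ v → ⟦ σ v ⟧)))))
        ⟫ *≤*ˡ (ι≥0 6) (∑-mono (allFin n) row ⟫ ≤-refl′ (∑-*ˡ (allFin n) (ι 6) (λ v → ∑ᶠ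
          (λ w → ⟦ β v w ⟧))))
        ⟫ ≤-refl′ (e36 (∑ᶠ λ v → ∑ᶠ λ w → ⟦ β v w ⟧))

-- This is (1 + 36/37)/2: a booster is missed with probability at most 36/37, and otherwise the
-- potential is halved.
γ₃ : ℚ
γ₃ = pos 73 Q./ 74

module Booster (n k : ℕ) where

  open Process n (suc k)

  Good-Fail≤0 : ∀ E → (∀ g → length g ℕ.≤ E → 0 ℕ.< length (offers g)) → ∀ t g →
    length g ℕ.+ t ℕ.≤ E → Hamiltonian g ≡ true → Fail≤ t g 0ℚ
  Good-Fail≤0 E ok zero g le h rewrite h = QP.≤-refl
  Good-Fail≤0 E ok (suc t) g le h = Fail≤-step {t} {g} (λ _ → 0ℚ) 0ℚ (ok g (ℕP.≤-trans (ℕP.m≤m+n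
      (length g) (suc t)) le)) each (≤-refl′ (trans (∑-0 (offers g)) (sym (QP.*-zeroʳ (ι (length
      (offers g)))))))
    where
    each : ∀ o → o ∈ offers g → Σ (Edge n) λ e → (e ∈ o) × Fail≤ t (e ∷ g) 0ℚ
    each [] m = ⊥-elim ([]∉subsets k (nonEdges g) m)
    each (e ∷ o) m = e , here refl , Good-Fail≤0 E ok t (e ∷ g) (ℕP.≤-trans (ℕP.≤-reflexive (sym
        (ℕP.+-suc (length g) t))) le) (hamiltonian-∷ g e h)

  -- The potential 2^j γ₃^t: each round adds a booster, which lowers j, with probability at least 1/37.
  hamiltonize : ∀ E → (∀ g → length g ℕ.≤ E → 0 ℕ.< length (offers g)) → 3 ℕ.≤ n → ∀ t j g →
    length g ℕ.+ t ℕ.≤ E → Expander g → Good g j → Fail≤ t g (two ^ j * γ₃ ^ t)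
  hamiltonize E ok n≥3 t zero g le ex good = Fail≤-weaken {t} {g} {0ℚ} {1ℚ * γ₃ ^ t} (*≥0 0≤1 (^≥0 t
      (QP.nonNegative⁻¹ γ₃))) (Good-Fail≤0 E ok t g le good)
  hamiltonize E ok n≥3 zero (suc j) g le ex good = Fail≤-trivial {zero} {g} {two ^ suc j * 1ℚ} (1≤^
      (suc j) (a≤a+b 0≤1) ⟫ ≤-refl′ (sym (QP.*-identityʳ (two ^ suc j))))
  hamiltonize E ok n≥3 (suc t) (suc j) g le ex good = Fail≤-stable {suc t} {g} {B} λ nf → boosters n≥3 ex
      good (λ gd → nf (Fail≤-weaken {suc t} {g} (*≤*ʳ (^≥0 (suc t) γ≥0) (a≤2a (^≥0 j 0≤2)))
      (hamiltonize E ok n≥3 (suc t) j g le ex gd))) (λ β props total → nf (round β props total))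
    where
    γ≥0 = QP.nonNegative⁻¹ γ₃
    0≤2 : 0ℚ ≤ two
    0≤2 = +≥0 0≤1 0≤1
    a≤2a : ∀ {a} → 0ℚ ≤ a → a ≤ two * a
    a≤2a {a} p = ≤-by a p (eq a)
      where
      eq : ∀ a → a + a ≡ (1ℚ + 1ℚ) * a
      eq = solve-∀ ℚring
    B = two ^ suc j * γ₃ ^ suc t
    C = two ^ j * γ₃ ^ t
    C≥0 : 0ℚ ≤ C
    C≥0 = *≥0 (^≥0 j 0≤2) (^≥0 t γ≥0)
    nonempty = ok g (ℕP.≤-trans (ℕP.m≤m+n (length g) (suc t)) le)
    le′ : suc (length g ℕ.+ t) ℕ.≤ E
    le′ = ℕP.≤-trans (ℕP.≤-reflexive (sym (ℕP.+-suc (length g) t))) le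
    module Round (β : Fin n → Fin n → Bool) (props : ∀ v w → β v w ≡ true → (nonadj g v w ≡ true) ×
        (∀ e → adj (e ∷ g) v w ≡ true → ¬ ¬ Good (e ∷ g) j)) (total : ι n * ι n ≤ ι 36 *
        (∑ᶠ λ v → ∑ᶠ λ w → ⟦ β v w ⟧)) where
      boost : Edge n → Bool
      boost (a , b) = β a b ∨ β b a
      b : List (Edge n) → ℚ
      b o = C * (1ℚ + ⟦ not (any boost o) ⟧)
      helps : ∀ e → boost e ≡ true → ¬ ¬ Good (e ∷ g) j
      helps (v , w) h with ∨-elim (β v w) (β w v) h
      ... | inj₁ p = proj₂ (props v w p) (v , w) (adj-head g v w)
      ... | inj₂ p = proj₂ (props w v p) (v , w) (trans (adj-sym ((v , w) ∷ g) w v) (adj-head g v w))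
      each : ∀ o → o ∈ offers g → Σ (Edge n) λ e → (e ∈ o) × Fail≤ t (e ∷ g) (b o)
      each o m with any boost o in bo
      each [] m | false = ⊥-elim ([]∉subsets k (nonEdges g) m)
      each (e ∷ o) m | false = e , here refl , subst (Fail≤ t (e ∷ g)) (eq (two ^ j) (γ₃ ^ t))
          (hamiltonize E ok n≥3 t (suc j) (e ∷ g) le′ (expander-∷ {g = g} e ex) (good-∷ e (suc j) good))
        where
        eq : ∀ x y → (1ℚ + 1ℚ) * x * y ≡ x * y * (1ℚ + 1ℚ)
        eq = solve-∀ ℚring
      each o m | true with any-witness boost o bo
      ... | e , e∈ , be = e , e∈ , Fail≤-stable {t} {e ∷ g} {C * (1ℚ + 0ℚ)} λ nf → helps e be (λ gd → nf
          (subst (Fail≤ t (e ∷ g)) (sym (QP.*-identityʳ C)) (hamiltonize E ok n≥3 t j (e ∷ g) le′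
          (expander-∷ {g = g} e ex) gd)))
      m = length (nonEdges g)
      M = #ᵇ (not ∘ boost) (nonEdges g)
      L = #ᵇ boost (nonEdges g)
      M+L : M ℕ.+ L ≡ m
      M+L = #ᵇ-not boost (nonEdges g)
      len = length (offers g)
      len≡ : len ≡ bin m (suc k)
      len≡ = length-subsets (suc k) (nonEdges g)
      m>0 : 0 ℕ.< m
      m>0 = go m (subst (0 ℕ.<_) len≡ nonempty)
        where
        go : ∀ m → 0 ℕ.< bin m (suc k) → 0 ℕ.< m
        go (suc m) _ = s≤s z≤n
      twice : ι m + ι m ≤ ι 36 * ι L + ι 36 * ι L
      twice = nonEdges≤ g
        ⟫ *≤*ˡ (ι≥0 n) (a-b≤a 0≤1)
        ⟫ total
        ⟫ *≤*ˡ (ι≥0 36) (≤-refl′ (trans (∑ᶠᶠ-cong only) (sym (∑-nonEdges g (λ i j → ⟦ β i j ⟧))))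
          ⟫ ∑-mono (nonEdges g) (λ { (v , w) → either (β v w) (β w v) }) ⟫ ≤-refl′ (trans (∑-+
          (nonEdges g) (λ e → ⟦ boost e ⟧) (λ e → ⟦ boost e ⟧)) (cong₂ _+_ (sym (#ᵇ-∑ boost
          (nonEdges g))) (sym (#ᵇ-∑ boost (nonEdges g))))))
        ⟫ ≤-refl′ (QP.*-distribˡ-+ (ι 36) (ι L) (ι L))
        where
        either : ∀ a b → ⟦ a ⟧ + ⟦ b ⟧ ≤ ⟦ a ∨ b ⟧ + ⟦ a ∨ b ⟧
        either true b = QP.+-monoʳ-≤ 1ℚ (⟦⟧≤1 b)
        either false b = QP.+-monoˡ-≤ ⟦ b ⟧ (⟦⟧≥0 b)
        only : ∀ v w → ⟦ β v w ⟧ ≡ ⟦ nonadj g v w ⟧ * ⟦ β v w ⟧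
        only v w with β v w in h
        ... | true rewrite proj₁ (props v w h) = refl
        ... | false = sym (QP.*-zeroʳ ⟦ nonadj g v w ⟧)
      half : ∀ {a b} → a + a ≤ b + b → a ≤ b
      half {a} {b} p = *-cancel≤ (1ℚ + 1ℚ) (QP.positive⁻¹ (1ℚ + 1ℚ)) (≤-refl′ (eq a) ⟫ p ⟫ ≤-refl′ (sym
          (eq b)))
        where
        eq : ∀ a → (1ℚ + 1ℚ) * a ≡ a + a
        eq = solve-∀ ℚring
      m≤36L : m ℕ.≤ 36 ℕ.* L
      m≤36L = ι-cancel≤ (half twice ⟫ ≤-refl′ (sym (ι-* 36 L)))
      -- The boosters are at least m/36 of the m non-edges, so `avoid-≤` bounds the chance of
      -- missing them by m/(m + LK) ≤ 1/(1 + 1/36), already with K replaced by 1.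
      avoids : 37 ℕ.* bin M (suc k) ℕ.≤ 36 ℕ.* len
      avoids = ℕP.*-cancelˡ-≤ m {{ℕ.>-nonZero m>0}} (ℕP.≤-trans (ℕP.≤-reflexive (e₁ m (bin M (suc k))))
          (ℕP.≤-trans (ℕP.*-monoʳ-≤ (bin M (suc k)) (ℕP.+-monoʳ-≤ (36 ℕ.* m) (ℕP.≤-trans m≤36L
          (ℕP.*-monoʳ-≤ 36 (ℕP.m≤m*n L (suc k)))))) (ℕP.≤-trans (ℕP.≤-reflexive (e₂ (bin M (suc k)) m
          (L ℕ.* suc k))) (ℕP.≤-trans (ℕP.*-monoʳ-≤ 36 main) (ℕP.≤-reflexive (e₃ m len))))))
        where
        e₁ : ∀ m b → m ℕ.* (37 ℕ.* b) ≡ b ℕ.* (36 ℕ.* m ℕ.+ m)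
        e₁ = NS.solve-∀
        e₂ : ∀ b m l → b ℕ.* (36 ℕ.* m ℕ.+ 36 ℕ.* l) ≡ 36 ℕ.* (b ℕ.* (m ℕ.+ l))
        e₂ = NS.solve-∀
        e₃ : ∀ m l → 36 ℕ.* (m ℕ.* l) ≡ m ℕ.* (36 ℕ.* l)
        e₃ = NS.solve-∀
        main : bin M (suc k) ℕ.* (m ℕ.+ L ℕ.* suc k) ℕ.≤ m ℕ.* len
        main = ℕP.≤-trans (subst (λ x → bin M (suc k) ℕ.* (x ℕ.+ L ℕ.* suc k) ℕ.≤ x ℕ.* bin x
            (suc k)) M+L (avoid-≤ M L (suc k))) (ℕP.≤-reflexive (cong (m ℕ.*_) (sym len≡)))
      sum : ∑ (offers g) b ≤ ι len * B
      sum = ≤-refl′ (trans (∑-*ˡ (offers g) C (λ o → 1ℚ + ⟦ not (any boost o) ⟧)) (cong (C *_) (trans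
          (∑-+ (offers g) (λ _ → 1ℚ) (λ o → ⟦ not (any boost o) ⟧)) (cong₂ _+_ (∑-const (offers g) 1ℚ)
          (∑-avoid boost (suc k) (nonEdges g))))))
        ⟫ *≤*ˡ C≥0 (QP.+-monoʳ-≤ (ι len * 1ℚ) frac)
        ⟫ ≤-refl′ (eq (two ^ j) (γ₃ ^ t) (ι len))
        where
        frac : ι (bin M (suc k)) ≤ (pos 36 Q./ 37) * ι len
        frac = *-cancel≤ (fromℕℚ 37) (QP.positive⁻¹ (fromℕℚ 37)) (≤-refl′ (trans (cong (_* ι (bin M
            (suc k))) (sym (ι-def 37))) (sym (ι-* 37 (bin M (suc k))))) ⟫ ι-mono avoids ⟫ ≤-refl′ (trans
            (ι-* 36 len) (trans (cong (_* ι len) (ι-def 36)) (e₄ (ι len)))))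
          where
          e₄ : ∀ l → fromℕℚ 36 * l ≡ fromℕℚ 37 * ((pos 36 Q./ 37) * l)
          e₄ = solve-∀ ℚring
        eq : ∀ x y l →
          x * y * (l * 1ℚ + (pos 36 Q./ 37) * l) ≡ l * ((1ℚ + 1ℚ) * x * ((pos 73 Q./ 74) * y))
        eq = solve-∀ ℚring
    round : ∀ β →
      (∀ v w → β v w ≡ true → (nonadj g v w ≡ true) × (∀ e → adj (e ∷ g) v w ≡ true → ¬ ¬ Good
        (e ∷ g) j)) →
      ι n * ι n ≤ ι 36 * (∑ᶠ λ v → ∑ᶠ λ w → ⟦ β v w ⟧) → Fail≤ (suc t) g B
    round β props total = Fail≤-step {t} {g} (Round.b β props total) B nonempty
        (Round.each β props total) (Round.sum β props total)

-- Serving an active set of vertices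

module Serving (n k : ℕ) (g : Graph n) (A : Fin n → Bool) (H : List (Fin n × Fin n)) where

  open Process n (suc k)

  touch : Edge n → Bool
  touch (i , j) = A i ∨ A j

  -- An edge with two active ends is given to neither of them, so that the partner of an owner is
  -- always inactive.
  orient : Edge n → Maybe (Fin n × Fin n)
  orient (i , j) = if A i then (if A j then nothing else just (i , j)) else (if A j then just
      (j , i) else nothing)

  served : List (Edge n) → Maybe (Fin n × Fin n)
  served o with sole touch o
  ... | just e = orient e
  ... | nothing = nothing

  extendBy : Maybe (Fin n × Fin n) → List (Fin n × Fin n)
  extendBy (just p) = p ∷ H
  extendBy nothing = H

  H′ : List (Edge n) → List (Fin n × Fin n)
  H′ o = extendBy (served o)

  -- Without a sole touching edge the first offered edge is taken: some edge has to be added, but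
  -- nobody comes to own it.
  choose : ∀ o → o ∈ offers g → Σ (Edge n) λ e →
    (e ∈ o) × (∀ {v x} → served o ≡ just (v , x) → adj (e ∷ g) v x ≡ true)
  choose o m with sole touch o in s
  choose [] m | nothing = ⊥-elim ([]∉subsets k (nonEdges g) m)
  choose (e ∷ o) m | nothing = e , here refl , λ ()
  ... | just (i , j) = (i , j) , sole-∈ touch o s , go
    where
    go : ∀ {v x} → orient (i , j) ≡ just (v , x) → adj ((i , j) ∷ g) v x ≡ true
    go e with A i | A j
    go () | true | true
    go refl | true | false = adj-head g i j
    go refl | false | true = trans (adj-sym ((i , j) ∷ g) j i) (adj-head g i j)
    go () | false | false

  H′-∈ : ∀ o {p} → p ∈ H′ o → (p ∈ H) ⊎ (served o ≡ just p)
  H′-∈ o m with served o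
  H′-∈ o (here refl) | just p = inj₂ refl
  H′-∈ o (there m) | just p = inj₁ m
  H′-∈ o m | nothing = inj₁ m

  -- The number of offers in which a given touching edge is the sole one; by `∑-sole` it does not
  -- depend on the edge.
  c : ℚ
  c = ι (bin (#ᵇ (not ∘ touch) (nonEdges g)) k)

  len : ℚ
  len = ι (length (offers g))

  allowed : Fin n → Fin n → ℚ
  allowed v x = ⟦ nonadj g v x ⟧ * ⟦ not (A x) ⟧

  allowed≥0 : ∀ v x → 0ℚ ≤ allowed v x
  allowed≥0 v x = *≥0 (⟦⟧≥0 (nonadj g v x)) (⟦⟧≥0 (not (A x)))

  -- An exact expectation: every pair of an active vertex and an allowed partner is served in
  -- exactly `c` offers, and all other offers leave `H` as it is.
  drift : ∀ (F : List (Fin n × Fin n) → ℚ) →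
    ∑ (offers g) (λ o → F (H′ o)) ≡ len * F H + c * ∑ᶠ (λ v → ⟦ A v ⟧ * ∑ᶠ (λ x → allowed v x * (F
      ((v , x) ∷ H) - F H)))
  drift F = trans (∑-cong (offers g) pointwise) (trans (∑-+ (offers g) (λ _ → F H) (onSole touch G))
      (cong₂ _+_ (∑-const (offers g) (F H)) (trans (∑-sole touch G k (nonEdges g)) (cong (c *_) (trans
      (∑-cong (nonEdges g) touched) (trans (∑-nonEdges g D) (∑-cong (allFin n) (λ v → trans (∑-cong
      (allFin n) (λ x → e₁ ⟦ nonadj g v x ⟧ ⟦ A v ⟧ ⟦ not (A x) ⟧ (F ((v , x) ∷ H) - F H))) (∑-*ˡ
      (allFin n) ⟦ A v ⟧ (λ x → allowed v x * (F ((v , x) ∷ H) - F H)))))))))))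
    where
    D : Fin n → Fin n → ℚ
    D v x = ⟦ A v ⟧ * (⟦ not (A x) ⟧ * (F ((v , x) ∷ H) - F H))
    G : Edge n → ℚ
    G e = D (proj₁ e) (proj₂ e) + D (proj₂ e) (proj₁ e)
    e₁ : ∀ p a b d → p * (a * (b * d)) ≡ a * ((p * b) * d)
    e₁ = solve-∀ ℚring
    e₂ : ∀ h a b → h ≡ h + (1ℚ * (0ℚ * a) + 1ℚ * (0ℚ * b))
    e₂ = solve-∀ ℚring
    e₃ : ∀ h f b → f ≡ h + (1ℚ * (1ℚ * (f - h)) + 0ℚ * (0ℚ * b))
    e₃ = solve-∀ ℚring
    e₄ : ∀ h f b → f ≡ h + (0ℚ * (0ℚ * b) + 1ℚ * (1ℚ * (f - h)))
    e₄ = solve-∀ ℚring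
    e₅ : ∀ h a b → h ≡ h + (0ℚ * (1ℚ * a) + 0ℚ * (1ℚ * b))
    e₅ = solve-∀ ℚring
    e₆ : ∀ a b → 0ℚ * (0ℚ * (1ℚ * a) + 0ℚ * (1ℚ * b)) ≡ 0ℚ * (1ℚ * a) + 0ℚ * (1ℚ * b)
    e₆ = solve-∀ ℚring
    pointwise : ∀ o → F (H′ o) ≡ F H + onSole touch G o
    pointwise o with sole touch o
    ... | nothing = sym (QP.+-identityʳ (F H))
    ... | just (i , j) with A i | A j
    ... | true | true = e₂ (F H) (F ((i , j) ∷ H) - F H) (F ((j , i) ∷ H) - F H)
    ... | true | false = e₃ (F H) (F ((i , j) ∷ H)) (F ((j , i) ∷ H) - F H)
    ... | false | true = e₄ (F H) (F ((j , i) ∷ H)) (F ((i , j) ∷ H) - F H)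
    ... | false | false = e₅ (F H) (F ((i , j) ∷ H) - F H) (F ((j , i) ∷ H) - F H)
    touched : ∀ e → ⟦ touch e ⟧ * G e ≡ G e
    touched (i , j) with A i | A j
    ... | true | a = QP.*-identityˡ _
    ... | false | true = QP.*-identityˡ _
    ... | false | false = e₆ (F ((i , j) ∷ H) - F H) (F ((j , i) ∷ H) - F H)

  c≥0 : 0ℚ ≤ c
  c≥0 = ι≥0 _

  len≥0 : 0ℚ ≤ len
  len≥0 = ι≥0 _

  drift-≤ : ∀ F (δ : Fin n → ℚ) →
    (∀ v → A v ≡ true → ∑ᶠ (λ x → allowed v x * (F ((v , x) ∷ H) - F H)) ≤ - δ v) →
    ∑ (offers g) (λ o → F (H′ o)) ≤ len * F H - c * ∑ᶠ (λ v → ⟦ A v ⟧ * δ v)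
  drift-≤ F δ h = ≤-refl′ (drift F)
    ⟫ QP.+-monoʳ-≤ (len * F H) (*≤*ˡ c≥0 (∑-mono (allFin n) each ⟫ ≤-refl′ (∑-*ˡ (allFin n) (- 1ℚ)
      (λ v → ⟦ A v ⟧ * δ v))) ⟫ ≤-refl′ (e₁ c (∑ᶠ (λ v → ⟦ A v ⟧ * δ v))))
    where
    e₁ : ∀ c s → c * (- 1ℚ * s) ≡ - (c * s)
    e₁ = solve-∀ ℚring
    e₂ : ∀ d → 1ℚ * (- d) ≡ - 1ℚ * (1ℚ * d)
    e₂ = solve-∀ ℚring
    e₃ : ∀ a d → 0ℚ * a ≡ - 1ℚ * (0ℚ * d)
    e₃ = solve-∀ ℚring
    each : ∀ v → ⟦ A v ⟧ * ∑ᶠ (λ x → allowed v x * (F ((v , x) ∷ H) - F H)) ≤ - 1ℚ * (⟦ A v ⟧ * δ v)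
    each v with A v in av
    ... | true = *≤*ˡ 0≤1 (h v av) ⟫ ≤-refl′ (e₂ (δ v))
    ... | false = ≤-refl′ (e₃ (∑ᶠ (λ x → allowed v x * (F ((v , x) ∷ H) - F H))) (δ v))

  drift-uniform : ∀ F (δ : Fin n → ℚ) y → (∀ v → 0ℚ ≤ δ v) →
    (∀ v → A v ≡ true → y ≤ ∑ᶠ (allowed v)) → (∀ v x → A v ≡ true → F ((v , x) ∷ H) - F H ≤ - δ v) →
    ∑ (offers g) (λ o → F (H′ o)) ≤ len * F H - c * (y * ∑ᶠ (λ v → ⟦ A v ⟧ * δ v))
  drift-uniform F δ y δ≥0 hy h = drift-≤ F (λ v → y * δ v) row
    ⟫ ≤-refl′ (cong (λ s → len * F H - c * s) (trans (∑-cong (allFin n) (λ v → e₁ ⟦ A v ⟧ y (δ v)))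
      (∑-*ˡ (allFin n) y (λ v → ⟦ A v ⟧ * δ v))))
    where
    e₁ : ∀ a y d → a * (y * d) ≡ y * (a * d)
    e₁ = solve-∀ ℚring
    e₂ : ∀ s d → s * (- d) ≡ - (s * d)
    e₂ = solve-∀ ℚring
    row : ∀ v → A v ≡ true → ∑ᶠ (λ x → allowed v x * (F ((v , x) ∷ H) - F H)) ≤ - (y * δ v)
    row v av = ∑-mono (allFin n) (λ x → *≤*ˡ (allowed≥0 v x) (h v x av))
      ⟫ ≤-refl′ (trans (∑-*ʳ (allFin n) (- δ v) (allowed v)) (e₂ (∑ᶠ (allowed v)) (δ v)))
      ⟫ neg≤ (*≤*ʳ (δ≥0 v) (hy v av))

  -- The loop at `v` needs no deduction of its own, since `v` is among the active vertices already
  -- subtracted.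
  allowed-≥ : ∀ v → A v ≡ true → ι n - ι (count A) - ι (degree g v) ≤ ∑ᶠ (allowed v)
  allowed-≥ v av = QP.+-monoʳ-≤ (ι n - ι (count A)) (neg≤ (neighbours≤degree g v))
    ⟫ ≤-refl′ (sym total)
    ⟫ ∑-mono (allFin n) each
    where
    total : ∑ᶠ (λ x → 1ℚ + (- 1ℚ * ⟦ A x ⟧ + - 1ℚ * ⟦ adj g v x ⟧)) ≡ ι n - ι (count A) - ∑ᶠ
        (λ x → ⟦ adj g v x ⟧)
    total = trans (∑-+ (allFin n) (λ _ → 1ℚ) (λ x → - 1ℚ * ⟦ A x ⟧ + - 1ℚ * ⟦ adj g v x ⟧)) (trans
        (cong₂ _+_ (∑ᶠ-const n 1ℚ) (trans (∑-+ (allFin n) (λ x → - 1ℚ * ⟦ A x ⟧)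
        (λ x → - 1ℚ * ⟦ adj g v x ⟧)) (cong₂ _+_ (trans (∑-*ˡ (allFin n) (- 1ℚ) (λ x → ⟦ A x ⟧)) (cong
        (- 1ℚ *_) (sym (ι-count A)))) (∑-*ˡ (allFin n) (- 1ℚ) (λ x → ⟦ adj g v x ⟧))))) (e₁ (ι n) (ι
        (count A)) _))
      where
      e₁ : ∀ n a d → n * 1ℚ + (- 1ℚ * a + - 1ℚ * d) ≡ n - a - d
      e₁ = solve-∀ ℚring
    bool : ∀ e a b → (e ≡ true → a ≡ true) →
      1ℚ + (- 1ℚ * ⟦ a ⟧ + - 1ℚ * ⟦ b ⟧) ≤ ⟦ not e ∧ not b ⟧ * ⟦ not a ⟧
    bool true true true h = QP.≤ᵇ⇒≤ _
    bool true true false h = QP.≤-refl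
    bool true false b h with h refl
    ... | ()
    bool false true true h = QP.≤ᵇ⇒≤ _
    bool false true false h = QP.≤-refl
    bool false false true h = QP.≤-refl
    bool false false false h = QP.≤-refl
    each : ∀ x → 1ℚ + (- 1ℚ * ⟦ A x ⟧ + - 1ℚ * ⟦ adj g v x ⟧) ≤ allowed v x
    each x = bool (v == x) (A x) (adj g v x) (λ e → subst (λ u → A u ≡ true) (==-true v x e) av)

  m L : ℕ
  m = length (nonEdges g)
  L = #ᵇ touch (nonEdges g)

  L≤ : ι L ≤ ι (count A) * ι n
  L≤ = ≤-refl′ (#ᵇ-∑ touch (nonEdges g))
    ⟫ ∑-mono (nonEdges g) (λ { (i , j) → ⟦∨⟧≤ (A i) (A j) })
    ⟫ ≤-refl′ (∑-nonEdges g (λ i j → ⟦ A i ⟧))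
    ⟫ ∑-mono (allFin n) (λ i → ∑-mono (allFin n) (λ j → *≤*ʳ (⟦⟧≥0 (A i)) (⟦⟧≤1 (nonadj g i j))
      ⟫ ≤-refl′ (QP.*-identityˡ ⟦ A i ⟧)) ⟫ ≤-refl′ (trans (∑ᶠ-const n ⟦ A i ⟧) (QP.*-comm
      (ι n) ⟦ A i ⟧)))
    ⟫ ≤-refl′ (trans (∑-*ʳ (allFin n) (ι n) (λ i → ⟦ A i ⟧)) (cong (_* ι n) (sym (ι-count A))))

  -- A given edge is offered with probability K/m, and its companions avoid the L touching edges
  -- with probability at least 1 - LK/m; divisions are cleared.
  c-≥ : 0 ℕ.< m → ι L * ι (suc k) ≤ ι m → ι (suc k) * len * (ι m - ι L * ι (suc k)) ≤ ι m * ι m * c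
  c-≥ m>0 LK≤m with nonEdges g
  ... | e ∷ es = ≤-refl′ (cong (_* (ι m′ - ι L′ * ι (suc k))) (sym rate))
    ⟫ ≤-refl′ (e₁ (ι m′) (ι (bin (length es) k)) (ι m′ - ι L′ * ι (suc k)))
    ⟫ *≤*ˡ (ι≥0 m′) (*≤* (ι≥0 _) (ι-mono (bin-suc-mono (length es) k)) (diff≥0 LK≤m) (QP.+-monoʳ-≤
      (ι m′) (neg≤ (*≤*ˡ (ι≥0 L′) (ι-mono (ℕP.n≤1+n k))))) ⟫ avoid)
    ⟫ ≤-refl′ (sym (QP.*-assoc (ι m′) (ι m′) c′))
    where
    m′ = suc (length es)
    L′ = #ᵇ touch (e ∷ es)
    M′ = #ᵇ (not ∘ touch) (e ∷ es)
    c′ = ι (bin M′ k)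
    rate : ι m′ * ι (bin (length es) k) ≡ ι (suc k) * ι (length (subsets (suc k) (e ∷ es)))
    rate = subsets-rate k (e ∷ es) (s≤s z≤n)
    e₁ : ∀ m b d → m * b * d ≡ m * (b * d)
    e₁ = solve-∀ ℚring
    avoid : ι (bin m′ k) * (ι m′ - ι L′ * ι k) ≤ ι m′ * c′
    avoid = ≤-by _ (diff≥0 (ι-mono (subst (λ x → x ℕ.* bin x k ℕ.≤ x ℕ.* bin M′ k ℕ.+ L′ ℕ.* k ℕ.* bin x
        k) (#ᵇ-not touch (e ∷ es)) (avoid-≥ M′ L′ k)))) (trans (cong₂ (λ a b → ι (bin m′ k) *
        (ι m′ - ι L′ * ι k) + (a - b)) (trans (ι-+ (m′ ℕ.* bin M′ k) _) (cong₂ _+_ (ι-* m′ (bin M′ k))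
        (trans (ι-* (L′ ℕ.* k) (bin m′ k)) (cong (_* ι (bin m′ k)) (ι-* L′ k))))) (ι-* m′ (bin m′ k)))
        (e₂ (ι (bin m′ k)) (ι m′) (ι L′) (ι k) c′))
      where
      e₂ : ∀ b m l k c → b * (m - l * k) + ((m * c + l * k * b) - m * b) ≡ m * c
      e₂ = solve-∀ ℚring

-- Potentials

½ : ℚ
½ = pos 1 Q./ 2

sumℕ : {A : Set} → List A → (A → ℕ) → ℕ
sumℕ [] f = 0
sumℕ (x ∷ xs) f = f x ℕ.+ sumℕ xs f

ι-sumℕ : ∀ {A : Set} (xs : List A) f → ι (sumℕ xs f) ≡ ∑ xs (λ x → ι (f x))
ι-sumℕ [] f = ι-def 0
ι-sumℕ (x ∷ xs) f = trans (ι-+ (f x) (sumℕ xs f)) (cong (ι (f x) +_) (ι-sumℕ xs f))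

ι-injective : ∀ {a b} → ι a ≡ ι b → a ≡ b
ι-injective e = ℕP.≤-antisym (ι-cancel≤ (≤-refl′ e)) (ι-cancel≤ (≤-refl′ (sym e)))

-- The value 0 instead of U^0 at `zero` makes `Φ` see unsaturated vertices only. Supplying the last
-- missing edge then lowers the weight by even more than a factor U.
weight : ℚ → ℕ → ℚ
weight U zero = 0ℚ
weight U (suc j) = U ^ suc j

weight≥0 : ∀ {U} j → 0ℚ ≤ U → 0ℚ ≤ weight U j
weight≥0 zero p = QP.≤-refl
weight≥0 (suc j) p = ^≥0 (suc j) p

weight-step : ∀ {U q} j → 0ℚ ≤ U → 0ℚ ≤ q → q * U ≡ 1ℚ → weight U j ≤ q * weight U (suc j)
weight-step zero U≥0 q≥0 e = *≥0 q≥0 (^≥0 1 U≥0)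
weight-step {U} {q} (suc j) U≥0 q≥0 e = ≤-refl′ (sym (trans (sym (QP.*-assoc q U (U ^ suc j))) (trans
    (cong (_* U ^ suc j) e) (QP.*-identityˡ (U ^ suc j)))))

module _ {n : ℕ} where

  own : List (Fin n × Fin n) → Fin n → ℕ
  own [] v = 0
  own ((a , x) ∷ H) v = bit (v == a) ℕ.+ own H v

  need : ℕ → List (Fin n × Fin n) → Fin n → ℕ
  need D H v = D ℕ.∸ own H v

  unsat : ℕ → List (Fin n × Fin n) → Fin n → Bool
  unsat D H v = own H v ℕ.<ᵇ D

  need-served : ∀ D H v x u → unsat D H v ≡ true → need D ((v , x) ∷ H) u ℕ.+ bit (u == v) ≡ need D H u
  need-served D H v x u h with u == v in e
  ... | false = ℕP.+-identityʳ (D ℕ.∸ own H u)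
  ... | true with ==-true u v e
  ... | refl = trans (ℕP.+-comm (D ℕ.∸ suc (own H u)) 1) (sym (ℕP.+-∸-assoc 1 (ℕP.<ᵇ⇒< (own H u) D
      (subst IsTrue (sym h) _))))

  sat-need : ∀ D H v → unsat D H v ≡ false → need D H v ≡ 0
  sat-need D H v h = ℕP.m≤n⇒m∸n≡0 {D} {own H v} (ℕP.≮⇒≥ (λ lt → subst IsTrue h
      (ℕP.<⇒<ᵇ {own H v} {D} lt)))

  unsat-need : ∀ D H v → unsat D H v ≡ true → Σ ℕ λ j → need D H v ≡ suc j
  unsat-need D H v h = D ℕ.∸ suc (own H v) , ℕP.+-∸-assoc 1 (ℕP.<ᵇ⇒< (own H v) D (subst IsTrue
      (sym h) _))

  total : (Fin n → Bool) → ℕ → List (Fin n × Fin n) → ℕ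
  total S D H = sumℕ (allFin n) (λ v → if S v then need D H v else 0)

  total-served : ∀ S D H v x → unsat D H v ≡ true → total S D ((v , x) ∷ H) ℕ.+ bit (S v) ≡ total S D H
  total-served S D H v x h = ι-injective (trans (ι-+ (total S D ((v , x) ∷ H)) (bit (S v))) (trans
      (cong₂ _+_ (ι-sumℕ (allFin n) _) (trans (ι-bit (S v)) (sym (∑ᶠ-δ v (λ u → ⟦ S u ⟧))))) (trans (sym
      (∑-+ (allFin n) (λ u → ι (if S u then need D ((v , x) ∷ H) u else 0))
      (λ u → ⟦ u == v ⟧ * ⟦ S u ⟧))) (trans (∑-cong (allFin n) each) (sym (ι-sumℕ (allFin n) _))))))
    where
    each : ∀ u →
      ι (if S u then need D ((v , x) ∷ H) u else 0) + ⟦ u == v ⟧ * ⟦ S u ⟧ ≡ ι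
        (if S u then need D H u else 0)
    each u with S u
    ... | false = trans (cong (ι 0 +_) (QP.*-zeroʳ ⟦ u == v ⟧)) (QP.+-identityʳ (ι 0))
    ... | true = trans (cong (ι (need D ((v , x) ∷ H) u) +_) (trans (QP.*-identityʳ ⟦ u == v ⟧) (sym
        (ι-bit (u == v))))) (trans (sym (ι-+ (need D ((v , x) ∷ H) u) (bit (u == v)))) (cong ι
        (need-served D H v x u h)))

  violates : (S R : Fin n → Bool) → List (Fin n × Fin n) → Bool
  violates S R H = any (λ p → S (proj₁ p) ∧ not (R (proj₂ p))) H

  -- A supermartingale bounding the probability that S ends up with all its owned edges inside R.
  trap : (S R : Fin n → Bool) → ℚ → ℕ → List (Fin n × Fin n) → ℚ
  trap S R ρ D H = if violates S R H then 0ℚ else ρ ^ total S D H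

  trap≥0 : ∀ S R {ρ} D H → 0ℚ ≤ ρ → 0ℚ ≤ trap S R ρ D H
  trap≥0 S R D H p with violates S R H
  ... | true = QP.≤-refl
  ... | false = ^≥0 (total S D H) p

  -- Serves the phase in which all unsaturated vertices are active: after a service at most 1/U of
  -- the weight of the served vertex is left.
  Φ : ℚ → ℕ → List (Fin n × Fin n) → ℚ
  Φ U D H = ∑ᶠ (λ v → weight U (need D H v))

  -- Serves the phase with many unsaturated vertices, where only the number of services counts: each
  -- halves it, whoever is served.
  Ξ : ℕ → List (Fin n × Fin n) → ℚ
  Ξ D H = two ^ total (λ _ → true) D H

  -- An exponential moment with a union bound over the vertices: while it stays below 2^d, no degree
  -- exceeds d.
  Ψ : Graph n → ℚ
  Ψ g = ∑ᶠ (λ v → two ^ degree g v)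

  edgeWeight : Graph n → Edge n → ℚ
  edgeWeight g (i , j) = two * two ^ degree g i + two * two ^ degree g j

edgeWeight≥0 : ∀ {n} (g : Graph n) e → 0ℚ ≤ edgeWeight g e
edgeWeight≥0 g (i , j) = +≥0 (*≥0 two≥0 (^≥0 (degree g i) two≥0)) (*≥0 two≥0 (^≥0 (degree g j) two≥0))

Ψ-∷ : ∀ {n} (g : Graph n) e → Ψ (e ∷ g) ≤ Ψ g + edgeWeight g e
Ψ-∷ {n} g (a , b) = ∑-mono (allFin n) each
  ⟫ ≤-refl′ (trans (∑-+ (allFin n) (λ v → two ^ degree g v) (λ v → ⟦ v == a ⟧ *
    (two * two ^ degree g v) + ⟦ v == b ⟧ * (two * two ^ degree g v))) (cong (Ψ g +_) (trans (∑-+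
    (allFin n) (λ v → ⟦ v == a ⟧ * (two * two ^ degree g v)) (λ v → ⟦ v == b ⟧ *
    (two * two ^ degree g v))) (cong₂ _+_ (∑ᶠ-δ a (λ v → two * two ^ degree g v)) (∑ᶠ-δ b
    (λ v → two * two ^ degree g v))))))
  where
  bool : ∀ p q x → 0ℚ ≤ x → two ^ (bit p ℕ.+ bit q) * x ≤ x + (⟦ p ⟧ * (two * x) + ⟦ q ⟧ * (two * x))
  bool true true x h = ≤-by x h (eq x)
    where
    eq : ∀ x → (1ℚ + 1ℚ) * ((1ℚ + 1ℚ) * 1ℚ) * x + x ≡ x + (1ℚ * ((1ℚ + 1ℚ) * x) + 1ℚ * ((1ℚ + 1ℚ) * x))
    eq = solve-∀ ℚring
  bool true false x h = ≤-by x h (eq x)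
    where
    eq : ∀ x → (1ℚ + 1ℚ) * 1ℚ * x + x ≡ x + (1ℚ * ((1ℚ + 1ℚ) * x) + 0ℚ * ((1ℚ + 1ℚ) * x))
    eq = solve-∀ ℚring
  bool false true x h = ≤-by x h (eq x)
    where
    eq : ∀ x → (1ℚ + 1ℚ) * 1ℚ * x + x ≡ x + (0ℚ * ((1ℚ + 1ℚ) * x) + 1ℚ * ((1ℚ + 1ℚ) * x))
    eq = solve-∀ ℚring
  bool false false x h = ≤-refl′ (eq x)
    where
    eq : ∀ x → 1ℚ * x ≡ x + (0ℚ * ((1ℚ + 1ℚ) * x) + 0ℚ * ((1ℚ + 1ℚ) * x))
    eq = solve-∀ ℚring
  each : ∀ v →
    two ^ degree ((a , b) ∷ g) v ≤ two ^ degree g v + (⟦ v == a ⟧ *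
      (two * two ^ degree g v) + ⟦ v == b ⟧ * (two * two ^ degree g v))
  each v = ≤-refl′ (^-+ two (bit (v == a) ℕ.+ bit (v == b)) (degree g v))
    ⟫ bool (v == a) (v == b) (two ^ degree g v) (^≥0 (degree g v) two≥0)

-- The chosen edge is charged as if the whole offer were taken, which makes the estimate independent
-- of the strategy. The lost factor K is affordable, because degrees need only stay below a small
-- multiple of n.
Ψ-step : ∀ {n} (g : Graph n) {o e} → e ∈ o → Ψ (e ∷ g) ≤ Ψ g + ∑ o (edgeWeight g)
Ψ-step g {o} {e} m = Ψ-∷ g e ⟫ QP.+-monoʳ-≤ (Ψ g) (∑-term≤ (edgeWeight≥0 g) m)

∑-edgeWeight : ∀ {n} (g : Graph n) → ∑ (nonEdges g) (edgeWeight g) ≤ ι n * (two * Ψ g)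
∑-edgeWeight {n} g = ≤-refl′ (∑-nonEdges g (λ i _ → two * two ^ degree g i))
  ⟫ ∑-mono (allFin n) (λ i → ∑-mono (allFin n) (λ j → *≤*ʳ (*≥0 two≥0 (^≥0 (degree g i) two≥0)) (⟦⟧≤1
    (nonadj g i j)) ⟫ ≤-refl′ (QP.*-identityˡ (two * two ^ degree g i))) ⟫ ≤-refl′ (∑ᶠ-const n
    (two * two ^ degree g i)))
  ⟫ ≤-refl′ (trans (∑-*ˡ (allFin n) (ι n) (λ i → two * two ^ degree g i)) (cong (ι n *_) (∑-*ˡ
    (allFin n) two (λ i → two ^ degree g i))))

Ψ-drift : ∀ {n} k (g : Graph n) → 0 ℕ.< length (nonEdges g) →
  ι (length (nonEdges g)) * ∑ (subsets (suc k) (nonEdges g)) (λ o → Ψ g + ∑ o (edgeWeight g)) ≤ ι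
    (length (subsets (suc k) (nonEdges g))) * (Ψ g * (ι (length (nonEdges g)) + ι (suc k) * (ι n * two)))
Ψ-drift {n} k g m>0 = ≤-refl′ (cong (ι m *_) (trans (∑-+ offs (λ _ → Ψ g) (λ o → ∑ o (edgeWeight g)))
    (cong₂ _+_ (∑-const offs (Ψ g)) (∑-elements′ (edgeWeight g) k (nonEdges g) m>0))))
  ⟫ ≤-refl′ (trans (e₁ (ι m) (ι (length offs)) (Ψ g) (ι (bin (ℕ.pred m) k)) W) (cong (λ z → ι
    (length offs) * (Ψ g * ι m) + z * W) (subsets-rate k (nonEdges g) m>0)))
  ⟫ QP.+-monoʳ-≤ (ι (length offs) * (Ψ g * ι m)) (*≤*ˡ (*≥0 (ι≥0 (suc k)) (ι≥0 (length offs)))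
    (∑-edgeWeight g))
  ⟫ ≤-refl′ (e₂ (ι (length offs)) (Ψ g) (ι m) (ι (suc k)) (ι n))
  where
  m = length (nonEdges g)
  offs = subsets (suc k) (nonEdges g)
  W = ∑ (nonEdges g) (edgeWeight g)
  e₁ : ∀ m l p b w → m * (l * p + b * w) ≡ l * (p * m) + m * b * w
  e₁ = solve-∀ ℚring
  e₂ : ∀ l p m k n → l * (p * m) + k * l * (n * ((1ℚ + 1ℚ) * p)) ≡ l * (p * (m + k * (n * (1ℚ + 1ℚ))))
  e₂ = solve-∀ ℚring

module Potentials (n k : ℕ) (g : Graph n) (A : Fin n → Bool) (H : List (Fin n × Fin n)) (D : ℕ)
    (active : ∀ v → A v ≡ true → unsat D H v ≡ true) (y : ℚ) where

  open Process n (suc k)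
  open Serving n k g A H

  own-grows : ∀ o u → own H u ℕ.≤ own (H′ o) u
  own-grows o u with served o
  ... | just (v , x) = ℕP.m≤n+m (own H u) (bit (u == v))
  ... | nothing = ℕP.≤-refl

  module _ (hy : ∀ v → A v ≡ true → y ≤ ∑ᶠ (allowed v)) where

    -- Serving a vertex of S sends its partner into R with conditional probability at most |R|/y ≤
    -- ρ, and the trap is then multiplied by 1/ρ; otherwise it becomes 0. Serving outside S never
    -- increases it.
    trap-drift : ∀ S R ρ → 0ℚ ≤ ρ → ι (count R) ≤ ρ * y →
      ∑ (offers g) (λ o → trap S R ρ D (H′ o)) ≤ len * trap S R ρ D H
    trap-drift S R ρ ρ≥0 hr = drift-≤ (trap S R ρ D) (λ _ → 0ℚ) row
      ⟫ ≤-refl′ (trans (cong (λ s → len * trap S R ρ D H - c * s) (trans (∑-cong (allFin n)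
        (λ v → QP.*-zeroʳ ⟦ A v ⟧)) (∑-0 (allFin n)))) (e₀ (len * trap S R ρ D H) c))
      where
      e₀ : ∀ a c → a - c * 0ℚ ≡ a
      e₀ = solve-∀ ℚring
      row : ∀ v → A v ≡ true →
        ∑ᶠ (λ x → allowed v x * (trap S R ρ D ((v , x) ∷ H) - trap S R ρ D H)) ≤ - 0ℚ
      row v av with violates S R H
      ... | true = ≤-refl′ (trans (∑-cong (allFin n) each) (∑-0 (allFin n)))
        where
        each : ∀ x →
          allowed v x * ((if (S v ∧ not (R x)) ∨ true then 0ℚ else ρ ^ total S D
            ((v , x) ∷ H)) - 0ℚ) ≡ 0ℚ
        each x rewrite ∨-introʳ (S v ∧ not (R x)) {true} refl = QP.*-zeroʳ (allowed v x)
      ... | false with S v in sv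
      ... | false = ≤-refl′ (trans (∑-cong (allFin n) each) (∑-0 (allFin n)))
        where
        each : ∀ x → allowed v x * (ρ ^ total S D ((v , x) ∷ H) - ρ ^ total S D H) ≡ 0ℚ
        each x = trans (cong (λ t → allowed v x * (ρ ^ t - ρ ^ total S D H)) (trans (sym
            (ℕP.+-identityʳ _)) (trans (cong (λ b → total S D ((v , x) ∷ H) ℕ.+ bit b) (sym sv))
            (total-served S D H v x (active v av))))) (trans (cong (allowed v x *_) (QP.+-inverseʳ
            (ρ ^ total S D H))) (QP.*-zeroʳ (allowed v x)))
      ... | true = ∑-mono (allFin n) each
        ⟫ ≤-refl′ (trans (∑-+ (allFin n) (λ x → P * ⟦ R x ⟧) (λ x → - (P * ρ) * allowed v x)) (cong₂ _+_
          (trans (∑-*ˡ (allFin n) P (λ x → ⟦ R x ⟧)) (cong (P *_) (sym (ι-count R)))) (∑-*ˡ (allFin n)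
          (- (P * ρ)) (allowed v))))
        ⟫ ≤-by (P * (ρ * (∑ᶠ (allowed v) - y) + (ρ * y - ι (count R)))) (*≥0 P≥0 (+≥0 (*≥0 ρ≥0 (diff≥0
          (hy v av))) (diff≥0 hr))) (e₁ P ρ (∑ᶠ (allowed v)) y (ι (count R)))
        where
        -- `total` ignores partners, so `v` stands in for the partner; writing everything through
        -- the value after the service avoids dividing by ρ.
        P : ℚ
        P = ρ ^ total S D ((v , v) ∷ H)
        P≥0 : 0ℚ ≤ P
        P≥0 = ^≥0 (total S D ((v , v) ∷ H)) ρ≥0
        e₁ : ∀ p r a y c → p * c + - (p * r) * a + p * (r * (a - y) + (r * y - c)) ≡ - 0ℚ
        e₁ = solve-∀ ℚring
        now : ρ ^ total S D H ≡ ρ * P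
        now = cong (ρ ^_) (trans (sym (total-served S D H v v (active v av))) (trans (cong
            (λ b → total S D ((v , v) ∷ H) ℕ.+ bit b) sv) (ℕP.+-comm (total S D ((v , v) ∷ H)) 1)))
        e₂ : ∀ a p r → a * (p - r * p) ≡ a * p + - (p * r) * a
        e₂ = solve-∀ ℚring
        e₃ : ∀ a p r → a * (0ℚ - r * p) ≡ p * 0ℚ + - (p * r) * a
        e₃ = solve-∀ ℚring
        allowed≤1 : ∀ x → allowed v x ≤ 1ℚ
        allowed≤1 x = *≤* (⟦⟧≥0 (nonadj g v x)) (⟦⟧≤1 (nonadj g v x)) (⟦⟧≥0 (not (A x))) (⟦⟧≤1 (not
            (A x)))
        each : ∀ x →
          allowed v x * ((if not (R x) ∨ false then 0ℚ else ρ ^ total S D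
            ((v , x) ∷ H)) - ρ ^ total S D H) ≤ P * ⟦ R x ⟧ + - (P * ρ) * allowed v x
        each x rewrite now with R x
        ... | true = ≤-refl′ (e₂ (allowed v x) P ρ)
          ⟫ QP.+-monoˡ-≤ (- (P * ρ) * allowed v x) (*≤*ʳ P≥0 (allowed≤1 x) ⟫ ≤-refl′ (QP.*-comm 1ℚ P))
        ... | false = ≤-refl′ (e₃ (allowed v x) P ρ)

    Φ-drift : ∀ U q → 0ℚ ≤ U → 0ℚ ≤ q → q ≤ 1ℚ → q * U ≡ 1ℚ → (∀ v → A v ≡ unsat D H v) →
      ∑ (offers g) (λ o → Φ U D (H′ o)) ≤ len * Φ U D H - c * (y * ((1ℚ - q) * Φ U D H))
    Φ-drift U q U≥0 q≥0 q≤1 qU all = drift-uniform (Φ U D) δ y (λ v → *≥0 (diff≥0 q≤1) (weight≥0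
        (need D H v) U≥0)) hy drop
      ⟫ ≤-refl′ (cong (λ s → len * Φ U D H - c * (y * s)) (trans (∑-cong (allFin n) active-only) (∑-*ˡ
        (allFin n) (1ℚ - q) (λ v → weight U (need D H v)))))
      where
      δ : Fin n → ℚ
      δ v = (1ℚ - q) * weight U (need D H v)
      active-only : ∀ v → ⟦ A v ⟧ * δ v ≡ δ v
      active-only v with A v in av
      ... | true = QP.*-identityˡ (δ v)
      ... | false rewrite sat-need D H v (trans (sym (all v)) av) = trans (QP.*-zeroˡ ((1ℚ - q) * 0ℚ))
          (sym (QP.*-zeroʳ (1ℚ - q)))
      drop : ∀ v x → A v ≡ true → Φ U D ((v , x) ∷ H) - Φ U D H ≤ - δ v
      drop v x av = ≥0diff (diff≥0 summed ⟫ ≤-refl′ (e₁ (Φ U D ((v , x) ∷ H)) (Φ U D H) (δ v)))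
        where
        e₁ : ∀ a b d → b + - 1ℚ * d - a ≡ - d - (a - b)
        e₁ = solve-∀ ℚring
        e₂ : ∀ b w → b + - 1ℚ * (0ℚ * w) ≡ b
        e₂ = solve-∀ ℚring
        e₃ : ∀ q w → q * w ≡ w + - 1ℚ * (1ℚ * ((1ℚ - q) * w))
        e₃ = solve-∀ ℚring
        each : ∀ u →
          weight U (need D ((v , x) ∷ H) u) ≤ weight U (need D H u) + - 1ℚ * (⟦ u == v ⟧ * δ u)
        each u with u == v in e | need-served D H v x u (active v av)
        ... | false | ns = ≤-refl′ (trans (cong (weight U) (trans (sym (ℕP.+-identityʳ _)) ns)) (sym (e₂
            (weight U (need D H u)) (δ u))))
        ... | true | ns with trans (sym ns) (ℕP.+-comm _ 1)
        ... | ns′ = weight-step (D ℕ.∸ suc (own H u)) U≥0 q≥0 qU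
          ⟫ ≤-refl′ (trans (cong (λ j → q * weight U j) (sym ns′)) (e₃ q (weight U (need D H u))))
        summed : Φ U D ((v , x) ∷ H) ≤ Φ U D H + - 1ℚ * δ v
        summed = ∑-mono (allFin n) each
          ⟫ ≤-refl′ (trans (∑-+ (allFin n) (λ u → weight U (need D H u)) (λ u → - 1ℚ *
            (⟦ u == v ⟧ * δ u))) (cong (Φ U D H +_) (trans (∑-*ˡ (allFin n) (- 1ℚ)
            (λ u → ⟦ u == v ⟧ * δ u)) (cong (- 1ℚ *_) (∑ᶠ-δ v δ)))))

    Ξ-drift : ∑ (offers g) (λ o → Ξ D (H′ o)) ≤ len * Ξ D H - c * (y * (ι (count A) * (½ * Ξ D H)))
    Ξ-drift = drift-uniform (Ξ D) (λ _ → ½ * Ξ D H) y (λ v → *≥0 (QP.nonNegative⁻¹ ½) (^≥0 (total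
        (λ _ → true) D H) two≥0)) hy drop
      ⟫ ≤-refl′ (cong (λ s → len * Ξ D H - c * (y * s)) (trans (∑-*ʳ (allFin n) (½ * Ξ D H)
        (λ v → ⟦ A v ⟧)) (cong (_* (½ * Ξ D H)) (sym (ι-count A)))))
      where
      drop : ∀ v x → A v ≡ true → Ξ D ((v , x) ∷ H) - Ξ D H ≤ - (½ * Ξ D H)
      drop v x av rewrite sym (trans (ℕP.+-comm 1 _) (total-served (λ _ → true) D H v x
          (active v av))) = ≤-refl′ (eq (two ^ total (λ _ → true) D ((v , x) ∷ H)))
        where
        eq : ∀ t → t - (1ℚ + 1ℚ) * t ≡ - ((pos 1 Q./ 2) * ((1ℚ + 1ℚ) * t))
        eq = solve-∀ ℚring

-- The union bound over pairs S ⊆ R of vertex sets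

-- A labeling encodes a pair S ⊆ R: S is the core, and R is the core together with the rim.
data Label : Set where
  out rim core : Label

isCore inSet : Label → Bool
isCore core = true
isCore _ = false
inSet out = false
inSet _ = true

labelOf : Bool → Bool → Label
labelOf s r = if s then core else (if r then rim else out)

isCore-labelOf : ∀ s r → isCore (labelOf s r) ≡ s
isCore-labelOf true r = refl
isCore-labelOf false true = refl
isCore-labelOf false false = refl

inSet-labelOf : ∀ s r → (s ≡ true → r ≡ true) → inSet (labelOf s r) ≡ r
inSet-labelOf true r h = sym (h refl)
inSet-labelOf false true h = refl
inSet-labelOf false false h = refl

consL : ∀ {n} → Label → (Fin n → Label) → Fin (suc n) → Label
consL a ℓ zero = a
consL a ℓ (suc i) = ℓ i

labelings : ∀ n → List (Fin n → Label)
labelings zero = (λ ()) ∷ []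
labelings (suc n) = concatMap (λ ℓ → consL out ℓ ∷ consL rim ℓ ∷ consL core ℓ ∷ []) (labelings n)

labelings-complete : ∀ n (f : Fin n → Label) → Σ (Fin n → Label) λ ℓ →
  (ℓ ∈ labelings n) × (∀ i → ℓ i ≡ f i)
labelings-complete zero f = (λ ()) , here refl , λ ()
labelings-complete (suc n) f with labelings-complete n (f ∘ suc)
... | ℓ , m , h = consL (f zero) ℓ , ∈-concatMap⁺ _ (Any.map (λ { refl → three
    (f zero) }) m) , λ { zero → refl ; (suc i) → h i }
  where
  three : ∀ a → consL a ℓ ∈ (consL out ℓ ∷ consL rim ℓ ∷ consL core ℓ ∷ [])
  three out = here refl
  three rim = there (here refl)
  three core = there (there (here refl))

count-suc : ∀ {n} (p : Fin (suc n) → Bool) → count p ≡ bit (p zero) ℕ.+ count (p ∘ suc)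
count-suc p = ι-injective (trans (ι-count p) (trans (∑ᶠ-suc (λ v → ⟦ p v ⟧)) (trans (cong₂ _+_ (sym
    (ι-bit (p zero))) (sym (ι-count (p ∘ suc)))) (sym (ι-+ (bit (p zero)) _)))))

-- The generating function factorises over the vertices: 1 for `out` and x for each of the two
-- labels inside R.
∑-labelings : ∀ n x → ∑ (labelings n) (λ ℓ → x ^ count (inSet ∘ ℓ)) ≡ (1ℚ + two * x) ^ n
∑-labelings zero x = refl
∑-labelings (suc n) x = trans (∑-concatMap _ (labelings n) (λ ℓ → x ^ count (inSet ∘ ℓ))) (trans (∑-cong
    (labelings n) each) (trans (∑-*ˡ (labelings n) (1ℚ + two * x) (λ ℓ → x ^ count (inSet ∘ ℓ))) (cong
    ((1ℚ + two * x) *_) (∑-labelings n x))))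
  where
  eq : ∀ x c → c + (x * c + (x * c + 0ℚ)) ≡ (1ℚ + (1ℚ + 1ℚ) * x) * c
  eq = solve-∀ ℚring
  each : ∀ ℓ →
    x ^ count (inSet ∘ consL out ℓ) + (x ^ count (inSet ∘ consL rim ℓ) + (x ^ count
      (inSet ∘ consL core ℓ) + 0ℚ)) ≡ (1ℚ + two * x) * x ^ count (inSet ∘ ℓ)
  each ℓ = trans (cong₂ (λ a b → x ^ a + b) (count-suc (inSet ∘ consL out ℓ)) (cong₂ (λ a b → x ^ a +
      (x ^ b + 0ℚ)) (count-suc (inSet ∘ consL rim ℓ)) (count-suc (inSet ∘ consL core ℓ)))) (eq x
      (x ^ count (inSet ∘ ℓ)))

-- The sizes of pairs that would contradict `Expander`.
valid : ∀ {n} → (Fin n → Label) → Bool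
valid {n} ℓ = (1 ℕ.≤ᵇ count (isCore ∘ ℓ)) ∧ ((count (inSet ∘ ℓ) ℕ.≤ᵇ 3 ℕ.* count (isCore ∘ ℓ)) ∧
    (2 ℕ.* count (inSet ∘ ℓ) ℕ.≤ᵇ n))

≤ᵇ-true : ∀ {a b} → a ℕ.≤ b → (a ℕ.≤ᵇ b) ≡ true
≤ᵇ-true {a} {b} p with a ℕ.≤ᵇ b | ℕP.≤⇒≤ᵇ p
... | true | _ = refl

≤ᵇ-elim : ∀ {a b} → (a ℕ.≤ᵇ b) ≡ true → a ℕ.≤ b
≤ᵇ-elim {a} {b} e = ℕP.≤ᵇ⇒≤ a b (subst IsTrue (sym e) _)

valid-elim : ∀ {n} (ℓ : Fin n → Label) → valid ℓ ≡ true →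
  (1 ℕ.≤ count (isCore ∘ ℓ)) × (count (inSet ∘ ℓ) ℕ.≤ 3 ℕ.* count (isCore ∘ ℓ)) × (2 ℕ.* count
    (inSet ∘ ℓ) ℕ.≤ n)
valid-elim {n} ℓ h with ∧-elim _ _ h
... | a , bc with ∧-elim _ (2 ℕ.* count (inSet ∘ ℓ) ℕ.≤ᵇ n) bc
... | b , c = ≤ᵇ-elim a , ≤ᵇ-elim b , ≤ᵇ-elim c

⅔ : ℚ
⅔ = pos 2 Q./ 3

⅛ : ℚ
⅛ = pos 1 Q./ 8

ratio : ℕ → ℕ → ℚ
ratio n r = ι r * recip n

ratio≥0 : ∀ n r → 0ℚ ≤ ratio n r
ratio≥0 n r = *≥0 (ι≥0 r) (recip≥0 n)

-- This is r/(3n/4): a partner is nearly uniform over at least 3n/4 vertices. It is split into 2r/n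
-- ≤ 1 and the constant 2/3, whose powers produce the geometric gain.
ρ : ℕ → ℕ → ℚ
ρ n r = ⅔ * (two * ratio n r)

ρ≥0 : ∀ n r → 0ℚ ≤ ρ n r
ρ≥0 n r = *≥0 (QP.nonNegative⁻¹ ⅔) (*≥0 two≥0 (ratio≥0 n r))

two*ratio≤1 : ∀ n r → 0 ℕ.< n → 2 ℕ.* r ℕ.≤ n → two * ratio n r ≤ 1ℚ
two*ratio≤1 n r n>0 h = ≤-refl′ (trans (sym (QP.*-assoc two (ι r) (recip n))) (cong (_* recip n) (trans
    (cong (_* ι r) (sym (ι-def 2))) (sym (ι-* 2 r)))))
  ⟫ recip-≤ {n} n>0 (ι-mono h ⟫ ≤-refl′ (sym (QP.*-identityʳ (ι n))))

ρ≤1 : ∀ n r → 0 ℕ.< n → 2 ℕ.* r ℕ.≤ n → ρ n r ≤ 1ℚ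
ρ≤1 n r n>0 h = *≤* (QP.nonNegative⁻¹ ⅔) (QP.≤ᵇ⇒≤ {⅔} {1ℚ} _) (*≥0 two≥0 (ratio≥0 n r))
    (two*ratio≤1 n r n>0 h)

-- The bound is e² ≤ 16, read off from (1 - 1/2)^4 exp (4 · 1/2) ≤ 1.
1+2/n-power : ∀ n → 0 ℕ.< n → (1ℚ + two * recip n) ^ n ≤ fromℕℚ 16
1+2/n-power n n>0 = geometric-≤-exp n (*≥0 two≥0 (recip≥0 n))
  ⟫ ≤-refl′ (cong (λ x → expPartial x (suc n)) (trans (e₁ (ι n) two (recip n)) (trans (cong (two *_)
    (*-recip n n>0)) (QP.*-identityʳ two))))
  ⟫ *-cancel≤ (½ ^ 4) (QP.positive⁻¹ (½ ^ 4)) (≤-refl′ (cong (λ x → ½ ^ 4 * expPartial x (suc n)) (sym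
    (cong (_* ½) (ι-def 4)))) ⟫ exp-≤-geometric 4 (suc n) (QP.nonNegative⁻¹ ½) (QP.≤ᵇ⇒≤ {½} {1ℚ} _))
  where
  e₁ : ∀ n t r → n * (t * r) ≡ t * (n * r)
  e₁ = solve-∀ ℚring

^-swap : ∀ x a b → (x ^ a) ^ b ≡ (x ^ b) ^ a
^-swap x a b = trans (sym (^-^ x a b)) (trans (cong (x ^_) (ℕP.*-comm a b)) (^-^ x b a))

module UnionBound (n e : ℕ) (n>0 : 0 ℕ.< n) (e≥2 : 2 ℕ.≤ e) (small : fromℕℚ 32 * ⅔ ^ suc e ≤ ⅛) where

  inverse : ℕ → ℚ
  inverse r = ι n * recip r

  inverse≥0 : ∀ r → 0ℚ ≤ inverse r
  inverse≥0 r = *≥0 (ι≥0 n) (recip≥0 r)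

  inverse-ratio : ∀ r → 0 ℕ.< r → inverse r * ratio n r ≡ 1ℚ
  inverse-ratio r r>0 = trans (e₁ (ι n) (recip r) (ι r) (recip n)) (cong₂ _*_ (*-recip n n>0)
      (*-recip r r>0))
    where
    e₁ : ∀ a b c d → a * b * (c * d) ≡ (a * d) * (c * b)
    e₁ = solve-∀ ℚring

  -- Instead of counting labelings with |R| = r, each of them is weighted by (r/n)^|R|, the factor
  -- n/r compensating. Summing these weights over all labelings gives (1 + 2r/n)^n, an
  -- exponential-moment substitute for a binomial estimate.
  coefficient : ℕ → ℚ
  coefficient r = ⟦ 2 ℕ.* r ℕ.≤ᵇ n ⟧ * (ρ n r ^ (suc e ℕ.* r) * inverse r ^ r)

  coefficient≥0 : ∀ r → 0ℚ ≤ coefficient r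
  coefficient≥0 r = *≥0 (⟦⟧≥0 (2 ℕ.* r ℕ.≤ᵇ n)) (*≥0 (^≥0 (suc e ℕ.* r) (ρ≥0 n r)) (^≥0 r (inverse≥0 r)))

  -- With Y = 2r/n everything is an r-th power of 32 (2/3)^(e+1) Y^e ≤ Y^e/8. As er ≥ 2, two factors
  -- Y remain and give 4r²/n²; the r² ≤ 4^r is absorbed by 8^(-r). Two powers of 1/n are needed, one
  -- being spent on the sum over r.
  term : ∀ r → 0 ℕ.< r → coefficient r * (1ℚ + two * ratio n r) ^ n ≤ fromℕℚ 4 * (recip n * recip n)
  term r r>0 with 2 ℕ.* r ℕ.≤ᵇ n in h
  ... | false = ≤-refl′ (e₀ (ρ n r ^ (suc e ℕ.* r) * inverse r ^ r) ((1ℚ + two * ratio n r) ^ n))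
    ⟫ *≥0 (QP.nonNegative⁻¹ (fromℕℚ 4)) (*≥0 (recip≥0 n) (recip≥0 n))
    where
    e₀ : ∀ a b → 0ℚ * a * b ≡ 0ℚ
    e₀ = solve-∀ ℚring
  ... | true = *≤*ˡ (*≥0 0≤1 (*≥0 (^≥0 (suc e ℕ.* r) (ρ≥0 n r)) (^≥0 r (inverse≥0 r)))) entropy
    ⟫ ≤-refl′ regroup
    ⟫ ^-mono r bracket≥0 bracket≤
    ⟫ ≤-refl′ (trans (^-*ˡ ⅛ (Y ^ e) r) (cong (⅛ ^ r *_) (sym (^-^ Y e r))))
    ⟫ *≤*ˡ (^≥0 r (QP.nonNegative⁻¹ ⅛)) (^-antitone {Y} {2} {e ℕ.* r} Y≥0 Y≤1 (ℕP.≤-trans e≥2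
      (ℕP.m≤m*n e r {{ℕ.>-nonZero r>0}})))
    ⟫ ≤-refl′ (e₃ (⅛ ^ r) (ι r) (recip n))
    ⟫ *≤*ʳ (*≥0 (QP.nonNegative⁻¹ (fromℕℚ 4)) (*≥0 (recip≥0 n) (recip≥0 n))) squares
    ⟫ ≤-refl′ (QP.*-identityˡ (fromℕℚ 4 * (recip n * recip n)))
    where
    Y = two * ratio n r
    Y≥0 : 0ℚ ≤ Y
    Y≥0 = *≥0 two≥0 (ratio≥0 n r)
    Y≤1 : Y ≤ 1ℚ
    Y≤1 = two*ratio≤1 n r n>0 (≤ᵇ-elim h)
    -- By Bernoulli 1 + 2r/n ≤ (1 + 2/n)^r, and the n-th power of 1 + 2/n is at most 16.
    entropy : (1ℚ + Y) ^ n ≤ fromℕℚ 16 ^ r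
    entropy = ^-mono n (+≥0 0≤1 Y≥0) (≤-refl′ (cong (1ℚ +_) (e₁ two (ι r) (recip n))) ⟫ bernoulli r
        (neg≤ {0ℚ} {1ℚ} 0≤1 ⟫ *≥0 two≥0 (recip≥0 n)))
      ⟫ ≤-refl′ (^-swap (1ℚ + two * recip n) r n)
      ⟫ ^-mono r (^≥0 n (+≥0 0≤1 (*≥0 two≥0 (recip≥0 n)))) (1+2/n-power n n>0)
      where
      e₁ : ∀ t r n → t * (r * n) ≡ r * (t * n)
      e₁ = solve-∀ ℚring
    bracket = ρ n r ^ suc e * inverse r * fromℕℚ 16
    bracket≥0 : 0ℚ ≤ bracket
    bracket≥0 = *≥0 (*≥0 (^≥0 (suc e) (ρ≥0 n r)) (inverse≥0 r)) (QP.nonNegative⁻¹ (fromℕℚ 16))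
    regroup : 1ℚ * (ρ n r ^ (suc e ℕ.* r) * inverse r ^ r) * fromℕℚ 16 ^ r ≡ bracket ^ r
    regroup = trans (cong (_* fromℕℚ 16 ^ r) (trans (QP.*-identityˡ _) (trans (cong (_* inverse r ^ r)
        (^-^ (ρ n r) (suc e) r)) (sym (^-*ˡ (ρ n r ^ suc e) (inverse r) r))))) (sym (^-*ˡ
        (ρ n r ^ suc e * inverse r) (fromℕℚ 16) r))
    bracket≤ : bracket ≤ ⅛ * Y ^ e
    bracket≤ = ≤-refl′ (trans (cong (λ z → z * inverse r * fromℕℚ 16) (^-*ˡ ⅔ Y (suc e))) (trans (e₂
        (⅔ ^ suc e) (ratio n r) (Y ^ e) (inverse r)) (cong (fromℕℚ 32 * ⅔ ^ suc e * Y ^ e *_)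
        (inverse-ratio r r>0))))
      ⟫ ≤-refl′ (QP.*-identityʳ (fromℕℚ 32 * ⅔ ^ suc e * Y ^ e))
      ⟫ *≤*ʳ (^≥0 e Y≥0) small
      where
      e₂ : ∀ p x y i → p * ((1ℚ + 1ℚ) * x * y) * i * fromℕℚ 16 ≡ fromℕℚ 32 * p * y * (i * x)
      e₂ = solve-∀ ℚring
    e₃ : ∀ p r n →
      p * ((1ℚ + 1ℚ) * (r * n) * ((1ℚ + 1ℚ) * (r * n) * 1ℚ)) ≡ p * (r * r) * (fromℕℚ 4 * (n * n))
    e₃ = solve-∀ ℚring
    squares : ⅛ ^ r * (ι r * ι r) ≤ 1ℚ
    squares = *≤*ˡ (^≥0 r (QP.nonNegative⁻¹ ⅛)) (*≤* (ι≥0 r) (ι≤two^ r) (ι≥0 r) (ι≤two^ r))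
      ⟫ ≤-refl′ (trans (cong (⅛ ^ r *_) (sym (^-*ˡ two two r))) (sym (^-*ˡ ⅛ (two * two) r)))
      ⟫ ^≤1 r (QP.nonNegative⁻¹ (⅛ * (two * two))) (QP.≤ᵇ⇒≤ {⅛ * (two * two)} {1ℚ} _)

  per-label : ∀ (ℓ : Fin n → Label) →
    ⟦ valid ℓ ⟧ * ρ n (count (inSet ∘ ℓ)) ^ (3 ℕ.* suc e ℕ.* count (isCore ∘ ℓ)) ≤ ∑ᶠ {n}
      (λ i → coefficient (suc (toℕ i)) * ratio n (suc (toℕ i)) ^ count (inSet ∘ ℓ))
  per-label ℓ with valid ℓ in v
  ... | false = ≤-refl′ (QP.*-zeroˡ (ρ n (count (inSet ∘ ℓ)) ^ (3 ℕ.* suc e ℕ.* count (isCore ∘ ℓ))))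
    ⟫ ∑≥0 (allFin n) (λ i → *≥0 (coefficient≥0 (suc (toℕ i))) (^≥0 (count (inSet ∘ ℓ)) (ratio≥0 n (suc
      (toℕ i)))))
  ... | true = ≤-refl′ (QP.*-identityˡ (ρ n r ^ (3 ℕ.* suc e ℕ.* s)))
    ⟫ ^-antitone (ρ≥0 n r) (ρ≤1 n r n>0 2r≤n) exponent
    ⟫ ≤-refl′ at-r
    ⟫ at r refl
    where
    r = count (inSet ∘ ℓ)
    s = count (isCore ∘ ℓ)
    r≤3s = proj₁ (proj₂ (valid-elim ℓ v))
    2r≤n = proj₂ (proj₂ (valid-elim ℓ v))
    core≤in : ∀ a → ⟦ isCore a ⟧ ≤ ⟦ inSet a ⟧
    core≤in out = QP.≤-refl
    core≤in rim = 0≤1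
    core≤in core = QP.≤-refl
    r>0 : 0 ℕ.< r
    r>0 = ℕP.≤-trans (proj₁ (valid-elim ℓ v)) (ι-cancel≤ (≤-refl′ (ι-count (isCore ∘ ℓ)) ⟫ ∑-mono
        (allFin n) (λ i → core≤in (ℓ i)) ⟫ ≤-refl′ (sym (ι-count (inSet ∘ ℓ)))))
    -- Here |R| ≤ 3|S| is used; the factor 3 in the number of owned edges is there to cancel it.
    exponent : suc e ℕ.* r ℕ.≤ 3 ℕ.* suc e ℕ.* s
    exponent = ℕP.≤-trans (ℕP.*-monoʳ-≤ (suc e) r≤3s) (ℕP.≤-reflexive (e₁ (suc e) s))
      where
      e₁ : ∀ e s → e ℕ.* (3 ℕ.* s) ≡ 3 ℕ.* e ℕ.* s
      e₁ = NS.solve-∀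
    at-r : ρ n r ^ (suc e ℕ.* r) ≡ coefficient r * ratio n r ^ r
    at-r = sym (trans (cong (λ b → ⟦ b ⟧ * (ρ n r ^ (suc e ℕ.* r) * inverse r ^ r) * ratio n r ^ r)
        (≤ᵇ-true 2r≤n)) (trans (e₁ (ρ n r ^ (suc e ℕ.* r)) (inverse r ^ r) (ratio n r ^ r)) (trans (cong
        (ρ n r ^ (suc e ℕ.* r) *_) (^-inverse r (inverse-ratio r r>0))) (QP.*-identityʳ _))))
      where
      e₁ : ∀ a b c → 1ℚ * (a * b) * c ≡ a * (b * c)
      e₁ = solve-∀ ℚring
    at : ∀ r′ → r ≡ r′ →
      coefficient r′ * ratio n r′ ^ r ≤ ∑ᶠ {n} (λ i → coefficient (suc (toℕ i)) * ratio n (suc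
        (toℕ i)) ^ r)
    at zero eq = ⊥-elim (ℕP.<-irrefl refl (subst (0 ℕ.<_) eq r>0))
    at (suc r″) eq = ≤-refl′ (cong (λ z → coefficient (suc z) * ratio n (suc z) ^ r) (sym
        (FP.toℕ-fromℕ< lt)))
      ⟫ ∑ᶠ-term≤ {n} (F.fromℕ< lt) (λ i → *≥0 (coefficient≥0 (suc (toℕ i))) (^≥0 r (ratio≥0 n (suc
        (toℕ i)))))
      where
      lt : r″ ℕ.< n
      lt = ℕP.≤-trans (ℕP.≤-trans (ℕP.≤-reflexive (sym eq)) (ℕP.m≤n*m r 2)) 2r≤n

  union-bound : ∑ (labelings n) (λ ℓ → ⟦ valid ℓ ⟧ * ρ n (count (inSet ∘ ℓ)) ^ (3 ℕ.* suc e ℕ.* count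
      (isCore ∘ ℓ))) ≤ fromℕℚ 4 * recip n
  union-bound = ∑-mono (labelings n) per-label
    ⟫ ≤-refl′ (trans (∑-swap (labelings n) (allFin n) (λ ℓ i → coefficient (suc (toℕ i)) * ratio n (suc
      (toℕ i)) ^ count (inSet ∘ ℓ))) (∑-cong (allFin n) (λ i → trans (∑-*ˡ (labelings n) (coefficient
      (suc (toℕ i))) (λ ℓ → ratio n (suc (toℕ i)) ^ count (inSet ∘ ℓ))) (cong (coefficient (suc
      (toℕ i)) *_) (∑-labelings n (ratio n (suc (toℕ i))))))))
    ⟫ ∑-mono (allFin n) (λ i → term (suc (toℕ i)) (s≤s z≤n))
    ⟫ ≤-refl′ (trans (∑ᶠ-const n (fromℕℚ 4 * (recip n * recip n))) (trans (e₁ (ι n) (fromℕℚ 4)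
      (recip n)) (trans (cong (λ z → fromℕℚ 4 * (z * recip n)) (*-recip n n>0)) (cong (fromℕℚ 4 *_)
      (QP.*-identityˡ (recip n))))))
    where
    e₁ : ∀ n f r → n * (f * (r * r)) ≡ f * (n * r * r)
    e₁ = solve-∀ ℚring

-- The two serving phases

firstN : ∀ {n} → ℕ → (Fin n → Bool) → Fin n → Bool
firstN {suc n} a p zero = p zero ∧ (1 ℕ.≤ᵇ a)
firstN {suc n} a p (suc i) = firstN (if p zero then ℕ.pred a else a) (p ∘ suc) i

firstN-⊆ : ∀ {n} a (p : Fin n → Bool) v → firstN a p v ≡ true → p v ≡ true
firstN-⊆ a p zero h = proj₁ (∧-elim (p zero) (1 ℕ.≤ᵇ a) h)
firstN-⊆ a p (suc v) h = firstN-⊆ (if p zero then ℕ.pred a else a) (p ∘ suc) v h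

firstN-0 : ∀ {n} (p : Fin n → Bool) → count (firstN 0 p) ≡ 0
firstN-0 {zero} p = refl
firstN-0 {suc n} p = trans (count-suc (firstN 0 p)) (go (p zero) refl)
  where
  go : ∀ b → p zero ≡ b → bit (firstN 0 p zero) ℕ.+ count (firstN 0 p ∘ suc) ≡ 0
  go true e rewrite e = firstN-0 (p ∘ suc)
  go false e rewrite e = firstN-0 (p ∘ suc)

firstN-count : ∀ {n} a (p : Fin n → Bool) → a ℕ.≤ count p → count (firstN a p) ≡ a
firstN-count zero p _ = firstN-0 p
firstN-count {suc n} (suc a) p le = trans (count-suc (firstN (suc a) p)) (go (p zero) refl (subst
    (suc a ℕ.≤_) (count-suc p) le))
  where
  go : ∀ b → p zero ≡ b → suc a ℕ.≤ bit (p zero) ℕ.+ count (p ∘ suc) →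
    bit (firstN (suc a) p zero) ℕ.+ count (firstN (suc a) p ∘ suc) ≡ suc a
  go true e le rewrite e = cong suc (firstN-count a (p ∘ suc) (ℕP.≤-pred le))
  go false e le rewrite e = firstN-count (suc a) (p ∘ suc) le

count-mono : ∀ {n} (p r : Fin n → Bool) → (∀ v → p v ≡ true → r v ≡ true) → count p ℕ.≤ count r
count-mono {n} p r h = ι-cancel≤ (≤-refl′ (ι-count p) ⟫ ∑-mono (allFin n) (λ v → each (p v) (r v)
    (h v)) ⟫ ≤-refl′ (sym (ι-count r)))
  where
  each : ∀ a b → (a ≡ true → b ≡ true) → ⟦ a ⟧ ≤ ⟦ b ⟧
  each true b h rewrite h refl = QP.≤-refl
  each false b h = ⟦⟧≥0 b

sumℕ-0 : ∀ {A : Set} (xs : List A) f → (∀ x → f x ≡ 0) → sumℕ xs f ≡ 0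
sumℕ-0 [] f h = refl
sumℕ-0 (x ∷ xs) f h = cong₂ ℕ._+_ (h x) (sumℕ-0 xs f h)

if-0 : ∀ b {m} → m ≡ 0 → (if b then m else 0) ≡ 0
if-0 true h = h
if-0 false h = refl

unsat-mono : ∀ {n} D (H H″ : List (Fin n × Fin n)) → (∀ u → own H u ℕ.≤ own H″ u) → ∀ v →
  unsat D H″ v ≡ true → unsat D H v ≡ true
unsat-mono D H H″ grows v h with own H v ℕ.<ᵇ D | ℕP.<⇒<ᵇ {own H v} {D} (ℕP.≤-trans (s≤s (grows v))
    (ℕP.<ᵇ⇒< (own H″ v) D (subst IsTrue (sym h) _)))
... | true | _ = refl

-- `D` is the number of edges to own, `a` caps the active set and `d₀` the degrees; `y` bounds the
-- number of allowed partners from below, `G` the growth of `Ψ` per round, and `λ₀` is the relative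
-- decay of `Φ` per round. `T` bounds all rounds and `t₃` counts those kept for boosters.
module Phases
  (n k D T t₃ a d₀ : ℕ) (y q U λ₀ G : ℚ)
  (n≥3 : 3 ℕ.≤ n)
  (nonempty : ∀ g → length g ℕ.≤ T → 0 ℕ.< length (Process.offers n (suc k) g))
  (q≥0 : 0ℚ ≤ q) (q≤1 : q ≤ 1ℚ) (U≥1 : 1ℚ ≤ U) (qU : q * U ≡ 1ℚ)
  (y≥0 : 0ℚ ≤ y) (y≤ : y ≤ ι n - ι a - ι d₀) (trapped : ∀ r → ι r ≤ ρ n r * y)
  (G≥1 : 1ℚ ≤ G) (growth : ∀ (g : Graph n) → length g ℕ.≤ T → ι (length (nonEdges g)) + ι (suc k) *
      (ι n * two) ≤ G * ι (length (nonEdges g)))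
  (λ≥0 : 0ℚ ≤ λ₀) (λ≤1 : λ₀ ≤ 1ℚ) (γ≥0 : 0ℚ ≤ 1ℚ - λ₀ * (ι a * ½))
  (rate : ∀ g A H → length g ℕ.≤ T → count A ℕ.≤ a → λ₀ * Serving.len n k g A H ≤ Serving.c n k g A H *
      (y * (1ℚ - q)))
  where

  open Process n (suc k)

  Owned : Set
  Owned = List (Fin n × Fin n)

  Ztot : Owned → ℚ
  Ztot H = ∑ (labelings n) (λ ℓ → ⟦ valid ℓ ⟧ * trap (isCore ∘ ℓ) (inSet ∘ ℓ) (ρ n (count
      (inSet ∘ ℓ))) D H)

  ztot-term≥0 : ∀ H (ℓ : Fin n → Label) →
    0ℚ ≤ ⟦ valid ℓ ⟧ * trap (isCore ∘ ℓ) (inSet ∘ ℓ) (ρ n (count (inSet ∘ ℓ))) D H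
  ztot-term≥0 H ℓ = *≥0 (⟦⟧≥0 (valid ℓ)) (trap≥0 (isCore ∘ ℓ) (inSet ∘ ℓ) D H (ρ≥0 n (count
      (inSet ∘ ℓ))))

  Ztot≥0 : ∀ H → 0ℚ ≤ Ztot H
  Ztot≥0 H = ∑≥0 (labelings n) (ztot-term≥0 H)

  Inv : Graph n → Owned → Set
  Inv g H = ∀ {v x} → (v , x) ∈ H → adj g v x ≡ true

  ψ₀ : ℚ
  ψ₀ = ½ ^ d₀

  ψ₀≥0 : 0ℚ ≤ ψ₀
  ψ₀≥0 = ^≥0 d₀ (QP.nonNegative⁻¹ ½)

  Ψ≥0 : ∀ (g : Graph n) → 0ℚ ≤ Ψ g
  Ψ≥0 g = ∑≥0 (allFin n) (λ v → ^≥0 (degree g v) two≥0)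

  G≥0 : 0ℚ ≤ G
  G≥0 = 0≤1 ⟫ G≥1

  U≥0 : 0ℚ ≤ U
  U≥0 = 0≤1 ⟫ U≥1

  Φ≥0 : ∀ (H : Owned) → 0ℚ ≤ Φ U D H
  Φ≥0 H = ∑≥0 (allFin n) (λ v → weight≥0 (need D H v) U≥0)

  Ξ≥0 : ∀ (H : Owned) → 0ℚ ≤ Ξ D H
  Ξ≥0 H = ^≥0 (total (λ _ → true) D H) two≥0

  B₃ : ℚ
  B₃ = two ^ n * γ₃ ^ t₃

  B₃≥0 : 0ℚ ≤ B₃
  B₃≥0 = *≥0 (^≥0 n two≥0) (^≥0 t₃ (QP.nonNegative⁻¹ γ₃))

  -- Bounds the mean of `ψ₀ * Ψ` after τ further rounds. Where `ψ₀ * Ψ g` reaches 1 the failure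
  -- bound is trivial, which replaces stopping the process at the first large degree.
  ΨG : Graph n → ℕ → ℚ
  ΨG g τ = ψ₀ * (Ψ g * G ^ τ)

  ΨG≥0 : ∀ g τ → 0ℚ ≤ ΨG g τ
  ΨG≥0 g τ = *≥0 ψ₀≥0 (*≥0 (Ψ≥0 g) (^≥0 τ G≥0))

  degrees : ∀ (g : Graph n) → ψ₀ * Ψ g < 1ℚ → ∀ v → degree g v ℕ.≤ d₀
  degrees g h v = by-casesℕ (degree g v) d₀ id (λ d₀< → ⊥-elim (<⇒≱ℚ h (≤-refl′ (sym
      (^-inverse {½} {two} d₀ refl)) ⟫ *≤*ˡ ψ₀≥0 (^-monotone two≥1 (ℕP.<⇒≤ d₀<) ⟫ ∑ᶠ-term≤ v (λ u → ^≥0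
      (degree g u) two≥0)))))

  ΨG-large : ∀ g τ → 1ℚ ≤ ψ₀ * Ψ g → 1ℚ ≤ ΨG g τ
  ΨG-large g τ h = h
    ⟫ ≤-refl′ (sym (QP.*-identityʳ (ψ₀ * Ψ g)))
    ⟫ *≤*ˡ (*≥0 ψ₀≥0 (Ψ≥0 g)) (1≤^ τ G≥1)
    ⟫ ≤-refl′ (QP.*-assoc ψ₀ (Ψ g) (G ^ τ))

  ≥1-part₂ : ∀ {w x y z} → 0ℚ ≤ w → 0ℚ ≤ y → 0ℚ ≤ z → 1ℚ ≤ x → 1ℚ ≤ w + x + y + z
  ≥1-part₂ w≥0 y≥0 z≥0 h = h ⟫ a≤b+a w≥0 ⟫ a≤a+b y≥0 ⟫ a≤a+b z≥0

  -- The step shared by both phases. `F` is the potential of the phase, `X` the bound on its mean,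
  -- and `C` the part of the bound reserved for later phases; traps and degrees behave alike in
  -- both.
  round : ∀ t τ g H A (F : Owned → ℚ) X C → (∀ v → A v ≡ true → unsat D H v ≡ true) → count A ℕ.≤ a →
    length g ℕ.≤ T → ψ₀ * Ψ g < 1ℚ → Inv g H →
    ((∀ v → A v ≡ true → y ≤ ∑ᶠ (Serving.allowed n k g A H v)) → ∑ (offers g) (λ o → F
      (Serving.H′ n k g A H o)) ≤ Serving.len n k g A H * X) →
    (∀ e H″ → Inv (e ∷ g) H″ → (∀ u → own H u ℕ.≤ own H″ u) → Fail≤ t (e ∷ g) (Ztot H″ + ΨG
      (e ∷ g) τ + F H″ + C)) →
    Fail≤ (suc t) g (Ztot H + ΨG g (suc τ) + X + C)
  round t τ g H A F X C act A≤a g≤T degs inv F-drift next = Fail≤-step {t} {g} β (Ztot H + ΨG g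
      (suc τ) + X + C) (nonempty g g≤T) each summed
    where
    allowed : Fin n → Fin n → ℚ
    allowed = Serving.allowed n k g A H
    served : List (Edge n) → Maybe (Fin n × Fin n)
    served = Serving.served n k g A H
    H′ : List (Edge n) → Owned
    H′ = Serving.H′ n k g A H
    len : ℚ
    len = ι (length (offers g))
    len≥0 : 0ℚ ≤ len
    len≥0 = ι≥0 (length (offers g))
    hy : ∀ v → A v ≡ true → y ≤ ∑ᶠ (allowed v)
    hy v av = y≤
      ⟫ QP.+-mono-≤ (QP.+-monoʳ-≤ (ι n) (neg≤ (ι-mono A≤a))) (neg≤ (ι-mono (degrees g degs v)))
      ⟫ Serving.allowed-≥ n k g A H v av
    Ψ⁺ : List (Edge n) → ℚ
    Ψ⁺ o = Ψ g + ∑ o (edgeWeight g)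
    β : List (Edge n) → ℚ
    β o = Ztot (H′ o) + ψ₀ * (Ψ⁺ o * G ^ τ) + F (H′ o) + C
    inv′ : ∀ o e → (∀ {v x} → served o ≡ just (v , x) → adj (e ∷ g) v x ≡ true) → Inv (e ∷ g) (H′ o)
    inv′ o e h {v} {x} m = go (Serving.H′-∈ n k g A H o m)
      where
      go : ((v , x) ∈ H) ⊎ (served o ≡ just (v , x)) → adj (e ∷ g) v x ≡ true
      go (inj₁ m′) = adj-∷ g e v x (inv m′)
      go (inj₂ s) = h s
    each : ∀ o → o ∈ offers g → Σ (Edge n) λ e → (e ∈ o) × Fail≤ t (e ∷ g) (β o)
    each o m = proj₁ choice , proj₁ (proj₂ choice) , Fail≤-weaken {t} {proj₁ choice ∷ g} (QP.+-monoˡ-≤ C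
        (QP.+-monoˡ-≤ (F (H′ o)) (QP.+-monoʳ-≤ (Ztot (H′ o)) (*≤*ˡ ψ₀≥0 (*≤*ʳ (^≥0 τ G≥0) (Ψ-step g
        (proj₁ (proj₂ choice)))))))) (next (proj₁ choice) (H′ o) (inv′ o (proj₁ choice) (proj₂
        (proj₂ choice))) (Potentials.own-grows n k g A H D act y o))
      where
      choice = Serving.choose n k g A H o m
    m>0 : 0 ℕ.< length (nonEdges g)
    m>0 = go (length (nonEdges g)) (subst (0 ℕ.<_) (length-subsets (suc k) (nonEdges g))
        (nonempty g g≤T))
      where
      go : ∀ m → 0 ℕ.< bin m (suc k) → 0 ℕ.< m
      go (suc m) _ = s≤s z≤n
    traps : ∑ (offers g) (λ o → Ztot (H′ o)) ≤ len * Ztot H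
    traps = ≤-refl′ (∑-swap (offers g) (labelings n) (λ o ℓ → ⟦ valid ℓ ⟧ * trap (isCore ∘ ℓ)
        (inSet ∘ ℓ) (ρ n (count (inSet ∘ ℓ))) D (H′ o)))
      ⟫ ∑-mono (labelings n) (λ ℓ → ≤-refl′ (∑-*ˡ (offers g) ⟦ valid ℓ ⟧ (λ o → trap (isCore ∘ ℓ)
        (inSet ∘ ℓ) (ρ n (count (inSet ∘ ℓ))) D (H′ o))) ⟫ *≤*ˡ (⟦⟧≥0 (valid ℓ))
        (Potentials.trap-drift n k g A H D act y hy (isCore ∘ ℓ) (inSet ∘ ℓ) (ρ n (count (inSet ∘ ℓ)))
        (ρ≥0 n (count (inSet ∘ ℓ))) (trapped (count (inSet ∘ ℓ)))) ⟫ ≤-refl′ (e₁ ⟦ valid ℓ ⟧ len (trap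
        (isCore ∘ ℓ) (inSet ∘ ℓ) (ρ n (count (inSet ∘ ℓ))) D H)))
      ⟫ ≤-refl′ (∑-*ˡ (labelings n) len (λ ℓ → ⟦ valid ℓ ⟧ * trap (isCore ∘ ℓ) (inSet ∘ ℓ) (ρ n (count
        (inSet ∘ ℓ))) D H))
      where
      e₁ : ∀ a b c → a * (b * c) ≡ b * (a * c)
      e₁ = solve-∀ ℚring
    degreeSum : ∑ (offers g) Ψ⁺ ≤ len * (Ψ g * G)
    degreeSum = *-cancel≤ (ι (length (nonEdges g))) (ι>0 m>0) (Ψ-drift k g m>0 ⟫ *≤*ˡ len≥0 (*≤*ˡ
        (Ψ≥0 g) (growth g g≤T)) ⟫ ≤-refl′ (e₁ len (Ψ g) G (ι (length (nonEdges g)))))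
      where
      e₁ : ∀ l p g m → l * (p * (g * m)) ≡ m * (l * (p * g))
      e₁ = solve-∀ ℚring
    degreePart : ∑ (offers g) (λ o → ψ₀ * (Ψ⁺ o * G ^ τ)) ≤ len * ΨG g (suc τ)
    degreePart = ≤-refl′ (trans (∑-*ˡ (offers g) ψ₀ (λ o → Ψ⁺ o * G ^ τ)) (cong (ψ₀ *_) (∑-*ʳ (offers g)
        (G ^ τ) Ψ⁺)))
      ⟫ *≤*ˡ ψ₀≥0 (*≤*ʳ (^≥0 τ G≥0) degreeSum)
      ⟫ ≤-refl′ (e₁ ψ₀ len (Ψ g) G (G ^ τ))
      where
      e₁ : ∀ s l p g h → s * (l * (p * g) * h) ≡ l * (s * (p * (g * h)))
      e₁ = solve-∀ ℚring
    summed : ∑ (offers g) β ≤ ι (length (offers g)) * (Ztot H + ΨG g (suc τ) + X + C)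
    summed = ≤-refl′ (trans (∑-+ (offers g) (λ o → Ztot (H′ o) + ψ₀ * (Ψ⁺ o * G ^ τ) + F (H′ o))
        (λ _ → C)) (cong₂ _+_ (trans (∑-+ (offers g) (λ o → Ztot (H′ o) + ψ₀ * (Ψ⁺ o * G ^ τ)) (λ o → F
        (H′ o))) (cong (_+ ∑ (offers g) (λ o → F (H′ o))) (∑-+ (offers g) (λ o → Ztot (H′ o))
        (λ o → ψ₀ * (Ψ⁺ o * G ^ τ))))) (∑-const (offers g) C)))
      ⟫ QP.+-monoˡ-≤ (len * C) (QP.+-mono-≤ (QP.+-mono-≤ traps degreePart) (F-drift hy))
      ⟫ ≤-refl′ (e₁ len (Ztot H) (ΨG g (suc τ)) X C)
      where
      e₁ : ∀ l a b c d → l * a + l * b + l * c + l * d ≡ l * (a + b + c + d)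
      e₁ = solve-∀ ℚring

  count-1 : ∀ (p : Fin n → Bool) v → p v ≡ true → 1 ℕ.≤ count p
  count-1 p v h = ι-cancel≤ (≤-refl′ (trans (ι-def 1) (cong ⟦_⟧ (sym h))) ⟫ ∑ᶠ-term≤ v (λ u → ⟦⟧≥0
      (p u)) ⟫ ≤-refl′ (sym (ι-count p)))

  -- A pair S ⊆ R that violates expansion has nothing missing in S and no owned edge from S leaving
  -- R, so its trap alone equals ρ^0 = 1.
  saturated-expander : ∀ g H → Inv g H → (∀ v → unsat D H v ≡ false) → Ztot H < 1ℚ → Expander g
  saturated-expander g H inv sat Z<1 S R S⊆R N (v₀ , Sv₀) r≤3s = by-casesℕ (2 ℕ.* count R) n
      (λ small → ⊥-elim (<⇒≱ℚ Z<1 (≤-refl′ (sym (one small)) ⟫ ∑-term≤ (ztot-term≥0 H) (proj₁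
      (proj₂ found))))) id
    where
    found = labelings-complete n (λ v → labelOf (S v) (R v))
    ℓ : Fin n → Label
    ℓ = proj₁ found
    isS : ∀ v → isCore (ℓ v) ≡ S v
    isS v = trans (cong isCore (proj₂ (proj₂ found) v)) (isCore-labelOf (S v) (R v))
    isR : ∀ v → inSet (ℓ v) ≡ R v
    isR v = trans (cong inSet (proj₂ (proj₂ found) v)) (inSet-labelOf (S v) (R v) (S⊆R v))
    countS : count (isCore ∘ ℓ) ≡ count S
    countS = ℕP.≤-antisym (count-mono _ _ (λ v h → trans (sym (isS v)) h)) (count-mono _ _
        (λ v h → trans (isS v) h))
    countR : count (inSet ∘ ℓ) ≡ count R
    countR = ℕP.≤-antisym (count-mono _ _ (λ v h → trans (sym (isR v)) h)) (count-mono _ _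
        (λ v h → trans (isR v) h))
    isValid : 2 ℕ.* count R ℕ.≤ n → valid ℓ ≡ true
    isValid small = ∧-intro (≤ᵇ-true (count-1 (isCore ∘ ℓ) v₀ (trans (isS v₀) Sv₀))) (∧-intro (≤ᵇ-true
        (subst (λ z → count (inSet ∘ ℓ) ℕ.≤ 3 ℕ.* z) (sym countS) (ℕP.≤-trans
        (ℕP.≤-reflexive countR) r≤3s))) (≤ᵇ-true (ℕP.≤-trans (ℕP.≤-reflexive (cong
        (2 ℕ.*_) countR)) small)))
    notViolated : violates (isCore ∘ ℓ) (inSet ∘ ℓ) H ≡ false
    notViolated = not-true λ h → contra (any-witness (λ p → isCore (ℓ (proj₁ p)) ∧ not (inSet (ℓ
        (proj₂ p)))) H h)
      where
      contra : (Σ (Fin n × Fin n) λ p → (p ∈ H) × (isCore (ℓ (proj₁ p)) ∧ not (inSet (ℓ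
          (proj₂ p))) ≡ true)) →
        ⊥
      contra ((v , x) , m , h) = false≢true (cong not (trans (isR x) (N v x (trans (sym (isS v)) (proj₁
          (∧-elim (isCore (ℓ v)) (not (inSet (ℓ x))) h))) (inv m)))) (proj₂ (∧-elim (isCore (ℓ v)) (not
          (inSet (ℓ x))) h))
    one : 2 ℕ.* count R ℕ.≤ n →
      ⟦ valid ℓ ⟧ * trap (isCore ∘ ℓ) (inSet ∘ ℓ) (ρ n (count (inSet ∘ ℓ))) D H ≡ 1ℚ
    one small = trans (cong₂ (λ b c → ⟦ b ⟧ * (if c then 0ℚ else ρ n (count (inSet ∘ ℓ)) ^ total
        (isCore ∘ ℓ) D H)) (isValid small) notViolated) (trans (cong (λ t → 1ℚ * ρ n (count
        (inSet ∘ ℓ)) ^ t) (sumℕ-0 (allFin n) (λ v → if isCore (ℓ v) then need D H v else 0) (λ v → if-0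
        (isCore (ℓ v)) (sat-need D H v (sat v))))) refl)

  start-path : ∀ g → Good g n
  start-path g = go n n≥3 g
    where
    go : ∀ n → 3 ℕ.≤ n → (g : Graph n) → Good g n
    go (suc n) _ g = tabulate suc , zero , zero , zero ∷ [] , spanning (λ { (there ()) }) ↭-refl
        ([] , refl) ([] , refl) , LP.length-tabulate suc

  -- All unsaturated vertices fit into the active set from now on, since saturation is never lost.
  -- At the end `Φ` < 1 means that nothing is missing, because an unsaturated vertex weighs at least
  -- 1.
  light : ∀ τ g H → Inv g H → length g ℕ.+ (τ ℕ.+ t₃) ℕ.≤ T → count (unsat D H) ℕ.≤ a →
    Fail≤ (τ ℕ.+ t₃) g (Ztot H + ΨG g τ + Φ U D H * (1ℚ - λ₀) ^ τ + B₃)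
  light zero g H inv le few = by-cases 1ℚ (Ztot H) (λ p → Fail≤-trivial {t₃} {g} (p ⟫ a≤a+b (ΨG≥0 g 0)
      ⟫ a≤a+b (*≥0 (Φ≥0 H) 0≤1) ⟫ a≤a+b B₃≥0)) (λ Z<1 → by-cases 1ℚ (Φ U D H)
      (λ p → Fail≤-trivial {t₃} {g} (p ⟫ ≤-refl′ (sym (QP.*-identityʳ (Φ U D H))) ⟫ a≤b+a (+≥0
      (Ztot≥0 H) (ΨG≥0 g 0)) ⟫ a≤a+b B₃≥0)) (λ Φ<1 → Fail≤-weaken {t₃} {g} (a≤b+a (+≥0 (+≥0 (Ztot≥0 H)
      (ΨG≥0 g 0)) (*≥0 (Φ≥0 H) 0≤1))) (Booster.hamiltonize n k T nonempty n≥3 t₃ n g le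
      (saturated-expander g H inv (sat Φ<1) Z<1) (start-path g))))
    where
    big : ∀ v → (Σ ℕ λ j → need D H v ≡ suc j) → 1ℚ ≤ Φ U D H
    big v (j , e) = 1≤^ (suc j) U≥1
      ⟫ ≤-refl′ (cong (weight U) (sym e))
      ⟫ ∑ᶠ-term≤ v (λ u → weight≥0 (need D H u) U≥0)
    sat : Φ U D H < 1ℚ → ∀ v → unsat D H v ≡ false
    sat Φ<1 v = not-true λ h → <⇒≱ℚ Φ<1 (big v (unsat-need D H v h))
  light (suc τ) g H inv le few = by-cases 1ℚ (ψ₀ * Ψ g) (λ p → Fail≤-trivial {suc τ ℕ.+ t₃} {g}
      (≥1-part₂ (Ztot≥0 H) (*≥0 (Φ≥0 H) (^≥0 (suc τ) (diff≥0 λ≤1))) B₃≥0 (ΨG-large g (suc τ) p)))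
      (λ p → round (τ ℕ.+ t₃) τ g H (unsat D H) (λ H″ → Φ U D H″ * (1ℚ - λ₀) ^ τ) (Φ U D H *
      (1ℚ - λ₀) ^ suc τ) B₃ (λ v h → h) few g≤T p inv drop (λ e H″ inv″ grows → light τ (e ∷ g) H″ inv″
      (ℕP.≤-trans (ℕP.≤-reflexive (sym (ℕP.+-suc (length g) (τ ℕ.+ t₃)))) le) (ℕP.≤-trans (count-mono
      (unsat D H″) (unsat D H) (unsat-mono D H H″ grows)) few)))
    where
    g≤T : length g ℕ.≤ T
    g≤T = ℕP.≤-trans (ℕP.m≤m+n (length g) _) le
    len = Serving.len n k g (unsat D H) H
    c = Serving.c n k g (unsat D H) H
    H′ = Serving.H′ n k g (unsat D H) H
    drop : (∀ v → unsat D H v ≡ true → y ≤ ∑ᶠ (Serving.allowed n k g (unsat D H) H v)) →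
      ∑ (offers g) (λ o → Φ U D (H′ o) * (1ℚ - λ₀) ^ τ) ≤ len * (Φ U D H * (1ℚ - λ₀) ^ suc τ)
    drop hy = ≤-refl′ (∑-*ʳ (offers g) ((1ℚ - λ₀) ^ τ) (λ o → Φ U D (H′ o)))
      ⟫ *≤*ʳ (^≥0 τ (diff≥0 λ≤1)) (Potentials.Φ-drift n k g (unsat D H) H D
        (λ v h → h) y hy U q U≥0 q≥0 q≤1 qU (λ v → refl) ⟫ ≤-by ((c * (y *
        (1ℚ - q)) - λ₀ * len) * Φ U D H) (*≥0 (diff≥0 (rate g (unsat D H) H g≤T few)) (Φ≥0 H)) (e₁ len
        (Φ U D H) c y (1ℚ - q) λ₀))
      ⟫ ≤-refl′ (e₂ len (Φ U D H) (1ℚ - λ₀) ((1ℚ - λ₀) ^ τ))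
      where
      e₁ : ∀ l f c y q λ₀ → l * f - c * (y * (q * f)) + (c * (y * q) - λ₀ * l) * f ≡ l * (f * (1ℚ - λ₀))
      e₁ = solve-∀ ℚring
      e₂ : ∀ l f m p → l * (f * m) * p ≡ l * (f * (m * p))
      e₂ = solve-∀ ℚring

  Φmax : ℚ
  Φmax = ι n * U ^ D

  Φmax≥0 : 0ℚ ≤ Φmax
  Φmax≥0 = *≥0 (ι≥0 n) (^≥0 D U≥0)

  Φ≤Φmax : ∀ (H : Owned) → Φ U D H ≤ Φmax
  Φ≤Φmax H = ∑-mono (allFin n) (λ v → weight≤ (need D H v) (ℕP.m∸n≤m D (own H v)))
    ⟫ ≤-refl′ (∑ᶠ-const n (U ^ D))
    where
    weight≤ : ∀ j → j ℕ.≤ D → weight U j ≤ U ^ D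
    weight≤ zero _ = ^≥0 D U≥0
    weight≤ (suc j) le = ^-monotone U≥1 le

  γ : ℚ
  γ = 1ℚ - λ₀ * (ι a * ½)

  -- The time at which few vertices are left is random; rounds of the first phase that remain are
  -- passed on to the second, where they only help.
  few-left : ∀ t₂ s g H → Inv g H → length g ℕ.+ (s ℕ.+ (t₂ ℕ.+ t₃)) ℕ.≤ T →
    count (unsat D H) ℕ.≤ a →
    Fail≤ (s ℕ.+ (t₂ ℕ.+ t₃)) g (Ztot H + ΨG g (s ℕ.+ t₂) + Ξ D H * γ ^ s + (Φmax * (1ℚ - λ₀) ^ t₂ + B₃))
  few-left t₂ s g H inv le few = subst (λ t → Fail≤ t g (Ztot H + ΨG g (s ℕ.+ t₂) + Ξ D H * γ ^ s +
      (Φmax * (1ℚ - λ₀) ^ t₂ + B₃))) (ℕP.+-assoc s t₂ t₃) (Fail≤-weaken {s ℕ.+ t₂ ℕ.+ t₃} {g} (≤-refl′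
      (QP.+-assoc (Ztot H + ΨG g (s ℕ.+ t₂)) (Φ U D H * (1ℚ - λ₀) ^ (s ℕ.+ t₂)) B₃) ⟫ QP.+-mono-≤
      (a≤a+b {Ztot H + ΨG g (s ℕ.+ t₂)} (*≥0 (Ξ≥0 H) (^≥0 s γ≥0))) (QP.+-monoˡ-≤ B₃ (*≤* (Φ≥0 H)
      (Φ≤Φmax H) (^≥0 (s ℕ.+ t₂) (diff≥0 λ≤1)) (^-antitone (diff≥0 λ≤1) (a-b≤a λ≥0) (ℕP.m≤n+m t₂ s)))))
      (light (s ℕ.+ t₂) g H inv (subst (λ t → length g ℕ.+ t ℕ.≤ T) (sym (ℕP.+-assoc s t₂ t₃)) le) few))

  -- While more than `a` vertices are unsaturated, exactly `a` are active and the mean of `Ξ` falls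
  -- by the factor γ. As `Ξ` is at least 1, its bound also covers the event that too many are left
  -- at the end.
  heavy : ∀ t₂ s g H → Inv g H → length g ℕ.+ (s ℕ.+ (t₂ ℕ.+ t₃)) ℕ.≤ T →
    Fail≤ (s ℕ.+ (t₂ ℕ.+ t₃)) g (Ztot H + ΨG g (s ℕ.+ t₂) + Ξ D H * γ ^ s + (Φmax * (1ℚ - λ₀) ^ t₂ + B₃))
  heavy t₂ zero g H inv le = by-casesℕ (count (unsat D H)) a (few-left t₂ zero g H inv le)
      (λ _ → Fail≤-trivial {t₂ ℕ.+ t₃} {g} (1≤^ (total (λ _ → true) D H) two≥1 ⟫ ≤-refl′ (sym
      (QP.*-identityʳ (Ξ D H))) ⟫ a≤b+a (+≥0 (Ztot≥0 H) (ΨG≥0 g t₂)) ⟫ a≤a+b (+≥0 (*≥0 Φmax≥0 (^≥0 t₂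
      (diff≥0 λ≤1))) B₃≥0)))
  heavy t₂ (suc s) g H inv le = by-casesℕ (count (unsat D H)) a (few-left t₂ (suc s) g H inv le)
      (λ many → by-cases 1ℚ (ψ₀ * Ψ g) (λ p → Fail≤-trivial {suc s ℕ.+ (t₂ ℕ.+ t₃)} {g} (≥1-part₂
      (Ztot≥0 H) (*≥0 (Ξ≥0 H) (^≥0 (suc s) γ≥0)) (+≥0 (*≥0 Φmax≥0 (^≥0 t₂ (diff≥0 λ≤1))) B₃≥0)
      (ΨG-large g (suc s ℕ.+ t₂) p))) (λ p → round (s ℕ.+ (t₂ ℕ.+ t₃)) (s ℕ.+ t₂) g H A
      (λ H″ → Ξ D H″ * γ ^ s) (Ξ D H * γ ^ suc s) (Φmax * (1ℚ - λ₀) ^ t₂ + B₃) act (ℕP.≤-reflexive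
      (A≡a many)) g≤T p inv (drop many) (λ e H″ inv″ _ → heavy t₂ s (e ∷ g) H″ inv″ (ℕP.≤-trans
      (ℕP.≤-reflexive (sym (ℕP.+-suc (length g) (s ℕ.+ (t₂ ℕ.+ t₃))))) le))))
    where
    A : Fin n → Bool
    A = firstN a (unsat D H)
    A≡a : a ℕ.< count (unsat D H) → count A ≡ a
    A≡a many = firstN-count a (unsat D H) (ℕP.<⇒≤ many)
    act : ∀ v → A v ≡ true → unsat D H v ≡ true
    act v h = firstN-⊆ a (unsat D H) v h
    g≤T : length g ℕ.≤ T
    g≤T = ℕP.≤-trans (ℕP.m≤m+n (length g) _) le
    len = Serving.len n k g A H
    c = Serving.c n k g A H
    H′ = Serving.H′ n k g A H
    drop : a ℕ.< count (unsat D H) → (∀ v → A v ≡ true → y ≤ ∑ᶠ (Serving.allowed n k g A H v)) →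
      ∑ (offers g) (λ o → Ξ D (H′ o) * γ ^ s) ≤ len * (Ξ D H * γ ^ suc s)
    drop many hy = ≤-refl′ (∑-*ʳ (offers g) (γ ^ s) (λ o → Ξ D (H′ o)))
      ⟫ *≤*ʳ (^≥0 s γ≥0) (Potentials.Ξ-drift n k g A H D act y hy ⟫ ≤-refl′ (cong
        (λ z → len * Ξ D H - c * (y * (ι z * (½ * Ξ D H)))) (A≡a many)) ⟫ ≤-by ((c * y - λ₀ * len) *
        (ι a * (½ * Ξ D H))) (*≥0 (diff≥0 cy) (*≥0 (ι≥0 a) (*≥0 (QP.nonNegative⁻¹ ½) (Ξ≥0 H)))) (e₁ len
        (Ξ D H) c y λ₀ (ι a) ½))
      ⟫ ≤-refl′ (e₂ len (Ξ D H) γ (γ ^ s))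
      where
      cy : λ₀ * len ≤ c * y
      cy = rate g A H g≤T (ℕP.≤-reflexive (A≡a many))
        ⟫ *≤*ˡ (Serving.c≥0 n k g A H) (*≤*ˡ y≥0 (a-b≤a q≥0) ⟫ ≤-refl′ (QP.*-identityʳ y))
      e₁ : ∀ l f c y λ₀ a h →
        l * f - c * (y * (a * (h * f))) + (c * y - λ₀ * l) * (a * (h * f)) ≡ l * (f * (1ℚ - λ₀ *
          (a * h)))
      e₁ = solve-∀ ℚring
      e₂ : ∀ l f m p → l * (f * m) * p ≡ l * (f * (m * p))
      e₂ = solve-∀ ℚring

  from-empty : ∀ t₁ t₂ → t₁ ℕ.+ (t₂ ℕ.+ t₃) ℕ.≤ T →
    Fail≤ (t₁ ℕ.+ (t₂ ℕ.+ t₃)) [] (∑ (labelings n) (λ ℓ → ⟦ valid ℓ ⟧ * trap (isCore ∘ ℓ) (inSet ∘ ℓ)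
      (ρ n (count (inSet ∘ ℓ))) D []) + ½ ^ d₀ * (Ψ {n} [] * G ^ (t₁ ℕ.+ t₂)) + Ξ {n} D [] * (1ℚ - λ₀ *
      (ι a * ½)) ^ t₁ + (ι n * U ^ D * (1ℚ - λ₀) ^ t₂ + two ^ n * γ₃ ^ t₃))
  from-empty t₁ t₂ le = heavy t₂ t₁ [] [] (λ ()) le

-- Concrete parameters

-- Every vertex is to own D₀ = 3 (e₀ + 1) edges; e₀ makes the r-th term of the union bound at most 8^-r (2r/n)².
opaque
  e₀ : ℕ
  e₀ = 13

  e₀≥2 : 2 ℕ.≤ e₀
  e₀≥2 = s≤s (s≤s z≤n)

  e₀-small : fromℕℚ 32 * ⅔ ^ suc e₀ ≤ ⅛
  e₀-small = QP.≤ᵇ⇒≤ _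

D₀ : ℕ
D₀ = 3 ℕ.* suc e₀

bin>0 : ∀ m k → k ℕ.≤ m → 0 ℕ.< bin m k
bin>0 m zero _ = s≤s z≤n
bin>0 (suc m) (suc k) (s≤s le) = ℕP.≤-trans (bin>0 m k le) (ℕP.m≤m+n (bin m k) (bin m (suc k)))

total-[] : ∀ {n} S D → total {n} S D [] ≡ D ℕ.* count S
total-[] {n} S D = go (allFin n)
  where
  go : ∀ xs → sumℕ xs (λ v → if S v then D else 0) ≡ D ℕ.* #ᵇ S xs
  go [] = sym (ℕP.*-zeroʳ D)
  go (x ∷ xs) with S x
  ... | true = trans (cong (D ℕ.+_) (go xs)) (sym (ℕP.*-suc D (#ᵇ S xs)))
  ... | false = go xs

-- From (1 + x)^N ≥ 1 + Nx ≥ 2 and (1 + x)(1 - x) ≤ 1.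
half-power : ∀ {x} N → 0ℚ ≤ x → x ≤ 1ℚ → 1ℚ ≤ ι N * x → (1ℚ - x) ^ N ≤ ½
half-power {x} N x≥0 x≤1 h = *-cancel≤ two (QP.positive⁻¹ two) (*≤*ʳ (^≥0 N (diff≥0 x≤1))
    (QP.+-monoʳ-≤ 1ℚ h ⟫ bernoulli N (neg≤ {0ℚ} {1ℚ} 0≤1 ⟫ x≥0)) ⟫ ≤-refl′ (sym (^-*ˡ (1ℚ + x)
    (1ℚ - x) N)) ⟫ ^≤1 N (*≥0 (+≥0 0≤1 x≥0) (diff≥0 x≤1)) (≤-by (x * x) (*≥0 x≥0 x≥0) (eq x)))
  where
  eq : ∀ x → (1ℚ + x) * (1ℚ - x) + x * x ≡ 1ℚ
  eq = solve-∀ ℚring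

½≥0 : 0ℚ ≤ ½
½≥0 = QP.nonNegative⁻¹ ½

½^≤recip : ∀ n → 0 ℕ.< n → ½ ^ n ≤ recip n
½^≤recip n n>0 = ≤-recip {n} n>0 (*≤*ʳ (^≥0 n ½≥0) (ι≤two^ n) ⟫ ≤-refl′ (^-inverse {two} {½} n refl))
  ⟫ ≤-refl′ (QP.*-identityˡ (recip n))

exp-≤-4^ : ∀ J k → expPartial (ι J) k ≤ two ^ (2 ℕ.* J)
exp-≤-4^ J k = *-cancel≤ (½ ^ (2 ℕ.* J)) (^>0 (2 ℕ.* J) (QP.positive⁻¹ ½)) (≤-refl′ (cong (λ x → ½ ^
    (2 ℕ.* J) * expPartial x k) (sym (trans (cong (_* ½) (trans (ι-* 2 J) (cong (_* ι J) (ι-def 2))))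
    (eq (ι J))))) ⟫ exp-≤-geometric (2 ℕ.* J) k ½≥0 (QP.≤ᵇ⇒≤ {½} {1ℚ} _) ⟫ ≤-refl′ (sym
    (^-inverse {½} {two} (2 ℕ.* J) refl)))
  where
  eq : ∀ j → fromℕℚ 2 * j * (pos 1 Q./ 2) ≡ j
  eq = solve-∀ ℚring

module Instance
  (n k u T a J : ℕ)
  (u≥4 : 4 ℕ.≤ u) (n≥8 : 8 ℕ.≤ n) (2K≤n : 2 ℕ.* suc k ℕ.≤ n)
  (8T≤n² : 8 ℕ.* T ℕ.≤ n ℕ.* n)
  (a≤ : 4 ℕ.* u ℕ.* (a ℕ.* suc k) ℕ.≤ n)
  (J≤ : 6 ℕ.* u ℕ.* J ℕ.≤ n)
  (K≥2 : 2 ℕ.≤ suc k)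
  where

  K : ℚ
  K = ι (suc k)

  N : ℚ
  N = ι n

  n>0 : 0 ℕ.< n
  n>0 = ℕP.≤-trans (s≤s z≤n) n≥8

  u>0 : 0 ℕ.< u
  u>0 = ℕP.≤-trans (s≤s z≤n) u≥4

  q p : ℚ
  q = recip u
  p = 1ℚ - q

  U : ℚ
  U = ι u

  q≥0 : 0ℚ ≤ q
  q≥0 = recip≥0 u

  qU : q * U ≡ 1ℚ
  qU = trans (QP.*-comm q U) (*-recip u u>0)

  q≤¼ : q ≤ pos 1 Q./ 4
  q≤¼ = ≤-refl′ (sym (QP.*-identityˡ q))
    ⟫ recip-≤ {u} u>0 (≤-refl′ {1ℚ} {ι 4 * (pos 1 Q./ 4)} (cong (_* (pos 1 Q./ 4)) (sym (ι-def 4)))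
      ⟫ *≤*ʳ (QP.nonNegative⁻¹ (pos 1 Q./ 4)) (ι-mono u≥4))

  q≤1 : q ≤ 1ℚ
  q≤1 = q≤¼ ⟫ QP.≤ᵇ⇒≤ {pos 1 Q./ 4} {1ℚ} _

  p≥0 : 0ℚ ≤ p
  p≥0 = diff≥0 q≤1

  p≤1 : p ≤ 1ℚ
  p≤1 = a-b≤a q≥0

  p≥¾ : pos 3 Q./ 4 ≤ p
  p≥¾ = -≤- {1ℚ} {1ℚ} {pos 1 Q./ 4} {q} QP.≤-refl q≤¼

  y : ℚ
  y = p * N

  N≥0 : 0ℚ ≤ N
  N≥0 = ι≥0 n

  K≥0 : 0ℚ ≤ K
  K≥0 = ι≥0 (suc k)

  R : ℚ
  R = recip n

  NR : N * R ≡ 1ℚ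
  NR = *-recip n n>0

  y≤ : y ≤ N - ι a - ι (3 ℕ.* J)
  y≤ = *-cancel≤ U (ι>0 u>0) (≥0diff (diff≥0 total′ ⟫ ≤-refl′ (sym eq)))
    where
    total′ : U * (ι a + ι (3 ℕ.* J)) ≤ N
    total′ = ≤-refl′ (trans (cong (U *_) (sym (ι-+ a (3 ℕ.* J)))) (sym (ι-* u (a ℕ.+ 3 ℕ.* J))))
      ⟫ ι-mono (ℕP.*-cancelˡ-≤ 2 (ℕP.≤-trans (ℕP.≤-reflexive (e₁ u a J)) (ℕP.≤-trans (ℕP.+-mono-≤
        (ℕP.≤-trans (ℕP.≤-trans (ℕP.*-monoˡ-≤ a (ℕP.*-monoˡ-≤ u (ℕP.m≤m+n 2 2))) (ℕP.*-monoʳ-≤ (4 ℕ.* u)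
        (ℕP.m≤m*n a (suc k)))) a≤) J≤) (ℕP.≤-reflexive (e₂ n)))))
      where
      e₁ : ∀ u a J → 2 ℕ.* (u ℕ.* (a ℕ.+ 3 ℕ.* J)) ≡ 2 ℕ.* u ℕ.* a ℕ.+ 6 ℕ.* u ℕ.* J
      e₁ = NS.solve-∀
      e₂ : ∀ n → n ℕ.+ n ≡ 2 ℕ.* n
      e₂ = NS.solve-∀
    eq : U * (N - ι a - ι (3 ℕ.* J)) - U * y ≡ N - U * (ι a + ι (3 ℕ.* J))
    eq = trans (e₁ U N (ι a) (ι (3 ℕ.* J)) q) (trans (cong (λ z → z * N - U * (ι a + ι (3 ℕ.* J))) qU)
        (cong (_- U * (ι a + ι (3 ℕ.* J))) (QP.*-identityˡ N)))
      where
      e₁ : ∀ u n a j q → u * (n - a - j) - u * ((1ℚ - q) * n) ≡ q * u * n - u * (a + j)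
      e₁ = solve-∀ ℚring

  trapped : ∀ r → ι r ≤ ρ n r * y
  trapped r = ≤-refl′ (trans (sym (QP.*-identityˡ (ι r))) (trans (cong (_* ι r) (sym NR)) (e₀′ N R
      (ι r))))
    ⟫ *≤*ˡ (*≥0 (*≥0 (QP.nonNegative⁻¹ (pos 4 Q./ 3)) (ratio≥0 n r)) N≥0) p≥¾
    ⟫ ≤-refl′ (e₁ (ratio n r) p N)
    where
    e₀′ : ∀ n r x → n * r * x ≡ (pos 4 Q./ 3) * (x * r) * n * (pos 3 Q./ 4)
    e₀′ = solve-∀ ℚring
    e₁ : ∀ x p n → (pos 4 Q./ 3) * x * n * p ≡ (pos 2 Q./ 3) * ((1ℚ + 1ℚ) * x) * (p * n)
    e₁ = solve-∀ ℚring

  -- At most n²/8 edges are present, so 2m ≥ n² - n - n²/4, which is at least n²/2 for n ≥ 4.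
  4m≥n² : ∀ (g : Graph n) → length g ℕ.≤ T → N * N ≤ fromℕℚ 4 * ι (length (nonEdges g))
  4m≥n² g le = ≤-by (two * ((M + M) - (N * (N - 1ℚ) - (ι (length g) + ι (length g)))) + (two * two *
      (ι T - ι (length g)) + ½ * ((N * N - fromℕℚ 8 * ι T) + N * (N - fromℕℚ 4)))) (+≥0 (*≥0 two≥0
      (diff≥0 (nonEdges≥ g))) (+≥0 (*≥0 (*≥0 two≥0 two≥0) (diff≥0 (ι-mono le))) (*≥0
      (QP.nonNegative⁻¹ ½) (+≥0 (diff≥0 T≤) (*≥0 N≥0 (diff≥0 4≤N)))))) (e₁ N M (ι (length g)) (ι T))
    where
    M = ι (length (nonEdges g))
    T≤ : fromℕℚ 8 * ι T ≤ N * N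
    T≤ = ≤-refl′ (trans (cong (_* ι T) (sym (ι-def 8))) (sym (ι-* 8 T)))
      ⟫ ι-mono 8T≤n²
      ⟫ ≤-refl′ (ι-* n n)
    4≤N : fromℕℚ 4 ≤ N
    4≤N = ≤-refl′ (sym (ι-def 4)) ⟫ ι-mono (ℕP.≤-trans (ℕP.m≤m+n 4 4) n≥8)
    e₁ : ∀ n m g t →
      n * n + ((1ℚ + 1ℚ) * ((m + m) - (n * (n - 1ℚ) - (g + g))) + ((1ℚ + 1ℚ) * (1ℚ + 1ℚ) * (t - g) +
        (pos 1 Q./ 2) * ((n * n - fromℕℚ 8 * t) + n * (n - fromℕℚ 4)))) ≡ fromℕℚ 4 * m
    e₁ = solve-∀ ℚring

  n≤m : ∀ (g : Graph n) → length g ℕ.≤ T → two * N ≤ ι (length (nonEdges g))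
  n≤m g le = *-cancel≤ (fromℕℚ 4) (QP.positive⁻¹ (fromℕℚ 4)) (≤-refl′ (e₁ N) ⟫ *≤*ʳ N≥0 (≤-refl′ (sym
      (ι-def 8)) ⟫ ι-mono n≥8) ⟫ 4m≥n² g le)
    where
    e₁ : ∀ n → fromℕℚ 4 * ((1ℚ + 1ℚ) * n) ≡ fromℕℚ 8 * n
    e₁ = solve-∀ ℚring

  2K≤N : two * K ≤ N
  2K≤N = ≤-refl′ (trans (cong (_* K) (sym (ι-def 2))) (sym (ι-* 2 (suc k)))) ⟫ ι-mono 2K≤n

  nonempty : ∀ (g : Graph n) → length g ℕ.≤ T → 0 ℕ.< length (subsets (suc k) (nonEdges g))
  nonempty g le = subst (0 ℕ.<_) (sym (length-subsets (suc k) (nonEdges g))) (bin>0 (length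
      (nonEdges g)) (suc k) (ι-cancel≤ (≤-by K K≥0 (e₁ K) ⟫ 2K≤N ⟫ ≤-by N N≥0 (e₁ N) ⟫ n≤m g le)))
    where
    e₁ : ∀ n → n + n ≡ (1ℚ + 1ℚ) * n
    e₁ = solve-∀ ℚring

  m>0 : ∀ (g : Graph n) → length g ℕ.≤ T → 0 ℕ.< length (nonEdges g)
  m>0 g le = ℕP.≤-trans n>0 (ι-cancel≤ (≤-by N N≥0 (e₁ N) ⟫ n≤m g le))
    where
    e₁ : ∀ n → n + n ≡ (1ℚ + 1ℚ) * n
    e₁ = solve-∀ ℚring

  G : ℚ
  G = 1ℚ + fromℕℚ 8 * (K * R)

  8KR≥0 : 0ℚ ≤ fromℕℚ 8 * (K * R)
  8KR≥0 = *≥0 (QP.nonNegative⁻¹ (fromℕℚ 8)) (*≥0 K≥0 (recip≥0 n))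

  growth : ∀ (g : Graph n) → length g ℕ.≤ T →
    ι (length (nonEdges g)) + K * (N * two) ≤ G * ι (length (nonEdges g))
  growth g le = ≤-by (two * (K * R) * (fromℕℚ 4 * M - N * N)) (*≥0 (*≥0 two≥0 (*≥0 K≥0 (recip≥0 n)))
      (diff≥0 (4m≥n² g le))) (trans (e₁ M K N R) (trans (cong (λ z → (1ℚ + fromℕℚ 8 *
      (K * R)) * M + K * N * two * (1ℚ - z)) NR) (e₂ ((1ℚ + fromℕℚ 8 * (K * R)) * M) (K * N))))
    where
    M = ι (length (nonEdges g))
    e₁ : ∀ m k n r →
      m + k * (n * (1ℚ + 1ℚ)) + (1ℚ + 1ℚ) * (k * r) * (fromℕℚ 4 * m - n * n) ≡ (1ℚ + fromℕℚ 8 *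
        (k * r)) * m + k * n * (1ℚ + 1ℚ) * (1ℚ - n * r)
    e₁ = solve-∀ ℚring
    e₂ : ∀ a b → a + b * (1ℚ + 1ℚ) * (1ℚ - 1ℚ) ≡ a
    e₂ = solve-∀ ℚring

  p³ : ℚ
  p³ = p * (p * p)

  p³≥0 : 0ℚ ≤ p³
  p³≥0 = *≥0 p≥0 (*≥0 p≥0 p≥0)

  p³≤1 : p³ ≤ 1ℚ
  p³≤1 = *≤* p≥0 p≤1 (*≥0 p≥0 p≥0) (*≤* p≥0 p≤1 p≥0 p≤1)

  -- The ideal rate is 2K/n. The three factors 1 - 1/u pay for partners that are active or already
  -- adjacent, for other offered edges meeting the active set, and for the weight left after a
  -- service.
  λ₀ : ℚ
  λ₀ = two * K * R * p³

  λ≥0 : 0ℚ ≤ λ₀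
  λ≥0 = *≥0 (*≥0 (*≥0 two≥0 K≥0) (recip≥0 n)) p³≥0

  2KR≤1 : two * K * R ≤ 1ℚ
  2KR≤1 = recip-≤ {n} n>0 (2K≤N ⟫ ≤-refl′ (sym (QP.*-identityʳ N)))

  λ≤1 : λ₀ ≤ 1ℚ
  λ≤1 = *≤* (*≥0 (*≥0 two≥0 K≥0) (recip≥0 n)) 2KR≤1 p³≥0 p³≤1

  Ka≤N : K * ι a ≤ N
  Ka≤N = ≤-refl′ (trans (QP.*-comm K (ι a)) (sym (ι-* a (suc k))))
    ⟫ ι-mono (ℕP.≤-trans (ℕP.m≤n*m (a ℕ.* suc k) (4 ℕ.* u) {{ℕ.>-nonZero (ℕP.≤-trans u>0
      (ℕP.m≤n*m u 4))}}) a≤)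

  γ≥0 : 0ℚ ≤ 1ℚ - λ₀ * (ι a * ½)
  γ≥0 = diff≥0 (≤-refl′ (e₁ K R p³ (ι a)) ⟫ *≤* (*≥0 (*≥0 K≥0 (ι≥0 a)) (recip≥0 n)) (recip-≤ {n} n>0
      (Ka≤N ⟫ ≤-refl′ (sym (QP.*-identityʳ N)))) p³≥0 p³≤1)
    where
    e₁ : ∀ k r p a → (1ℚ + 1ℚ) * k * r * p * (a * (pos 1 Q./ 2)) ≡ k * a * r * p
    e₁ = solve-∀ ℚring

  rate : ∀ g A H → length g ℕ.≤ T → count A ℕ.≤ a →
    λ₀ * Serving.len n k g A H ≤ Serving.c n k g A H * (y * p)
  rate g A H le A≤a = ≤-refl′ (e₁ K R p len)
    ⟫ *≤*ˡ (*≥0 (recip≥0 n) (*≥0 p≥0 p≥0)) n²c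
    ⟫ ≤-refl′ (trans (e₂ R p N c) (trans (cong (_* (c * (p * N * p))) NR) (QP.*-identityˡ (c *
      (p * N * p)))))
    where
    len = Serving.len n k g A H
    c = Serving.c n k g A H
    m = Serving.m n k g A H
    L = Serving.L n k g A H
    M = ι m
    e₁ : ∀ k r p l → (1ℚ + 1ℚ) * k * r * (p * (p * p)) * l ≡ r * (p * p) * ((1ℚ + 1ℚ) * (k * l * p))
    e₁ = solve-∀ ℚring
    e₂ : ∀ r p n c → r * (p * p) * (n * n * c) ≡ n * r * (c * (p * n * p))
    e₂ = solve-∀ ℚring
    LK : ι L * K ≤ q * M
    LK = *-cancel≤ U (ι>0 u>0) (*≤*ˡ (ι≥0 u) (*≤*ʳ K≥0 (Serving.L≤ n k g A H ⟫ *≤*ʳ N≥0 (ι-mono A≤a)))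
        ⟫ *-cancel≤ (fromℕℚ 4) (QP.positive⁻¹ (fromℕℚ 4)) (≤-refl′ (e₃ U (ι a) N K) ⟫ *≤*ʳ N≥0 4uaK
        ⟫ 4m≥n² g le ⟫ ≤-refl′ (cong (fromℕℚ 4 *_) (sym (trans (sym (QP.*-assoc U q M)) (trans (cong
        (_* M) (*-recip u u>0)) (QP.*-identityˡ M)))))))
      where
      e₃ : ∀ u a n k → fromℕℚ 4 * (u * (a * n * k)) ≡ fromℕℚ 4 * u * (a * k) * n
      e₃ = solve-∀ ℚring
      4uaK : fromℕℚ 4 * U * (ι a * K) ≤ N
      4uaK = ≤-refl′ (sym (trans (ι-* (4 ℕ.* u) (a ℕ.* suc k)) (cong₂ _*_ (trans (ι-* 4 u) (cong (_* U)
          (ι-def 4))) (ι-* a (suc k)))))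
        ⟫ ι-mono a≤
    LK≤M : ι L * K ≤ M
    LK≤M = LK ⟫ *≤*ʳ (ι≥0 m) q≤1 ⟫ ≤-refl′ (QP.*-identityˡ M)
    mc : K * len * p ≤ M * c
    mc = *-cancel≤ M (ι>0 (m>0 g le)) (≤-refl′ (e₄ M K len q) ⟫ *≤*ˡ (*≥0 K≥0 (Serving.len≥0 n k g A H))
        (QP.+-monoʳ-≤ M (neg≤ LK)) ⟫ Serving.c-≥ n k g A H (m>0 g le) LK≤M ⟫ ≤-refl′ (QP.*-assoc M M c))
      where
      e₄ : ∀ m k l q → m * (k * l * (1ℚ - q)) ≡ k * l * (m - q * m)
      e₄ = solve-∀ ℚring
    n²c : two * (K * len * p) ≤ N * N * c
    n²c = *≤*ˡ two≥0 mc
      ⟫ ≤-refl′ (e₅ M c)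
      ⟫ *≤*ʳ (Serving.c≥0 n k g A H) (nonEdges≤ g ⟫ *≤*ˡ N≥0 (a-b≤a 0≤1))
      where
      e₅ : ∀ m c → (1ℚ + 1ℚ) * (m * c) ≡ (m + m) * c
      e₅ = solve-∀ ℚring

  U≥1 : 1ℚ ≤ U
  U≥1 = ι≥1 u>0

  γ : ℚ
  γ = 1ℚ - λ₀ * (ι a * ½)

  from-empty : ∀ t₁ t₂ → t₁ ℕ.+ (t₂ ℕ.+ 148 ℕ.* n) ℕ.≤ T →
    Process.Fail≤ n (suc k) (t₁ ℕ.+ (t₂ ℕ.+ 148 ℕ.* n)) [] (∑ (labelings n) (λ ℓ → ⟦ valid ℓ ⟧ * trap
      (isCore ∘ ℓ) (inSet ∘ ℓ) (ρ n (count (inSet ∘ ℓ))) D₀ []) + ½ ^ (3 ℕ.* J) * (Ψ {n} [] * G ^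
      (t₁ ℕ.+ t₂)) + Ξ {n} D₀ [] * γ ^ t₁ + (N * U ^ D₀ * (1ℚ - λ₀) ^ t₂ + two ^ n * γ₃ ^ (148 ℕ.* n)))
  from-empty = Phases.from-empty n k D₀ T (148 ℕ.* n) a (3 ℕ.* J) y q U λ₀ G (ℕP.≤-trans
      (ℕP.m≤m+n 3 5) n≥8) nonempty q≥0 q≤1 U≥1 qU (*≥0 p≥0 N≥0) y≤ trapped
      (a≤a+b 8KR≥0) growth λ≥0 λ≤1 γ≥0 rate

  trap-small : ∑ (labelings n) (λ ℓ → ⟦ valid ℓ ⟧ * trap (isCore ∘ ℓ) (inSet ∘ ℓ) (ρ n (count
      (inSet ∘ ℓ))) D₀ []) ≤ fromℕℚ 4 * R
  trap-small = ≤-refl′ (∑-cong (labelings n) (λ ℓ → cong (λ t → ⟦ valid ℓ ⟧ * ρ n (count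
      (inSet ∘ ℓ)) ^ t) (total-[] (isCore ∘ ℓ) D₀)))
    ⟫ UnionBound.union-bound n e₀ n>0 e₀≥2 e₀-small

  module Bounds
    (t₁ t₂ : ℕ)
    (a≥ : n ℕ.≤ 8 ℕ.* u ℕ.* (suc k ℕ.* a))
    (J≥ : 8 ℕ.* (suc k ℕ.* T) ℕ.≤ n ℕ.* J)
    (2^J : ι n * ι n ≤ two ^ J)
    (t₁≡ : t₁ ≡ 32 ℕ.* u ℕ.* suc D₀ ℕ.* n)
    (T≥ : t₁ ℕ.+ (t₂ ℕ.+ 148 ℕ.* n) ℕ.≤ T)
    where

    -- The loss per round is K a p³/n, where K a/n ≥ 1/(8u) and p³ ≥ (3/4)³ ≥ 1/4.
    γ≤ : γ ≤ 1ℚ - recip (32 ℕ.* u)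
    γ≤ = -≤- {1ℚ} {1ℚ} {λ₀ * (ι a * ½)} {recip (32 ℕ.* u)} QP.≤-refl (≤-refl′ (sym (QP.*-identityˡ
        (recip (32 ℕ.* u)))) ⟫ recip-≤ {32 ℕ.* u} (ℕP.≤-trans u>0 (ℕP.m≤n*m u 32)) (1≤ ⟫ ≤-refl′ (trans
        (e₂ U (K * ι a) R p³) (sym (trans (cong (_* (λ₀ * (ι a * ½))) (trans (ι-* 32 u) (cong (_* U)
        (ι-def 32)))) (e₃ U K R p³ (ι a)))))))
      where
      p³≥ : pos 1 Q./ 4 ≤ p³
      p³≥ = QP.≤ᵇ⇒≤ {pos 1 Q./ 4} {(pos 3 Q./ 4) * ((pos 3 Q./ 4) * (pos 3 Q./ 4))} _
        ⟫ *≤* (QP.nonNegative⁻¹ (pos 3 Q./ 4)) p≥¾ (QP.nonNegative⁻¹ ((pos 3 Q./ 4) * (pos 3 Q./ 4)))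
          (*≤* (QP.nonNegative⁻¹ (pos 3 Q./ 4)) p≥¾ (QP.nonNegative⁻¹ (pos 3 Q./ 4)) p≥¾)
      8uKaR : 1ℚ ≤ fromℕℚ 8 * U * (K * ι a) * R
      8uKaR = ≤-refl′ (sym NR)
        ⟫ *≤*ʳ (recip≥0 n) (ι-mono a≥ ⟫ ≤-refl′ (trans (ι-* (8 ℕ.* u) (suc k ℕ.* a)) (cong₂ _*_ (trans
          (ι-* 8 u) (cong (_* U) (ι-def 8))) (ι-* (suc k) a))))
      1≤ : 1ℚ ≤ (fromℕℚ 8 * U * (K * ι a) * R) * (fromℕℚ 4 * p³)
      1≤ = *≤* 0≤1 8uKaR 0≤1 (*≤*ˡ (QP.nonNegative⁻¹ (fromℕℚ 4)) p³≥)
      e₂ : ∀ u x r p → (fromℕℚ 8 * u * x * r) * (fromℕℚ 4 * p) ≡ fromℕℚ 32 * u * x * r * p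
      e₂ = solve-∀ ℚring
      e₃ : ∀ u k r p a →
        fromℕℚ 32 * u * ((1ℚ + 1ℚ) * k * r * p * (a * (pos 1 Q./ 2))) ≡ fromℕℚ 32 * u * (k * a) * r * p
      e₃ = solve-∀ ℚring

    -- Initially `Ξ` is 2^(D₀ n). Every 32u rounds halve the bound, so `t₁` provides (D₀ + 1) n
    -- halvings and leaves 2^(-n).
    heavy-small : Ξ {n} D₀ [] * γ ^ t₁ ≤ R
    heavy-small = *≤* (^≥0 (total {n} (λ _ → true) D₀ []) two≥0) (≤-refl′ (trans (cong (two ^_) (trans
        (total-[] {n} (λ _ → true) D₀) (cong (D₀ ℕ.*_) count-true))) (^-^ two D₀ n))) (^≥0 t₁ γ≥0) power
      ⟫ ≤-refl′ (sym (^-*ˡ (two ^ D₀) (½ ^ suc D₀) n))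
      ⟫ ≤-refl′ (cong (_^ n) (trans (e₁ (two ^ D₀) ½ (½ ^ D₀)) (trans (cong (½ *_)
        (^-inverse {two} {½} D₀ refl)) (QP.*-identityʳ ½))))
      ⟫ ½^≤recip n n>0
      where
      count-true : count {n} (λ _ → true) ≡ n
      count-true = ι-injective (trans (ι-count {n} (λ _ → true)) (trans (∑ᶠ-const n 1ℚ) (QP.*-identityʳ
          (ι n))))
      e₁ : ∀ a h b → a * (h * b) ≡ h * (a * b)
      e₁ = solve-∀ ℚring
      x = recip (32 ℕ.* u)
      32u>0 : 0 ℕ.< 32 ℕ.* u
      32u>0 = ℕP.≤-trans u>0 (ℕP.m≤n*m u 32)
      power : γ ^ t₁ ≤ (½ ^ suc D₀) ^ n
      power = ≤-refl′ (trans (cong (γ ^_) t₁≡) (trans (^-^ γ (32 ℕ.* u ℕ.* suc D₀) n) (cong (_^ n)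
          (^-^ γ (32 ℕ.* u) (suc D₀)))))
        ⟫ ^-mono n (^≥0 (suc D₀) (^≥0 (32 ℕ.* u) γ≥0)) (^-mono (suc D₀) (^≥0 (32 ℕ.* u) γ≥0) (^-mono
          (32 ℕ.* u) γ≥0 γ≤ ⟫ half-power (32 ℕ.* u) (recip≥0 (32 ℕ.* u)) (≤-refl′ (sym
          (QP.*-identityˡ x)) ⟫ recip-≤ {32 ℕ.* u} 32u>0 (ι≥1 32u>0 ⟫ ≤-refl′ (sym (QP.*-identityʳ (ι
          (32 ℕ.* u)))))) (≤-refl′ (sym (*-recip (32 ℕ.* u) 32u>0)))))

    -- As 74 rounds halve the potential, 148 n rounds give 4^(-n) against the initial 2^n.
    booster-small : two ^ n * γ₃ ^ (148 ℕ.* n) ≤ R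
    booster-small = *≤*ˡ (^≥0 n two≥0) (≤-refl′ (trans (^-^ γ₃ 148 n) (cong (_^ n) (^-^ γ₃ 74 2)))
        ⟫ ^-mono n (^≥0 2 γ₃⁷⁴≥0) (^-mono 2 γ₃⁷⁴≥0 γ₃⁷⁴≤))
      ⟫ ≤-refl′ (sym (^-*ˡ two (½ ^ 2) n))
      ⟫ ½^≤recip n n>0
      where
      γ₃⁷⁴≥0 : 0ℚ ≤ γ₃ ^ 74
      γ₃⁷⁴≥0 = ^≥0 74 (QP.nonNegative⁻¹ γ₃)
      γ₃⁷⁴≤ : γ₃ ^ 74 ≤ ½
      γ₃⁷⁴≤ = half-power {pos 1 Q./ 74} 74 (QP.nonNegative⁻¹ (pos 1 Q./ 74))
          (QP.≤ᵇ⇒≤ {pos 1 Q./ 74} {1ℚ} _) (≤-refl′ {1ℚ} {ι 74 * (pos 1 Q./ 74)} (cong (_*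
          (pos 1 Q./ 74)) (sym (ι-def 74))))

    -- The growth is at most exp (8KT/n) ≤ exp J ≤ 4^J. Of the 2^(-3J) two thirds are spent on it,
    -- and the remaining 2^(-J) beats n².
    degree-small : ½ ^ (3 ℕ.* J) * (Ψ {n} [] * G ^ (t₁ ℕ.+ t₂)) ≤ R
    degree-small = *≤*ˡ (^≥0 (3 ℕ.* J) ½≥0) (*≤* (∑≥0 (allFin n) (λ _ → 0≤1)) (≤-refl′ (trans
        (∑ᶠ-const n 1ℚ) (QP.*-identityʳ N))) (^≥0 (t₁ ℕ.+ t₂) G≥0) GT)
      ⟫ ≤-refl′ (trans (cong (_* (N * two ^ (2 ℕ.* J))) (^-+ ½ J (2 ℕ.* J))) (trans (e₁ (½ ^ J) (½ ^
        (2 ℕ.* J)) N (two ^ (2 ℕ.* J))) (trans (cong (½ ^ J * N *_) (^-inverse {½} {two}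
        (2 ℕ.* J) refl)) (QP.*-identityʳ (½ ^ J * N)))))
      ⟫ ≤-recip {n} n>0 (≤-refl′ (e₂ N (½ ^ J)) ⟫ *≤*ˡ (^≥0 J ½≥0) 2^J ⟫ ≤-refl′
        (^-inverse {½} {two} J refl))
      ⟫ ≤-refl′ (QP.*-identityˡ R)
      where
      e₁ : ∀ a b n c → a * b * (n * c) ≡ a * n * (b * c)
      e₁ = solve-∀ ℚring
      e₂ : ∀ n h → n * (h * n) ≡ h * (n * n)
      e₂ = solve-∀ ℚring
      G≥0 : 0ℚ ≤ G
      G≥0 = +≥0 0≤1 8KR≥0
      GT : G ^ (t₁ ℕ.+ t₂) ≤ two ^ (2 ℕ.* J)
      GT = ^-monotone (a≤a+b 8KR≥0) (ℕP.≤-trans (ℕP.+-monoʳ-≤ t₁ (ℕP.m≤m+n t₂ (148 ℕ.* n))) T≥)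
        ⟫ geometric-≤-exp T 8KR≥0
        ⟫ expPartial-mono (suc T) (*≥0 (ι≥0 T) 8KR≥0) (≤-refl′ (e₃ (ι T) K R) ⟫ recip-≤ {n} n>0 (≤-refl′
          (sym (trans (ι-* 8 (suc k ℕ.* T)) (cong₂ _*_ (ι-def 8) (ι-* (suc k) T)))) ⟫ ι-mono J≥
          ⟫ ≤-refl′ (ι-* n J)))
        ⟫ exp-≤-4^ J (suc T)
        where
        e₃ : ∀ t k r → t * (fromℕℚ 8 * (k * r)) ≡ fromℕℚ 8 * (k * t) * r
        e₃ = solve-∀ ℚring

    upper : Process.Fail≤ n (suc k) (t₁ ℕ.+ (t₂ ℕ.+ 148 ℕ.* n)) [] (fromℕℚ 7 * R + U ^ D₀ * (N *
        (1ℚ - λ₀) ^ t₂))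
    upper = Process.Fail≤-weaken n (suc k) {t₁ ℕ.+ (t₂ ℕ.+ 148 ℕ.* n)} {[]} (QP.+-mono-≤ (QP.+-mono-≤
        (QP.+-mono-≤ trap-small degree-small) heavy-small) (QP.+-monoʳ-≤ (N * U ^ D₀ *
        (1ℚ - λ₀) ^ t₂) booster-small) ⟫ ≤-refl′ (e₁ R N (U ^ D₀) ((1ℚ - λ₀) ^ t₂)))
        (from-empty t₁ t₂ T≥)
      where
      e₁ : ∀ r n u l → fromℕℚ 4 * r + r + r + (n * u * l + r) ≡ fromℕℚ 7 * r + u * (n * l)
      e₁ = solve-∀ ℚring

-- A discrete logarithm

largest : ∀ (P : ℕ → Set) → (∀ s → P s ⊎ ¬ P s) → P 0 → ∀ S → ¬ P S → Σ ℕ λ s → P s × ¬ P (suc s)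
largest P dec P0 zero h = ⊥-elim (h P0)
largest P dec P0 (suc S) h with dec S
... | inj₁ p = S , p , h
... | inj₂ np = largest P dec P0 S np

floor : ∀ m d → 0 ℕ.< d → Σ ℕ λ a → (d ℕ.* a ℕ.≤ m) × (m ℕ.< d ℕ.* suc a)
floor zero d d>0 = 0 , ℕP.≤-reflexive (ℕP.*-zeroʳ d) , ℕP.≤-trans d>0 (ℕP.≤-reflexive (sym
    (ℕP.*-identityʳ d)))
floor (suc m) d d>0 with floor m d d>0
... | a , lo , hi with suc m ℕP.<? d ℕ.* suc a
... | yes p = a , ℕP.≤-trans lo (ℕP.n≤1+n m) , p
... | no p = suc a , ℕP.≮⇒≥ p , ℕP.≤-trans (s≤s hi) (ℕP.≤-trans (ℕP.+-monoˡ-≤ (d ℕ.* suc a) d>0)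
    (ℕP.≤-reflexive (sym (ℕP.*-suc d (suc a)))))

square-cancel : ∀ {a b} → a ℕ.* a ℕ.≤ b ℕ.* b → a ℕ.≤ b
square-cancel {a} {b} h = ℕP.≮⇒≥ (λ lt → ℕP.<-irrefl refl (ℕP.<-≤-trans (ℕP.*-mono-< lt lt) h))

module Log (b n : ℕ) (b>0 : 0 ℕ.< b) (n>0 : 0 ℕ.< n) where

  bn : ℕ
  bn = b ℕ.* n

  bn>0 : 0 ℕ.< bn
  bn>0 = ℕP.*-mono-≤ b>0 n>0

  z : ℚ
  z = recip bn

  z≥0 : 0ℚ ≤ z
  z≥0 = recip≥0 bn

  z≤1 : z ≤ 1ℚ
  z≤1 = ≤-refl′ (sym (QP.*-identityˡ z))
    ⟫ recip-≤ {bn} bn>0 (ι≥1 bn>0 ⟫ ≤-refl′ (sym (QP.*-identityʳ (ι bn))))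

  -- Approximately s ≤ b n log n.
  Below : ℕ → Set
  Below s = 1ℚ ≤ ι n * (1ℚ - z) ^ s

  below? : ∀ s → Below s ⊎ ¬ Below s
  below? s with 1ℚ Q.≤? ι n * (1ℚ - z) ^ s
  ... | yes p = inj₁ p
  ... | no p = inj₂ p

  geometric-pair : ∀ s → (1ℚ + z) ^ s * (1ℚ - z) ^ s ≤ 1ℚ
  geometric-pair s = ≤-refl′ (sym (^-*ˡ (1ℚ + z) (1ℚ - z) s))
    ⟫ ^≤1 s (*≥0 (+≥0 0≤1 z≥0) (diff≥0 z≤1)) (≤-by (z * z) (*≥0 z≥0 z≥0) (eq z))
    where
    eq : ∀ x → (1ℚ + x) * (1ℚ - x) + x * x ≡ 1ℚ
    eq = solve-∀ ℚring

  below-growth : ∀ s → Below s → (1ℚ + z) ^ s ≤ ι n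
  below-growth s h = ≤-refl′ (sym (QP.*-identityʳ ((1ℚ + z) ^ s)))
    ⟫ *≤*ˡ (^≥0 s (+≥0 0≤1 z≥0)) h
    ⟫ ≤-refl′ (e₁ ((1ℚ + z) ^ s) (ι n) ((1ℚ - z) ^ s))
    ⟫ *≤*ˡ (ι≥0 n) (geometric-pair s)
    ⟫ ≤-refl′ (QP.*-identityʳ (ι n))
    where
    e₁ : ∀ a n c → a * (n * c) ≡ n * (a * c)
    e₁ = solve-∀ ℚring

  opaque
    logarithm : Σ ℕ λ s → Below s × ¬ Below (suc s)
    -- The search stops at b n · n: there Bernoulli gives (1 + z)^(bn·n) ≥ 1 + n, while `Below`
    -- would force at most n.
    logarithm = largest Below below? (ι≥1 n>0 ⟫ ≤-refl′ (sym (QP.*-identityʳ (ι n)))) (bn ℕ.* n)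
        (λ h → <⇒≱ℚ (subst (_< 1ℚ + ι n) (QP.+-identityˡ (ι n)) (QP.+-monoˡ-< (ι n) 0<1)) (≤-refl′ (cong
        (1ℚ +_) (sym whole)) ⟫ bernoulli (bn ℕ.* n) (neg≤ {0ℚ} {1ℚ} 0≤1 ⟫ z≥0) ⟫ below-growth
        (bn ℕ.* n) h))
      where
      whole : ι (bn ℕ.* n) * z ≡ ι n
      whole = trans (cong (_* z) (ι-* bn n)) (trans (e₁ (ι bn) (ι n) z) (trans (cong (_* ι n)
          (*-recip bn bn>0)) (QP.*-identityˡ (ι n))))
        where
        e₁ : ∀ b n z → b * n * z ≡ b * z * n
        e₁ = solve-∀ ℚring

  s : ℕ
  s = proj₁ logarithm

  s-below : Below s
  s-below = proj₁ (proj₂ logarithm)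

  s-above : ι n * (1ℚ - z) ^ suc s ≤ 1ℚ
  s-above = QP.<⇒≤ (QP.≰⇒> (proj₂ (proj₂ logarithm)))

  below⇒≤s : ∀ S → Below S → S ℕ.≤ s
  below⇒≤s S h with S ℕP.≤? s
  ... | yes p = p
  ... | no p = ⊥-elim (proj₂ (proj₂ logarithm) (h ⟫ *≤*ˡ (ι≥0 n) (^-antitone (diff≥0 z≤1) (a-b≤a z≥0)
      (ℕP.≰⇒> p))))

  -- With h ≈ s/2, Bernoulli gives (h z)² ≤ (1 + z)^s ≤ n.
  s-sublinear : ∀ C → 16 ℕ.* (C ℕ.* C) ℕ.< n → 2 ℕ.* C ℕ.≤ n → C ℕ.* s ℕ.≤ b ℕ.* (n ℕ.* n)
  s-sublinear C big₁ big₂ = cases (proj₁ f) (proj₁ (proj₂ f)) (proj₂ (proj₂ f))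
    where
    f = floor s 2 (s≤s z≤n)
    cases : ∀ h → 2 ℕ.* h ℕ.≤ s → s ℕ.< 2 ℕ.* suc h → C ℕ.* s ℕ.≤ b ℕ.* (n ℕ.* n)
    cases h lo hi = ℕP.*-cancelˡ-≤ 2 (ℕP.≤-trans (ℕP.*-monoʳ-≤ 2 (ℕP.*-monoʳ-≤ C (ℕP.≤-pred
        (ℕP.≤-trans hi (ℕP.≤-reflexive (ℕP.*-suc 2 h)))))) (ℕP.≤-trans (ℕP.≤-reflexive (e₁ C h))
        (ℕP.≤-trans (ℕP.+-mono-≤ (ℕP.≤-trans big₂ (ℕP.≤-trans (ℕP.m≤m*n n n {{ℕ.>-nonZero n>0}})
        (ℕP.m≤n*m (n ℕ.* n) b {{ℕ.>-nonZero b>0}}))) (square-cancel square-bound)) (ℕP.≤-reflexive (e₂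
        (b ℕ.* (n ℕ.* n)))))))
      where
      e₁ : ∀ C h → 2 ℕ.* (C ℕ.* suc (2 ℕ.* h)) ≡ 2 ℕ.* C ℕ.+ 4 ℕ.* C ℕ.* h
      e₁ = NS.solve-∀
      e₂ : ∀ x → x ℕ.+ x ≡ 2 ℕ.* x
      e₂ = NS.solve-∀
      hz≥0 : 0ℚ ≤ ι h * z
      hz≥0 = *≥0 (ι≥0 h) z≥0
      hz≤ : ι h * z ≤ (1ℚ + z) ^ h
      hz≤ = a≤b+a 0≤1 ⟫ bernoulli h (neg≤ {0ℚ} {1ℚ} 0≤1 ⟫ z≥0)
      square : (ι h * z) * (ι h * z) ≤ ι n
      square = *≤* hz≥0 hz≤ hz≥0 hz≤
        ⟫ ≤-refl′ (sym (^-+ (1ℚ + z) h h))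
        ⟫ ^-monotone (a≤a+b z≥0) (ℕP.≤-trans (ℕP.≤-reflexive (cong (h ℕ.+_) (sym
          (ℕP.+-identityʳ h)))) lo)
        ⟫ below-growth s s-below
      h² : h ℕ.* h ℕ.≤ bn ℕ.* bn ℕ.* n
      h² = ι-cancel≤ (≤-refl′ (trans (ι-* h h) (sym (trans (e₅ (ι bn) (ι h) z) (trans (cong
          (λ o → ι h * ι h * (o * o)) (*-recip bn bn>0)) (QP.*-identityʳ (ι h * ι h)))))) ⟫ *≤*ˡ (*≥0
          (ι≥0 bn) (ι≥0 bn)) square ⟫ ≤-refl′ (sym (trans (ι-* (bn ℕ.* bn) n) (cong (_* ι n)
          (ι-* bn bn)))))
        where
        e₅ : ∀ b h z → b * b * (h * z * (h * z)) ≡ h * h * (b * z * (b * z))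
        e₅ = solve-∀ ℚring
      square-bound : 4 ℕ.* C ℕ.* h ℕ.* (4 ℕ.* C ℕ.* h) ℕ.≤ b ℕ.* (n ℕ.* n) ℕ.* (b ℕ.* (n ℕ.* n))
      square-bound = ℕP.≤-trans (ℕP.≤-reflexive (e₆ C h)) (ℕP.≤-trans (ℕP.*-mono-≤ (ℕP.<⇒≤ big₁) h²)
          (ℕP.≤-reflexive (e₇ b n)))
        where
        e₆ : ∀ C h → 4 ℕ.* C ℕ.* h ℕ.* (4 ℕ.* C ℕ.* h) ≡ 16 ℕ.* (C ℕ.* C) ℕ.* (h ℕ.* h)
        e₆ = NS.solve-∀
        e₇ : ∀ b n → n ℕ.* (b ℕ.* n ℕ.* (b ℕ.* n) ℕ.* n) ≡ b ℕ.* (n ℕ.* n) ℕ.* (b ℕ.* (n ℕ.* n))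
        e₇ = NS.solve-∀

  -- Here (1 + 2z)^S ≤ n, and (1 + 2z)(1 - z) ≥ 1 converts it to a power of 1 - z. The factor 2 is
  -- lost, so this is used only where constants do not matter.
  exp-below : ∀ {x} S → 2 ℕ.≤ bn → ι S * (two * z) ≤ x → ExpLe x n → Below S
  exp-below {x} S bn≥2 le h = ≤-refl′ (sym (1^ S))
    ⟫ ^-mono S 0≤1 (≥0diff (*≥0 z≥0 (diff≥0 2z≤1) ⟫ ≤-refl′ (e₁ z)))
    ⟫ ≤-refl′ (^-*ˡ (1ℚ + two * z) (1ℚ - z) S)
    ⟫ *≤*ʳ (^≥0 S (diff≥0 z≤1)) (ExpLe-elim S n (*≥0 two≥0 z≥0) le h)
    where
    2z≤1 : two * z ≤ 1ℚ
    2z≤1 = recip-≤ {bn} bn>0 (≤-refl′ (sym (ι-def 2)) ⟫ ι-mono bn≥2 ⟫ ≤-refl′ (sym (QP.*-identityʳ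
        (ι bn))))
    e₁ : ∀ z → z * (1ℚ - (1ℚ + 1ℚ) * z) ≡ (1ℚ + (1ℚ + 1ℚ) * z) * (1ℚ - z) - 1ℚ
    e₁ = solve-∀ ℚring

-- The schedule of the online algorithm

module Constants (e : ℕ) where

  -- For ε ≥ 1/e: the rate loss (1 - 1/u)³ ≥ h/(2b) and the margin 1 + 1/b of the second phase
  -- combine to 2(b + 1)/h = 1 + 3/h, which leaves room below 1 + ε for the O(n) other rounds.
  b h u c₁ M C : ℕ
  b = suc (3 ℕ.* e)
  h = suc (6 ℕ.* e)
  u = 6 ℕ.* b
  c₁ = 32 ℕ.* u ℕ.* suc D₀
  -- K = o(log n) enters as M K n ≤ s. The three summands absorb the O(n) rounds outside the second
  -- phase, the rounding of `t₂`, and the step from s to s + 1.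
  M = 2 ℕ.* e ℕ.* h ℕ.* (c₁ ℕ.+ 148) ℕ.+ 2 ℕ.* e ℕ.* h ℕ.+ 2 ℕ.* e ℕ.* suc b
  C = 96 ℕ.* u

  b>0 : 0 ℕ.< b
  b>0 = s≤s z≤n

  u>0 : 0 ℕ.< u
  u>0 = ℕP.≤-trans b>0 (ℕP.m≤n*m b 6)

module Schedule (e k n : ℕ) (n>0 : 0 ℕ.< n) where

  open Constants e
  open Log b n b>0 n>0 public

  K : ℕ
  K = suc k

  bKh>0 : 0 ℕ.< b ℕ.* (K ℕ.* h)
  bKh>0 = ℕP.*-mono-≤ b>0 (ℕP.*-mono-≤ {1} {K} {1} {h} (s≤s z≤n) (s≤s z≤n))

  4uK>0 : 0 ℕ.< 4 ℕ.* u ℕ.* K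
  4uK>0 = ℕP.*-mono-≤ {1} {4 ℕ.* u} {1} {K} (ℕP.≤-trans u>0 (ℕP.m≤n*m u 4)) (s≤s z≤n)

  18u>0 : 0 ℕ.< 18 ℕ.* u
  18u>0 = ℕP.≤-trans u>0 (ℕP.m≤n*m u 18)

  opaque
    -- At rate at least K h z, b t₂ rounds amount to (b + 1)(s + 1) factors 1 - z, hence to at most
    -- n^(-(b+1)). The summand `b ℕ.* (K ℕ.* h)` is the cost of rounding up.
    t₂-def : Σ ℕ λ t₂ →
      (suc b ℕ.* suc s ℕ.≤ b ℕ.* (K ℕ.* h) ℕ.* t₂) × (b ℕ.* (K ℕ.* h) ℕ.* t₂ ℕ.≤ suc b ℕ.* suc s ℕ.+ b
        ℕ.* (K ℕ.* h))
    t₂-def with floor (suc b ℕ.* suc s) (b ℕ.* (K ℕ.* h)) bKh>0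
    ... | f , lo , hi = suc f , ℕP.<⇒≤ hi , ℕP.≤-trans (ℕP.≤-reflexive (trans (ℕP.*-suc (b ℕ.*
        (K ℕ.* h)) f) (ℕP.+-comm (b ℕ.* (K ℕ.* h)) _))) (ℕP.+-monoˡ-≤ (b ℕ.* (K ℕ.* h)) lo)

    a-def : Σ ℕ λ a → (4 ℕ.* u ℕ.* K ℕ.* a ℕ.≤ n) × (n ℕ.< 4 ℕ.* u ℕ.* K ℕ.* suc a)
    a-def = floor n (4 ℕ.* u ℕ.* K) 4uK>0

    J-def : Σ ℕ λ J₁ → (18 ℕ.* u ℕ.* J₁ ℕ.≤ n) × (n ℕ.< 18 ℕ.* u ℕ.* suc J₁)
    J-def = floor n (18 ℕ.* u) 18u>0

  t₁ t₂ T a J₁ J : ℕ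
  t₁ = c₁ ℕ.* n
  t₂ = proj₁ t₂-def
  T = t₁ ℕ.+ (t₂ ℕ.+ 148 ℕ.* n)
  a = proj₁ a-def
  J₁ = proj₁ J-def
  J = 3 ℕ.* J₁

  module Large (e>0 : 0 ℕ.< e) (K≥2 : 2 ℕ.≤ K) (s≥ : M ℕ.* K ℕ.* n ℕ.≤ s) (big₁ : 16 ℕ.*
      (C ℕ.* C) ℕ.< n) (big₂ : 2 ℕ.* C ℕ.≤ n) (big₃ : 18 ℕ.* u ℕ.* (18 ℕ.* u ℕ.* (18 ℕ.* u)) ℕ.≤ n) where

    rounds : e ℕ.* (2 ℕ.* K ℕ.* b ℕ.* T) ℕ.≤ suc e ℕ.* s
    rounds = ℕP.*-cancelˡ-≤ h (ℕP.≤-trans (ℕP.≤-reflexive (e₁ e h K b t₂ c₁ n)) (ℕP.≤-trans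
        (ℕP.+-monoʳ-≤ X (ℕP.*-monoʳ-≤ (2 ℕ.* e) (proj₂ (proj₂ t₂-def)))) (ℕP.≤-trans (ℕP.≤-reflexive
        (e₂ X e b s (b ℕ.* (K ℕ.* h)))) (ℕP.≤-trans (ℕP.+-monoʳ-≤ (2 ℕ.* e ℕ.* suc b ℕ.* s)
        (ℕP.≤-trans pieces (ℕP.*-monoʳ-≤ b s≥))) (ℕP.≤-reflexive (e₃ e s))))))
      where
      X = 2 ℕ.* e ℕ.* h ℕ.* (c₁ ℕ.+ 148) ℕ.* (b ℕ.* K ℕ.* n)
      e₁ : ∀ e h K b t c n →
        h ℕ.* (e ℕ.* (2 ℕ.* K ℕ.* b ℕ.* (c ℕ.* n ℕ.+ (t ℕ.+ 148 ℕ.* n)))) ≡ 2 ℕ.* e ℕ.* h ℕ.*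
          (c ℕ.+ 148) ℕ.* (b ℕ.* K ℕ.* n) ℕ.+ 2 ℕ.* e ℕ.* (b ℕ.* (K ℕ.* h) ℕ.* t)
      e₁ = NS.solve-∀
      e₂ : ∀ X e b s d →
        X ℕ.+ 2 ℕ.* e ℕ.* (suc b ℕ.* suc s ℕ.+ d) ≡ 2 ℕ.* e ℕ.* suc b ℕ.* s ℕ.+
          (X ℕ.+ 2 ℕ.* e ℕ.* d ℕ.+ 2 ℕ.* e ℕ.* suc b)
      e₂ = NS.solve-∀
      -- The identity 2e(b + 1) + b = h(e + 1), for which b = 3e + 1 and h = 6e + 1 were chosen.
      e₃ : ∀ e s →
        2 ℕ.* e ℕ.* suc (suc (3 ℕ.* e)) ℕ.* s ℕ.+ suc (3 ℕ.* e) ℕ.* s ≡ suc (6 ℕ.* e) ℕ.* (suc e ℕ.* s)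
      e₃ = NS.solve-∀
      bKn≥1 : 1 ℕ.≤ b ℕ.* K ℕ.* n
      bKn≥1 = ℕP.*-mono-≤ {1} {b ℕ.* K} {1} {n} (ℕP.*-mono-≤ {1} {b} {1} {K} b>0 (s≤s z≤n)) n>0
      pieces : X ℕ.+ 2 ℕ.* e ℕ.* (b ℕ.* (K ℕ.* h)) ℕ.+ 2 ℕ.* e ℕ.* suc b ℕ.≤ b ℕ.* (M ℕ.* K ℕ.* n)
      pieces = ℕP.≤-trans (ℕP.+-mono-≤ (ℕP.+-monoʳ-≤ X (ℕP.≤-trans (ℕP.≤-reflexive (e₅ e b K h))
          (ℕP.*-monoʳ-≤ (2 ℕ.* e ℕ.* h) (ℕP.m≤m*n (b ℕ.* K) n {{ℕ.>-nonZero n>0}})))) (ℕP.m≤m*n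
          (2 ℕ.* e ℕ.* suc b) (b ℕ.* K ℕ.* n) {{ℕ.>-nonZero bKn≥1}})) (ℕP.≤-reflexive (e₆
          (2 ℕ.* e ℕ.* h ℕ.* (c₁ ℕ.+ 148)) (2 ℕ.* e ℕ.* h) (2 ℕ.* e ℕ.* suc b) b K n))
        where
        e₅ : ∀ e b K h → 2 ℕ.* e ℕ.* (b ℕ.* (K ℕ.* h)) ≡ 2 ℕ.* e ℕ.* h ℕ.* (b ℕ.* K)
        e₅ = NS.solve-∀
        e₆ : ∀ x y w b K n →
          x ℕ.* (b ℕ.* K ℕ.* n) ℕ.+ y ℕ.* (b ℕ.* K ℕ.* n) ℕ.+ w ℕ.* (b ℕ.* K ℕ.* n) ≡ b ℕ.*
            ((x ℕ.+ y ℕ.+ w) ℕ.* K ℕ.* n)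
        e₆ = NS.solve-∀

    bKT≤s : b ℕ.* (K ℕ.* T) ℕ.≤ s
    bKT≤s = ℕP.*-cancelˡ-≤ (2 ℕ.* e) {{ℕ.>-nonZero (ℕP.≤-trans e>0 (ℕP.m≤n*m e 2))}} (ℕP.≤-trans
        (ℕP.≤-reflexive (e₁ e b K T)) (ℕP.≤-trans rounds (ℕP.*-monoˡ-≤ s (ℕP.≤-trans
        (ℕP.+-monoˡ-≤ e e>0) (ℕP.≤-reflexive (cong (e ℕ.+_) (sym (ℕP.+-identityʳ e))))))))
      where
      e₁ : ∀ e b K T → 2 ℕ.* e ℕ.* (b ℕ.* (K ℕ.* T)) ≡ e ℕ.* (2 ℕ.* K ℕ.* b ℕ.* T)
      e₁ = NS.solve-∀

    Cs≤ : C ℕ.* s ℕ.≤ b ℕ.* (n ℕ.* n)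
    Cs≤ = s-sublinear C big₁ big₂

    CKT≤n² : C ℕ.* (K ℕ.* T) ℕ.≤ n ℕ.* n
    CKT≤n² = ℕP.*-cancelˡ-≤ b (ℕP.≤-trans (ℕP.≤-reflexive (e₁ b C (K ℕ.* T))) (ℕP.≤-trans
        (ℕP.*-monoʳ-≤ C bKT≤s) Cs≤))
      where
      e₁ : ∀ b C x → b ℕ.* (C ℕ.* x) ≡ C ℕ.* (b ℕ.* x)
      e₁ = NS.solve-∀

    b≤M : b ℕ.≤ M
    b≤M = ℕP.≤-trans (ℕP.≤-trans (ℕP.n≤1+n b) (ℕP.m≤n*m (suc b) (2 ℕ.* e) {{ℕ.>-nonZero (ℕP.≤-trans e>0
        (ℕP.m≤n*m e 2))}})) (ℕP.m≤n+m (2 ℕ.* e ℕ.* suc b) _)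

    CK≤n : C ℕ.* K ℕ.≤ n
    CK≤n = ℕP.*-cancelˡ-≤ (b ℕ.* n) {{ℕ.>-nonZero bn>0}} (ℕP.≤-trans (ℕP.≤-reflexive (e₁ b n C K))
        (ℕP.≤-trans (ℕP.*-monoʳ-≤ C (ℕP.≤-trans (ℕP.*-monoˡ-≤ n (ℕP.*-monoˡ-≤ K b≤M)) s≥))
        (ℕP.≤-trans Cs≤ (ℕP.≤-reflexive (sym (ℕP.*-assoc b n n))))))
      where
      e₁ : ∀ b n C K → b ℕ.* n ℕ.* (C ℕ.* K) ≡ C ℕ.* (b ℕ.* K ℕ.* n)
      e₁ = NS.solve-∀

    96≤C : 96 ℕ.≤ C
    96≤C = ℕP.m≤m*n 96 u {{ℕ.>-nonZero u>0}}

    n≥8 : 8 ℕ.≤ n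
    n≥8 = ℕP.≤-trans (ℕP.≤-trans (ℕP.m≤m+n 8 88) (ℕP.≤-trans 96≤C (ℕP.m≤n*m C 2))) big₂

    2K≤n : 2 ℕ.* K ℕ.≤ n
    2K≤n = ℕP.≤-trans (ℕP.*-monoˡ-≤ K (ℕP.≤-trans (ℕP.m≤m+n 2 94) 96≤C)) CK≤n

    8T≤n² : 8 ℕ.* T ℕ.≤ n ℕ.* n
    8T≤n² = ℕP.≤-trans (ℕP.*-mono-≤ (ℕP.≤-trans (ℕP.m≤m+n 8 88) 96≤C) (ℕP.m≤n*m T K)) CKT≤n²

    u≥4 : 4 ℕ.≤ u
    u≥4 = ℕP.≤-trans (ℕP.m≤m+n 4 2) (ℕP.m≤m*n 6 b)

    a≤ : 4 ℕ.* u ℕ.* (a ℕ.* K) ℕ.≤ n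
    a≤ = ℕP.≤-trans (ℕP.≤-reflexive (e₁ u a K)) (proj₁ (proj₂ a-def))
      where
      e₁ : ∀ u a K → 4 ℕ.* u ℕ.* (a ℕ.* K) ≡ 4 ℕ.* u ℕ.* K ℕ.* a
      e₁ = NS.solve-∀

    a>0 : 0 ℕ.< a
    a>0 = ℕP.n≢0⇒n>0 (λ eq → ℕP.<-irrefl refl (ℕP.<-≤-trans (proj₂ (proj₂ a-def)) (ℕP.≤-trans
        (ℕP.≤-reflexive (trans (cong (λ m → 4 ℕ.* u ℕ.* K ℕ.* suc m) eq) (ℕP.*-identityʳ
        (4 ℕ.* u ℕ.* K)))) (ℕP.≤-trans (ℕP.*-monoˡ-≤ K (ℕP.*-monoˡ-≤ u (ℕP.m≤m+n 4 92))) CK≤n))))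

    a≥ : n ℕ.≤ 8 ℕ.* u ℕ.* (K ℕ.* a)
    a≥ = ℕP.≤-trans (ℕP.<⇒≤ (proj₂ (proj₂ a-def))) (ℕP.≤-trans (ℕP.*-monoʳ-≤ (4 ℕ.* u ℕ.* K)
        (ℕP.+-monoˡ-≤ a a>0)) (ℕP.≤-reflexive (e₁ u K a)))
      where
      e₁ : ∀ u K a → 4 ℕ.* u ℕ.* K ℕ.* (a ℕ.+ a) ≡ 8 ℕ.* u ℕ.* (K ℕ.* a)
      e₁ = NS.solve-∀

    J≤ : 6 ℕ.* u ℕ.* J ℕ.≤ n
    J≤ = ℕP.≤-trans (ℕP.≤-reflexive (e₁ u J₁)) (proj₁ (proj₂ J-def))
      where
      e₁ : ∀ u J → 6 ℕ.* u ℕ.* (3 ℕ.* J) ≡ 18 ℕ.* u ℕ.* J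
      e₁ = NS.solve-∀

    n≤36uJ₁ : n ℕ.≤ 2 ℕ.* (18 ℕ.* u ℕ.* J₁)
    n≤36uJ₁ = ℕP.+-cancelʳ-≤ n n _ (ℕP.≤-trans (ℕP.+-mono-≤ (ℕP.<⇒≤ (proj₂ (proj₂ J-def))) (ℕP.<⇒≤
        (proj₂ (proj₂ J-def)))) (ℕP.≤-trans (ℕP.≤-reflexive (e₁ u J₁)) (ℕP.+-monoʳ-≤ (2 ℕ.*
        (18 ℕ.* u ℕ.* J₁)) (ℕP.≤-trans (ℕP.*-monoˡ-≤ u (ℕP.m≤m+n 36 156)) (ℕP.≤-trans (ℕP.≤-reflexive
        (e₂ u)) big₂)))))
      where
      e₁ : ∀ u J → 18 ℕ.* u ℕ.* suc J ℕ.+ 18 ℕ.* u ℕ.* suc J ≡ 2 ℕ.* (18 ℕ.* u ℕ.* J) ℕ.+ 36 ℕ.* u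
      e₁ = NS.solve-∀
      e₂ : ∀ u → 192 ℕ.* u ≡ 2 ℕ.* (96 ℕ.* u)
      e₂ = NS.solve-∀

    J≥ : 8 ℕ.* (K ℕ.* T) ℕ.≤ n ℕ.* J
    J≥ = ℕP.*-cancelˡ-≤ (12 ℕ.* u) {{ℕ.>-nonZero (ℕP.≤-trans u>0 (ℕP.m≤n*m u 12))}} (ℕP.≤-trans
        (ℕP.≤-reflexive (e₁ u (K ℕ.* T))) (ℕP.≤-trans CKT≤n² (ℕP.≤-trans (ℕP.*-monoʳ-≤ n n≤36uJ₁)
        (ℕP.≤-reflexive (e₂ u n J₁)))))
      where
      e₁ : ∀ u x → 12 ℕ.* u ℕ.* (8 ℕ.* x) ≡ 96 ℕ.* u ℕ.* x
      e₁ = NS.solve-∀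
      e₂ : ∀ u n J → n ℕ.* (2 ℕ.* (18 ℕ.* u ℕ.* J)) ≡ 12 ℕ.* u ℕ.* (n ℕ.* (3 ℕ.* J))
      e₂ = NS.solve-∀

    -- n³ ≤ (18u)³ (J₁ + 1)³ and (J₁ + 1)³ ≤ 2^J
    2^J : ι n * ι n ≤ two ^ J
    2^J = *-cancel≤ (ι n) (ι>0 n>0) (cube ⟫ *≤* (*≥0 v≥0 (*≥0 v≥0 v≥0)) (≤-refl′ (sym (trans (ι-* v
        (v ℕ.* v)) (cong (ι v *_) (ι-* v v)))) ⟫ ι-mono big₃) (^≥0 3 (^≥0 J₁ two≥0)) (≤-refl′ (trans
        (sym (^-^ two J₁ 3)) (cong (two ^_) (ℕP.*-comm J₁ 3)))))
      where
      v = 18 ℕ.* u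
      v≥0 = ι≥0 v
      n≤ : ι n ≤ ι v * two ^ J₁
      n≤ = ι-mono (ℕP.<⇒≤ (proj₂ (proj₂ J-def)))
        ⟫ ≤-refl′ (ι-* v (suc J₁))
        ⟫ *≤*ˡ v≥0 (≤-refl′ (trans (ι-suc J₁) (cong (1ℚ +_) (sym (QP.*-identityʳ (ι J₁)))))
          ⟫ bernoulli J₁ (neg≤ {0ℚ} {1ℚ} 0≤1 ⟫ 0≤1))
      e₁ : ∀ v x → v * x * (v * x * (v * x)) ≡ v * (v * v) * (x * (x * (x * 1ℚ)))
      e₁ = solve-∀ ℚring
      cube : ι n * (ι n * ι n) ≤ ι v * (ι v * ι v) * (two ^ J₁) ^ 3
      cube = *≤* (ι≥0 n) n≤ (*≥0 (ι≥0 n) (ι≥0 n)) (*≤* (ι≥0 n) n≤ (ι≥0 n) n≤)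
        ⟫ ≤-refl′ (e₁ (ι v) (two ^ J₁))

    q p p³ λ₀ : ℚ
    q = recip u
    p = 1ℚ - q
    p³ = p * (p * p)
    λ₀ = two * ι K * recip n * p³

    λ≤1 : λ₀ ≤ 1ℚ
    λ≤1 = Instance.λ≤1 n k u T a J u≥4 n≥8 2K≤n 8T≤n² a≤ J≤ K≥2

    upper : Process.Fail≤ n K T [] (fromℕℚ 7 * recip n + ι u ^ D₀ * (ι n * (1ℚ - λ₀) ^ t₂))
    upper = Instance.Bounds.upper n k u T a J u≥4 n≥8 2K≤n 8T≤n² a≤ J≤ K≥2 t₁ t₂ a≥ J≥ 2^J refl ℕP.≤-refl

    success-probability : ∀ η → fromℕℚ 7 * recip n + ι u ^ D₀ * (ι n * (1ℚ - λ₀) ^ t₂) ≤ η →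
      1ℚ - η ≤ ProbHamAfter n K (Process.optimal n K T) T
    success-probability η h = Process.Fail≤-weaken n K {T} {[]} h upper
      ⟫ Process.V≤optimal n K T T [] refl

    q≥0 : 0ℚ ≤ q
    q≥0 = recip≥0 u

    p≥0 : 0ℚ ≤ p
    p≥0 = Instance.p≥0 n k u T a J u≥4 n≥8 2K≤n 8T≤n² a≤ J≤ K≥2

    NR : ι n * recip n ≡ 1ℚ
    NR = *-recip n n>0

    qU : q * ι u ≡ 1ℚ
    qU = trans (QP.*-comm q (ι u)) (*-recip u u>0)

    X : ℚ
    X = ι n * (1ℚ - λ₀) ^ t₂

    X≥0 : 0ℚ ≤ X
    X≥0 = *≥0 (ι≥0 n) (^≥0 t₂ (diff≥0 λ≤1))

    -- After multiplication by bn this says h ≤ 2b p³, and p³ ≥ 1 - 3/u = 1 - 1/(2b) makes the right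
    -- side at least 2b - 1 = h.
    Khz≤λ : ι (K ℕ.* h) * z ≤ λ₀
    Khz≤λ = *-cancel≤ (ι bn) (ι>0 bn>0) (≤-refl′ (trans (e₁ (ι bn) (ι (K ℕ.* h)) z) (trans (cong (ι
        (K ℕ.* h) *_) (*-recip bn bn>0)) (trans (QP.*-identityʳ (ι (K ℕ.* h))) (ι-* K h)))) ⟫ *≤*ˡ
        (ι≥0 K) h≤ ⟫ ≤-refl′ (trans (e₂ (ι K) (ι b) p³) (trans (cong (λ o → ι K * (two * ι b * p³) * o)
        (sym NR)) (trans (e₃ (ι K) (ι b) p³ (ι n) (recip n)) (cong (_* λ₀) (sym (ι-* b n)))))))
      where
      e₁ : ∀ b k z → b * (k * z) ≡ k * (b * z)
      e₁ = solve-∀ ℚring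
      e₂ : ∀ k b p → k * ((1ℚ + 1ℚ) * b * p) ≡ k * ((1ℚ + 1ℚ) * b * p) * 1ℚ
      e₂ = solve-∀ ℚring
      e₃ : ∀ k b p n r → k * ((1ℚ + 1ℚ) * b * p) * (n * r) ≡ b * n * ((1ℚ + 1ℚ) * k * r * p)
      e₃ = solve-∀ ℚring
      p³≥ : 1ℚ - fromℕℚ 3 * q ≤ p³
      p³≥ = ≤-by (q * q * (fromℕℚ 2 + p)) (*≥0 (*≥0 q≥0 q≥0) (+≥0 (QP.nonNegative⁻¹ (fromℕℚ 2)) p≥0))
          (e₄ q)
        where
        e₄ : ∀ q → 1ℚ - fromℕℚ 3 * q + q * q * (fromℕℚ 2 + (1ℚ - q)) ≡ (1ℚ - q) * ((1ℚ - q) * (1ℚ - q))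
        e₄ = solve-∀ ℚring
      h≤ : ι h ≤ two * ι b * p³
      h≤ = ≤-refl′ (trans (sym (trans (cong₂ _-_ (trans (sym (ι-* 2 b)) (trans (cong ι (e₅ e))
          (ι-suc h))) (trans (cong (_* q) (trans (cong (_* ι b) (sym (ι-def 6))) (sym (ι-* 6 b))))
          (trans (QP.*-comm (ι u) q) qU))) (e₆ (ι h)))) (trans (cong
          (λ w → w * ι b - fromℕℚ 6 * ι b * q) (ι-def 2)) (e₇ (ι b) q)))
        ⟫ *≤*ˡ (*≥0 two≥0 (ι≥0 b)) p³≥
        where
        e₅ : ∀ e → 2 ℕ.* suc (3 ℕ.* e) ≡ suc (suc (6 ℕ.* e))
        e₅ = NS.solve-∀
        e₆ : ∀ x → 1ℚ + x - 1ℚ ≡ x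
        e₆ = solve-∀ ℚring
        e₇ : ∀ b q → fromℕℚ 2 * b - fromℕℚ 6 * b * q ≡ (1ℚ + 1ℚ) * b * (1ℚ - fromℕℚ 3 * q)
        e₇ = solve-∀ ℚring

    1-λ≤ : 1ℚ - λ₀ ≤ (1ℚ - z) ^ (K ℕ.* h)
    1-λ≤ = QP.+-monoʳ-≤ 1ℚ (neg≤ Khz≤λ) ⟫ bernoulli⁻ (K ℕ.* h) z≤1

    -- The estimate X ≤ n^(-1/b) without roots: the left side is n^(b+1) times at least (b + 1)(s +
    -- 1) factors 1 - z, and n (1 - z)^(s+1) ≤ 1.
    X-small : ι n * X ^ b ≤ 1ℚ
    X-small = *≤*ˡ (ι≥0 n) (^-mono b X≥0 (*≤*ˡ (ι≥0 n) (^-mono t₂ (diff≥0 λ≤1) 1-λ≤ ⟫ ≤-refl′ (sym (^-^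
        (1ℚ - z) (K ℕ.* h) t₂)))) ⟫ ≤-refl′ (trans (^-*ˡ (ι n) ((1ℚ - z) ^ (K ℕ.* h ℕ.* t₂)) b) (cong
        (ι n ^ b *_) (trans (sym (^-^ (1ℚ - z) (K ℕ.* h ℕ.* t₂) b)) (cong ((1ℚ - z) ^_)
        (e₁ K h t₂ b))))) ⟫ *≤*ˡ (^≥0 b (ι≥0 n)) (^-antitone (diff≥0 z≤1) (a-b≤a z≥0) (proj₁
        (proj₂ t₂-def))))
      ⟫ ≤-refl′ (trans (sym (QP.*-assoc (ι n) (ι n ^ b) ((1ℚ - z) ^ (suc b ℕ.* suc s)))) (trans (cong
        (ι n ^ suc b *_) (trans (cong ((1ℚ - z) ^_) (ℕP.*-comm (suc b) (suc s))) (^-^ (1ℚ - z) (suc s)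
        (suc b)))) (sym (^-*ˡ (ι n) ((1ℚ - z) ^ suc s) (suc b)))))
      ⟫ ^≤1 (suc b) (*≥0 (ι≥0 n) (^≥0 (suc s) (diff≥0 z≤1))) s-above
      where
      e₁ : ∀ K h t b → K ℕ.* h ℕ.* t ℕ.* b ≡ b ℕ.* (K ℕ.* h) ℕ.* t
      e₁ = NS.solve-∀

rounds-at : ℕ → ℕ → ℕ → ℕ
rounds-at e k zero = 0
rounds-at e k (suc n) = Schedule.T e k (suc n) (s≤s z≤n)

+-≤ : ∀ a b {n} → a ℕ.+ b ℕ.≤ n → (a ℕ.≤ n) × (b ℕ.≤ n)
+-≤ a b h = ℕP.≤-trans (ℕP.m≤m+n a b) h , ℕP.≤-trans (ℕP.m≤n+m b a) h

+-≤³ : ∀ a b c {n} → a ℕ.+ (b ℕ.+ c) ℕ.≤ n → (a ℕ.≤ n) × (b ℕ.≤ n) × (c ℕ.≤ n)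
+-≤³ a b c h = proj₁ (+-≤ a (b ℕ.+ c) h) , +-≤ b c (proj₂ (+-≤ a (b ℕ.+ c) h))

-- θ is the target size of X. If X exceeded it, n X^b would exceed n θ^b, which is larger than 1 for
-- large n; so no b-th root has to be approximated.
small-enough : ∀ W → 0ℚ < W → ∀ b η → 0ℚ < η → Σ ℕ λ N → ∀ n X → 0 ℕ.< n → N ℕ.≤ n → 0ℚ ≤ X →
  ι n * X ^ b ≤ 1ℚ → fromℕℚ 7 * recip n + W * X ≤ η
small-enough W W>0 b η η>0 = N₁ ℕ.+ suc N₂ , λ n X n>0 n≥ X≥0 h → QP.+-mono-≤ (first-half n n>0 (proj₁
    (+-≤ N₁ (suc N₂) n≥))) (second-half X (X≤θ n X (proj₂ (+-≤ N₁ (suc N₂) n≥)) h))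
  ⟫ ≤-refl′ (e₀′ η)
  where
  θ : ℚ
  θ = ½ * η * inv W W>0
  θ>0 : 0ℚ < θ
  θ>0 = *>0 (*>0 (QP.positive⁻¹ ½) η>0) (inv>0 W W>0)
  N₁ N₂ : ℕ
  N₁ = proj₁ (archimedean (fromℕℚ 14 * inv η η>0))
  N₂ = proj₁ (archimedean (inv (θ ^ b) (^>0 b θ>0)))
  e₀′ : ∀ x → (pos 1 Q./ 2) * x + (pos 1 Q./ 2) * x ≡ x
  e₀′ = solve-∀ ℚring
  first-half : ∀ n → 0 ℕ.< n → N₁ ℕ.≤ n → fromℕℚ 7 * recip n ≤ ½ * η
  first-half n n>0 n≥N₁ = recip-≤ {n} n>0 (*-cancel≤ two (QP.positive⁻¹ two) (≤-refl′ (trans (sym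
      (QP.*-identityʳ (fromℕℚ 14))) (trans (cong (fromℕℚ 14 *_) (sym (trans (QP.*-comm (inv η η>0) η)
      (*-inv η η>0)))) (sym (QP.*-assoc (fromℕℚ 14) (inv η η>0) η)))) ⟫ *≤*ʳ (QP.<⇒≤ η>0) (proj₂
      (archimedean (fromℕℚ 14 * inv η η>0)) ⟫ ι-mono n≥N₁) ⟫ ≤-refl′ (e₁ (ι n) η)))
    where
    e₁ : ∀ n x → n * x ≡ (1ℚ + 1ℚ) * (n * ((pos 1 Q./ 2) * x))
    e₁ = solve-∀ ℚring
  1<nθ^b : ∀ n → N₂ ℕ.< n → 1ℚ < ι n * θ ^ b
  1<nθ^b n n>N₂ = QP.≤-<-trans (≤-refl′ (trans (sym (*-inv (θ ^ b) (^>0 b θ>0))) (QP.*-comm (θ ^ b) (inv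
      (θ ^ b) (^>0 b θ>0)))) ⟫ *≤*ʳ (^≥0 b (QP.<⇒≤ θ>0)) (proj₂ (archimedean (inv (θ ^ b)
      (^>0 b θ>0))))) (QP.*-monoˡ-<-pos (θ ^ b) {{Q.positive (^>0 b θ>0)}} (ι-mono< n>N₂))
  X≤θ : ∀ n X → N₂ ℕ.< n → ι n * X ^ b ≤ 1ℚ → X ≤ θ
  X≤θ n X n>N₂ h = QP.≮⇒≥ (λ θ<X → <⇒≱ℚ (1<nθ^b n n>N₂) (*≤*ˡ (ι≥0 n) (^-mono b (QP.<⇒≤ θ>0)
      (QP.<⇒≤ θ<X)) ⟫ h))
  second-half : ∀ X → X ≤ θ → W * X ≤ ½ * η
  second-half X le = *≤*ˡ (QP.<⇒≤ W>0) le
    ⟫ ≤-refl′ (trans (e₁ W (½ * η) (inv W W>0)) (trans (cong (½ * η *_) (*-inv W W>0)) (QP.*-identityʳ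
      (½ * η))))
    where
    e₁ : ∀ u x i → u * (x * i) ≡ x * (u * i)
    e₁ = solve-∀ ℚring

-- Assembling the upper bound

module Upper (e : ℕ) (e>0 : 0 ℕ.< e) where

  open Constants e

  M>0 : 0 ℕ.< M
  M>0 = ℕP.≤-trans (ℕP.*-mono-≤ {1} {2 ℕ.* e} {1} {suc b} (ℕP.≤-trans e>0 (ℕP.m≤n*m e 2)) (s≤s z≤n))
      (ℕP.m≤n+m (2 ℕ.* e ℕ.* suc b) _)

  2M>0 : 0 ℕ.< 2 ℕ.* M
  2M>0 = ℕP.≤-trans M>0 (ℕP.m≤n*m M 2)

  -- From K ≤ δ log n the inequality M K n ≤ s must follow, where s is about b n log n; the 2 makes
  -- up for the loss in `exp-below`.
  δ : ℚ
  δ = ι b * recip (2 ℕ.* M)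

  recip>0 : ∀ n → 0 ℕ.< n → 0ℚ < recip n
  recip>0 n p = QP.≰⇒> (λ h → <⇒≱ℚ 0<1 (≤-refl′ (sym (*-recip n p)) ⟫ *≤*ˡ (ι≥0 n) h ⟫ ≤-refl′
      (QP.*-zeroʳ (ι n))))

  δ>0 : 0ℚ < δ
  δ>0 = *>0 (ι>0 b>0) (recip>0 (2 ℕ.* M) 2M>0)

  log-dominates : ∀ k n (n>0 : 0 ℕ.< n) → 2 ℕ.≤ n → LeTimesLog (fromℕℚ (suc k)) δ n →
    M ℕ.* suc k ℕ.* n ℕ.≤ Schedule.s e k n n>0
  log-dominates k n n>0 n≥2 (inj₁ (eq , _)) = ⊥-elim (QP.<-irrefl (sym eq) (subst (0ℚ <_) (ι-def
      (suc k)) (ι>0 (s≤s z≤n))))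
  log-dominates k n n>0 n≥2 (inj₂ (δ⁺ , h)) = below⇒≤s (M ℕ.* suc k ℕ.* n) (exp-below
      (M ℕ.* suc k ℕ.* n) (ℕP.≤-trans n≥2 (ℕP.m≤n*m n b)) x≤ h)
    where
    open Log b n b>0 n>0
    y = ι (M ℕ.* suc k ℕ.* n) * (two * z)
    yδ : y * δ ≡ fromℕℚ (suc k)
    yδ = trans (cong₂ (λ S m → S * (two * z) * (ι b * m)) (trans (ι-* (M ℕ.* suc k) n) (cong (_* ι n)
        (ι-* M (suc k)))) refl) (trans (e₁ (ι M) (ι (suc k)) (ι n) z (ι b) (recip (2 ℕ.* M))) (trans
        (cong₂ (λ p r → ι (suc k) * p * r) (trans (cong (_* recip (2 ℕ.* M)) (trans (cong (_* ι M) (sym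
        (ι-def 2))) (sym (ι-* 2 M)))) (*-recip (2 ℕ.* M) 2M>0)) (trans (cong (_* z) (sym (ι-* b n)))
        (*-recip bn bn>0))) (trans (e₂ (ι (suc k))) (ι-def (suc k)))))
      where
      e₁ : ∀ m k n z b r → m * k * n * ((1ℚ + 1ℚ) * z) * (b * r) ≡ k * ((1ℚ + 1ℚ) * m * r) * (b * n * z)
      e₁ = solve-∀ ℚring
      e₂ : ∀ k → k * 1ℚ * 1ℚ ≡ k
      e₂ = solve-∀ ℚring
    x≤ : y ≤ fromℕℚ (suc k) * inv δ δ⁺
    x≤ = ≤-refl′ (trans (sym (QP.*-identityʳ y)) (trans (cong (y *_) (sym (*-inv δ δ⁺))) (trans (sym
        (QP.*-assoc y δ (inv δ δ⁺))) (cong (_* inv δ δ⁺) yδ))))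

  module _ (ε : ℚ) (ε>0 : 0ℚ < ε) (e≤ : recip e ≤ ε) where

    rounds-le : ∀ k n T (n>0 : 0 ℕ.< n) → 2 ℕ.≤ n →
      e ℕ.* (2 ℕ.* suc k ℕ.* b ℕ.* T) ℕ.≤ suc e ℕ.* Log.s b n b>0 n>0 → RoundsLe T (1ℚ + ε) n (suc k)
    rounds-le k n T n>0 n≥2 rounds = inj₂ (B>0 , ExpLe-intro s n (*≥0 (subst (0ℚ ≤_) (ι-def A) (ι≥0 A))
        (inv≥0 B B>0)) z≥0 z<1 x≤ s-below)
      where
      open Log b n b>0 n>0
      A = 2 ℕ.* suc k ℕ.* T
      B = (1ℚ + ε) * fromℕℚ n
      1+ε>0 : 0ℚ < 1ℚ + ε
      1+ε>0 = QP.<-≤-trans 0<1 (a≤a+b (QP.<⇒≤ ε>0))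
      B>0 : 0ℚ < B
      B>0 = *>0 1+ε>0 (subst (0ℚ <_) (ι-def n) (ι>0 n>0))
      z<1 : z < 1ℚ
      z<1 = QP.≤-<-trans (≤-refl′ (sym (QP.*-identityˡ z)) ⟫ recip-≤ {bn} bn>0 (*≤*ʳ ½≥0 (≤-refl′ (sym
          (ι-def 2)) ⟫ ι-mono (ℕP.≤-trans n≥2 (ℕP.m≤n*m n b))))) half<1
        where
        half<1 : ½ < 1ℚ
        half<1 = QP.≰⇒> (λ h → <⇒≱ℚ (QP.positive⁻¹ ½) (QP.+-monoˡ-≤ (- ½) h))
      scaled : ι b * ι A ≤ (1ℚ + ε) * ι s
      scaled = *-cancel≤ (ι e) (ι>0 e>0) (≤-refl′ (trans (cong (ι e *_) (trans (sym (ι-* b A)) (cong ι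
          (e₁ b (suc k) T)))) (sym (ι-* e (2 ℕ.* suc k ℕ.* b ℕ.* T)))) ⟫ ι-mono rounds ⟫ ≤-refl′ (trans
          (ι-* (suc e) s) (cong (_* ι s) (trans (ι-suc e) (trans (cong (_+ ι e) (sym (*-recip e e>0)))
          (e₂ (ι e) (recip e)))))) ⟫ *≤*ʳ (ι≥0 s) (*≤*ˡ (ι≥0 e) (QP.+-monoʳ-≤ 1ℚ e≤)) ⟫ ≤-refl′
          (QP.*-assoc (ι e) (1ℚ + ε) (ι s)))
        where
        e₁ : ∀ b K T → b ℕ.* (2 ℕ.* K ℕ.* T) ≡ 2 ℕ.* K ℕ.* b ℕ.* T
        e₁ = NS.solve-∀
        e₂ : ∀ e r → e * r + e ≡ e * (1ℚ + r)
        e₂ = solve-∀ ℚring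
      x≤ : fromℕℚ A * inv B B>0 ≤ ι s * z
      x≤ = *-cancel≤ B B>0 (*-cancel≤ (ι b) (ι>0 b>0) (≤-refl′ (trans (e₃ (ι b) B (fromℕℚ A)
          (inv B B>0)) (trans (cong (ι b * fromℕℚ A *_) (*-inv B B>0)) (trans (QP.*-identityʳ
          (ι b * fromℕℚ A)) (cong (ι b *_) (sym (ι-def A)))))) ⟫ scaled ⟫ ≤-refl′ (sym (trans (cong
          (λ w → ι b * ((1ℚ + ε) * w * (ι s * z))) (sym (ι-def n))) (trans (e₄ (ι b) (1ℚ + ε) (ι n)
          (ι s) z) (trans (cong ((1ℚ + ε) * ι s *_) (trans (cong (_* z) (sym (ι-* b n)))
          (*-recip bn bn>0))) (QP.*-identityʳ ((1ℚ + ε) * ι s))))))))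
        where
        e₃ : ∀ b c a i → b * (c * (a * i)) ≡ b * a * (c * i)
        e₃ = solve-∀ ℚring
        e₄ : ∀ b o n s z → b * (o * n * (s * z)) ≡ o * s * (b * n * z)
        e₄ = solve-∀ ℚring

  opaque
    threshold : ℕ
    threshold = suc (16 ℕ.* (C ℕ.* C)) ℕ.+ (2 ℕ.* C ℕ.+ 18 ℕ.* u ℕ.* (18 ℕ.* u ℕ.* (18 ℕ.* u)))

    threshold-large : ∀ {n} → threshold ℕ.≤ n →
      (16 ℕ.* (C ℕ.* C) ℕ.< n) × (2 ℕ.* C ℕ.≤ n) × (18 ℕ.* u ℕ.* (18 ℕ.* u ℕ.* (18 ℕ.* u)) ℕ.≤ n)
    threshold-large = +-≤³ (suc (16 ℕ.* (C ℕ.* C))) (2 ℕ.* C) (18 ℕ.* u ℕ.* (18 ℕ.* u ℕ.* (18 ℕ.* u)))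

  U^D>0 : 0ℚ < ι u ^ D₀
  U^D>0 = ^>0 D₀ (ι>0 u>0)

  opaque
    smallness : ∀ η → 0ℚ < η → Σ ℕ λ N → ∀ n X → 0 ℕ.< n → N ℕ.≤ n → 0ℚ ≤ X → ι n * X ^ b ≤ 1ℚ →
      fromℕℚ 7 * recip n + ι u ^ D₀ * X ≤ η
    smallness = small-enough (ι u ^ D₀) U^D>0 b

  success-probability : ∀ η (η>0 : 0ℚ < η) k n (n>0 : 0 ℕ.< n) → 2 ℕ.≤ suc k →
    M ℕ.* suc k ℕ.* n ℕ.≤ Schedule.s e k n n>0 → threshold ℕ.≤ n → proj₁ (smallness η η>0) ℕ.≤ n →
    (e ℕ.* (2 ℕ.* suc k ℕ.* b ℕ.* Schedule.T e k n n>0) ℕ.≤ suc e ℕ.* Schedule.s e k n n>0) ×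
      (1ℚ - η ≤ ProbHamAfter n (suc k) (Process.optimal n (suc k) (Schedule.T e k n n>0))
      (Schedule.T e k n n>0))
  success-probability η η>0 k n n>0 K≥2 s≥ n≥ n≥N = Schedule.Large.rounds e k n n>0 e>0 K≥2 s≥ b₁ b₂ b₃ ,
      Schedule.Large.success-probability e k n n>0 e>0 K≥2 s≥ b₁ b₂ b₃ η (proj₂ (smallness η η>0) n
      (Schedule.Large.X e k n n>0 e>0 K≥2 s≥ b₁ b₂ b₃) n>0 n≥N (Schedule.Large.X≥0 e k n n>0 e>0 K≥2 s≥
      b₁ b₂ b₃) (Schedule.Large.X-small e k n n>0 e>0 K≥2 s≥ b₁ b₂ b₃))
    where
    b₁ = proj₁ (threshold-large n≥)
    b₂ = proj₁ (proj₂ (threshold-large n≥))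
    b₃ = proj₂ (proj₂ (threshold-large n≥))

  likely : ∀ ε → 0ℚ < ε → recip e ≤ ε → ∀ η (η>0 : 0ℚ < η) n κ → 2 ℕ.≤ κ → threshold ℕ.≤ n →
    2 ℕ.+ proj₁ (smallness η η>0) ℕ.≤ n → LeTimesLog (fromℕℚ κ) δ n →
    RoundsLe (rounds-at e (ℕ.pred κ) n) (1ℚ + ε) n κ × (1ℚ - η ≤ ProbHamAfter n κ (Process.optimal n κ
      (rounds-at e (ℕ.pred κ) n)) (rounds-at e (ℕ.pred κ) n))
  likely ε ε>0 e≤ η η>0 n@(suc n′) (suc k) κ≥2 n≥thr n≥₂ lo = rounds-le ε ε>0 e≤ k n (Schedule.T e k n
      (s≤s z≤n)) (s≤s z≤n) n≥2 (proj₁ both) , proj₂ both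
    where
    N₃ = proj₁ (smallness η η>0)
    n≥2 : 2 ℕ.≤ n
    n≥2 = proj₁ (+-≤ 2 N₃ n≥₂)
    both = success-probability η η>0 k n (s≤s z≤n) κ≥2 (log-dominates k n (s≤s z≤n) n≥2 lo) n≥thr (proj₂
        (+-≤ 2 N₃ n≥₂))

upper-bound : (K : ℕ → ℕ) → (∀ n → 2 ℕ.≤ K n) → LittleOLog K → ∀ ε → 0ℚ < ε →
  Σ ((n : ℕ) → Alg n) λ A → ∀ η → 0ℚ < η → Σ ℕ λ N → ∀ n → N ℕ.≤ n → Σ ℕ λ t →
  RoundsLe t (1ℚ + ε) n (K n) × (1ℚ - η ≤ ProbHamAfter n (K n) (A n) t)
upper-bound K K≥2 o ε ε>0 = (λ n → Process.optimal n (K n) (T n)) , bound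
  where
  E = small-recip ε ε>0
  e = proj₁ E
  e>0 = proj₁ (proj₂ E)
  T : ℕ → ℕ
  T n = rounds-at e (ℕ.pred (K n)) n
  little = o (Upper.δ e e>0) (Upper.δ>0 e e>0)
  N₀ thr : ℕ
  N₀ = proj₁ little
  thr = Upper.threshold e e>0
  bound : ∀ η → 0ℚ < η → Σ ℕ λ N → ∀ n → N ℕ.≤ n → Σ ℕ λ t →
    RoundsLe t (1ℚ + ε) n (K n) × (1ℚ - η ≤ ProbHamAfter n (K n) (Process.optimal n (K n) (T n)) t)
  bound η η>0 = N₀ ℕ.+ (thr ℕ.+ N₂) , λ n n≥ → T n , Upper.likely e e>0 ε ε>0 (proj₂ (proj₂ E)) η η>0 n
      (K n) (K≥2 n) (proj₁ (proj₂ (+-≤³ N₀ thr N₂ n≥))) (proj₂ (proj₂ (+-≤³ N₀ thr N₂ n≥)))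
      (proj₂ little n (proj₁ (+-≤³ N₀ thr N₂ n≥)))
    where
    N₂ : ℕ
    N₂ = 2 ℕ.+ proj₁ (Upper.smallness e e>0 η η>0)

-- The second moment of the number of untouched vertices

insertions-∈ : ∀ {A : Set} {x : A} c′ {c} → c ∈ insertions x c′ → (x ∈ c) × (∀ {v} → v ∈ c′ → v ∈ c)
insertions-∈ [] (here refl) = here refl , λ ()
insertions-∈ (y ∷ c′) (here refl) = here refl , there
insertions-∈ (y ∷ c′) (there m) with ∈-map⁻ (y ∷_) m
... | c₁ , c₁∈ , refl = there (proj₁ (insertions-∈ c′ c₁∈)) , λ { (here refl) → here refl ;
    (there v∈) → there (proj₂ (insertions-∈ c′ c₁∈) v∈) }

perms-∈ : ∀ {A : Set} (xs : List A) {c v} → c ∈ perms xs → v ∈ xs → v ∈ c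
perms-∈ (x ∷ xs) m v∈ with find (∈-concatMap⁻ (insertions x) {perms xs} m)
perms-∈ (x ∷ xs) m (here refl) | c′ , _ , c∈ = proj₁ (insertions-∈ c′ c∈)
perms-∈ (x ∷ xs) m (there v∈) | c′ , c′∈ , c∈ = proj₂ (insertions-∈ c′ c∈) (perms-∈ xs c′∈ v∈)

pathOK-adj : ∀ {n} (g : Graph n) v vs {w} → pathOK g v vs ≡ true → w ∈ vs → Σ (Fin n) λ u →
  adj g u w ≡ true
pathOK-adj g v (x ∷ vs) h m with ∧-elim (adj g v x) (pathOK g x vs) h
pathOK-adj g v (x ∷ vs) h (here refl) | a , _ = v , a
pathOK-adj g v (x ∷ vs) h (there m) | _ , b = pathOK-adj g x vs b m

isolated⇒¬Hamiltonian : ∀ {n} (g : Graph n) v → (∀ w → adj g v w ≡ false) → Hamiltonian g ≡ false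
isolated⇒¬Hamiltonian {n} g v iso = not-true λ h → go (any-witness (cycleOK g) (perms (allFin n)) (proj₂
    (∧-elim (3 ℕ.≤ᵇ n) (any (cycleOK g) (perms (allFin n))) h)))
  where
  no-neighbour : (Σ (Fin n) λ u → adj g u v ≡ true) → ⊥
  no-neighbour (u , a) = false≢true (iso u) (trans (adj-sym g v u) a)
  go : (Σ (List (Fin n)) λ c → (c ∈ perms (allFin n)) × (cycleOK g c ≡ true)) → ⊥
  go (c@(x ∷ xs) , m , ok) with ∧-elim (pathOK g x xs) (adj g (lastOf x xs) x) ok | perms-∈ (allFin n) m
      (∈-allFin v)
  ... | _ , a | here refl = no-neighbour (lastOf x xs , a)
  ... | p , _ | there v∈ = no-neighbour (pathOK-adj g x xs p v∈)

incident : ∀ {n} → Fin n → Edge n → Bool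
incident v (i , j) = (v == i) ∨ (v == j)

any-∨ : ∀ {A : Set} (p q : A → Bool) xs → any (λ x → p x ∨ q x) xs ≡ any p xs ∨ any q xs
any-∨ p q [] = refl
any-∨ p q (x ∷ xs) rewrite any-∨ p q xs with p x | q x | any p xs
... | true | _ | _ = refl
... | false | true | true = refl
... | false | true | false = refl
... | false | false | _ = refl

singles pairs : ∀ {n} → (Fin n → Bool) → ℚ
singles Y = ∑ᶠ (λ v → ⟦ Y v ⟧)
pairs Y = ∑ᶠ λ v → ∑ᶠ λ w → ⟦ not (v == w) ⟧ * (⟦ Y v ⟧ * ⟦ Y w ⟧)

pairs-singles : ∀ {n} (Y : Fin n → Bool) → pairs Y + singles Y ≡ singles Y * singles Y
pairs-singles {n} Y = trans (sym (∑-+ (allFin n) (λ v → ∑ᶠ λ w → ⟦ not (v == w) ⟧ * (⟦ Y v ⟧ * ⟦ Y w ⟧))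
    (λ v → ⟦ Y v ⟧))) (trans (∑-cong (allFin n) row) (∑-*ʳ (allFin n) (singles Y) (λ v → ⟦ Y v ⟧)))
  where
  square : ∀ b → ⟦ b ⟧ ≡ ⟦ b ⟧ * ⟦ b ⟧
  square true = refl
  square false = refl
  e₁ : ∀ d a b → (1ℚ - d) * (a * b) + d * (a * b) ≡ a * b
  e₁ = solve-∀ ℚring
  row : ∀ v → ∑ᶠ (λ w → ⟦ not (v == w) ⟧ * (⟦ Y v ⟧ * ⟦ Y w ⟧)) + ⟦ Y v ⟧ ≡ ⟦ Y v ⟧ * singles Y
  row v = trans (cong (∑ᶠ (λ w → ⟦ not (v == w) ⟧ * (⟦ Y v ⟧ * ⟦ Y w ⟧)) +_) (trans (square (Y v)) (sym
      (∑ᶠ-δ v (λ w → ⟦ Y v ⟧ * ⟦ Y w ⟧))))) (trans (sym (∑-+ (allFin n) (λ w → ⟦ not (v == w) ⟧ *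
      (⟦ Y v ⟧ * ⟦ Y w ⟧)) (λ w → ⟦ w == v ⟧ * (⟦ Y v ⟧ * ⟦ Y w ⟧)))) (trans (∑-cong (allFin n)
      (λ w → trans (cong₂ (λ a b → a * (⟦ Y v ⟧ * ⟦ Y w ⟧) + ⟦ b ⟧ * (⟦ Y v ⟧ * ⟦ Y w ⟧)) (⟦not⟧
      (v == w)) (==-sym w v)) (e₁ ⟦ v == w ⟧ ⟦ Y v ⟧ ⟦ Y w ⟧))) (∑-*ˡ (allFin n) ⟦ Y v ⟧
      (λ w → ⟦ Y w ⟧))))

incident≤ : ∀ {n} (g : Graph n) v → ι (#ᵇ (incident v) (nonEdges g)) ≤ ι n - 1ℚ
incident≤ {n} g v = ≤-refl′ (#ᵇ-∑ (incident v) (nonEdges g))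
  ⟫ ∑-mono (nonEdges g) (λ { (i , j) → ⟦∨⟧≤ (v == i) (v == j) })
  ⟫ ≤-refl′ (trans (∑-nonEdges g (λ i _ → ⟦ v == i ⟧)) (trans (∑-cong (allFin n) (λ i → trans (∑-*ʳ
    (allFin n) ⟦ v == i ⟧ (λ j → ⟦ nonadj g i j ⟧)) (trans (QP.*-comm _ ⟦ v == i ⟧) (cong
    (λ b → ⟦ b ⟧ * ∑ᶠ (λ j → ⟦ nonadj g i j ⟧)) (==-sym v i))))) (∑ᶠ-δ v (λ i → ∑ᶠ
    (λ j → ⟦ nonadj g i j ⟧)))))
  ⟫ row≤ g v

isolated-row : ∀ {n} (g : Graph n) v → (∀ w → adj g v w ≡ false) → ∀ w →
  ⟦ nonadj g v w ⟧ ≡ 1ℚ - ⟦ w == v ⟧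
isolated-row g v iso w rewrite iso w | ==-sym v w with w == v
... | true = refl
... | false = refl

∑-1-δ : ∀ {n} (v : Fin n) → ∑ᶠ (λ w → 1ℚ - ⟦ w == v ⟧) ≡ ι n - 1ℚ
∑-1-δ {n} v = trans (∑-cong (allFin n) (λ w → cong (1ℚ +_) (neg1 ⟦ w == v ⟧))) (trans (∑-+ (allFin n)
    (λ _ → 1ℚ) (λ w → - 1ℚ * ⟦ w == v ⟧)) (cong₂ _+_ (trans (∑ᶠ-const n 1ℚ) (QP.*-identityʳ (ι n)))
    (trans (∑-*ˡ (allFin n) (- 1ℚ) (λ w → ⟦ w == v ⟧)) (cong (- 1ℚ *_) (∑ᶠ-δ₁ v)))))
  where
  neg1 : ∀ x → - x ≡ - 1ℚ * x
  neg1 = solve-∀ ℚring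

incident₂≥ : ∀ {n} (g : Graph n) v w → (v == w) ≡ false → (∀ x → adj g v x ≡ false) →
  (∀ x → adj g w x ≡ false) →
  two * ι n - fromℕℚ 3 ≤ ι (#ᵇ (λ e → incident v e ∨ incident w e) (nonEdges g))
incident₂≥ {n} g v w v≠w isoᵥ isoʷ = ≤-refl′ (sym total₁)
  ⟫ ≤-refl′ (sym (∑-nonEdges g F))
  ⟫ ∑-mono (nonEdges g) (λ { (i , j) → each i j })
  ⟫ ≤-refl′ (sym (#ᵇ-∑ (λ e → incident v e ∨ incident w e) (nonEdges g)))
  where
  -- Edges at `v` are charged to `v`, and edges at `w` to `w` except for v w, which would otherwise
  -- count twice; this gives (n - 1) + (n - 2).
  F : Fin n → Fin n → ℚ
  F i j = ⟦ not (i == j) ⟧ * (⟦ i == v ⟧ + ⟦ i == w ⟧ * (1ℚ - ⟦ j == v ⟧))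
  bool : ∀ a b c d → (a ≡ true → b ≡ true → ⊥) → (c ≡ true → d ≡ true → ⊥) →
    (a ≡ true → c ≡ true → ⊥) → (b ≡ true → d ≡ true → ⊥) →
    1ℚ * (⟦ a ⟧ + ⟦ c ⟧ * (1ℚ - ⟦ b ⟧)) + 1ℚ * (⟦ b ⟧ + ⟦ d ⟧ * (1ℚ - ⟦ a ⟧)) ≤ ⟦ (a ∨ b) ∨ (c ∨ d) ⟧
  bool true true c d h _ _ _ = ⊥-elim (h refl refl)
  bool true false true d _ _ h _ = ⊥-elim (h refl refl)
  bool true false false true _ _ _ _ = QP.≤-refl
  bool true false false false _ _ _ _ = QP.≤-refl
  bool false true c true _ _ _ h = ⊥-elim (h refl refl)
  bool false true true false _ _ _ _ = QP.≤-refl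
  bool false true false false _ _ _ _ = QP.≤-refl
  bool false false true true _ h _ _ = ⊥-elim (h refl refl)
  bool false false true false _ _ _ _ = QP.≤-refl
  bool false false false true _ _ _ _ = QP.≤-refl
  bool false false false false _ _ _ _ = QP.≤-refl
  each : ∀ i j → F i j + F j i ≤ ⟦ incident v (i , j) ∨ incident w (i , j) ⟧
  each i j rewrite ==-sym j i | ==-sym v i | ==-sym v j | ==-sym w i | ==-sym w j with i == j in ij
  ... | true = ≤-refl′ (e₀′ (⟦ i == v ⟧ + ⟦ i == w ⟧ * (1ℚ - ⟦ j == v ⟧)) (⟦ j == v ⟧ + ⟦ j == w ⟧ *
      (1ℚ - ⟦ i == v ⟧)))
    ⟫ ⟦⟧≥0 (((i == v) ∨ (j == v)) ∨ ((i == w) ∨ (j == w)))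
    where
    e₀′ : ∀ a b → 0ℚ * a + 0ℚ * b ≡ 0ℚ
    e₀′ = solve-∀ ℚring
  ... | false = bool (i == v) (j == v) (i == w) (j == w) (λ a b → diff (==-true i v a) (==-true j v b))
      (λ a b → diff (==-true i w a) (==-true j w b)) (λ a b → other (==-true i v a) (==-true i w b))
      (λ a b → other (==-true j v a) (==-true j w b))
    where
    diff : ∀ {x} → i ≡ x → j ≡ x → ⊥
    diff refl refl = false≢true ij (==-refl i)
    other : ∀ {x} → x ≡ v → x ≡ w → ⊥
    other refl refl = false≢true v≠w (==-refl v)
  ⟦i≠j⟧ : ∀ i j →
    ⟦ nonadj g i j ⟧ * F i j ≡ ⟦ i == v ⟧ * ⟦ nonadj g i j ⟧ + ⟦ i == w ⟧ * (⟦ nonadj g i j ⟧ *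
      (1ℚ - ⟦ j == v ⟧))
  ⟦i≠j⟧ i j with i == j
  ... | true = e₁ ⟦ i == v ⟧ ⟦ i == w ⟧ (1ℚ - ⟦ j == v ⟧)
    where
    e₁ : ∀ a c d → 0ℚ * (0ℚ * (a + c * d)) ≡ a * 0ℚ + c * (0ℚ * d)
    e₁ = solve-∀ ℚring
  ... | false = e₂ ⟦ not (adj g i j) ⟧ ⟦ i == v ⟧ ⟦ i == w ⟧ (1ℚ - ⟦ j == v ⟧)
    where
    e₂ : ∀ x a c d → x * (1ℚ * (a + c * d)) ≡ a * x + c * (x * d)
    e₂ = solve-∀ ℚring
  w-row : ∑ᶠ (λ j → ⟦ nonadj g w j ⟧ * (1ℚ - ⟦ j == v ⟧)) ≡ ι n - 1ℚ - 1ℚ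
  w-row = trans (∑-cong (allFin n) (λ j → trans (cong (_* (1ℚ - ⟦ j == v ⟧)) (isolated-row g w isoʷ j))
      (pointwise j))) (trans (∑-+ (allFin n) (λ j → 1ℚ - ⟦ j == w ⟧) (λ j → - 1ℚ * ⟦ j == v ⟧))
      (cong₂ _+_ (∑-1-δ w) (trans (∑-*ˡ (allFin n) (- 1ℚ) (λ j → ⟦ j == v ⟧)) (cong (- 1ℚ *_)
      (∑ᶠ-δ₁ v)))))
    where
    pointwise : ∀ j → (1ℚ - ⟦ j == w ⟧) * (1ℚ - ⟦ j == v ⟧) ≡ 1ℚ - ⟦ j == w ⟧ + - 1ℚ * ⟦ j == v ⟧
    pointwise j with j == w in jw | j == v in jv
    ... | true | true = ⊥-elim (false≢true v≠w (trans (cong (_== w) (sym (==-true j v jv))) jw))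
    ... | true | false = refl
    ... | false | true = refl
    ... | false | false = refl
  total₁ : (∑ᶠ λ i → ∑ᶠ λ j → ⟦ nonadj g i j ⟧ * F i j) ≡ two * ι n - fromℕℚ 3
  total₁ = trans (∑-cong (allFin n) (λ i → trans (∑-cong (allFin n) (⟦i≠j⟧ i)) (trans (∑-+ (allFin n)
      (λ j → ⟦ i == v ⟧ * ⟦ nonadj g i j ⟧) (λ j → ⟦ i == w ⟧ * (⟦ nonadj g i j ⟧ * (1ℚ - ⟦ j == v ⟧))))
      (cong₂ _+_ (∑-*ˡ (allFin n) ⟦ i == v ⟧ (λ j → ⟦ nonadj g i j ⟧)) (∑-*ˡ (allFin n) ⟦ i == w ⟧
      (λ j → ⟦ nonadj g i j ⟧ * (1ℚ - ⟦ j == v ⟧))))))) (trans (∑-+ (allFin n) (λ i → ⟦ i == v ⟧ * ∑ᶠ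
      (λ j → ⟦ nonadj g i j ⟧)) (λ i → ⟦ i == w ⟧ * ∑ᶠ (λ j → ⟦ nonadj g i j ⟧ * (1ℚ - ⟦ j == v ⟧))))
      (trans (cong₂ _+_ (trans (∑ᶠ-δ v (λ i → ∑ᶠ (λ j → ⟦ nonadj g i j ⟧))) (trans (∑-cong (allFin n)
      (isolated-row g v isoᵥ)) (∑-1-δ v))) (trans (∑ᶠ-δ w (λ i → ∑ᶠ (λ j → ⟦ nonadj g i j ⟧ *
      (1ℚ - ⟦ j == v ⟧)))) w-row)) (e₃ (ι n))))
    where
    e₃ : ∀ n → n - 1ℚ + (n - 1ℚ - 1ℚ) ≡ (1ℚ + 1ℚ) * n - fromℕℚ 3
    e₃ = solve-∀ ℚring

module SecondMoment
  (n k T : ℕ) (A : Alg n) (p r μ : ℚ) (p≥0 : 0ℚ ≤ p) (r≥0 : 0ℚ ≤ r) (μ≥ : 1ℚ ≤ two * μ)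
  (nonempty : ∀ (g : Graph n) → length g ℕ.≤ T → 0 ℕ.< length (subsets (suc k) (nonEdges g)))
  (m>0 : ∀ (g : Graph n) → length g ℕ.≤ T → 0 ℕ.< length (nonEdges g))
  (low : ∀ (g : Graph n) → length g ℕ.≤ T → p * ι (length (nonEdges g)) ≤ ι (length (nonEdges g)) -
      (ι n - 1ℚ) * ι (suc k))
  (high : ∀ (g : Graph n) → length g ℕ.≤ T → ι (length (nonEdges g)) ≤ r * (ι (length (nonEdges g)) +
      (two * ι n - fromℕℚ 3) * ι (suc k)))
  where

  open Process n (suc k)

  Isolated : Graph n → (Fin n → Bool) → Set
  Isolated g Y = ∀ v → Y v ≡ true → ∀ w → adj g v w ≡ false

  -- A vertex is dropped once any offered edge meets it, chosen or not; so the set does not depend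
  -- on the choice made in the round.
  after : (Fin n → Bool) → List (Edge n) → Fin n → Bool
  after Y o v = Y v ∧ not (any (incident v) o)

  -- Bounds the mean of (S - μ)² after t rounds, written as pairs - (2μ - 1) S + μ². Pairs are
  -- estimated from above by `r` and S from below by `p`, which needs the sign 2μ ≥ 1.
  bound : ℕ → (Fin n → Bool) → ℚ
  bound t Y = r ^ t * pairs Y - (two * μ - 1ℚ) * (p ^ t * singles Y) + μ * μ

  avoid-one : ∀ g → length g ℕ.≤ T → ∀ v →
    p * ι (length (offers g)) ≤ ∑ (offers g) (λ o → ⟦ not (any (incident v) o) ⟧)
  avoid-one g le v = *-cancel≤ (ι m) (ι>0 (m>0 g le)) (≤-refl′ (e₁ (ι m) p len) ⟫ *≤*ʳ (ι≥0 (length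
      (offers g))) (low g le) ⟫ *≤*ʳ (ι≥0 (length (offers g))) (QP.+-monoʳ-≤ (ι m) (neg≤ (*≤*ʳ (ι≥0
      (suc k)) (incident≤ g v)))) ⟫ ≤-by (ι m * ι (bin M (suc k)) + ι L * ι (suc k) * len - ι m * len)
      (diff≥0 avoid) (e₂ (ι m) (ι L) (ι (suc k)) len (ι (bin M (suc k)))) ⟫ ≤-refl′ (cong (ι m *_) (sym
      (∑-avoid (incident v) (suc k) (nonEdges g)))))
    where
    m = length (nonEdges g)
    len = ι (length (offers g))
    M = #ᵇ (not ∘ incident v) (nonEdges g)
    L = #ᵇ (incident v) (nonEdges g)
    len≡ : length (offers g) ≡ bin m (suc k)
    len≡ = length-subsets (suc k) (nonEdges g)
    avoid : ι m * len ≤ ι m * ι (bin M (suc k)) + ι L * ι (suc k) * len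
    avoid = ≤-refl′ (trans (cong (λ z → ι m * ι z) len≡) (sym (ι-* m (bin m (suc k)))))
      ⟫ ι-mono (subst (λ x → x ℕ.* bin x (suc k) ℕ.≤ x ℕ.* bin M (suc k) ℕ.+ L ℕ.* suc k ℕ.* bin x
        (suc k)) (#ᵇ-not (incident v) (nonEdges g)) (avoid-≥ M L (suc k)))
      ⟫ ≤-refl′ (trans (ι-+ (m ℕ.* bin M (suc k)) _) (cong₂ _+_ (ι-* m (bin M (suc k))) (trans (ι-*
        (L ℕ.* suc k) (bin m (suc k))) (cong₂ _*_ (ι-* L (suc k)) (cong ι (sym len≡))))))
    e₁ : ∀ m p l → m * (p * l) ≡ p * m * l
    e₁ = solve-∀ ℚring
    e₂ : ∀ m l k n b → (m - l * k) * n + (m * b + l * k * n - m * n) ≡ m * b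
    e₂ = solve-∀ ℚring

  avoid-two : ∀ g → length g ℕ.≤ T → ∀ v w → (v == w) ≡ false → (∀ x → adj g v x ≡ false) →
    (∀ x → adj g w x ≡ false) →
    ∑ (offers g) (λ o → ⟦ not (any (incident v) o) ⟧ * ⟦ not (any (incident w) o) ⟧) ≤ r * ι (length
      (offers g))
  avoid-two g le v w v≠w isoᵥ isoʷ = ≤-refl′ (trans (∑-cong (offers g) merge) (∑-avoid both (suc k)
      (nonEdges g)))
    ⟫ *-cancel≤ (ι m) (ι>0 (m>0 g le)) (*≤*ʳ (ι≥0 (bin M (suc k))) (high g le) ⟫ *≤*ʳ (ι≥0 (bin M
      (suc k))) (*≤*ˡ r≥0 (QP.+-monoʳ-≤ (ι m) (*≤*ʳ (ι≥0 (suc k)) (incident₂≥ g v w v≠w isoᵥ isoʷ))))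
      ⟫ ≤-refl′ (e₁ r (ι m + ι L * ι (suc k)) (ι (bin M (suc k)))) ⟫ *≤*ˡ r≥0 avoid ⟫ ≤-refl′ (e₂ r
      (ι m) (ι (length (offers g)))))
    where
    both : Edge n → Bool
    both e = incident v e ∨ incident w e
    m = length (nonEdges g)
    M = #ᵇ (not ∘ both) (nonEdges g)
    L = #ᵇ both (nonEdges g)
    merge : ∀ o → ⟦ not (any (incident v) o) ⟧ * ⟦ not (any (incident w) o) ⟧ ≡ ⟦ not (any both o) ⟧
    merge o rewrite any-∨ (incident v) (incident w) o with any (incident v) o | any (incident w) o
    ... | true | true = refl
    ... | true | false = refl
    ... | false | true = refl
    ... | false | false = refl
    avoid : ι (bin M (suc k)) * (ι m + ι L * ι (suc k)) ≤ ι m * ι (length (offers g))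
    avoid = ≤-refl′ (sym (trans (ι-* (bin M (suc k)) (m ℕ.+ L ℕ.* suc k)) (cong (ι (bin M (suc k)) *_)
        (trans (ι-+ m (L ℕ.* suc k)) (cong (ι m +_) (ι-* L (suc k)))))))
      ⟫ ι-mono (subst (λ x → bin M (suc k) ℕ.* (x ℕ.+ L ℕ.* suc k) ℕ.≤ x ℕ.* bin x (suc k)) (#ᵇ-not both
        (nonEdges g)) (avoid-≤ M L (suc k)))
      ⟫ ≤-refl′ (trans (ι-* m (bin m (suc k))) (cong (λ z → ι m * ι z) (sym (length-subsets (suc k)
        (nonEdges g)))))
    e₁ : ∀ r s b → r * s * b ≡ r * (b * s)
    e₁ = solve-∀ ℚring
    e₂ : ∀ r m l → r * (m * l) ≡ m * (r * l)
    e₂ = solve-∀ ℚring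

  singles-drift : ∀ g Y → length g ℕ.≤ T →
    ι (length (offers g)) * (p * singles Y) ≤ ∑ (offers g) (λ o → singles (after Y o))
  singles-drift g Y le = ≤-refl′ (trans (e₁ (ι (length (offers g))) p (singles Y)) (sym (∑-*ʳ (allFin n)
      (p * ι (length (offers g))) (λ v → ⟦ Y v ⟧))))
    ⟫ ∑-mono (allFin n) (λ v → *≤*ˡ (⟦⟧≥0 (Y v)) (avoid-one g le v) ⟫ ≤-refl′ (trans (sym (∑-*ˡ
      (offers g) ⟦ Y v ⟧ (λ o → ⟦ not (any (incident v) o) ⟧))) (∑-cong (offers g) (λ o → sym (⟦∧⟧ (Y v)
      (not (any (incident v) o)))))))
    ⟫ ≤-refl′ (∑-swap (allFin n) (offers g) (λ v o → ⟦ after Y o v ⟧))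
    where
    e₁ : ∀ l p s → l * (p * s) ≡ s * (p * l)
    e₁ = solve-∀ ℚring

  pairs-drift : ∀ g Y → length g ℕ.≤ T → Isolated g Y →
    ∑ (offers g) (λ o → pairs (after Y o)) ≤ ι (length (offers g)) * (r * pairs Y)
  pairs-drift g Y le iso = ≤-refl′ (trans (∑-swap (offers g) (allFin n) (λ o v → ∑ᶠ λ w → term o v w))
      (∑-cong (allFin n) (λ v → ∑-swap (offers g) (allFin n) (λ o w → term o v w))))
    ⟫ ∑-mono (allFin n) (λ v → ∑-mono (allFin n) (each v))
    ⟫ ≤-refl′ (trans (∑-cong (allFin n) (λ v → ∑-*ˡ (allFin n) (r * len) (λ w → ⟦ not (v == w) ⟧ *
      (⟦ Y v ⟧ * ⟦ Y w ⟧)))) (trans (∑-*ˡ (allFin n) (r * len) (λ v → ∑ᶠ λ w → ⟦ not (v == w) ⟧ *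
      (⟦ Y v ⟧ * ⟦ Y w ⟧))) (e₁ r len (pairs Y))))
    where
    len = ι (length (offers g))
    term : List (Edge n) → Fin n → Fin n → ℚ
    term o v w = ⟦ not (v == w) ⟧ * (⟦ after Y o v ⟧ * ⟦ after Y o w ⟧)
    e₁ : ∀ r l p → r * l * p ≡ l * (r * p)
    e₁ = solve-∀ ℚring
    e₂ : ∀ d a x b y → d * (a * x * (b * y)) ≡ d * (a * b) * (x * y)
    e₂ = solve-∀ ℚring
    zero-case : ∀ {x s} → x ≡ 0ℚ → x * s ≤ r * len * x
    zero-case {x} {s} refl = ≤-refl′ (trans (QP.*-zeroˡ s) (sym (QP.*-zeroʳ (r * len))))
    each : ∀ v w → ∑ (offers g) (λ o → term o v w) ≤ r * len * (⟦ not (v == w) ⟧ * (⟦ Y v ⟧ * ⟦ Y w ⟧))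
    each v w = ≤-refl′ (trans (∑-cong (offers g) (λ o → trans (cong₂ (λ a b → ⟦ not (v == w) ⟧ *
        (a * b)) (⟦∧⟧ (Y v) (not (any (incident v) o))) (⟦∧⟧ (Y w) (not (any (incident w) o))))
        (e₂ ⟦ not (v == w) ⟧ ⟦ Y v ⟧ ⟦ not (any (incident v) o) ⟧ ⟦ Y w ⟧ ⟦ not (any
        (incident w) o) ⟧))) (∑-*ˡ (offers g) (⟦ not (v == w) ⟧ * (⟦ Y v ⟧ * ⟦ Y w ⟧)) (λ o → ⟦ not (any
        (incident v) o) ⟧ * ⟦ not (any (incident w) o) ⟧)))
      ⟫ go (v == w) (Y v) (Y w) refl refl refl
      where
      S = ∑ (offers g) (λ o → ⟦ not (any (incident v) o) ⟧ * ⟦ not (any (incident w) o) ⟧)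
      go : ∀ a b c → (v == w) ≡ a → Y v ≡ b → Y w ≡ c →
        ⟦ not a ⟧ * (⟦ b ⟧ * ⟦ c ⟧) * S ≤ r * len * (⟦ not a ⟧ * (⟦ b ⟧ * ⟦ c ⟧))
      go true b c _ _ _ = zero-case {⟦ false ⟧ * (⟦ b ⟧ * ⟦ c ⟧)} {S} (QP.*-zeroˡ (⟦ b ⟧ * ⟦ c ⟧))
      go false false c _ _ _ = zero-case {⟦ true ⟧ * (0ℚ * ⟦ c ⟧)} {S} (trans (QP.*-identityˡ
          (0ℚ * ⟦ c ⟧)) (QP.*-zeroˡ ⟦ c ⟧))
      go false true false _ _ _ = zero-case {⟦ true ⟧ * (1ℚ * 0ℚ)} {S} refl
      go false true true ne yv yw = ≤-refl′ (QP.*-identityˡ S)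
        ⟫ avoid-two g le v w ne (iso v yv) (iso w yw)
        ⟫ ≤-refl′ (sym (QP.*-identityʳ (r * len)))

  isolated-after : ∀ g Y o e → e ∈ o → Isolated g Y → Isolated (e ∷ g) (after Y o)
  isolated-after g Y o (a , b) e∈ iso v h w with ∧-elim (Y v) (not (any (incident v) o)) h
  ... | yv , nt = not-true λ ad → go (∨-elim (sameEdge (a , b) (v , w) ∨ sameEdge (a , b) (w , v))
      (adj g v w) ad)
    where
    untouched : incident v (a , b) ≡ true → ⊥
    untouched i = false≢true (cong not (any-true (incident v) e∈ i)) nt
    go : (sameEdge (a , b) (v , w) ∨ sameEdge (a , b) (w , v) ≡ true) ⊎ (adj g v w ≡ true) → ⊥
    go (inj₂ x) = false≢true (iso v yv w) x
    go (inj₁ x) with ∨-elim (sameEdge (a , b) (v , w)) (sameEdge (a , b) (w , v)) x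
    ... | inj₁ s = untouched (∨-introˡ (v == b) (trans (==-sym v a) (proj₁ (∧-elim (a == v)
        (b == w) s))))
    ... | inj₂ s = untouched (∨-introʳ (v == a) (trans (==-sym v b) (proj₂ (∧-elim (a == w)
        (b == v) s))))

  μ²≥0 : 0ℚ ≤ μ * μ
  μ²≥0 = *≥0 μ≥0 μ≥0
    where
    μ≥0 : 0ℚ ≤ μ
    μ≥0 = *-cancel≤ two (QP.positive⁻¹ two) (0≤1 ⟫ μ≥)

  ∈-lookup : ∀ {X : Set} (xs : List X) i → lookup xs i ∈ xs
  ∈-lookup (x ∷ xs) zero = here refl
  ∈-lookup (x ∷ xs) (suc i) = there (∈-lookup xs i)

  -- A Hamilton cycle leaves no isolated vertex, so μ² times its indicator is at most (S - μ)². The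
  -- bound is linear in `pairs` and `singles`, hence passes through the average of a round.
  second-moment : ∀ t h g Y → length g ℕ.+ t ℕ.≤ T → Isolated g Y →
    μ * μ * probHam n (suc k) A t h g ≤ bound t Y
  second-moment zero h g Y le iso = final (any Y (allFin n)) refl
    where
    S = singles Y
    e₁ : ∀ p s m → 1ℚ * p - ((1ℚ + 1ℚ) * m - 1ℚ) * (1ℚ * s) + m * m ≡ (p + s - s * s) + (s - m) * (s - m)
    e₁ = solve-∀ ℚring
    e₂ : ∀ s m → s * s - s * s + (s - m) * (s - m) ≡ (s - m) * (s - m)
    e₂ = solve-∀ ℚring
    square-form : bound zero Y ≡ (S - μ) * (S - μ)
    square-form = trans (e₁ (pairs Y) S μ) (trans (cong (λ z → z - S * S + (S - μ) * (S - μ))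
        (pairs-singles Y)) (e₂ S μ))
    final : ∀ b → any Y (allFin n) ≡ b → μ * μ * success g ≤ bound zero Y
    final true e with any-witness Y (allFin n) e
    ... | v , _ , yv rewrite isolated⇒¬Hamiltonian g v (iso v yv) = ≤-refl′ (QP.*-zeroʳ (μ * μ))
      ⟫ square≥0 (S - μ)
      ⟫ ≤-refl′ (sym square-form)
    final false e = *≤*ˡ μ²≥0 success≤1
      ⟫ ≤-refl′ (trans (e₄ μ) (trans (cong (λ s → (s - μ) * (s - μ)) (sym S≡0)) (sym square-form)))
      where
      success≤1 : success g ≤ 1ℚ
      success≤1 with Hamiltonian g
      ... | true = QP.≤-refl
      ... | false = 0≤1
      e₄ : ∀ m → m * m * 1ℚ ≡ (0ℚ - m) * (0ℚ - m)
      e₄ = solve-∀ ℚring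
      S≡0 : S ≡ 0ℚ
      S≡0 = trans (∑-cong (allFin n) (λ v → cong ⟦_⟧ (not-true (λ yv → false≢true e (any-true Y
          (∈-allFin v) yv))))) (∑-0 (allFin n))
  second-moment (suc t) h g Y le iso = ≤-refl′ (cong (μ * μ *_) (trans (probHam-suc A t h g
      (nonempty g g≤T)) (average-∑ (offerStep A t h g) (offers g))))
    ⟫ ≤-refl′ (sym (QP.*-assoc (μ * μ) (∑ (offers g) (offerStep A t h g)) (recip (length (offers g)))))
    ⟫ recip-≤ {length (offers g)} (nonempty g g≤T) summed
    where
    len = ι (length (offers g))
    g≤T : length g ℕ.≤ T
    g≤T = ℕP.≤-trans (ℕP.m≤m+n (length g) (suc t)) le
    each : ∀ o → o ∈ offers g → μ * μ * offerStep A t h g o ≤ bound t (after Y o)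
    each [] m = ⊥-elim ([]∉subsets k (nonEdges g) m)
    each (e ∷ es) m = second-moment t (h ++ ((e ∷ es) ∷ [])) (lookup (e ∷ es) (A h e es) ∷ g) (after Y
        (e ∷ es)) (ℕP.≤-trans (ℕP.≤-reflexive (sym (ℕP.+-suc (length g) t))) le) (isolated-after g Y
        (e ∷ es) (lookup (e ∷ es) (A h e es)) (∈-lookup (e ∷ es) (A h e es)) iso)
    c = two * μ - 1ℚ
    c≥0 : 0ℚ ≤ c
    c≥0 = diff≥0 μ≥
    split : ∑ (offers g) (λ o → bound t (after Y o)) ≡ r ^ t * ∑ (offers g) (λ o → pairs (after Y o)) +
        (- (c * p ^ t) * ∑ (offers g) (λ o → singles (after Y o)) + len * (μ * μ))
    split = trans (∑-cong (offers g) (λ o → e₃ (r ^ t) (pairs (after Y o)) c (p ^ t) (singles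
        (after Y o)) (μ * μ))) (trans (∑-+ (offers g) (λ o → r ^ t * pairs (after Y o)) (λ o → -
        (c * p ^ t) * singles (after Y o) + μ * μ)) (cong₂ _+_ (∑-*ˡ (offers g) (r ^ t) (λ o → pairs
        (after Y o))) (trans (∑-+ (offers g) (λ o → - (c * p ^ t) * singles (after Y o)) (λ _ → μ * μ))
        (cong₂ _+_ (∑-*ˡ (offers g) (- (c * p ^ t)) (λ o → singles (after Y o))) (∑-const (offers g)
        (μ * μ))))))
      where
      e₃ : ∀ a p c q s m → a * p - c * (q * s) + m ≡ a * p + (- (c * q) * s + m)
      e₃ = solve-∀ ℚring
    summed : μ * μ * ∑ (offers g) (offerStep A t h g) ≤ len * bound (suc t) Y
    summed = ≤-refl′ (sym (∑-*ˡ (offers g) (μ * μ) (offerStep A t h g)))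
      ⟫ ∑-mono∈ (offers g) each
      ⟫ ≤-refl′ split
      ⟫ QP.+-mono-≤ (*≤*ˡ (^≥0 t r≥0) (pairs-drift g Y g≤T iso)) (QP.+-monoˡ-≤ (len *
        (μ * μ)) singles-part)
      ⟫ ≤-refl′ (e₄ (r ^ t) len r (pairs Y) p (singles Y) (μ * μ) c (p ^ t))
      where
      neg* : ∀ x y → - x * y ≡ - (x * y)
      neg* = solve-∀ ℚring
      singles-part : - (c * p ^ t) * ∑ (offers g) (λ o → singles (after Y o)) ≤ - (c * p ^ t) * (len *
          (p * singles Y))
      singles-part = ≤-refl′ (neg* (c * p ^ t) _)
        ⟫ neg≤ (*≤*ˡ (*≥0 c≥0 (^≥0 t p≥0)) (singles-drift g Y g≤T))
        ⟫ ≤-refl′ (sym (neg* (c * p ^ t) (len * (p * singles Y))))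
      e₄ : ∀ rt l r P p S m c pt →
        rt * (l * (r * P)) + (- (c * pt) * (l * (p * S)) + l * m) ≡ l * (r * rt * P - c *
          (p * pt * S) + m)
      e₄ = solve-∀ ℚring

-- Numerical estimates for the lower bound

module LowerAt
  (n k t : ℕ) (n≥8 : 8 ℕ.≤ n) (K≥2 : 2 ℕ.≤ suc k) (t>0 : 0 ℕ.< t)
  (8t≤n² : 8 ℕ.* t ℕ.≤ n ℕ.* n) (8K≤n : 8 ℕ.* suc k ℕ.≤ n)
  where

  2K≤n : 2 ℕ.* suc k ℕ.≤ n
  2K≤n = ℕP.≤-trans (ℕP.*-monoˡ-≤ (suc k) (ℕP.m≤m+n 2 6)) 8K≤n

  nonempty : ∀ (g : Graph n) → length g ℕ.≤ t → 0 ℕ.< length (subsets (suc k) (nonEdges g))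
  -- Only estimates on the number of non-edges are borrowed here; with u = 4 and a = J = 0 the
  -- remaining conditions of `Instance` hold trivially.
  nonempty = Instance.nonempty n k 4 t 0 0 ℕP.≤-refl n≥8 2K≤n 8t≤n² z≤n z≤n K≥2

  m>0 : ∀ (g : Graph n) → length g ℕ.≤ t → 0 ℕ.< length (nonEdges g)
  m>0 = Instance.m>0 n k 4 t 0 0 ℕP.≤-refl n≥8 2K≤n 8t≤n² z≤n z≤n K≥2

  n>0 : 0 ℕ.< n
  n>0 = ℕP.≤-trans (s≤s z≤n) n≥8

  N K R : ℚ
  N = ι n
  K = ι (suc k)
  R = recip n

  N≥0 : 0ℚ ≤ N
  N≥0 = ι≥0 n

  K≥0 : 0ℚ ≤ K
  K≥0 = ι≥0 (suc k)

  NR : N * R ≡ 1ℚ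
  NR = *-recip n n>0

  R≥0 : 0ℚ ≤ R
  R≥0 = recip≥0 n

  τ : ℚ
  τ = ι t

  τ≥0 : 0ℚ ≤ τ
  τ≥0 = ι≥0 t

  -- `w` bounds the probability (n - 1)K/m of meeting one vertex from above, κ accounting for edges
  -- already present; `x` bounds (2n - 3)K/m for two isolated vertices from below.
  κ v₀ w x : ℚ
  κ = fromℕℚ 4 * τ * (R * R)
  v₀ = two * K * R
  w = v₀ * (1ℚ + κ)
  x = two * v₀ * (1ℚ - R)

  κ≥0 : 0ℚ ≤ κ
  κ≥0 = *≥0 (*≥0 (QP.nonNegative⁻¹ (fromℕℚ 4)) τ≥0) (*≥0 R≥0 R≥0)

  v₀≥0 : 0ℚ ≤ v₀
  v₀≥0 = *≥0 (*≥0 two≥0 K≥0) R≥0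

  w≥0 : 0ℚ ≤ w
  w≥0 = *≥0 v₀≥0 (+≥0 0≤1 κ≥0)

  8τ≤N² : fromℕℚ 8 * τ ≤ N * N
  8τ≤N² = ≤-refl′ (trans (cong (_* τ) (sym (ι-def 8))) (sym (ι-* 8 t)))
    ⟫ ι-mono 8t≤n²
    ⟫ ≤-refl′ (ι-* n n)

  4≤N : fromℕℚ 4 ≤ N
  4≤N = ≤-refl′ (sym (ι-def 4)) ⟫ ι-mono (ℕP.≤-trans (ℕP.m≤m+n 4 4) n≥8)

  scale² : ∀ {a b} → a ≤ b * (N * N) → a * (R * R) ≤ b
  scale² {a} {b} h = *≤*ʳ (*≥0 R≥0 R≥0) h
    ⟫ ≤-refl′ (trans (e₁ b N R) (trans (cong (λ o → b * (o * o)) NR) (QP.*-identityʳ b)))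
    where
    e₁ : ∀ b n r → b * (n * n) * (r * r) ≡ b * (n * r * (n * r))
    e₁ = solve-∀ ℚring

  scale : ∀ {a b} → a ≤ b * N → a * R ≤ b
  scale {a} {b} h = *≤*ʳ R≥0 h
    ⟫ ≤-refl′ (trans (QP.*-assoc b N R) (trans (cong (b *_) NR) (QP.*-identityʳ b)))

  κ≤1 : κ ≤ 1ℚ
  κ≤1 = scale² {fromℕℚ 4 * τ} {1ℚ} (*≤*ʳ τ≥0 (QP.≤ᵇ⇒≤ {fromℕℚ 4} {fromℕℚ 8} _) ⟫ 8τ≤N² ⟫ ≤-refl′ (sym
      (QP.*-identityˡ (N * N))))

  v₀≤¼ : v₀ ≤ pos 1 Q./ 4
  v₀≤¼ = scale {two * K} {pos 1 Q./ 4} (*-cancel≤ (fromℕℚ 4) (QP.positive⁻¹ (fromℕℚ 4)) (≤-refl′ (e₁ K)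
      ⟫ ≤-refl′ (trans (cong (_* K) (sym (ι-def 8))) (sym (ι-* 8 (suc k)))) ⟫ ι-mono 8K≤n ⟫ ≤-refl′
      (e₂ N)))
    where
    e₁ : ∀ k → fromℕℚ 4 * ((1ℚ + 1ℚ) * k) ≡ fromℕℚ 8 * k
    e₁ = solve-∀ ℚring
    e₂ : ∀ n → n ≡ fromℕℚ 4 * ((pos 1 Q./ 4) * n)
    e₂ = solve-∀ ℚring

  w≤2v₀ : w ≤ two * v₀
  w≤2v₀ = *≤*ˡ v₀≥0 (QP.+-monoʳ-≤ 1ℚ κ≤1) ⟫ ≤-refl′ (QP.*-comm v₀ two)

  w≤½ : w ≤ ½
  w≤½ = w≤2v₀ ⟫ *≤*ˡ two≥0 v₀≤¼

  w≤1 : w ≤ 1ℚ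
  w≤1 = w≤½ ⟫ QP.≤ᵇ⇒≤ {½} {1ℚ} _

  R≤½ : two * R ≤ 1ℚ
  R≤½ = scale {two} {1ℚ} (QP.≤ᵇ⇒≤ {two} {fromℕℚ 4} _ ⟫ 4≤N ⟫ ≤-refl′ (sym (QP.*-identityˡ N)))

  R≤1 : R ≤ 1ℚ
  R≤1 = ≤-by R R≥0 (e₁ R) ⟫ R≤½
    where
    e₁ : ∀ r → r + r ≡ (1ℚ + 1ℚ) * r
    e₁ = solve-∀ ℚring

  x≥0 : 0ℚ ≤ x
  x≥0 = *≥0 (*≥0 two≥0 v₀≥0) (diff≥0 R≤1)

  x≤2v₀ : x ≤ two * v₀
  x≤2v₀ = *≤*ˡ (*≥0 two≥0 v₀≥0) (a-b≤a R≥0) ⟫ ≤-refl′ (QP.*-identityʳ (two * v₀))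

  1+x>0 : 0ℚ < 1ℚ + x
  1+x>0 = QP.<-≤-trans 0<1 (a≤a+b x≥0)

  p r : ℚ
  p = 1ℚ - w
  r = inv (1ℚ + x) 1+x>0

  p≥0 : 0ℚ ≤ p
  p≥0 = diff≥0 w≤1

  r≥0 : 0ℚ ≤ r
  r≥0 = inv≥0 (1ℚ + x) 1+x>0

  rx : r * (1ℚ + x) ≡ 1ℚ
  rx = trans (QP.*-comm r (1ℚ + x)) (*-inv (1ℚ + x) 1+x>0)

  low : ∀ (g : Graph n) → length g ℕ.≤ t →
    p * ι (length (nonEdges g)) ≤ ι (length (nonEdges g)) - (N - 1ℚ) * K
  low g le = ≤-by (K * R * (1ℚ + κ) * ((m + m) - (N * (N - 1ℚ) - (l + l))) + K * R * (1ℚ + κ) * (two *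
      (τ - l)) + K * R * κ * (½ * (½ * (N * N - fromℕℚ 8 * τ) + ½ * (N * (N - fromℕℚ 4))))) (+≥0 (+≥0
      (*≥0 (*≥0 (*≥0 K≥0 R≥0) (+≥0 0≤1 κ≥0)) (diff≥0 (nonEdges≥ g))) (*≥0 (*≥0 (*≥0 K≥0 R≥0)
      (+≥0 0≤1 κ≥0)) (*≥0 two≥0 (diff≥0 (ι-mono le))))) (*≥0 (*≥0 (*≥0 K≥0 R≥0) κ≥0) (*≥0 ½≥0 (+≥0
      (*≥0 ½≥0 (diff≥0 8τ≤N²)) (*≥0 ½≥0 (*≥0 N≥0 (diff≥0 4≤N))))))) (trans (e₁ m K R κ N l τ) (trans
      (cong₂ (λ a b → m - K * (N - 1ℚ) * a + K * R * (two * τ - ½ * b)) NR κN²) (e₂ m K N R τ)))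
    where
    m = ι (length (nonEdges g))
    l = ι (length g)
    κN² : κ * (N * N) ≡ fromℕℚ 4 * τ
    κN² = trans (e₃ τ R N) (trans (cong (λ o → fromℕℚ 4 * τ * (o * o)) NR) (QP.*-identityʳ
        (fromℕℚ 4 * τ)))
      where
      e₃ : ∀ t r n → fromℕℚ 4 * t * (r * r) * (n * n) ≡ fromℕℚ 4 * t * (n * r * (n * r))
      e₃ = solve-∀ ℚring
    e₁ : ∀ m k r c n l t →
      (1ℚ - (1ℚ + 1ℚ) * k * r * (1ℚ + c)) * m + (k * r * (1ℚ + c) * ((m + m) - (n * (n - 1ℚ) -
        (l + l))) + k * r * (1ℚ + c) * ((1ℚ + 1ℚ) * (t - l)) + k * r * c * ((pos 1 Q./ 2) *
        ((pos 1 Q./ 2) * (n * n - fromℕℚ 8 * t) + (pos 1 Q./ 2) * (n * (n - fromℕℚ 4))))) ≡ m - k *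
        (n - 1ℚ) * (n * r) + k * r * ((1ℚ + 1ℚ) * t - (pos 1 Q./ 2) * (c * (n * n)))
    e₁ = solve-∀ ℚring
    e₂ : ∀ m k n r t →
      m - k * (n - 1ℚ) * 1ℚ + k * r * ((1ℚ + 1ℚ) * t - (pos 1 Q./ 2) * (fromℕℚ 4 * t)) ≡ m - (n - 1ℚ) * k
    e₂ = solve-∀ ℚring

  high : ∀ (g : Graph n) → length g ℕ.≤ t →
    ι (length (nonEdges g)) ≤ r * (ι (length (nonEdges g)) + (two * N - fromℕℚ 3) * K)
  high g le = ≤-refl′ (trans (sym (QP.*-identityˡ m)) (trans (cong (_* m) (sym rx)) (QP.*-assoc r
      (1ℚ + x) m)))
    ⟫ *≤*ˡ r≥0 (≤-by (two * K * R * (1ℚ - R) * (N * (N - 1ℚ) - (m + m)) + K * (1ℚ - two * R)) (+≥0 (*≥0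
      (*≥0 v₀≥0 (diff≥0 R≤1)) (diff≥0 (nonEdges≤ g))) (*≥0 K≥0 (diff≥0 R≤½))) (trans (e₁ m K R N) (trans
      (cong (λ o → m + K * (1ℚ - two * R) + two * K * (N - 1ℚ - o + R) * o) NR) (e₂ m K R N))))
    where
    m = ι (length (nonEdges g))
    e₁ : ∀ m k r n →
      (1ℚ + (1ℚ + 1ℚ) * ((1ℚ + 1ℚ) * k * r) * (1ℚ - r)) * m + ((1ℚ + 1ℚ) * k * r * (1ℚ - r) * (n *
        (n - 1ℚ) - (m + m)) + k * (1ℚ - (1ℚ + 1ℚ) * r)) ≡ m + k * (1ℚ - (1ℚ + 1ℚ) * r) + (1ℚ + 1ℚ) * k *
        (n - 1ℚ - n * r + r) * (n * r)
    e₁ = solve-∀ ℚring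
    e₂ : ∀ m k r n →
      m + k * (1ℚ - (1ℚ + 1ℚ) * r) + (1ℚ + 1ℚ) * k * (n - 1ℚ - 1ℚ + r) * 1ℚ ≡ m +
        ((1ℚ + 1ℚ) * n - fromℕℚ 3) * k
    e₂ = solve-∀ ℚring

  μ : ℚ
  μ = N * p ^ t

  -- The relative excess of `r` over p² in one round. The first-order terms 2w and x nearly cancel,
  -- leaving 2v₀(κ + 1/n); the last summand bounds 2wx.
  Ω : ℚ
  Ω = two * v₀ * (κ + R) + two * ((two * v₀) * (two * v₀))

  Ω≥0 : 0ℚ ≤ Ω
  Ω≥0 = +≥0 (*≥0 (*≥0 two≥0 v₀≥0) (+≥0 κ≥0 R≥0)) (*≥0 two≥0 (*≥0 (*≥0 two≥0 v₀≥0) (*≥0 two≥0 v₀≥0)))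

  -- (1 + x)(1 - w)² ≥ 1 - Ω
  r-Ω : r * (1ℚ - Ω) ≤ p * p
  r-Ω = *≤*ˡ r≥0 (≤-by (two * ((two * v₀) * (two * v₀) - w * x) + w * w * (1ℚ + x)) (+≥0 (*≥0 two≥0
      (diff≥0 (*≤* w≥0 w≤2v₀ x≥0 x≤2v₀))) (*≥0 (*≥0 w≥0 w≥0) (+≥0 0≤1 x≥0))) (e₁ v₀ κ R))
    ⟫ ≤-refl′ (trans (sym (QP.*-assoc r (1ℚ + x) (p * p))) (trans (cong (_* (p * p)) rx) (QP.*-identityˡ
      (p * p))))
    where
    e₁ : ∀ v c r →
      1ℚ - ((1ℚ + 1ℚ) * v * (c + r) + (1ℚ + 1ℚ) * (((1ℚ + 1ℚ) * v) * ((1ℚ + 1ℚ) * v))) + ((1ℚ + 1ℚ) *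
        (((1ℚ + 1ℚ) * v) * ((1ℚ + 1ℚ) * v) - v * (1ℚ + c) * ((1ℚ + 1ℚ) * v * (1ℚ - r))) + v * (1ℚ + c) *
        (v * (1ℚ + c)) * (1ℚ + (1ℚ + 1ℚ) * v * (1ℚ - r))) ≡ (1ℚ + (1ℚ + 1ℚ) * v * (1ℚ - r)) * ((1ℚ - v *
        (1ℚ + c)) * (1ℚ - v * (1ℚ + c)))
    e₁ = solve-∀ ℚring

  -- Chebyshev's inequality: the pairs exceed μ² by at most 2φμ², and the diagonal contributes μ ≤
  -- ψμ².
  probability-≤ : ∀ A φ ψ → τ * Ω ≤ φ → φ ≤ ½ → 1ℚ ≤ ψ * μ → ψ ≤ 1ℚ →
    ProbHamAfter n (suc k) A t ≤ two * φ + ψ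
  probability-≤ A φ ψ tΩ φ≤½ ψμ ψ≤1 = *-cancel≤ (μ * μ) (*>0 μ>0 μ>0)
      (SecondMoment.second-moment n k t A p r μ p≥0 r≥0 (μ≥1 ⟫ ≤-by μ μ≥0
      (dbl μ)) nonempty m>0 low high t [] [] (λ _ → true) ℕP.≤-refl (λ v _ w → refl) ⟫ QP.+-monoˡ-≤
      (μ * μ) (QP.+-mono-≤ (*≤*ˡ (^≥0 t r≥0) pairs≤) (≤-refl′ (cong (λ s → - ((two * μ - 1ℚ) *
      (p ^ t * s))) singles≡))) ⟫ ≤-by ((μ * μ * (1ℚ + two * φ) - r ^ t * (N * N)) + μ * (ψ * μ - 1ℚ))
      (+≥0 (diff≥0 second) (*≥0 μ≥0 (diff≥0 ψμ))) (e₁ (r ^ t) N (p ^ t) φ ψ))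
    where
    dbl : ∀ a → a + a ≡ (1ℚ + 1ℚ) * a
    dbl = solve-∀ ℚring
    μ≥0 : 0ℚ ≤ μ
    μ≥0 = *≥0 N≥0 (^≥0 t p≥0)
    μ≥1 : 1ℚ ≤ μ
    μ≥1 = ψμ ⟫ *≤*ʳ μ≥0 ψ≤1 ⟫ ≤-refl′ (QP.*-identityˡ μ)
    μ>0 : 0ℚ < μ
    μ>0 = QP.<-≤-trans 0<1 μ≥1
    singles≡ : singles {n} (λ _ → true) ≡ N
    singles≡ = trans (∑ᶠ-const n 1ℚ) (QP.*-identityʳ N)
    pairs≤ : pairs {n} (λ _ → true) ≤ N * N
    pairs≤ = a≤a+b (∑≥0 (allFin n) (λ _ → 0≤1))
      ⟫ ≤-refl′ (trans (pairs-singles {n} (λ _ → true)) (cong₂ _*_ singles≡ singles≡))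
    Ω≤φ : Ω ≤ φ
    Ω≤φ = ≤-refl′ (sym (QP.*-identityˡ Ω)) ⟫ *≤*ʳ Ω≥0 (ι≥1 t>0) ⟫ tΩ
    Ω≤1 : Ω ≤ 1ℚ
    Ω≤1 = Ω≤φ ⟫ φ≤½ ⟫ QP.≤ᵇ⇒≤ {½} {1ℚ} _
    φ≥0 : 0ℚ ≤ φ
    φ≥0 = Ω≥0 ⟫ Ω≤φ
    μ² : p ^ t * p ^ t * (N * N) ≡ μ * μ
    μ² = e₂ (p ^ t) N
      where
      e₂ : ∀ q n → q * q * (n * n) ≡ n * q * (n * q)
      e₂ = solve-∀ ℚring
    ratio-bound : r ^ t * (N * N) * (1ℚ - φ) ≤ μ * μ
    ratio-bound = *≤*ˡ (*≥0 (^≥0 t r≥0) (*≥0 N≥0 N≥0)) (QP.+-monoʳ-≤ 1ℚ (neg≤ tΩ) ⟫ bernoulli⁻ t Ω≤1)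
      ⟫ ≤-refl′ (trans (e₃ (r ^ t) (N * N) ((1ℚ - Ω) ^ t)) (cong (_* (N * N)) (sym (^-*ˡ r (1ℚ - Ω) t))))
      ⟫ *≤*ʳ (*≥0 N≥0 N≥0) (^-mono t (*≥0 r≥0 (diff≥0 Ω≤1)) r-Ω ⟫ ≤-refl′ (^-*ˡ p p t))
      ⟫ ≤-refl′ μ²
      where
      e₃ : ∀ a b c → a * b * c ≡ a * c * b
      e₃ = solve-∀ ℚring
    second : r ^ t * (N * N) ≤ μ * μ * (1ℚ + two * φ)
    second = ≤-by (r ^ t * (N * N) * (φ * (1ℚ - two * φ))) (*≥0 (*≥0 (^≥0 t r≥0) (*≥0 N≥0 N≥0)) (*≥0 φ≥0
        (diff≥0 (*≤*ˡ two≥0 φ≤½)))) (e₄ (r ^ t * (N * N)) φ)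
      ⟫ *≤*ʳ (+≥0 0≤1 (*≥0 two≥0 φ≥0)) ratio-bound
      where
      e₄ : ∀ a f → a + a * (f * (1ℚ - (1ℚ + 1ℚ) * f)) ≡ a * (1ℚ - f) * (1ℚ + (1ℚ + 1ℚ) * f)
      e₄ = solve-∀ ℚring
    e₁ : ∀ rt n q f s →
      rt * (n * n) - ((1ℚ + 1ℚ) * (n * q) - 1ℚ) * (q * n) + n * q * (n * q) + ((n * q * (n * q) * (1ℚ +
        (1ℚ + 1ℚ) * f) - rt * (n * n)) + n * q * (s * (n * q) - 1ℚ)) ≡ n * q * (n * q) *
        ((1ℚ + 1ℚ) * f + s)
    e₁ = solve-∀ ℚring

  -- The exponent is close enough to a multiple of log n: if (1 + v)^t ≤ n for
  -- v ≥ (1 + 1/e) v₀ then the expected number μ of untouched vertices is at least n^(1/(2e+1)).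
  module Mean (e : ℕ) (σ v : ℚ) (σ≤1 : σ ≤ 1ℚ) (σ-small : σ * (ι (suc (2 ℕ.* e)) * (ι (suc
      (2 ℕ.* e)) + fromℕℚ 4)) ≤ 1ℚ) (κ≤σ : κ ≤ σ) (w≤σ : two * w ≤ σ) (v-large : (ι (suc
      (2 ℕ.* e)) + 1ℚ) * v₀ ≤ ι (2 ℕ.* e) * v) (v≥0 : 0ℚ ≤ v) (grow : (1ℚ + v) ^ t ≤ N) where

    β : ℕ
    β = suc (2 ℕ.* e)

    B : ℚ
    B = ι β

    B≥0 : 0ℚ ≤ B
    B≥0 = ι≥0 β

    σ≥0 : 0ℚ ≤ σ
    σ≥0 = κ≥0 ⟫ κ≤σ

    -- An upper substitute for 1/(1 - w) - 1: the product (1 - w)(1 + w″) is 1 + w²(1 - 2w).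
    w″ : ℚ
    w″ = w * (1ℚ + two * w)

    2w≤1 : two * w ≤ 1ℚ
    2w≤1 = w≤σ ⟫ σ≤1

    w″≥0 : 0ℚ ≤ w″
    w″≥0 = *≥0 w≥0 (+≥0 0≤1 (*≥0 two≥0 w≥0))

    w″≤σ : w″ ≤ σ
    w″≤σ = *≤*ˡ w≥0 (QP.+-monoʳ-≤ 1ℚ 2w≤1) ⟫ ≤-refl′ (QP.*-comm w two) ⟫ w≤σ

    -- Expanded, it needs σ(B² + 3B) + Bσ² ≤ 1; with σ ≤ 1 this follows from σB(B + 4) ≤ 1, the
    -- origin of the 4.
    core-ineq : B * ((1ℚ + σ) * (1ℚ + σ)) ≤ (B + 1ℚ) * (1ℚ - B * σ)
    core-ineq = ≤-by ((1ℚ - σ * (B * (B + fromℕℚ 4))) + B * σ * (1ℚ - σ)) (+≥0 (diff≥0 σ-small) (*≥0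
        (*≥0 B≥0 σ≥0) (diff≥0 σ≤1))) (e₁ B σ)
      where
      e₁ : ∀ b s →
        b * ((1ℚ + s) * (1ℚ + s)) + ((1ℚ - s * (b * (b + fromℕℚ 4))) + b * s * (1ℚ - s)) ≡ (b + 1ℚ) *
          (1ℚ - b * s)
      e₁ = solve-∀ ℚring

    Bw″≤ : B * w″ ≤ (B + 1ℚ) * v₀ * (1ℚ - B * w″)
    Bw″≤ = ≤-refl′ (e₁ B v₀ κ (two * w))
      ⟫ *≤*ˡ v₀≥0 (*≤*ˡ B≥0 (*≤* (+≥0 0≤1 κ≥0) (QP.+-monoʳ-≤ 1ℚ κ≤σ) (+≥0 0≤1 (*≥0 two≥0 w≥0))
        (QP.+-monoʳ-≤ 1ℚ w≤σ)) ⟫ core-ineq ⟫ *≤*ˡ (+≥0 B≥0 0≤1) (QP.+-monoʳ-≤ 1ℚ (neg≤ (*≤*ˡ B≥0 w″≤σ))))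
      ⟫ ≤-refl′ (e₂ v₀ (B + 1ℚ) (1ℚ - B * w″))
      where
      e₁ : ∀ b v c d → b * (v * (1ℚ + c) * (1ℚ + d)) ≡ v * (b * ((1ℚ + c) * (1ℚ + d)))
      e₁ = solve-∀ ℚring
      e₂ : ∀ v b c → v * (b * c) ≡ b * v * c
      e₂ = solve-∀ ℚring

    w″≤1 : w″ ≤ 1ℚ
    w″≤1 = w″≤σ ⟫ σ≤1

    -- The chain is (1 + w″)^β ≤ 1/(1 - βw″) ≤ 1 + (β + 1)v₀ ≤ 1 + 2e v ≤ (1 + v)^(2e); the gap
    -- between v₀ and v, of relative size 1/e, leaves room for the error terms.
    compare : (1ℚ + w″) ^ β ≤ (1ℚ + v) ^ (2 ℕ.* e)
    compare = step ⟫ bernoulli (2 ℕ.* e) (neg≤ {0ℚ} {1ℚ} 0≤1 ⟫ v≥0)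
      where
      Y = (1ℚ + w″) ^ β
      Y≥0 : 0ℚ ≤ Y
      Y≥0 = ^≥0 β (+≥0 0≤1 w″≥0)
      small : Y * (1ℚ - B * w″) ≤ 1ℚ
      small = *≤*ˡ Y≥0 (bernoulli⁻ β w″≤1)
        ⟫ ≤-refl′ (sym (^-*ˡ (1ℚ + w″) (1ℚ - w″) β))
        ⟫ ^≤1 β (*≥0 (+≥0 0≤1 w″≥0) (diff≥0 w″≤1)) (≤-by (w″ * w″) (*≥0 w″≥0 w″≥0) (sqd w″))
        where
        sqd : ∀ x → (1ℚ + x) * (1ℚ - x) + x * x ≡ 1ℚ
        sqd = solve-∀ ℚring
      step : Y ≤ 1ℚ + ι (2 ℕ.* e) * v
      step = ≤-by (Y * ((B + 1ℚ) * v₀ * (1ℚ - B * w″) - B * w″)) (*≥0 Y≥0 (diff≥0 Bw″≤)) (e₂ Y (B * w″)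
          ((B + 1ℚ) * v₀))
        ⟫ *≤*ʳ (+≥0 0≤1 (*≥0 (+≥0 B≥0 0≤1) v₀≥0)) small
        ⟫ ≤-refl′ (QP.*-identityˡ (1ℚ + (B + 1ℚ) * v₀))
        ⟫ QP.+-monoʳ-≤ 1ℚ v-large
        where
        e₂ : ∀ y a c → y + y * (c * (1ℚ - a) - a) ≡ y * (1ℚ - a) * (1ℚ + c)
        e₂ = solve-∀ ℚring

    -- Since 1 ≤ p(1 + w″), the t-th power of `compare` yields 1 ≤ p^(tβ) N^(2e); one more factor N
    -- completes μ^β, as β = 2e + 1.
    mean-large : N ≤ μ ^ β
    mean-large = ≤-refl′ (sym (QP.*-identityʳ N))
      ⟫ *≤*ˡ N≥0 (≤-refl′ (sym (1^ (t ℕ.* β))) ⟫ ^-mono (t ℕ.* β) 0≤1 unit ⟫ ≤-refl′ (^-*ˡ p (1ℚ + w″)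
        (t ℕ.* β)) ⟫ *≤*ˡ (^≥0 (t ℕ.* β) p≥0) (≤-refl′ (trans (cong ((1ℚ + w″) ^_) (ℕP.*-comm t β)) (^-^
        (1ℚ + w″) β t)) ⟫ ^-mono t (^≥0 β (+≥0 0≤1 w″≥0)) compare ⟫ ≤-refl′ (^-swap (1ℚ + v)
        (2 ℕ.* e) t) ⟫ ^-mono (2 ℕ.* e) (^≥0 t (+≥0 0≤1 v≥0)) grow))
      ⟫ ≤-refl′ (trans (e₁ N (p ^ (t ℕ.* β)) (N ^ (2 ℕ.* e))) (trans (cong (N * N ^ (2 ℕ.* e) *_)
        (^-^ p t β)) (sym (^-*ˡ N (p ^ t) β))))
      where
      e₁ : ∀ n q m → n * (q * m) ≡ n * m * q
      e₁ = solve-∀ ℚring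
      unit : 1ℚ ≤ p * (1ℚ + w″)
      unit = ≤-by (w * w * (1ℚ - two * w)) (*≥0 (*≥0 w≥0 w≥0) (diff≥0 2w≤1)) (e₂ w)
        where
        e₂ : ∀ w → 1ℚ + w * w * (1ℚ - (1ℚ + 1ℚ) * w) ≡ (1ℚ - w) * (1ℚ + w * (1ℚ + (1ℚ + 1ℚ) * w))
        e₂ = solve-∀ ℚring

module LogSquare (n : ℕ) (n>0 : 0 ℕ.< n) where

  open Log 1 n (s≤s z≤n) n>0 public

  P : ℕ
  P = bn ℕ.* bn

  -- With four copies of h in place of two, log n is compared with n^(1/4), which is what makes s²
  -- of smaller order than n³.
  fourth-power : ∀ h → h ℕ.* 4 ℕ.≤ s → h ℕ.* h ℕ.* (h ℕ.* h) ℕ.≤ P ℕ.* P ℕ.* n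
  fourth-power h le = ι-cancel≤ (≤-refl′ (trans (ι-* (h ℕ.* h) (h ℕ.* h)) (trans (cong₂ _*_ (ι-* h h)
      (ι-* h h)) (sym (trans (e₁ (ι bn) (ι h) z) (trans (cong (λ o → ι h * ι h * (ι h * ι h) * (o * o *
      (o * o))) (*-recip bn bn>0)) (QP.*-identityʳ (ι h * ι h * (ι h * ι h)))))))) ⟫ *≤*ˡ (*≥0 (*≥0
      (ι≥0 bn) (ι≥0 bn)) (*≥0 (ι≥0 bn) (ι≥0 bn))) (^-mono 4 (*≥0 (ι≥0 h) z≥0) (a≤b+a 0≤1 ⟫ bernoulli h
      (neg≤ {0ℚ} {1ℚ} 0≤1 ⟫ z≥0)) ⟫ ≤-refl′ (sym (^-^ (1ℚ + z) h 4)) ⟫ ^-monotone (a≤a+b z≥0) le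
      ⟫ below-growth s s-below) ⟫ ≤-refl′ (sym (trans (ι-* (P ℕ.* P) n) (cong (_* ι n) (trans (ι-* P P)
      (cong₂ _*_ (ι-* bn bn) (ι-* bn bn)))))))
    where
    e₁ : ∀ b h z →
      b * b * (b * b) * (h * z * (h * z * (h * z * (h * z * 1ℚ)))) ≡ h * h * (h * h) * (b * z *
        (b * z) * (b * z * (b * z)))
    e₁ = solve-∀ ℚring

  s²-bound : ∀ C → 49 ℕ.* C ℕ.* (49 ℕ.* C) ℕ.≤ n → 9 ℕ.* C ℕ.≤ n → C ℕ.* (s ℕ.* s) ℕ.≤ P ℕ.* n
  s²-bound C big₁ big₂ = cases (proj₁ f) (proj₁ (proj₂ f)) (proj₂ (proj₂ f))
    where
    f = floor s 4 (s≤s z≤n)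
    P>0 : 0 ℕ.< P
    P>0 = ℕP.*-mono-≤ bn>0 bn>0
    cases : ∀ h → 4 ℕ.* h ℕ.≤ s → s ℕ.< 4 ℕ.* suc h → C ℕ.* (s ℕ.* s) ℕ.≤ P ℕ.* n
    cases zero lo hi = ℕP.≤-trans (ℕP.*-monoʳ-≤ C (ℕP.*-mono-≤ {s} {3} {s} {3} (ℕP.≤-pred hi)
        (ℕP.≤-pred hi))) (ℕP.≤-trans (ℕP.≤-reflexive (ℕP.*-comm C 9)) (ℕP.≤-trans big₂
        (ℕP.m≤n*m n P {{ℕ.>-nonZero P>0}})))
    -- For h ≥ 1 one has s ≤ 4h + 3 ≤ 7h, whence the constant 49; for h = 0, s ≤ 3 gave the 9.
    cases h@(suc h′) lo hi = ℕP.≮⇒≥ λ lt → ℕP.<-irrefl refl (ℕP.<-≤-trans (ℕP.*-mono-<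
        (ℕP.<-≤-trans lt upper) (ℕP.<-≤-trans lt upper)) below)
      where
      Q₀ = 49 ℕ.* C
      s≤7h : s ℕ.≤ 7 ℕ.* h
      s≤7h = ℕP.≤-trans (ℕP.≤-pred hi) (ℕP.≤-trans (ℕP.≤-reflexive (e₁ h′)) (ℕP.≤-trans (ℕP.m≤m+n
          (7 ℕ.+ 4 ℕ.* h′) (3 ℕ.* h′)) (ℕP.≤-reflexive (e₂ h′))))
        where
        e₁ : ∀ h → suc h ℕ.+ 3 ℕ.* suc (suc h) ≡ 7 ℕ.+ 4 ℕ.* h
        e₁ = NS.solve-∀
        e₂ : ∀ h → 7 ℕ.+ 4 ℕ.* h ℕ.+ 3 ℕ.* h ≡ 7 ℕ.* suc h
        e₂ = NS.solve-∀
      upper : C ℕ.* (s ℕ.* s) ℕ.≤ Q₀ ℕ.* (h ℕ.* h)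
      upper = ℕP.≤-trans (ℕP.*-monoʳ-≤ C (ℕP.*-mono-≤ s≤7h s≤7h)) (ℕP.≤-reflexive (e₁ C h))
        where
        e₁ : ∀ C h → C ℕ.* (7 ℕ.* h ℕ.* (7 ℕ.* h)) ≡ 49 ℕ.* C ℕ.* (h ℕ.* h)
        e₁ = NS.solve-∀
      below : Q₀ ℕ.* (h ℕ.* h) ℕ.* (Q₀ ℕ.* (h ℕ.* h)) ℕ.≤ P ℕ.* n ℕ.* (P ℕ.* n)
      below = ℕP.≤-trans (ℕP.≤-reflexive (e₁ Q₀ h)) (ℕP.≤-trans (ℕP.*-mono-≤ big₁ (fourth-power h
          (ℕP.≤-trans (ℕP.≤-reflexive (ℕP.*-comm h 4)) lo))) (ℕP.≤-reflexive (e₂ n P)))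
        where
        e₁ : ∀ q h → q ℕ.* (h ℕ.* h) ℕ.* (q ℕ.* (h ℕ.* h)) ≡ q ℕ.* q ℕ.* (h ℕ.* h ℕ.* (h ℕ.* h))
        e₁ = NS.solve-∀
        e₂ : ∀ n P → n ℕ.* (P ℕ.* P ℕ.* n) ≡ P ℕ.* n ℕ.* (P ℕ.* n)
        e₂ = NS.solve-∀

-- Assembling the lower bound

module Lower (e e′ : ℕ) (e>0 : 0 ℕ.< e) (e′>0 : 0 ℕ.< e′) (ε : ℚ) (ε>0 : 0ℚ < ε) (e≤ : recip e ≤ ε) where

  -- 1/q is the tolerance σ of `Mean`, and the summand 8q of C keeps κ and 2w below it. The 104 is 2
  -- · 16 + 2 · 36, twice the coefficients in the estimate of τΩ.
  β q C : ℕ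
  β = suc (2 ℕ.* e)
  q = β ℕ.* (β ℕ.+ 4)
  C = 8 ℕ.* q ℕ.+ 104 ℕ.* e′

  q>0 : 0 ℕ.< q
  q>0 = s≤s z≤n

  8q≤C : 8 ℕ.* q ℕ.≤ C
  8q≤C = ℕP.m≤m+n (8 ℕ.* q) (104 ℕ.* e′)

  104e′≤C : 104 ℕ.* e′ ℕ.≤ C
  104e′≤C = ℕP.m≤n+m (104 ℕ.* e′) (8 ℕ.* q)

  8≤C : 8 ℕ.≤ C
  8≤C = ℕP.≤-trans (ℕP.m≤m*n 8 q {{ℕ.>-nonZero q>0}}) 8q≤C

  module At (n k t : ℕ) (n>0 : 0 ℕ.< n) (K≥2 : 2 ℕ.≤ suc k) (t>0 : 0 ℕ.< t)
    (big₁ : 49 ℕ.* C ℕ.* (49 ℕ.* C) ℕ.≤ n) (big₂ : 9 ℕ.* C ℕ.≤ n) (big₃ : e′ ℕ.^ β ℕ.< n)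
    (d>0 : 0ℚ < (1ℚ - ε) * fromℕℚ n) (exp-t : ExpLe (fromℕℚ (2 ℕ.* suc k ℕ.* t) * inv
        ((1ℚ - ε) * fromℕℚ n) d>0) n)
    (½>0 : 0ℚ < ½) (exp-K : ExpLe (fromℕℚ (suc k) * inv ½ ½>0) n)
    where

    open LogSquare n n>0

    K S : ℕ
    K = suc k
    S = K ℕ.* t

    d d⁻¹ : ℚ
    d = (1ℚ - ε) * fromℕℚ n
    d⁻¹ = inv d d>0

    bn≡n : bn ≡ n
    bn≡n = ℕP.*-identityˡ n

    nz : ι n * z ≡ 1ℚ
    nz = trans (cong (λ m → ι m * z) (sym bn≡n)) (*-recip bn bn>0)

    n≥8 : 8 ℕ.≤ n
    n≥8 = ℕP.≤-trans (ℕP.≤-trans 8≤C (ℕP.m≤n*m C 9)) big₂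

    bn≥2 : 2 ℕ.≤ bn
    bn≥2 = ℕP.≤-trans (ℕP.≤-trans (ℕP.m≤m+n 2 6) n≥8) (ℕP.≤-reflexive (sym bn≡n))

    d≤n : d ≤ ι n
    d≤n = *≤*ʳ (subst (0ℚ ≤_) (ι-def n) (ι≥0 n)) (a-b≤a {1ℚ} {ε} (QP.<⇒≤ ε>0))
      ⟫ ≤-refl′ (trans (QP.*-identityˡ (fromℕℚ n)) (sym (ι-def n)))

    z≤d⁻¹ : z ≤ d⁻¹
    z≤d⁻¹ = *-cancel≤ d d>0 (*≤*ʳ z≥0 d≤n ⟫ ≤-refl′ (trans nz (sym (*-inv d d>0))))

    S≤s : S ℕ.≤ s
    S≤s = below⇒≤s S (exp-below S bn≥2 (≤-refl′ (trans (e₁ (ι S) z) (cong (_* z) (trans (cong (_* ι S)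
        (sym (ι-def 2))) (trans (sym (ι-* 2 S)) (cong ι (sym (ℕP.*-assoc 2 K t))))))) ⟫ *≤*ˡ (ι≥0
        (2 ℕ.* K ℕ.* t)) z≤d⁻¹ ⟫ ≤-refl′ (cong (_* d⁻¹) (ι-def (2 ℕ.* K ℕ.* t)))) exp-t)
      where
      e₁ : ∀ s z → s * ((1ℚ + 1ℚ) * z) ≡ (1ℚ + 1ℚ) * s * z
      e₁ = solve-∀ ℚring

    -- K ≤ (1/2) log n is assumed so that the factor 2 lost in `exp-below` cancels.
    Kn≤s : K ℕ.* n ℕ.≤ s
    Kn≤s = below⇒≤s (K ℕ.* n) (exp-below (K ℕ.* n) bn≥2 (≤-refl′ (trans left (sym right))) exp-K)
      where
      left : ι (K ℕ.* n) * (two * z) ≡ two * ι K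
      e₁ : ∀ k n z → k * n * ((1ℚ + 1ℚ) * z) ≡ (1ℚ + 1ℚ) * k * (n * z)
      e₁ = solve-∀ ℚring
      e₂ : ∀ k i → k * i ≡ (1ℚ + 1ℚ) * k * ((pos 1 Q./ 2) * i)
      e₂ = solve-∀ ℚring
      left = trans (cong (_* (two * z)) (ι-* K n)) (trans (e₁ (ι K) (ι n) z) (trans (cong
          (λ o → two * ι K * o) nz) (QP.*-identityʳ (two * ι K))))
      right : fromℕℚ K * inv ½ ½>0 ≡ two * ι K
      right = trans (cong (_* inv ½ ½>0) (sym (ι-def K))) (trans (e₂ (ι K) (inv ½ ½>0)) (trans (cong
          (λ o → two * ι K * o) (*-inv ½ ½>0)) (QP.*-identityʳ (two * ι K))))

    Cs²≤ : C ℕ.* (s ℕ.* s) ℕ.≤ n ℕ.* n ℕ.* n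
    Cs²≤ = ℕP.≤-trans (s²-bound C big₁ big₂) (ℕP.≤-reflexive (cong (λ m → m ℕ.* m ℕ.* n) bn≡n))

    CS² : C ℕ.* (S ℕ.* S) ℕ.≤ n ℕ.* n ℕ.* n
    CS² = ℕP.≤-trans (ℕP.*-monoʳ-≤ C (ℕP.*-mono-≤ S≤s S≤s)) Cs²≤

    CK² : C ℕ.* (K ℕ.* K) ℕ.≤ n
    CK² = ℕP.*-cancelˡ-≤ (n ℕ.* n) {{ℕ.>-nonZero (ℕP.*-mono-≤ n>0 n>0)}} (ℕP.≤-trans (ℕP.≤-reflexive
        (e₁ n C K)) (ℕP.≤-trans (ℕP.*-monoʳ-≤ C (ℕP.*-mono-≤ Kn≤s Kn≤s)) Cs²≤))
      where
      e₁ : ∀ n C K → n ℕ.* n ℕ.* (C ℕ.* (K ℕ.* K)) ≡ C ℕ.* (K ℕ.* n ℕ.* (K ℕ.* n))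
      e₁ = NS.solve-∀

    -- The geometric mean of `CK²` and `CS²`.
    CKS : C ℕ.* (K ℕ.* S) ℕ.≤ n ℕ.* n
    CKS = square-cancel (ℕP.≤-trans (ℕP.≤-reflexive (e₁ C K S)) (ℕP.≤-trans (ℕP.*-mono-≤ CK² CS²)
        (ℕP.≤-reflexive (e₂ n))))
      where
      e₁ : ∀ C K S → C ℕ.* (K ℕ.* S) ℕ.* (C ℕ.* (K ℕ.* S)) ≡ C ℕ.* (K ℕ.* K) ℕ.* (C ℕ.* (S ℕ.* S))
      e₁ = NS.solve-∀
      e₂ : ∀ n → n ℕ.* (n ℕ.* n ℕ.* n) ≡ n ℕ.* n ℕ.* (n ℕ.* n)
      e₂ = NS.solve-∀

    Ct : C ℕ.* t ℕ.≤ n ℕ.* n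
    Ct = ℕP.≤-trans (ℕP.*-monoʳ-≤ C (ℕP.≤-trans (ℕP.m≤n*m t K) (ℕP.m≤n*m S K))) CKS

    CK : C ℕ.* K ℕ.≤ n
    CK = ℕP.≤-trans (ℕP.*-monoʳ-≤ C (ℕP.m≤m*n K K)) CK²

    open LowerAt n k t n≥8 K≥2 t>0 (ℕP.≤-trans (ℕP.*-monoˡ-≤ t 8≤C) Ct) (ℕP.≤-trans
        (ℕP.*-monoˡ-≤ K 8≤C) CK) hiding (n>0; K; nonempty; m>0)

    Kℚ : ℚ
    Kℚ = ι K

    σ v : ℚ
    σ = recip q
    v = two * Kℚ * d⁻¹

    qσ : ι q * σ ≡ 1ℚ
    qσ = *-recip q q>0

    σ≤1 : σ ≤ 1ℚ
    σ≤1 = ≤-refl′ (sym (QP.*-identityˡ σ))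
      ⟫ recip-≤ {q} q>0 (ι≥1 q>0 ⟫ ≤-refl′ (sym (QP.*-identityʳ (ι q))))

    σ-small : σ * (ι β * (ι β + fromℕℚ 4)) ≤ 1ℚ
    σ-small = ≤-refl′ (trans (cong (σ *_) (sym (trans (ι-* β (β ℕ.+ 4)) (cong (ι β *_) (trans (ι-+ β 4)
        (cong (ι β +_) (ι-def 4))))))) (trans (QP.*-comm σ (ι q)) qσ))

    κ≤σ : κ ≤ σ
    κ≤σ = scale² {fromℕℚ 4 * τ} {σ} (≤-recip {q} q>0 (≤-refl′ (sym (trans (ι-* q (4 ℕ.* t)) (cong
        (ι q *_) (trans (ι-* 4 t) (cong (_* τ) (ι-def 4)))))) ⟫ ι-mono (ℕP.≤-trans (ℕP.≤-reflexive
        (e₁ q t)) (ℕP.≤-trans (ℕP.*-monoˡ-≤ t (ℕP.≤-trans (ℕP.*-monoˡ-≤ q (ℕP.m≤m+n 4 4)) 8q≤C)) Ct))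
        ⟫ ≤-refl′ (ι-* n n)) ⟫ ≤-refl′ (QP.*-comm (N * N) σ))
      where
      e₁ : ∀ q t → q ℕ.* (4 ℕ.* t) ≡ 4 ℕ.* q ℕ.* t
      e₁ = NS.solve-∀

    w≤σ : two * w ≤ σ
    w≤σ = *≤*ˡ two≥0 w≤2v₀
      ⟫ ≤-refl′ (e₁ Kℚ R)
      ⟫ scale {fromℕℚ 8 * Kℚ} {σ} (≤-recip {q} q>0 (≤-refl′ (sym (trans (ι-* q (8 ℕ.* K)) (cong (ι q *_)
        (trans (ι-* 8 K) (cong (_* Kℚ) (ι-def 8)))))) ⟫ ι-mono (ℕP.≤-trans (ℕP.≤-reflexive (e₂ q K))
        (ℕP.≤-trans (ℕP.*-monoˡ-≤ K 8q≤C) CK))) ⟫ ≤-refl′ (QP.*-comm N σ))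
      where
      e₁ : ∀ k r → (1ℚ + 1ℚ) * ((1ℚ + 1ℚ) * ((1ℚ + 1ℚ) * k * r)) ≡ fromℕℚ 8 * k * r
      e₁ = solve-∀ ℚring
      e₂ : ∀ q K → q ℕ.* (8 ℕ.* K) ≡ 8 ℕ.* q ℕ.* K
      e₂ = NS.solve-∀

    v≥0 : 0ℚ ≤ v
    v≥0 = *≥0 (*≥0 two≥0 (ι≥0 K)) (inv≥0 d d>0)

    [1+ε]v₀≤v : (1ℚ + ε) * v₀ ≤ v
    [1+ε]v₀≤v = *-cancel≤ d d>0 (≤-refl′ (trans (cong (λ m → (1ℚ - ε) * m * ((1ℚ + ε) * v₀)) (sym
        (ι-def n))) (trans (e₁ ε N Kℚ R) (cong (λ o → two * Kℚ * o - ε * ε * (two * Kℚ) * o)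
        (*-recip n n>0)))) ⟫ a-b≤a (*≥0 (*≥0 (*≥0 (QP.<⇒≤ ε>0) (QP.<⇒≤ ε>0)) (*≥0 two≥0 (ι≥0 K))) 0≤1)
        ⟫ ≤-refl′ (sym (trans (e₂ d (two * Kℚ) d⁻¹) (cong (two * Kℚ *_) (*-inv d d>0)))))
      where
      e₁ : ∀ e n k r →
        (1ℚ - e) * n * ((1ℚ + e) * ((1ℚ + 1ℚ) * k * r)) ≡ (1ℚ + 1ℚ) * k * (n * r) - e * e *
          ((1ℚ + 1ℚ) * k) * (n * r)
      e₁ = solve-∀ ℚring
      e₂ : ∀ d k i → d * (k * i) ≡ k * (d * i)
      e₂ = solve-∀ ℚring

    v-large : (ι β + 1ℚ) * v₀ ≤ ι (2 ℕ.* e) * v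
    v-large = ≤-refl′ (trans (cong (_* v₀) (trans (cong (_+ 1ℚ) (trans (ι-suc (2 ℕ.* e)) (cong
        (1ℚ +_) E≡))) (trans (cong (λ o → o + two * ι e + o) (sym (*-recip e e>0))) (e₁ (ι e)
        (recip e))))) (QP.*-assoc (two * ι e) (1ℚ + recip e) v₀))
      ⟫ *≤*ˡ (*≥0 two≥0 (ι≥0 e)) (*≤*ʳ v₀≥0 (QP.+-monoʳ-≤ 1ℚ e≤) ⟫ [1+ε]v₀≤v)
      ⟫ ≤-refl′ (cong (_* v) (sym E≡))
      where
      E≡ : ι (2 ℕ.* e) ≡ two * ι e
      E≡ = trans (ι-* 2 e) (cong (_* ι e) (ι-def 2))
      e₁ : ∀ e r → e * r + (1ℚ + 1ℚ) * e + e * r ≡ (1ℚ + 1ℚ) * e * (1ℚ + r)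
      e₁ = solve-∀ ℚring

    grow : (1ℚ + v) ^ t ≤ N
    grow = ExpLe-elim t n v≥0 (≤-refl′ (trans (e₁ τ Kℚ d⁻¹) (cong (_* d⁻¹) (trans (sym (trans (ι-*
        (2 ℕ.* K) t) (cong (_* τ) (trans (ι-* 2 K) (cong (_* Kℚ) (ι-def 2)))))) (ι-def
        (2 ℕ.* K ℕ.* t)))))) exp-t
      where
      e₁ : ∀ t k i → t * ((1ℚ + 1ℚ) * k * i) ≡ (1ℚ + 1ℚ) * k * t * i
      e₁ = solve-∀ ℚring

    ψ : ℚ
    ψ = recip e′

    e′ψ : ι e′ * ψ ≡ 1ℚ
    e′ψ = *-recip e′ e′>0

    ψ≤1 : ψ ≤ 1ℚ
    ψ≤1 = ≤-refl′ (sym (QP.*-identityˡ ψ))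
      ⟫ recip-≤ {e′} e′>0 (ι≥1 e′>0 ⟫ ≤-refl′ (sym (QP.*-identityʳ (ι e′))))

    μ≥0 : 0ℚ ≤ μ
    μ≥0 = *≥0 (ι≥0 n) (^≥0 t p≥0)

    -- If ψμ < 1, then n ≤ μ^β would give n ≤ e′^β, against the choice of the threshold.
    ψμ≥1 : 1ℚ ≤ ψ * μ
    ψμ≥1 = QP.≮⇒≥ λ lt → <⇒≱ℚ (ι-mono< big₃) (≤-refl′ (trans (sym (QP.*-identityˡ N)) (trans (cong
        (_* N) (sym (^-inverse {ι e′} {ψ} β e′ψ))) (QP.*-assoc (ι e′ ^ β) (ψ ^ β) N))) ⟫ *≤*ˡ (^≥0 β
        (ι≥0 e′)) (*≤*ˡ (^≥0 β (recip≥0 e′)) (Mean.mean-large e σ v σ≤1 σ-small κ≤σ w≤σ v-large v≥0 grow)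
        ⟫ ≤-refl′ (sym (^-*ˡ ψ μ β)) ⟫ ^≤1 β (*≥0 (recip≥0 e′) μ≥0) (QP.<⇒≤ lt)) ⟫ ≤-refl′ (trans
        (QP.*-identityʳ (ι e′ ^ β)) (sym (ι-^ e′ β))))

    -- τΩ ≤ 16 S² R³ + 36 K S R²
    tΩ : τ * Ω ≤ ½ * ψ
    tΩ = *-cancel≤ (two * ι e′) (*>0 (QP.positive⁻¹ two) (ι>0 e′>0)) (≤-refl′ (cong (two * ι e′ *_)
        (e₁ τ Kℚ R)) ⟫ *≤*ˡ (*≥0 two≥0 (ι≥0 e′)) (QP.+-mono-≤ (QP.+-mono-≤ (*≤*ˡ (QP.nonNegative⁻¹
        (fromℕℚ 16)) (*≤*ʳ (*≥0 R≥0 (*≥0 R≥0 R≥0)) Kτ²)) (*≤*ˡ (QP.nonNegative⁻¹ (fromℕℚ 4)) (*≤*ʳ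
        (*≥0 R≥0 R≥0) Sℚ≤))) (QP.≤-refl)) ⟫ ≤-refl′ (e₂ (ι e′) Sℚ Kℚ R) ⟫ QP.+-mono-≤ (*≤*ˡ
        (QP.nonNegative⁻¹ (pos 32 Q./ 104)) part₁) (*≤*ˡ (QP.nonNegative⁻¹ (pos 72 Q./ 104)) part₂)
        ⟫ ≤-refl′ (sym (trans (e₃ (ι e′) ψ) e′ψ)))
      where
      Sℚ : ℚ
      Sℚ = Kℚ * τ
      S≡ : ι S ≡ Sℚ
      S≡ = ι-* K t
      Sℚ≥0 : 0ℚ ≤ Sℚ
      Sℚ≥0 = *≥0 (ι≥0 K) τ≥0
      Sℚ≤ : Sℚ ≤ Kℚ * Sℚ
      Sℚ≤ = ≤-refl′ (sym (QP.*-identityˡ Sℚ)) ⟫ *≤*ʳ Sℚ≥0 (ι≥1 {K} (s≤s z≤n))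
      Kτ² : Sℚ * τ ≤ Sℚ * Sℚ
      Kτ² = *≤*ˡ Sℚ≥0 (≤-refl′ (sym (QP.*-identityˡ τ)) ⟫ *≤*ʳ τ≥0 (ι≥1 {K} (s≤s z≤n)))
      e₁ : ∀ t k r →
        t * ((1ℚ + 1ℚ) * ((1ℚ + 1ℚ) * k * r) * (fromℕℚ 4 * t * (r * r) + r) + (1ℚ + 1ℚ) * (((1ℚ + 1ℚ) *
          ((1ℚ + 1ℚ) * k * r)) * ((1ℚ + 1ℚ) * ((1ℚ + 1ℚ) * k * r)))) ≡ fromℕℚ 16 * (k * t * t * (r *
          (r * r))) + fromℕℚ 4 * (k * t * (r * r)) + fromℕℚ 32 * (k * (k * t) * (r * r))
      e₁ = solve-∀ ℚring
      e₂ : ∀ e s k r →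
        (1ℚ + 1ℚ) * e * (fromℕℚ 16 * (s * s * (r * (r * r))) + fromℕℚ 4 * (k * s *
          (r * r)) + fromℕℚ 32 * (k * s * (r * r))) ≡ (pos 32 Q./ 104) * (fromℕℚ 104 * e * (s * s) *
          (r * (r * r))) + (pos 72 Q./ 104) * (fromℕℚ 104 * e * (k * s) * (r * r))
      e₂ = solve-∀ ℚring
      e₃ : ∀ e p → (1ℚ + 1ℚ) * e * ((pos 1 Q./ 2) * p) ≡ e * p
      e₃ = solve-∀ ℚring
      lift : ∀ a → ι (104 ℕ.* e′ ℕ.* a) ≡ fromℕℚ 104 * ι e′ * ι a
      lift a = trans (ι-* (104 ℕ.* e′) a) (cong (_* ι a) (trans (ι-* 104 e′) (cong (_* ι e′)
          (ι-def 104))))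
      part₁ : fromℕℚ 104 * ι e′ * (Sℚ * Sℚ) * (R * (R * R)) ≤ 1ℚ
      part₁ = *≤*ʳ (*≥0 R≥0 (*≥0 R≥0 R≥0)) (≤-refl′ (sym (trans (lift (S ℕ.* S)) (cong
          (fromℕℚ 104 * ι e′ *_) (trans (ι-* S S) (cong₂ _*_ S≡ S≡))))) ⟫ ι-mono (ℕP.≤-trans
          (ℕP.*-monoˡ-≤ (S ℕ.* S) 104e′≤C) CS²) ⟫ ≤-refl′ (trans (ι-* (n ℕ.* n) n) (cong (_* N)
          (ι-* n n))))
        ⟫ ≤-refl′ (trans (e₄ N R) (cong (λ o → o * (o * o)) (*-recip n n>0)))
        where
        e₄ : ∀ n r → n * n * n * (r * (r * r)) ≡ n * r * (n * r * (n * r))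
        e₄ = solve-∀ ℚring
      part₂ : fromℕℚ 104 * ι e′ * (Kℚ * Sℚ) * (R * R) ≤ 1ℚ
      part₂ = scale² {fromℕℚ 104 * ι e′ * (Kℚ * Sℚ)} {1ℚ} (≤-refl′ (sym (trans (lift (K ℕ.* S)) (cong
          (fromℕℚ 104 * ι e′ *_) (trans (ι-* K S) (cong (Kℚ *_) S≡))))) ⟫ ι-mono (ℕP.≤-trans
          (ℕP.*-monoˡ-≤ (K ℕ.* S) 104e′≤C) CKS) ⟫ ≤-refl′ (trans (ι-* n n) (sym (QP.*-identityˡ
          (N * N)))))

    conclusion : ∀ A → ProbHamAfter n (suc k) A t ≤ ψ + ψ
    conclusion A = probability-≤ A (½ * ψ) ψ tΩ (*≤*ˡ ½≥0 ψ≤1) ψμ≥1 ψ≤1 ⟫ ≤-refl′ (e₁ ψ)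
      where
      e₁ : ∀ p → (1ℚ + 1ℚ) * ((pos 1 Q./ 2) * p) + p ≡ p + p
      e₁ = solve-∀ ℚring

module LowerThreshold (e e′ : ℕ) (e>0 : 0 ℕ.< e) (e′>0 : 0 ℕ.< e′) (ε : ℚ) (ε>0 : 0ℚ < ε)
    (e≤ : recip e ≤ ε) where

  C β : ℕ
  C = Lower.C e e′ e>0 e′>0 ε ε>0 e≤
  β = Lower.β e e′ e>0 e′>0 ε ε>0 e≤

  opaque
    threshold : ℕ
    threshold = 49 ℕ.* C ℕ.* (49 ℕ.* C) ℕ.+ (9 ℕ.* C ℕ.+ suc (e′ ℕ.^ β))

    threshold-large : ∀ {n} → threshold ℕ.≤ n →
      (49 ℕ.* C ℕ.* (49 ℕ.* C) ℕ.≤ n) × (9 ℕ.* C ℕ.≤ n) × (e′ ℕ.^ β ℕ.< n)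
    threshold-large = +-≤³ (49 ℕ.* C ℕ.* (49 ℕ.* C)) (9 ℕ.* C) (suc (e′ ℕ.^ β))

  positive : ∀ m → 0 ℕ.< m → ¬ (fromℕℚ m ≡ 0ℚ)
  positive m m>0 eq = QP.<-irrefl (sym (trans (ι-def m) eq)) (ι>0 m>0)

  unlikely : ∀ n κ t (A : Alg n) → 2 ℕ.≤ κ → threshold ℕ.≤ n → LeTimesLog (fromℕℚ κ) ½ n →
    RoundsLe t (1ℚ - ε) n κ → ProbHamAfter n κ A t ≤ recip e′ + recip e′
  unlikely zero κ t A κ≥2 h _ _ = ⊥-elim (ℕP.n≮0 (proj₂ (proj₂ (threshold-large h))))
  -- The case t = 0 is settled by an isolated vertex. For ε ≥ 1 no positive t is admissible, so only
  -- this case remains; a positive t forces `d>0`, hence ε < 1.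
  unlikely (suc n) κ zero A κ≥2 _ _ _ = subst (_≤ recip e′ + recip e′) (cong
      (λ b → if b then 1ℚ else 0ℚ) (sym (isolated⇒¬Hamiltonian {suc n} [] zero (λ _ → refl)))) (+≥0
      (recip≥0 e′) (recip≥0 e′))
  unlikely (suc n) (suc k) (suc t) A κ≥2 _ (inj₁ (eq , _)) _ = ⊥-elim (positive (suc k) (s≤s z≤n) eq)
  unlikely (suc n) (suc k) (suc t) A κ≥2 _ (inj₂ _) (inj₁ (eq , _)) = ⊥-elim (positive
      (2 ℕ.* suc k ℕ.* suc t) (s≤s z≤n) eq)
  unlikely (suc n) (suc k) (suc t) A κ≥2 h (inj₂ (½>0 , exp-K)) (inj₂
      (d>0 , exp-t)) = Lower.At.conclusion e e′ e>0 e′>0 ε ε>0 e≤ (suc n) k (suc t) (s≤s z≤n) κ≥2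
      (s≤s z≤n) (proj₁ (threshold-large h)) (proj₁ (proj₂ (threshold-large h))) (proj₂ (proj₂
      (threshold-large h))) d>0 exp-t ½>0 exp-K A

lower-bound : (K : ℕ → ℕ) → (∀ n → 2 ℕ.≤ K n) → LittleOLog K → ∀ ε → 0ℚ < ε → (A : (n : ℕ) → Alg n) →
  ∀ η → 0ℚ < η → Σ ℕ λ N → ∀ n → N ℕ.≤ n → ∀ t → RoundsLe t (1ℚ - ε) n (K n) →
  ProbHamAfter n (K n) (A n) t ≤ η
lower-bound K K≥2 o ε ε>0 A η η>0 = N₀ ℕ.+ thr , λ n n≥ t rounds → LowerThreshold.unlikely e e′ e>0 e′>0
    ε ε>0 (proj₂ (proj₂ E)) n (K n) t (A n) (K≥2 n) (proj₂ (+-≤ N₀ thr n≥)) (proj₂ little n (proj₁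
    (+-≤ N₀ thr n≥))) rounds
  ⟫ 2ψ≤η
  where
  E = small-recip ε ε>0
  E′ = small-recip (½ * η) (*>0 (QP.positive⁻¹ ½) η>0)
  e = proj₁ E
  e′ = proj₁ E′
  e>0 = proj₁ (proj₂ E)
  e′>0 = proj₁ (proj₂ E′)
  little = o ½ (QP.positive⁻¹ ½)
  N₀ thr : ℕ
  N₀ = proj₁ little
  thr = LowerThreshold.threshold e e′ e>0 e′>0 ε ε>0 (proj₂ (proj₂ E))
  2ψ≤η : recip (proj₁ E′) + recip (proj₁ E′) ≤ η
  2ψ≤η = QP.+-mono-≤ (proj₂ (proj₂ E′)) (proj₂ (proj₂ E′)) ⟫ ≤-refl′ (eq η)
    where
    eq : ∀ x → (pos 1 Q./ 2) * x + (pos 1 Q./ 2) * x ≡ x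
    eq = solve-∀ ℚring

theorem1p1 : (K : ℕ → ℕ) → ((n : ℕ) → 2 ℕ.≤ K n) → LittleOLog K →
    (ε : ℚ) → 0ℚ < ε →
      Σ ((n : ℕ) → Alg n) (λ A → (η : ℚ) → 0ℚ < η →
          Σ ℕ (λ N → (n : ℕ) → N ℕ.≤ n →
            Σ ℕ (λ t → RoundsLe t (1ℚ + ε) n (K n)
                      × (1ℚ - η) Q.≤ ProbHamAfter n (K n) (A n) t)))
      × ((A : (n : ℕ) → Alg n) → (η : ℚ) → 0ℚ < η →
          Σ ℕ (λ N → (n : ℕ) → N ℕ.≤ n → (t : ℕ) →
            RoundsLe t (1ℚ - ε) n (K n) →
            ProbHamAfter n (K n) (A n) t Q.≤ η))
theorem1p1 K K≥2 o ε ε>0 = upper-bound K K≥2 o ε ε>0 , lower-bound K K≥2 o ε ε>0
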